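{- Among all $k$-uniform hypertrees with $m$ hyperedges, the second hypertree in $S_\alpha$-order is $F_{m,k}$ for $k\ge3$ and $0<\alpha<1$.
   Context: Hypergraphs are finite; $k$-uniform means every hyperedge has exactly $k$ vertices; a hypertree is a connected hypergraph without cycles; a cored vertex is a vertex of degree one. Let $P_{m-1}$ be the path of length $m-1$ with vertices $v_1,\dots,v_m$ and edges $e_i=\{v_i,v_{i+1}\}$, $i=1,\dots,m-1$; the hyperpath $P_{m-1}^{(k)}$ is obtained from it by inserting $k-2$ new (cored) vertices into each edge $e_i$, giving the hyperedge $e_i^{(k)}$. $F_{m,k}$ is the $k$-uniform hypertree obtained from $P_{m-1}^{(k)}$ by attaching a pendant hyperedge (a new hyperedge consisting of the attachment vertex and $k-1$ new vertices) to a cored vertex on the hyperedge $e_2^{(k)}$. For a $k$-uniform hypergraph $\mathcal{H}$ on $[n]$, $\mathcal{A}(\mathcal{H})$ is the $k$-order $n$-dimensional tensor with entry $\frac1{(k-1)!}$ at $(i_1,\dots,i_k)$ if $\{i_1,\dots,i_k\}\in E(\mathcal{H})$ and $0$ otherwise; $\mathcal{D}(\mathcal{H})$ is the diagonal tensor of vertex degrees; $\mathcal{A}_\alpha(\mathcal{H})=\alpha\mathcal{D}(\mathcal{H})+(1-\alpha)\mathcal{A}(\mathcal{H})$. For a tensor $\mathcal{T}$, $\mathrm{Tr}_d(\mathcal{T})$ is the sum of the $d$-th powers of all $n(k-1)^{n-1}$ eigenvalues of $\mathcal{T}$; in particular $\mathrm{Tr}_0(\mathcal{T})=n(k-1)^{n-1}$,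 and for $d\ge1$ $$\mathrm{Tr}_{d}(\mathcal{T})=(k-1)^{n-1}\sum_{d_1+\cdots+d_n=d}\ \prod_{i=1}^{n}\frac{1}{(d_i(k-1))!}\Big(\sum_{\gamma\in[n]^{k-1}}(\mathcal{T})_{i\gamma}\frac{\partial}{\partial a_{i\gamma}}\Big)^{d_i}\mathrm{tr}\big(A^{d(k-1)}\big),$$ with $A=(a_{ij})$ an $n\times n$ matrix of indeterminates, $d_i\ge0$ integers, $\frac{\partial}{\partial a_{i\gamma}}=\frac{\partial}{\partial a_{i i_2}}\cdots\frac{\partial}{\partial a_{i i_k}}$ for $\gamma=i_2\cdots i_k$. $S_\alpha$-order: for $k$-uniform hypergraphs $\mathcal{H}_1,\mathcal{H}_2$ with $n$ vertices, $\mathcal{H}_1\prec_\alpha\mathcal{H}_2$ ($\mathcal{H}_1$ comes before $\mathcal{H}_2$) if there is $d\in\{1,\dots,n(k-1)^{n-1}-1\}$ with $\mathrm{Tr}_t(\mathcal{A}_\alpha(\mathcal{H}_1))=\mathrm{Tr}_t(\mathcal{A}_\alpha(\mathcal{H}_2))$ for $t=0,\dots,d-1$ and $\mathrm{Tr}_d(\mathcal{A}_\alpha(\mathcal{H}_1))<\mathrm{Tr}_d(\mathcal{A}_\alpha(\mathcal{H}_2))$. The first hypertree $F$ in a class is the member with $F\prec_\alpha\mathcal{H}$ for every other member $\mathcal{H}$ of the class (up to isomorphism); the second is the first among the members other than $F$.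
   Formalization: The theorem is stated for m ≥ 4: for m ≤ 2 the hyperedge e_2 does not exist, and for m = 3 the hypertree F_{3,k} is the hyperpath itself, which is the first hypertree and not the second. -}

module Defs where

open import Level using (_⊔_) renaming (suc to lsuc)
open import Algebra.Apartness.Bundles using (HeytingField; HeytingCommutativeRing)
open import Algebra.Bundles using (CommutativeRing)
import Algebra.Definitions.RawMonoid as RawMonoidDefs
open import Data.Bool.Base using (if_then_else_)
import Data.Bool.Properties as Bool
open import Data.Empty using (⊥-elim)
open import Data.Fin.Base using (Fin; zero; suc; inject₁; fromℕ; toℕ; combine; quotient; _↑ʳ_)
import Data.Fin.Properties as Fin
open import Data.Fin.Subset using (Subset; _∈_; ⁅_⁆; _∪_; ⋃; ⊤; ⊥; ∣_∣)
open import Data.Fin.Subset.Properties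
  using (_∈?_; x∈⁅x⁆; x∈⁅y⁆⇒x≡y; x∈p∪q⁺; x∈p∪q⁻)
open import Data.List.Base as List
  using (List; []; _∷_; map; concatMap; foldr; filter; allFin; upTo; length;
         cartesianProductWith)
open import Data.List.Membership.Propositional using () renaming (_∈_ to _∈ˡ_)
import Data.List.Membership.DecPropositional as DecMembership
open import Data.List.Relation.Unary.All as All using (All; _∷_)
import Data.List.Relation.Unary.All.Properties as All
open import Data.List.Relation.Unary.AllPairs using (_∷_)
open import Data.List.Relation.Unary.Unique.Propositional using (Unique)
import Data.List.Relation.Unary.Unique.Propositional.Properties as Unique
open import Data.Nat.Base as ℕ using (ℕ; zero; suc; _≤_; s≤s; _∸_; _^_; _!; NonZero)
import Data.Nat.Properties as ℕ
open import Data.Nat.GeneralisedArithmetic using (iterate)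
open import Data.Product.Base using (∃; _×_; _,_; proj₁; proj₂)
open import Data.Sum.Base using (_⊎_; inj₁; inj₂)
open import Data.Vec.Base as Vec using (Vec; []; _∷_; lookup; tabulate; toList; _++_)
import Data.Vec.Properties as Vec
open import Function.Base using (_∘_)
open import Function.Bundles using (Inverse; _↔_; _⇔_)
open import Function.Definitions using (Injective)
open import Relation.Binary.Core using (Rel)
open import Relation.Binary.Structures using (IsStrictPartialOrder)
open import Relation.Binary.Construct.Closure.ReflexiveTransitive using (Star)
open import Relation.Binary.PropositionalEquality using (_≡_; refl; sym; trans; cong; subst)
open import Relation.Nullary.Decidable using (⌊_⌋; _×-dec_)
open import Relation.Nullary.Negation using (¬_)

record OrderedField c ℓ₁ ℓ₂ : Set (lsuc (c ⊔ ℓ₁ ⊔ ℓ₂)) where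
  infix 4 _<_
  field
    heytingField : HeytingField c ℓ₁ ℓ₂

  open HeytingField heytingField public

  field
    _<_                  : Rel Carrier ℓ₂
    isStrictPartialOrder : IsStrictPartialOrder _≈_ _<_
    #⇒<                  : ∀ {x y} → x # y → x < y ⊎ y < x
    <⇒#                  : ∀ {x y} → x < y → x # y
    0<1                  : 0# < 1#
    +-monoˡ-<            : ∀ {x y} z → x < y → x + z < y + z
    *-pos                : ∀ {x y} → 0# < x → 0# < y → 0# < x * y

  private
    module SPO = IsStrictPartialOrder isStrictPartialOrder

  commutativeRing : CommutativeRing c ℓ₁
  commutativeRing = HeytingCommutativeRing.commutativeRing heytingCommutativeRing

  fromNat : ℕ → Carrier
  fromNat n = n · 1#
    where
    open RawMonoidDefs (CommutativeRing.+-rawMonoid commutativeRing) using ()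
      renaming (_×_ to _·_)

  0<fromNat-suc : ∀ n → 0# < fromNat (suc n)
  0<fromNat-suc zero    = SPO.<-respʳ-≈ (Eq.sym (+-identityʳ 1#)) 0<1
    where module Eq = CommutativeRing commutativeRing
  0<fromNat-suc (suc n) =
    SPO.trans (0<fromNat-suc n)
      (SPO.<-respˡ-≈ (+-identityˡ _) (+-monoˡ-< (fromNat (suc n)) 0<1))

  recip : (n : ℕ) .{{_ : NonZero n}} → Carrier
  recip (suc n) = proj₁ (#⇒invertible (#-sym (<⇒# (0<fromNat-suc n))))

-- The Archimedean, Cauchy-complete ordered fields.  Any two are isomorphic, so
-- quantifying over them is quantifying over the reals.  The axioms are those
-- that hold constructively; in particular < is not assumed to be trichotomous.
record RealNumbers c ℓ₁ ℓ₂ : Set (lsuc (c ⊔ ℓ₁ ⊔ ℓ₂)) where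
  field
    orderedField : OrderedField c ℓ₁ ℓ₂

  open OrderedField orderedField public

  Close : Carrier → Carrier → Carrier → Set ℓ₂
  Close ε x y = x - y < ε × y - x < ε

  field
    archimedean : ∀ x → ∃ λ n → x < fromNat n
    complete    : (s : ℕ → Carrier) →
                  (∀ ε → 0# < ε → ∃ λ N → ∀ i j → N ≤ i → N ≤ j → Close ε (s i) (s j)) →
                  ∃ λ l → ∀ ε → 0# < ε → ∃ λ N → ∀ i → N ≤ i → Close ε (s i) l

record Hypergraph : Set where
  field
    order  : ℕ
    edges  : List (Subset order)
    unique : Unique edges

open Hypergraph public

Uniform : ℕ → Hypergraph → Set
Uniform k H = All (λ e → ∣ e ∣ ≡ k) (edges H)

degree : (H : Hypergraph) → Fin (order H) → ℕ
degree H v = length (filter (v ∈?_) (edges H))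

Adjacent : (H : Hypergraph) → Fin (order H) → Fin (order H) → Set
Adjacent H u v = ∃ λ e → e ∈ˡ edges H × u ∈ e × v ∈ e

Connected : Hypergraph → Set
Connected H = ∀ u v → Star (Adjacent H) u v

-- A (Berge) cycle v₀ e₁ v₁ e₂ … e_ℓ v_ℓ = v₀ with ℓ ≥ 2, in which v₀, …, v_{ℓ-1}
-- are distinct and e₁, …, e_ℓ are distinct.  Two hyperedges with two common
-- vertices form a cycle.
record Cycle (H : Hypergraph) : Set where
  field
    len         : ℕ
    2≤len       : 2 ≤ len
    vertex      : Fin (suc len) → Fin (order H)
    edge        : Fin len → Subset (order H)
    isEdge      : ∀ i → edge i ∈ˡ edges H
    source∈     : ∀ i → vertex (inject₁ i) ∈ edge i
    target∈     : ∀ i → vertex (suc i) ∈ edge i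
    closed      : vertex (fromℕ len) ≡ vertex zero
    vertex-dist : Injective _≡_ _≡_ (vertex ∘ inject₁)
    edge-dist   : Injective _≡_ _≡_ edge

record IsHypertree (k m : ℕ) (H : Hypergraph) : Set where
  field
    uniform   : Uniform k H
    size      : length (edges H) ≡ m
    connected : Connected H
    acyclic   : ¬ Cycle H

image : ∀ {m n} → Fin m ↔ Fin n → Subset m → Subset n
image f e = tabulate (λ w → lookup e (Inverse.from f w))

infix 4 _≅_

_≅_ : Hypergraph → Hypergraph → Set
G ≅ H = ∃ λ (f : Fin (order G) ↔ Fin (order H)) →
          ∀ e → (e ∈ˡ edges G) ⇔ (image f e ∈ˡ edges H)

private
  pair-injective : ∀ {l} {i j : Fin l} →
    ⁅ inject₁ i ⁆ ∪ ⁅ suc i ⁆ ≡ ⁅ inject₁ j ⁆ ∪ ⁅ suc j ⁆ → i ≡ j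
  pair-injective {l} {i} {j} eq
    with x∈p∪q⁻ _ _ (subst (inject₁ i ∈_) eq (x∈p∪q⁺ (inj₁ (x∈⁅x⁆ _))))
       | x∈p∪q⁻ _ _ (subst (suc i ∈_) eq (x∈p∪q⁺ (inj₂ (x∈⁅x⁆ _))))
  ... | inj₁ p | _      = Fin.inject₁-injective (x∈⁅y⁆⇒x≡y _ p)
  ... | inj₂ _ | inj₂ q = Fin.suc-injective (x∈⁅y⁆⇒x≡y _ q)
  ... | inj₂ p | inj₁ q = ⊥-elim (ℕ.<-asym i<j j<i)
    where
    j<i : toℕ j ℕ.< toℕ i
    j<i = ℕ.≤-reflexive (sym (trans (sym (Fin.toℕ-inject₁ i)) (cong toℕ (x∈⁅y⁆⇒x≡y _ p))))
    i<j : toℕ i ℕ.< toℕ j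
    i<j = ℕ.≤-reflexive (trans (cong toℕ (x∈⁅y⁆⇒x≡y _ q)) (Fin.toℕ-inject₁ j))

-- The hyperpath P_l^{(k)} (k ≥ 2).  Its vertices are the l + 1 path vertices
-- followed by l blocks of k - 2 inserted vertices; the i-th hyperedge consists
-- of the i-th and (i+1)-st path vertices and the i-th block.
hyperpath : (l k : ℕ) → Hypergraph
hyperpath l k = record
  { order  = suc l ℕ.+ l ℕ.* (k ∸ 2)
  ; edges  = List.tabulate edge
  ; unique = Unique.tabulate⁺ (pair-injective ∘ Vec.++-injectiveˡ _ _)
  }
  where
  block : Fin l → Subset (l ℕ.* (k ∸ 2))
  block i = tabulate (λ x → ⌊ quotient (k ∸ 2) x Fin.≟ i ⌋)
  edge : Fin l → Subset (suc l ℕ.+ l ℕ.* (k ∸ 2))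
  edge i = (⁅ inject₁ i ⁆ ∪ ⁅ suc i ⁆) ++ block i

insertedVertex : ∀ l k → Fin l → Fin (k ∸ 2) → Fin (order (hyperpath l k))
insertedVertex l k i j = suc l ↑ʳ combine i j

attachPendant : ∀ k → 2 ≤ k → (H : Hypergraph) → Fin (order H) → Hypergraph
attachPendant (suc (suc k)) (s≤s (s≤s _)) H v = record
  { order  = order H ℕ.+ suc k
  ; edges  = (⁅ v ⁆ ++ ⊤) ∷ map (_++ ⊥) (edges H)
  ; unique = All.map⁺ (All.universal (λ e eq → ⊤≢⊥ (Vec.++-injectiveʳ ⁅ v ⁆ e eq)) (edges H))
           ∷ Unique.map⁺ (Vec.++-injectiveˡ _ _) (unique H)
  }
  where
  ⊤≢⊥ : ¬ (⊤ {suc k} ≡ ⊥)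
  ⊤≢⊥ ()

-- The path P_{m-1} has its second edge e₂ only for m ≥ 3, and e₂^{(k)} has
-- inserted vertices only for k ≥ 3; all of them give isomorphic results.
F : ∀ m k → 3 ≤ m → 3 ≤ k → Hypergraph
F m@(suc (suc (suc _))) k@(suc (suc (suc _))) (s≤s (s≤s (s≤s _))) 3≤k@(s≤s (s≤s (s≤s _))) =
  attachPendant k (ℕ.<⇒≤ 3≤k) (hyperpath (m ∸ 1) k)
    (insertedVertex (m ∸ 1) k (suc zero) zero)

vectors : ∀ {a} {A : Set a} → List A → (r : ℕ) → List (Vec A r)
vectors xs zero    = [] ∷ []
vectors xs (suc r) = cartesianProductWith _∷_ xs (vectors xs r)

weakCompositions : (n d : ℕ) → List (Vec ℕ n)
weakCompositions n d = filter (λ ds → Vec.sum ds ℕ.≟ d) (vectors (upTo (suc d)) n)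

module Tensors {c ℓ₁ ℓ₂} (K : OrderedField c ℓ₁ ℓ₂) where
  open OrderedField K

  ∑ : List Carrier → Carrier
  ∑ = foldr _+_ 0#

  -- k-order n-dimensional tensors (k ≥ 1): T i (i₂ ∷ … ∷ i_k) is the entry at (i, i₂, …, i_k).
  Tensor : (k n : ℕ) → Set c
  Tensor k n = Fin n → Vec (Fin n) (k ∸ 1) → Carrier

  -- Polynomials in the indeterminates a_{ij} (i, j : Fin n) as formal sums of
  -- terms; a monomial is given by its exponents.
  Monomial : ℕ → Set
  Monomial n = Fin n → Fin n → ℕ

  Poly : ℕ → Set c
  Poly n = List (Carrier × Monomial n)

  module _ {n : ℕ} where

    isIndet : (i j i′ j′ : Fin n) → ℕ
    isIndet i j i′ j′ = if ⌊ (i Fin.≟ i′) ×-dec (j Fin.≟ j′) ⌋ then 1 else 0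

    onePoly : Poly n
    onePoly = (1# , λ _ _ → 0) ∷ []

    indet : Fin n → Fin n → Poly n
    indet i j = (1# , isIndet i j) ∷ []

    _*ₚ_ : Poly n → Poly n → Poly n
    _*ₚ_ = cartesianProductWith
      (λ (a , e) (b , f) → a * b , λ i j → e i j ℕ.+ f i j)

    scale : Carrier → Poly n → Poly n
    scale a = map (λ (b , e) → a * b , e)

    -- A term in which a_{ij} has exponent 0 becomes a term with coefficient 0.
    ∂ : Fin n → Fin n → Poly n → Poly n
    ∂ i j = map (λ (a , e) → fromNat (e i j) * a , λ i′ j′ → e i′ j′ ∸ isIndet i j i′ j′)

    constantTerm : Poly n → Carrier
    constantTerm p = ∑ (map proj₁ (filter
      (λ (_ , e) → Fin.all? (λ i → Fin.all? (λ j → e i j ℕ.≟ 0))) p))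

    PolyMatrix : Set c
    PolyMatrix = Fin n → Fin n → Poly n

    identity : PolyMatrix
    identity i j = if ⌊ i Fin.≟ j ⌋ then onePoly else []

    _*ₘ_ : PolyMatrix → PolyMatrix → PolyMatrix
    (A *ₘ B) i j = concatMap (λ l → A i l *ₚ B l j) (allFin n)

    powₘ : PolyMatrix → ℕ → PolyMatrix
    powₘ A zero    = identity
    powₘ A (suc r) = A *ₘ powₘ A r

    tr : PolyMatrix → Poly n
    tr A = concatMap (λ i → A i i) (allFin n)

    ∂ᵥ : ∀ {r} → Fin n → Vec (Fin n) r → Poly n → Poly n
    ∂ᵥ i []      p = p
    ∂ᵥ i (j ∷ γ) p = ∂ i j (∂ᵥ i γ p)

  module _ (k : ℕ) {n : ℕ} (T : Tensor k n) where

    rowOperator : Fin n → Poly n → Poly n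
    rowOperator i p =
      concatMap (λ γ → scale (T i γ) (∂ᵥ i γ p)) (vectors (allFin n) (k ∸ 1))

    -- ∏ᵢ 1/(dᵢ(k-1))! (∑_γ T_{iγ} ∂/∂a_{iγ})^{dᵢ}; the factors commute.
    operator : Vec ℕ n → Poly n → Poly n
    operator ds p = foldr
      (λ i q → scale (recip ((lookup ds i ℕ.* (k ∸ 1)) !) {{(lookup ds i ℕ.* (k ∸ 1)) ℕ.!≢0}})
                     (iterate (rowOperator i) q (lookup ds i)))
      p (allFin n)

    -- For d ≥ 1 the operators have total order d(k-1), so that applied to
    -- tr(A^{d(k-1)}) they give a constant polynomial, which `constantTerm`
    -- turns into a number.
    Tr : ℕ → Carrier
    Tr zero      = fromNat (n ℕ.* (k ∸ 1) ^ (n ∸ 1))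
    Tr d@(suc _) = fromNat ((k ∸ 1) ^ (n ∸ 1)) *
      ∑ (map (λ ds → constantTerm (operator ds (tr (powₘ indet (d ℕ.* (k ∸ 1))))))
             (weakCompositions n d))

  adjacencyTensor : (k : ℕ) (H : Hypergraph) → Tensor k (order H)
  adjacencyTensor k H i γ =
    if ⌊ ⋃ (map ⁅_⁆ (toList (i ∷ γ))) ∈ˡ? edges H ⌋
    then recip ((k ∸ 1) !) {{(k ∸ 1) ℕ.!≢0}}
    else 0#
    where open DecMembership (Vec.≡-dec Bool._≟_) renaming (_∈?_ to _∈ˡ?_)

  degreeTensor : (k : ℕ) (H : Hypergraph) → Tensor k (order H)
  degreeTensor k H i γ =
    if ⌊ Vec.≡-dec Fin._≟_ γ (Vec.replicate (k ∸ 1) i) ⌋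
    then fromNat (degree H i)
    else 0#

  Aα-tensor : Carrier → (k : ℕ) (H : Hypergraph) → Tensor k (order H)
  Aα-tensor α k H i γ = α * degreeTensor k H i γ + (1# - α) * adjacencyTensor k H i γ

  -- H₁ ≺_α H₂, which only relates hypergraphs with the same number of vertices.
  Precedes : ℕ → Carrier → Hypergraph → Hypergraph → Set (ℓ₁ ⊔ ℓ₂)
  Precedes k α H₁ H₂ =
    order H₁ ≡ order H₂ ×
    ∃ λ d → 1 ≤ d × d ≤ order H₁ ℕ.* (k ∸ 1) ^ (order H₁ ∸ 1) ∸ 1 ×
      (∀ t → t ℕ.< d → Tr k (Aα-tensor α k H₁) t ≈ Tr k (Aα-tensor α k H₂) t) ×
      Tr k (Aα-tensor α k H₁) d < Tr k (Aα-tensor α k H₂) d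

IsFirst : ∀ {ℓ} → Rel Hypergraph ℓ → (Hypergraph → Set) → Hypergraph → Set ℓ
IsFirst _≺_ C G = C G × (∀ H → C H → ¬ (H ≅ G) → G ≺ H)

IsSecond : ∀ {ℓ} → Rel Hypergraph ℓ → (Hypergraph → Set) → Hypergraph → Set ℓ
IsSecond _≺_ C G =
  ∃ λ G₁ → IsFirst _≺_ C G₁ × IsFirst _≺_ (λ H → C H × ¬ (H ≅ G₁)) G

{-# OPTIONS --safe #-}

-- By the trace formula, Tr_d is, up to a positive factor, the sum over the
-- d-tuples of rows (i, γ) of the products of their entries, each tuple being
-- weighted by a constant that is nonnegative, depends only on the tuple up to
-- permutation of the vertices, and is positive exactly when the arcs i → j
-- (j ∈ γ) form a closed walk.  The entries of 𝒜_α are nonzero on the diagonal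
-- rows (u, u…u), with entry α deg u, and on the rows that enumerate an edge.  In
-- a hypertree the balance of the arcs at the vertices forces an edge that is met
-- to be spanned at least once from each of its k vertices.  Hence, for d < 3k,
-- Tr_d is a sum over the vertices, plus a sum over the edges (zero if d < k),
-- plus a sum over the pairs of adjacent edges (zero if d < 2k).
--
-- Tr_1 depends only on the number of edges, and Tr_2 on Σ deg², so hypertrees
-- with a vertex of degree ≥ 3 come after those without.  If all degrees are at
-- most 2, let 1 + a_e be the number of neighbours of the edge e.  As a function of
-- a_e, the contribution of e to Tr_d has second difference zero for d < k + 2 and
-- positive for d = k + 2, so that Tr_{k+2} is decided by the defect Σ_e C(a_e, 2).
-- It vanishes only on the hyperpath.  It is 1 if a single edge (the hub) has three
-- neighbours; then the three branches at the hub are paths, and the first trace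
-- that can differ is Tr_{2k+2}, in which a positive mixed second difference of the
-- pair contributions is multiplied by minus the number of leaves adjacent to the hub.
-- That number is at least 2 only for F_{m,k}.

module Submission where

open import Defs
open import Algebra.Bundles using (CommutativeSemiring; CommutativeRing)
open import Data.Bool.Base using (Bool; true; false; if_then_else_)
import Data.Bool.Properties as Bool
open import Data.Empty using (⊥; ⊥-elim)
open import Data.Fin.Base as Fin using (Fin; zero; suc; toℕ)
import Data.Fin.Properties as Fin
import Data.Fin.Relation.Unary.Top as Top
open import Data.Fin.Subset as Subset using (Subset; ∣_∣; ⁅_⁆; ⋃; _∪_; _∩_) renaming (_∈_ to _∈ₛ_; _∉_ to _∉ₛ_)
import Data.Fin.Subset.Properties as Subset
open import Data.Fin.Permutation as Perm using (Permutation′; _⟨$⟩ʳ_; _⟨$⟩ˡ_; inverseʳ; inverseˡ)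
open import Data.List.Base as List using (List; []; _∷_; map; concatMap; foldr; filter; allFin; length; cartesianProductWith; _++_; replicate)
import Data.List.Properties as List
open import Data.List.Membership.Propositional using (_∈_; _∉_; find; lose)
import Data.List.Membership.DecPropositional as DecMembership
open import Data.List.Membership.Propositional.Properties
open import Data.List.Relation.Binary.Permutation.Propositional as ↭ using (_↭_; prep; swap; ↭-sym; ↭-trans; ↭-refl)
import Data.List.Relation.Binary.Permutation.Propositional.Properties as ↭
open import Data.List.Relation.Unary.All as All using (All; []; _∷_)
import Data.List.Relation.Unary.All.Properties as All
open import Data.List.Relation.Unary.Any as Any using (Any; here; there)
import Data.List.Relation.Unary.Any.Properties as Any
open import Data.List.Relation.Unary.AllPairs using ([]; _∷_)
open import Data.List.Relation.Unary.Unique.Propositional using (Unique)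
import Data.List.Relation.Unary.Unique.Propositional.Properties as Unique
open import Data.Nat.Base as ℕ using (ℕ; _≤_; zero; suc; z≤n; s≤s; NonZero; _∸_; _^_; _!)
import Data.Nat.Properties as ℕ
open import Data.Nat.Properties using (<⇒≤)
open import Data.Nat.GeneralisedArithmetic using (iterate)
open import Data.Product.Base as Product using (∃; ∃₂; _×_; _,_; proj₁; proj₂)
import Data.Product.Properties as Product
open import Data.Sum.Base as Sum using (_⊎_; inj₁; inj₂; [_,_]′)
open import Data.Vec.Base as Vec using (Vec; []; _∷_; lookup; toList)
import Data.Vec.Properties as Vec
open import Function.Base using (_∘_; id; case_of_)
open import Function.Bundles using (Inverse; _↔_; mk⇔; Equivalence)
open import Relation.Binary.PropositionalEquality as ≡ using (_≡_; _≢_; cong; cong₂; subst; subst₂; _≗_)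
open import Relation.Nullary.Decidable as Dec using (Dec; yes; no; does; _×-dec_; _⊎-dec_; ¬?; ⌊_⌋; dec-true; dec-false)
open import Relation.Nullary.Negation using (¬_; contradiction)
open import Relation.Unary using (Pred; Decidable)
open import Relation.Binary.Construct.Closure.ReflexiveTransitive using (Star; ε; _◅_; _◅◅_)
open import Relation.Binary.Structures using (IsStrictPartialOrder)

-- No coefficient of a trace is ever evaluated (k is the uniformity here). The contribution of an
-- edge or of a pair of edges is carried by a permutation of the vertices to a fixed reference,
-- where it depends only on numbers of vertices of degree 2, and a strict inequality needs just one
-- closed walk that makes a difference positive. The thresholds come from counting rows. An edge
-- that is met takes up at least k of the d rows; so d ≤ k + 2 with one edge, or d ≤ 2k + 2 with
-- two, leaves at most two diagonal rows, and the product of their entries has degree at most 2 in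
-- the vertex degrees. Its mixed second difference keeps only the pairs of loops at the two vertices
-- that change: it vanishes if fewer than two rows are left and is positive for exactly two. For k ≥
-- 3 one has k + 2 < 2k and 2k + 2 < 3k, so that pairs of edges do not enter the first comparison,
-- nor triples the second. In the second comparison the vertex sums and the edge sums agree for all
-- d, because defect 1 fixes how often each number of neighbours occurs: three leaves, one hub, and
-- two neighbours for all other edges.

-- Finite sums over lists in a commutative semiring

module ListSums {c ℓ} (R : CommutativeSemiring c ℓ) where

  open CommutativeSemiring R hiding (zero)
  open import Relation.Binary.Reasoning.Setoid setoid
  open import Algebra.Properties.CommutativeSemigroup +-commutativeSemigroup using (interchange; x∙yz≈y∙xz)
  open import Algebra.Properties.CommutativeMonoid.Sum +-commutativeMonoid using (sum; sum-permute)

  ⅀ : ∀ {a} {A : Set a} → List A → (A → Carrier) → Carrier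
  ⅀ xs f = foldr _+_ 0# (map f xs)

  𝟙 : ∀ {p} {P : Set p} → Dec P → Carrier
  𝟙 d = if does d then 1# else 0#

  𝟙-yes : ∀ {p} {P : Set p} (d : Dec P) → P → 𝟙 d ≈ 1#
  𝟙-yes d p rewrite dec-true d p = refl

  𝟙-no : ∀ {p} {P : Set p} (d : Dec P) → ¬ P → 𝟙 d ≈ 0#
  𝟙-no d ¬p rewrite dec-false d ¬p = refl

  𝟙-⇔ : ∀ {p q} {P : Set p} {Q : Set q} (d : Dec P) (e : Dec Q) → (P → Q) → (Q → P) → 𝟙 d ≈ 𝟙 e
  𝟙-⇔ d (yes q) f g = 𝟙-yes d (g q)
  𝟙-⇔ d (no ¬q) f g = 𝟙-no d (¬q ∘ f)

  module _ {a} {A : Set a} where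

    ⅀-cong∈ : ∀ (xs : List A) {f g : A → Carrier} → (∀ {x} → x ∈ xs → f x ≈ g x) → ⅀ xs f ≈ ⅀ xs g
    ⅀-cong∈ []       h = refl
    ⅀-cong∈ (x ∷ xs) h = +-cong (h (here ≡.refl)) (⅀-cong∈ xs (h ∘ there))

    ⅀-cong : ∀ (xs : List A) {f g : A → Carrier} → (∀ x → f x ≈ g x) → ⅀ xs f ≈ ⅀ xs g
    ⅀-cong xs h = ⅀-cong∈ xs (λ {x} _ → h x)

    ⅀-0 : ∀ (xs : List A) {f : A → Carrier} → (∀ {x} → x ∈ xs → f x ≈ 0#) → ⅀ xs f ≈ 0#
    ⅀-0 []       h = refl
    ⅀-0 (x ∷ xs) h = trans (+-cong (h (here ≡.refl)) (⅀-0 xs (h ∘ there))) (+-identityˡ 0#)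

    ⅀-++ : ∀ (xs ys : List A) (f : A → Carrier) → ⅀ (xs ++ ys) f ≈ ⅀ xs f + ⅀ ys f
    ⅀-++ []       ys f = sym (+-identityˡ _)
    ⅀-++ (x ∷ xs) ys f = trans (+-congˡ (⅀-++ xs ys f)) (sym (+-assoc _ _ _))

    ⅀-+ : ∀ (xs : List A) (f g : A → Carrier) → ⅀ xs (λ x → f x + g x) ≈ ⅀ xs f + ⅀ xs g
    ⅀-+ []       f g = sym (+-identityˡ 0#)
    ⅀-+ (x ∷ xs) f g = trans (+-congˡ (⅀-+ xs f g)) (interchange _ _ _ _)

    ⅀-*ˡ : ∀ (xs : List A) (b : Carrier) (f : A → Carrier) → b * ⅀ xs f ≈ ⅀ xs (λ x → b * f x)
    ⅀-*ˡ []       b f = zeroʳ b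
    ⅀-*ˡ (x ∷ xs) b f = trans (distribˡ b _ _) (+-congˡ (⅀-*ˡ xs b f))

    ⅀-*ʳ : ∀ (xs : List A) (f : A → Carrier) (b : Carrier) → ⅀ xs f * b ≈ ⅀ xs (λ x → f x * b)
    ⅀-*ʳ []       f b = zeroˡ b
    ⅀-*ʳ (x ∷ xs) f b = trans (distribʳ b _ _) (+-congˡ (⅀-*ʳ xs f b))

    ⅀-↭ : ∀ {xs ys : List A} (f : A → Carrier) → xs ↭ ys → ⅀ xs f ≈ ⅀ ys f
    ⅀-↭ f ↭.refl         = refl
    ⅀-↭ f (prep x p)     = +-congˡ (⅀-↭ f p)
    ⅀-↭ f (swap x y p)   = trans (x∙yz≈y∙xz _ _ _) (+-congˡ (+-congˡ (⅀-↭ f p)))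
    ⅀-↭ f (↭.trans p q)  = trans (⅀-↭ f p) (⅀-↭ f q)

    ⅀-filter : ∀ {p} {P : Pred A p} (P? : Decidable P) (xs : List A) (f : A → Carrier) →
               ⅀ (filter P? xs) f ≈ ⅀ xs (λ x → 𝟙 (P? x) * f x)
    ⅀-filter P? []       f = refl
    ⅀-filter P? (x ∷ xs) f with does (P? x)
    ... | true  = +-cong (sym (*-identityˡ _)) (⅀-filter P? xs f)
    ... | false = trans (⅀-filter P? xs f) (sym (trans (+-congʳ (zeroˡ _)) (+-identityˡ _)))

    ⅀-single : ∀ {xs : List A} {x} (f : A → Carrier) → Unique xs → x ∈ xs →
               (∀ {y} → y ∈ xs → y ≢ x → f y ≈ 0#) → ⅀ xs f ≈ f x
    ⅀-single {x ∷ xs} f (x∉ ∷ u) (here ≡.refl) h =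
      trans (+-congˡ (⅀-0 xs (λ y∈ → h (there y∈) (λ e → All.lookup x∉ y∈ (≡.sym e))))) (+-identityʳ _)
    ⅀-single {y ∷ xs} f (x∉ ∷ u) (there x∈) h =
      trans (+-congʳ (h (here ≡.refl) (All.lookup x∉ x∈)))
            (trans (+-identityˡ _) (⅀-single f u x∈ (h ∘ there)))

  ⅀-map : ∀ {a b} {A : Set a} {B : Set b} (h : A → B) (xs : List A) (f : B → Carrier) →
          ⅀ (map h xs) f ≡ ⅀ xs (f ∘ h)
  ⅀-map h []       f = ≡.refl
  ⅀-map h (x ∷ xs) f = cong (f (h x) +_) (⅀-map h xs f)

  module _ {a b} {A : Set a} {B : Set b} where

    ⅀-concatMap : ∀ (h : A → List B) (xs : List A) (f : B → Carrier) →
                  ⅀ (concatMap h xs) f ≈ ⅀ xs (λ x → ⅀ (h x) f)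
    ⅀-concatMap h []       f = refl
    ⅀-concatMap h (x ∷ xs) f = trans (⅀-++ (h x) _ f) (+-congˡ (⅀-concatMap h xs f))

    ⅀-swap : ∀ (xs : List A) (ys : List B) (f : A → B → Carrier) →
             ⅀ xs (λ x → ⅀ ys (f x)) ≈ ⅀ ys (λ y → ⅀ xs (λ x → f x y))
    ⅀-swap []       ys f = sym (⅀-0 ys (λ _ → refl))
    ⅀-swap (x ∷ xs) ys f = trans (+-congˡ (⅀-swap xs ys f)) (sym (⅀-+ ys _ _))

  ⅀-cartesianProductWith : ∀ {a b d} {A : Set a} {B : Set b} {D : Set d} (h : A → B → D) xs ys
    (f : D → Carrier) → ⅀ (cartesianProductWith h xs ys) f ≈ ⅀ xs (λ x → ⅀ ys (λ y → f (h x y)))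
  ⅀-cartesianProductWith h []       ys f = refl
  ⅀-cartesianProductWith h (x ∷ xs) ys f =
    trans (⅀-++ (map (h x) ys) _ f)
          (+-cong (reflexive (⅀-map (h x) ys f)) (⅀-cartesianProductWith h xs ys f))

  ⅀-vectors : ∀ {a} {A : Set a} (xs : List A) r (f : Vec A (suc r) → Carrier) →
              ⅀ (vectors xs (suc r)) f ≈ ⅀ xs (λ x → ⅀ (vectors xs r) (λ v → f (x ∷ v)))
  ⅀-vectors xs r = ⅀-cartesianProductWith _∷_ xs (vectors xs r)

  -- The hypothesis speaks of sums and not of a bijection, so the lemma applies to its own
  -- conclusion: once for the entries of a row, and once more for the rows of a configuration.
  ⅀-vectors-map : ∀ {a} {A : Set a} (φ : A → A) (xs : List A) →
    (∀ f → ⅀ xs (f ∘ φ) ≈ ⅀ xs f) →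
    ∀ r f → ⅀ (vectors xs r) (f ∘ Vec.map φ) ≈ ⅀ (vectors xs r) f
  ⅀-vectors-map φ xs h zero    f = refl
  ⅀-vectors-map φ xs h (suc r) f = begin
    ⅀ (vectors xs (suc r)) (f ∘ Vec.map φ)
      ≈⟨ ⅀-vectors xs r _ ⟩
    ⅀ xs (λ x → ⅀ (vectors xs r) (λ v → f (φ x ∷ Vec.map φ v)))
      ≈⟨ ⅀-cong xs (λ x → ⅀-vectors-map φ xs h r (λ v → f (φ x ∷ v))) ⟩
    ⅀ xs (λ x → ⅀ (vectors xs r) (λ v → f (φ x ∷ v)))
      ≈⟨ h (λ x → ⅀ (vectors xs r) (λ v → f (x ∷ v))) ⟩
    ⅀ xs (λ x → ⅀ (vectors xs r) (λ v → f (x ∷ v)))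
      ≈⟨ ⅀-vectors xs r f ⟨
    ⅀ (vectors xs (suc r)) f ∎

  ⅀-allFin-suc : ∀ {n} (f : Fin (suc n) → Carrier) →
                 ⅀ (allFin (suc n)) f ≡ f zero + ⅀ (allFin n) (f ∘ suc)
  ⅀-allFin-suc {n} f = cong (f zero +_)
    (≡.trans (cong (λ xs → ⅀ xs f) (≡.sym (List.map-tabulate id suc))) (⅀-map suc (allFin n) f))

  private
    ⅀-sum : ∀ {n} (f : Fin n → Carrier) → ⅀ (allFin n) f ≡ sum f
    ⅀-sum {zero}  f = ≡.refl
    ⅀-sum {suc n} f = ≡.trans (⅀-allFin-suc f) (cong (f zero +_) (⅀-sum (f ∘ suc)))

  ⅀-permute : ∀ {n} (π : Permutation′ n) (f : Fin n → Carrier) →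
              ⅀ (allFin n) (f ∘ (π ⟨$⟩ʳ_)) ≈ ⅀ (allFin n) f
  ⅀-permute π f = trans (reflexive (⅀-sum (f ∘ (π ⟨$⟩ʳ_))))
    (sym (trans (reflexive (⅀-sum f)) (sum-permute f π)))

  ⅀-δ : ∀ {n} (j : Fin n) (f : Fin n → Carrier) → ⅀ (allFin n) (λ i → 𝟙 (i Fin.≟ j) * f i) ≈ f j
  ⅀-δ j f = trans
    (⅀-single (λ i → 𝟙 (i Fin.≟ j) * f i) (Unique.allFin⁺ _) (∈-allFin j)
       (λ {y} _ y≢j → trans (*-congʳ (𝟙-no (y Fin.≟ j) y≢j)) (zeroˡ _)))
    (trans (*-congʳ (𝟙-yes (j Fin.≟ j) ≡.refl)) (*-identityˡ _))

  -- One summand for each unordered pair of positions. On a list without repetitions these are the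
  -- two-element subsets, and `h` receives the two elements in the order of the list.
  ⅀₂ : ∀ {a} {A : Set a} → List A → (A → A → Carrier) → Carrier
  ⅀₂ []       h = 0#
  ⅀₂ (x ∷ xs) h = ⅀ xs (h x) + ⅀₂ xs h

  module _ {a} {A : Set a} where

    ⅀₂-cong∈ : ∀ {xs : List A} {g h : A → A → Carrier} → Unique xs →
      (∀ {x y} → x ∈ xs → y ∈ xs → x ≢ y → g x y ≈ h x y) → ⅀₂ xs g ≈ ⅀₂ xs h
    ⅀₂-cong∈ {[]}     u       eq = refl
    ⅀₂-cong∈ {x ∷ xs} (x∉ ∷ u) eq = +-cong
      (⅀-cong∈ xs (λ y∈ → eq (here ≡.refl) (there y∈) (All.lookup x∉ y∈)))
      (⅀₂-cong∈ u (λ x∈ y∈ → eq (there x∈) (there y∈)))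

    ⅀₂-0 : ∀ {xs : List A} {h : A → A → Carrier} → Unique xs →
      (∀ {x y} → x ∈ xs → y ∈ xs → x ≢ y → h x y ≈ 0#) → ⅀₂ xs h ≈ 0#
    ⅀₂-0 {[]}     u        eq = refl
    ⅀₂-0 {x ∷ xs} (x∉ ∷ u) eq = trans (+-cong
      (⅀-0 xs (λ y∈ → eq (here ≡.refl) (there y∈) (All.lookup x∉ y∈)))
      (⅀₂-0 u (λ x∈ y∈ → eq (there x∈) (there y∈)))) (+-identityˡ 0#)

    ⅀₂-+ : ∀ (xs : List A) (g h : A → A → Carrier) → ⅀₂ xs (λ x y → g x y + h x y) ≈ ⅀₂ xs g + ⅀₂ xs h
    ⅀₂-+ []       g h = sym (+-identityˡ 0#)
    ⅀₂-+ (x ∷ xs) g h = trans (+-cong (⅀-+ xs (g x) (h x)) (⅀₂-+ xs g h)) (interchange _ _ _ _)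

    ⅀₂-*ʳ : ∀ (xs : List A) (h : A → A → Carrier) b → ⅀₂ xs h * b ≈ ⅀₂ xs (λ x y → h x y * b)
    ⅀₂-*ʳ []       h b = zeroˡ b
    ⅀₂-*ʳ (x ∷ xs) h b = trans (distribʳ b _ _) (+-cong (⅀-*ʳ xs (h x) b) (⅀₂-*ʳ xs h b))

module ℕΣ = ListSums ℕ.+-*-commutativeSemiring
open ℕΣ public using () renaming (⅀ to Σℕ; 𝟙 to [_]ℕ)

-- Ordered fields: positivity, nonnegativity, reciprocals, products

module OrderedFields {c ℓ₁ ℓ₂} (K : OrderedField c ℓ₁ ℓ₂) where

  open OrderedField K public
  open IsStrictPartialOrder isStrictPartialOrder public using (<-resp-≈; <-respʳ-≈; <-respˡ-≈)
    renaming (trans to <-trans; irrefl to <-irrefl)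
  module R = CommutativeRing commutativeRing
  open ListSums R.commutativeSemiring public
  open import Relation.Binary.Reasoning.Setoid R.setoid
  open import Algebra.Properties.Ring R.ring public using (-‿distribˡ-*)
  open import Algebra.Properties.Semiring.Mult R.semiring using (×-homo-+; ×1-homo-*)

  fromNat-+ : ∀ a b → fromNat (a ℕ.+ b) ≈ fromNat a + fromNat b
  fromNat-+ = ×-homo-+ 1#

  fromNat-* : ∀ a b → fromNat (a ℕ.* b) ≈ fromNat a * fromNat b
  fromNat-* = ×1-homo-*

  fromNat-1 : fromNat 1 ≈ 1#
  fromNat-1 = R.+-identityʳ 1#

  fromNat-[] : ∀ {p} {P : Set p} (d : Dec P) → fromNat [ d ]ℕ ≈ 𝟙 d
  fromNat-[] (yes _) = fromNat-1
  fromNat-[] (no _)  = R.refl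

  fromNat-Σ : ∀ {a} {A : Set a} (xs : List A) f → fromNat (Σℕ xs f) ≈ ⅀ xs (fromNat ∘ f)
  fromNat-Σ []       f = R.refl
  fromNat-Σ (x ∷ xs) f = R.trans (fromNat-+ (f x) _) (R.+-congˡ (fromNat-Σ xs f))

  x<x+d : ∀ {x d} → 0# < d → x < x + d
  x<x+d {x} {d} 0<d = <-respˡ-≈ (R.+-identityˡ x) (<-respʳ-≈ (R.+-comm d x) (+-monoˡ-< x 0<d))

  <-fromDifference : ∀ {x y d} → x + d ≈ y → 0# < d → x < y
  <-fromDifference eq 0<d = <-respʳ-≈ eq (x<x+d 0<d)

  0<y-x : ∀ {x y} → x < y → 0# < y - x
  0<y-x {x} {y} x<y = <-respˡ-≈ (R.-‿inverseʳ x) (+-monoˡ-< (- x) x<y)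

  *-monoˡ-< : ∀ {b x y} → 0# < b → x < y → b * x < b * y
  *-monoˡ-< {b} {x} {y} 0<b x<y = <-fromDifference eq (*-pos 0<b (0<y-x x<y))
    where
    eq : b * x + b * (y - x) ≈ b * y
    eq = begin
      b * x + b * (y - x) ≈⟨ R.distribˡ b x _ ⟨
      b * (x + (y - x))   ≈⟨ R.*-congˡ (R.+-congˡ (R.+-comm y (- x))) ⟩
      b * (x + (- x + y)) ≈⟨ R.*-congˡ (R.+-assoc x (- x) y) ⟨
      b * ((x - x) + y)   ≈⟨ R.*-congˡ (R.trans (R.+-congʳ (R.-‿inverseʳ x)) (R.+-identityˡ y)) ⟩
      b * y ∎

  +-cancelʳ-< : ∀ {x y} z → x + z < y + z → x < y
  +-cancelʳ-< {x} {y} z lt = <-respˡ-≈ (e x) (<-respʳ-≈ (e y) (+-monoˡ-< (- z) lt))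
    where
    e : ∀ w → (w + z) - z ≈ w
    e w = R.trans (R.+-assoc w z (- z)) (R.trans (R.+-congˡ (R.-‿inverseʳ z)) (R.+-identityʳ w))

  0<-+ : ∀ {x y} → 0# < x → 0# < y → 0# < x + y
  0<-+ 0<x 0<y = <-trans 0<x (x<x+d 0<y)

  -- The order is not assumed trichotomous, so nonnegativity is an explicit alternative. The
  -- weights, masses and indicators that are summed below all come with one, and then a single
  -- positive summand makes a whole sum positive.
  Nonneg : Carrier → Set _
  Nonneg x = x ≈ 0# ⊎ 0# < x

  nonneg-resp : ∀ {x y} → x ≈ y → Nonneg x → Nonneg y
  nonneg-resp e (inj₁ x≈0) = inj₁ (R.trans (R.sym e) x≈0)
  nonneg-resp e (inj₂ 0<x) = inj₂ (<-respʳ-≈ e 0<x)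

  pos+nonneg : ∀ {x y} → 0# < x → Nonneg y → 0# < x + y
  pos+nonneg 0<x (inj₁ y≈0) = <-respʳ-≈ (R.sym (R.trans (R.+-congˡ y≈0) (R.+-identityʳ _))) 0<x
  pos+nonneg 0<x (inj₂ 0<y) = 0<-+ 0<x 0<y

  nonneg-+ : ∀ {x y} → Nonneg x → Nonneg y → Nonneg (x + y)
  nonneg-+ (inj₁ x≈0) ny = nonneg-resp (R.sym (R.trans (R.+-congʳ x≈0) (R.+-identityˡ _))) ny
  nonneg-+ (inj₂ 0<x) ny = inj₂ (pos+nonneg 0<x ny)

  nonneg-* : ∀ {x y} → Nonneg x → Nonneg y → Nonneg (x * y)
  nonneg-* (inj₁ x≈0) _          = inj₁ (R.trans (R.*-congʳ x≈0) (R.zeroˡ _))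
  nonneg-* (inj₂ _)   (inj₁ y≈0) = inj₁ (R.trans (R.*-congˡ y≈0) (R.zeroʳ _))
  nonneg-* (inj₂ 0<x) (inj₂ 0<y) = inj₂ (*-pos 0<x 0<y)

  module _ {a} {A : Set a} where

    nonneg-⅀ : ∀ (xs : List A) {f : A → Carrier} → (∀ x → Nonneg (f x)) → Nonneg (⅀ xs f)
    nonneg-⅀ []       h = inj₁ R.refl
    nonneg-⅀ (x ∷ xs) h = nonneg-+ (h x) (nonneg-⅀ xs h)

    ⅀-pos : ∀ {xs : List A} {x} {f : A → Carrier} → (∀ x → Nonneg (f x)) → x ∈ xs → 0# < f x → 0# < ⅀ xs f
    ⅀-pos {xs = x ∷ xs} h (here ≡.refl) 0<fx = pos+nonneg 0<fx (nonneg-⅀ xs h)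
    ⅀-pos {xs = x ∷ xs} h (there x∈)    0<fx =
      <-respʳ-≈ (R.+-comm _ _) (pos+nonneg (⅀-pos h x∈ 0<fx) (h x))

  𝟙-nonneg : ∀ {p} {P : Set p} (d : Dec P) → Nonneg (𝟙 d)
  𝟙-nonneg (yes _) = inj₂ 0<1
  𝟙-nonneg (no _)  = inj₁ R.refl

  fromNat-nonneg : ∀ n → Nonneg (fromNat n)
  fromNat-nonneg zero    = inj₁ R.refl
  fromNat-nonneg (suc n) = inj₂ (0<fromNat-suc n)

  fromNat-pos : ∀ {n} → 1 ℕ.≤ n → 0# < fromNat n
  fromNat-pos {suc n} _ = 0<fromNat-suc n

  fromNat-< : ∀ {a b} → a ℕ.< b → fromNat a < fromNat b
  fromNat-< {a} {b} a<b = <-fromDifference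
    (R.trans (R.sym (fromNat-+ a (b ∸ a))) (R.reflexive (cong fromNat (ℕ.m+[n∸m]≡n (ℕ.<⇒≤ a<b)))))
    (fromNat-pos (ℕ.m<n⇒0<n∸m a<b))

  recip₊ : ℕ → Carrier
  recip₊ n = recip (suc n)

  private
    x-0 : ∀ x → x - 0# ≈ x
    x-0 x = begin
      x - 0#        ≈⟨ R.+-congʳ (R.+-identityʳ x) ⟨
      (x + 0#) - 0# ≈⟨ R.+-assoc x 0# (- 0#) ⟩
      x + (0# - 0#) ≈⟨ R.+-congˡ (R.-‿inverseʳ 0#) ⟩
      x + 0#        ≈⟨ R.+-identityʳ x ⟩
      x ∎

  recip-inverse : ∀ n → fromNat (suc n) * recip₊ n ≈ 1#
  recip-inverse n = R.trans (R.*-congʳ (R.sym (x-0 _)))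
    (proj₂ (proj₂ (#⇒invertible (#-sym (<⇒# (0<fromNat-suc n))))))

  -- An invertible element is apart from zero, hence positive or negative. In the negative case the
  -- product of its opposite with `fromNat (suc n)` would make `- 1#` positive.
  recip₊-pos : ∀ n → 0# < recip₊ n
  recip₊-pos n with #⇒< (invertible⇒# {recip₊ n} {0#}
    (fromNat (suc n) , R.trans (R.*-congˡ (x-0 _)) (recip-inverse n)
                     , R.trans (R.*-congʳ (x-0 _)) (R.trans (R.*-comm _ _) (recip-inverse n))))
  ... | inj₂ 0<r = 0<r
  ... | inj₁ r<0 = contradiction (<-trans 0<1 1<0) (<-irrefl R.refl)
    where
    0<-r : 0# < 0# - recip₊ n
    0<-r = 0<y-x r<0
    0<-1 : 0# < - 1#
    0<-1 = <-respʳ-≈ (begin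
      (0# - recip₊ n) * fromNat (suc n) ≈⟨ R.*-congʳ (R.+-identityˡ _) ⟩
      (- recip₊ n) * fromNat (suc n)    ≈⟨ -‿distribˡ-* _ _ ⟨
      - (recip₊ n * fromNat (suc n))    ≈⟨ R.-‿cong (R.trans (R.*-comm _ _) (recip-inverse n)) ⟩
      - 1# ∎) (*-pos 0<-r (0<fromNat-suc n))
    1<0 : 1# < 0#
    1<0 = <-respˡ-≈ (R.+-identityˡ 1#) (<-respʳ-≈ (R.-‿inverseˡ 1#) (+-monoˡ-< 1# 0<-1))

  recip-pos : ∀ n .{{_ : NonZero n}} → 0# < recip n
  recip-pos (suc n) = recip₊-pos n

  ∏ : ∀ {a} {A : Set a} → List A → (A → Carrier) → Carrier
  ∏ xs f = foldr _*_ 1# (map f xs)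

  module _ {a} {A : Set a} where

    ∏-cong : ∀ (xs : List A) {f g : A → Carrier} → (∀ x → f x ≈ g x) → ∏ xs f ≈ ∏ xs g
    ∏-cong []       h = R.refl
    ∏-cong (x ∷ xs) h = R.*-cong (h x) (∏-cong xs h)

    ∏-cong∈ : ∀ (xs : List A) {f g : A → Carrier} → (∀ {x} → x ∈ xs → f x ≈ g x) → ∏ xs f ≈ ∏ xs g
    ∏-cong∈ []       h = R.refl
    ∏-cong∈ (x ∷ xs) h = R.*-cong (h (here ≡.refl)) (∏-cong∈ xs (h ∘ there))

    ∏-↭ : ∀ {xs ys : List A} (f : A → Carrier) → xs ↭ ys → ∏ xs f ≈ ∏ ys f
    ∏-↭ f ↭.refl        = R.refl
    ∏-↭ f (prep x p)    = R.*-congˡ (∏-↭ f p)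
    ∏-↭ f (swap x y p)  = R.trans (R.sym (R.*-assoc _ _ _))
      (R.trans (R.*-cong (R.*-comm _ _) (∏-↭ f p)) (R.*-assoc _ _ _))
    ∏-↭ f (↭.trans p q) = R.trans (∏-↭ f p) (∏-↭ f q)

    ∏-pos : ∀ (xs : List A) {f : A → Carrier} → (∀ x → 0# < f x) → 0# < ∏ xs f
    ∏-pos []       h = 0<1
    ∏-pos (x ∷ xs) h = *-pos (h x) (∏-pos xs h)

  ∏-map : ∀ {a b} {A : Set a} {B : Set b} (h : A → B) (xs : List A) (f : B → Carrier) →
          ∏ (map h xs) f ≡ ∏ xs (f ∘ h)
  ∏-map h []       f = ≡.refl
  ∏-map h (x ∷ xs) f = cong (f (h x) *_) (∏-map h xs f)

-- Permutations, multiplicities and lists without repetitions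

module Lists where

  open ≡ using (refl; sym; trans)

  module _ {a} {A : Set a} where

    ∈⇒↭ : ∀ {x : A} {xs} → x ∈ xs → ∃ λ ys → xs ↭ x ∷ ys
    ∈⇒↭ {x} x∈ with ys , zs , refl ← ∈-∃++ x∈ = ys ++ zs , ↭.shift x ys zs

    unique-↭ : ∀ {xs ys : List A} → xs ↭ ys → Unique xs → Unique ys
    unique-↭ ↭.refl        u = u
    unique-↭ (prep x p)    (x∉ ∷ u) = ↭.All-resp-↭ p x∉ ∷ unique-↭ p u
    unique-↭ (swap x y p)  ((x≢y ∷ x∉) ∷ (y∉ ∷ u)) =
      ((x≢y ∘ sym) ∷ ↭.All-resp-↭ p y∉) ∷ (↭.All-resp-↭ p x∉ ∷ unique-↭ p u)
    unique-↭ (↭.trans p q) u = unique-↭ q (unique-↭ p u)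

    unique-⊆⇒↭ : ∀ {xs ys : List A} → Unique xs → (∀ {x} → x ∈ xs → x ∈ ys) →
                 ∃ λ zs → ys ↭ xs ++ zs
    unique-⊆⇒↭ {[]}     {ys} u        sub = ys , ↭-refl
    unique-⊆⇒↭ {x ∷ xs} {ys} (x∉ ∷ u) sub with ∈⇒↭ (sub (here refl))
    ... | ys′ , p with unique-⊆⇒↭ u sub′
      where
      sub′ : ∀ {z} → z ∈ xs → z ∈ ys′
      sub′ z∈ with ↭.∈-resp-↭ p (sub (there z∈))
      ... | here refl = contradiction refl (All.lookup x∉ z∈)
      ... | there z∈′ = z∈′
    ...   | zs , q = zs , ↭-trans p (prep x q)

    unique-same⇒↭ : ∀ {xs ys : List A} → Unique xs → Unique ys →
      (∀ {x} → x ∈ xs → x ∈ ys) → (∀ {x} → x ∈ ys → x ∈ xs) → ys ↭ xs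
    unique-same⇒↭ {xs} u v sub sup with unique-⊆⇒↭ u sub
    ... | [] , p = ↭-trans p (↭.↭-reflexive (List.++-identityʳ xs))
    ... | z ∷ zs , p = ⊥-elim (Unique.Unique[x∷xs]⇒x∉xs
            (unique-↭ (↭.shift z xs zs) (unique-↭ p v))
            (∈-++⁺ˡ (sup (↭.∈-resp-↭ (↭-sym p) (∈-++⁺ʳ xs (here refl))))))

  unique-++ˡ : ∀ {a} {A : Set a} (xs : List A) {ys} → Unique (xs ++ ys) → Unique xs
  unique-++ˡ []       _        = []
  unique-++ˡ (x ∷ xs) (x∉ ∷ u) = All.++⁻ˡ xs x∉ ∷ unique-++ˡ xs u

  unique-++-disjoint : ∀ {a} {A : Set a} (xs : List A) {ys} → Unique (xs ++ ys) → ∀ {v} → v ∈ ys → v ∉ xs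
  unique-++-disjoint (x ∷ xs) (x∉ ∷ u) v∈ys (here refl) = All.lookup (All.++⁻ʳ xs x∉) v∈ys refl
  unique-++-disjoint (x ∷ xs) (x∉ ∷ u) v∈ys (there v∈xs)  = unique-++-disjoint xs u v∈ys v∈xs

  Σℕ-const : ∀ {a} {A : Set a} (xs : List A) c → Σℕ xs (λ _ → c) ≡ length xs ℕ.* c
  Σℕ-const []       c = refl
  Σℕ-const (x ∷ xs) c = cong (c ℕ.+_) (Σℕ-const xs c)

  Σℕ-mono : ∀ {a} {A : Set a} (xs : List A) {f g : A → ℕ} → (∀ {x} → x ∈ xs → f x ℕ.≤ g x) → Σℕ xs f ℕ.≤ Σℕ xs g
  Σℕ-mono []       h = z≤n
  Σℕ-mono (x ∷ xs) h = ℕ.+-mono-≤ (h (here refl)) (Σℕ-mono xs (h ∘ there))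

  Σℕ-≥ : ∀ {a} {A : Set a} {xs : List A} {x} (f : A → ℕ) → x ∈ xs → f x ℕ.≤ Σℕ xs f
  Σℕ-≥ f (here refl)        = ℕ.m≤m+n _ _
  Σℕ-≥ f (there {x = y} x∈) = ℕ.≤-trans (Σℕ-≥ f x∈) (ℕ.m≤n+m _ (f y))

  Σℕ-pos : ∀ {a} {A : Set a} (xs : List A) (f : A → ℕ) → 1 ℕ.≤ Σℕ xs f → ∃ λ x → x ∈ xs × 1 ℕ.≤ f x
  Σℕ-pos (x ∷ xs) f le with f x in eq
  ... | suc _ = x , here refl , subst (1 ℕ.≤_) (sym eq) (s≤s z≤n)
  ... | zero with y , y∈ , p ← Σℕ-pos xs f le = y , there y∈ , p

  []-≤1 : ∀ {p} {P : Set p} (d : Dec P) → [ d ]ℕ ℕ.≤ 1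
  []-≤1 (yes _) = s≤s z≤n
  []-≤1 (no _)  = z≤n

  []-≥1⇒ : ∀ {p} {P : Set p} (d : Dec P) → 1 ℕ.≤ [ d ]ℕ → P
  []-≥1⇒ (yes p) _ = p

  module Occurrences {a} {A : Set a} (_≟_ : (x y : A) → Dec (x ≡ y)) where

    occ : A → List A → ℕ
    occ x xs = Σℕ xs (λ y → [ y ≟ x ]ℕ)

    ∈⇒occ : ∀ {x xs} → x ∈ xs → 1 ℕ.≤ occ x xs
    ∈⇒occ {x} x∈ = ℕ.≤-trans (ℕ.≤-reflexive (sym (ℕΣ.𝟙-yes (x ≟ x) refl))) (Σℕ-≥ _ x∈)

    occ⇒∈ : ∀ {x} xs → 1 ℕ.≤ occ x xs → x ∈ xs
    occ⇒∈ {x} xs le with y , y∈ , p ← Σℕ-pos xs _ le with refl ← []-≥1⇒ (y ≟ x) p = y∈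

    occ-++ : ∀ x xs ys → occ x (xs ++ ys) ≡ occ x xs ℕ.+ occ x ys
    occ-++ x xs ys = ℕΣ.⅀-++ xs ys _

    occ≡⇒↭ : ∀ xs ys → (∀ x → occ x xs ≡ occ x ys) → xs ↭ ys
    occ≡⇒↭ []       []       h = ↭-refl
    occ≡⇒↭ []       (y ∷ ys) h =
      contradiction (subst (1 ℕ.≤_) (sym (h y)) (∈⇒occ {xs = y ∷ ys} (here refl))) λ ()
    occ≡⇒↭ (x ∷ xs) ys       h with ∈⇒↭ (occ⇒∈ ys (subst (1 ℕ.≤_) (h x) (∈⇒occ {xs = x ∷ xs} (here refl))))
    ... | ys′ , p = ↭-trans (prep x (occ≡⇒↭ xs ys′ h′)) (↭-sym p)
      where
      h′ : ∀ z → occ z xs ≡ occ z ys′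
      h′ z = ℕ.+-cancelˡ-≡ [ x ≟ z ]ℕ _ _ (trans (h z) (ℕΣ.⅀-↭ _ p))

  module _ {n : ℕ} where
    open Occurrences (Fin._≟_ {n}) public

  map-permute-allFin : ∀ {n} (π : Permutation′ n) → map (π ⟨$⟩ʳ_) (allFin n) ↭ allFin n
  map-permute-allFin {n} π = occ≡⇒↭ _ _ λ i →
    trans (ℕΣ.⅀-map (π ⟨$⟩ʳ_) (allFin n) _) (ℕΣ.⅀-permute π (λ j → [ j Fin.≟ i ]ℕ))

  perm-injective : ∀ {n} (π : Permutation′ n) {i j} → π ⟨$⟩ʳ i ≡ π ⟨$⟩ʳ j → i ≡ j
  perm-injective π e = trans (sym (inverseˡ π)) (trans (cong (π ⟨$⟩ˡ_) e) (inverseˡ π))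
open Lists public

-- Arcs, closed walks and tallies of roots

module Walks where

  open ≡ using (refl; sym; trans)

  Arc : ℕ → Set
  Arc n = Fin n × Fin n

  _≟ᵃ_ : ∀ {n} (a b : Arc n) → Dec (a ≡ b)
  _≟ᵃ_ = Product.≡-dec Fin._≟_ Fin._≟_

  mapArc : ∀ {n} → (Fin n → Fin n) → Arc n → Arc n
  mapArc f (i , j) = f i , f j

  -- The indeterminates by which ∂/∂a_{iγ} differentiates.
  rowArcs : ∀ {n k} → Vec (Fin n) (suc k) → List (Arc n)
  rowArcs (i ∷ γ) = map (i ,_) (toList γ)

  arcs : ∀ {n k d} → Vec (Vec (Fin n) (suc k)) d → List (Arc n)
  arcs []      = []
  arcs (ρ ∷ s) = rowArcs ρ ++ arcs s

  arcs-map : ∀ {n k d} (f : Fin n → Fin n) (s : Vec (Vec (Fin n) (suc k)) d) →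
             arcs (Vec.map (Vec.map f) s) ≡ map (mapArc f) (arcs s)
  arcs-map f []            = refl
  arcs-map f ((i ∷ γ) ∷ s) = trans
    (cong₂ _++_ (trans (cong (map (f i ,_)) (Vec.toList-map f γ))
                       (trans (sym (List.map-∘ (toList γ))) (List.map-∘ (toList γ))))
                (arcs-map f s))
    (sym (List.map-++ (mapArc f) (rowArcs (i ∷ γ)) (arcs s)))

  -- The terms of the entry at `i`, `j` of the `N`-th power of the matrix of indeterminates, each
  -- given by the list of its factors.
  walks : ∀ {n} → ℕ → Fin n → Fin n → List (List (Arc n))
  walks zero    i j = if ⌊ i Fin.≟ j ⌋ then [] ∷ [] else []
  walks (suc N) i j = concatMap (λ l → map ((i , l) ∷_) (walks N l j)) (allFin _)

  closedWalks : ∀ {n} → ℕ → List (List (Arc n))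
  closedWalks N = concatMap (λ i → walks N i i) (allFin _)

  data Walk {n} : Fin n → Fin n → List (Arc n) → Set where
    []  : ∀ {i} → Walk i i []
    _∷_ : ∀ {l j A} i → Walk l j A → Walk i j ((i , l) ∷ A)

  ∈walks⇒Walk : ∀ {n} N {i j : Fin n} {A} → A ∈ walks N i j → Walk i j A
  ∈walks⇒Walk zero    {i} {j} A∈ with i Fin.≟ j
  ∈walks⇒Walk zero    (here refl) | yes refl = []
  ∈walks⇒Walk (suc N) {i} A∈ with l , _ , A∈′ ← find (∈-concatMap⁻ _ {xs = allFin _} A∈)
    with A′ , A′∈ , refl ← ∈-map⁻ ((i , l) ∷_) A∈′ = i ∷ ∈walks⇒Walk N A′∈

  Walk⇒∈walks : ∀ {n} {i j : Fin n} {A} → Walk i j A → A ∈ walks (length A) i j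
  Walk⇒∈walks {i = i} [] with i Fin.≟ i
  ... | yes _  = here refl
  ... | no i≢i = contradiction refl i≢i
  Walk⇒∈walks (_∷_ {l} i w) = ∈-concatMap⁺ _ (lose (∈-allFin l) (∈-map⁺ _ (Walk⇒∈walks w)))

  ∈closedWalks⇒Walk : ∀ {n} N {A : List (Arc n)} → A ∈ closedWalks N → ∃ λ i → Walk i i A
  ∈closedWalks⇒Walk N A∈ with i , _ , A∈′ ← find (∈-concatMap⁻ _ {xs = allFin _} A∈) =
    i , ∈walks⇒Walk N A∈′

  Walk⇒∈closedWalks : ∀ {n} {i : Fin n} {A} → Walk i i A → A ∈ closedWalks (length A)
  Walk⇒∈closedWalks {i = i} w = ∈-concatMap⁺ _ (lose (∈-allFin i) (Walk⇒∈walks w))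

  -- Holds exactly when the product of the indeterminates in `B` is a monomial of the trace of the
  -- corresponding matrix power.
  Eulerian : ∀ {n} → List (Arc n) → Set
  Eulerian B = ∃₂ λ i A → Walk i i A × A ↭ B

  tally : ∀ {n d} → Vec (Fin n) d → Vec ℕ n
  tally r = Vec.tabulate (λ i → occ i (toList r))

  rootsOf : ∀ {n} → Vec ℕ n → List (Fin n)
  rootsOf ds = concatMap (λ i → replicate (lookup ds i) i) (allFin _)

  Vec-sum : ∀ {n} (v : Vec ℕ n) → Vec.sum v ≡ Σℕ (allFin n) (lookup v)
  Vec-sum []      = refl
  Vec-sum (x ∷ v) = trans (cong (x ℕ.+_) (Vec-sum v)) (sym (ℕΣ.⅀-allFin-suc (lookup (x ∷ v))))

  sum-tally : ∀ {n d} (r : Vec (Fin n) d) → Vec.sum (tally r) ≡ d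
  sum-tally {n} {d} r = begin
    Vec.sum (tally r)                                        ≡⟨ Vec-sum (tally r) ⟩
    Σℕ (allFin n) (lookup (tally r))                         ≡⟨ ℕΣ.⅀-cong (allFin n) (λ i → Vec.lookup∘tabulate _ i) ⟩
    Σℕ (allFin n) (λ i → occ i (toList r))                   ≡⟨ ℕΣ.⅀-swap (allFin n) (toList r) _ ⟩
    Σℕ (toList r) (λ x → Σℕ (allFin n) (λ i → [ x Fin.≟ i ]ℕ)) ≡⟨ ℕΣ.⅀-cong (toList r) one ⟩
    Σℕ (toList r) (λ _ → 1)                                  ≡⟨ Σℕ-const (toList r) 1 ⟩
    length (toList r) ℕ.* 1                                  ≡⟨ ℕ.*-identityʳ _ ⟩
    length (toList r)                                        ≡⟨ Vec.length-toList r ⟩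
    d ∎
    where
    open ≡.≡-Reasoning
    one : ∀ x → Σℕ (allFin n) (λ i → [ x Fin.≟ i ]ℕ) ≡ 1
    one x = trans (ℕΣ.⅀-cong (allFin n) λ i → trans (ℕΣ.𝟙-⇔ (x Fin.≟ i) (i Fin.≟ x) sym sym) (sym (ℕ.*-identityʳ _)))
                  (ℕΣ.⅀-δ x (λ _ → 1))

  occ-replicate : ∀ {n} (i x : Fin n) m → occ x (replicate m i) ≡ [ i Fin.≟ x ]ℕ ℕ.* m
  occ-replicate i x zero    = sym (ℕ.*-zeroʳ [ i Fin.≟ x ]ℕ)
  occ-replicate i x (suc m) = trans (cong ([ i Fin.≟ x ]ℕ ℕ.+_) (occ-replicate i x m)) (sym (ℕ.*-suc [ i Fin.≟ x ]ℕ m))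

  occ-rootsOf : ∀ {n} (ds : Vec ℕ n) x → occ x (rootsOf ds) ≡ lookup ds x
  occ-rootsOf {n} ds x = trans (ℕΣ.⅀-concatMap (λ i → replicate (lookup ds i) i) (allFin n) (λ y → [ y Fin.≟ x ]ℕ))
    (trans (ℕΣ.⅀-cong (allFin n) (λ i → occ-replicate i x (lookup ds i))) (ℕΣ.⅀-δ x (lookup ds)))

  length-rootsOf : ∀ {n} (ds : Vec ℕ n) → length (rootsOf ds) ≡ Vec.sum ds
  length-rootsOf {n} ds = begin
    length (rootsOf ds)                ≡⟨ trans (Σℕ-const (rootsOf ds) 1) (ℕ.*-identityʳ _) ⟨
    Σℕ (rootsOf ds) (λ _ → 1)          ≡⟨ ℕΣ.⅀-concatMap (λ i → replicate (lookup ds i) i) (allFin n) _ ⟩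
    Σℕ (allFin n) (λ i → Σℕ (replicate (lookup ds i) i) (λ _ → 1))
      ≡⟨ ℕΣ.⅀-cong (allFin n) (λ i → trans (Σℕ-const (replicate (lookup ds i) i) 1)
           (trans (ℕ.*-identityʳ _) (List.length-replicate (lookup ds i)))) ⟩
    Σℕ (allFin n) (lookup ds)          ≡⟨ Vec-sum ds ⟨
    Vec.sum ds ∎
    where open ≡.≡-Reasoning

  tally⇒↭ : ∀ {n d} (r : Vec (Fin n) d) → toList r ↭ rootsOf (tally r)
  tally⇒↭ r = occ≡⇒↭ _ _ λ x → sym (trans (occ-rootsOf (tally r) x) (Vec.lookup∘tabulate _ x))

  -- Makes the multiplicity of a weak composition at least 1, so that the trace formula can be
  -- divided by it.
  tally-surjective : ∀ {n d} (ds : Vec ℕ n) → Vec.sum ds ≡ d → ∃ λ (r : Vec (Fin n) d) → tally r ≡ ds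
  tally-surjective ds refl with rootsOf ds in eq₁ | length-rootsOf ds
  ... | rs | eq₂ = subst (λ d → ∃ λ (r : Vec (Fin _) d) → tally r ≡ ds) eq₂ (Vec.fromList rs , (begin
    Vec.tabulate (λ i → occ i (toList (Vec.fromList rs)))
      ≡⟨ Vec.tabulate-cong (λ i → trans (cong (occ i) (trans (Vec.toList∘fromList rs) (sym eq₁))) (occ-rootsOf ds i)) ⟩
    Vec.tabulate (lookup ds)                              ≡⟨ Vec.tabulate∘lookup ds ⟩
    ds ∎))
    where open ≡.≡-Reasoning

  ∈-vectors : ∀ {a} {A : Set a} {xs : List A} {r} (v : Vec A r) → (∀ i → lookup v i ∈ xs) → v ∈ vectors xs r
  ∈-vectors []      h = here refl
  ∈-vectors (x ∷ v) h = ∈-cartesianProductWith⁺ _∷_ (h zero) (∈-vectors v (h ∘ suc))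

  unique-vectors : ∀ {a} {A : Set a} {xs : List A} r → Unique xs → Unique (vectors xs r)
  unique-vectors zero    u = [] ∷ []
  unique-vectors (suc r) u = Unique.cartesianProductWith⁺ _∷_ Vec.∷-injective u (unique-vectors r u)

  ∈-weakCompositions : ∀ {n} (ds : Vec ℕ n) {d} → Vec.sum ds ≡ d → ds ∈ weakCompositions n d
  ∈-weakCompositions ds refl = ∈-filter⁺ _ (∈-vectors ds (λ i → ∈-upTo⁺ (s≤s
    (ℕ.≤-trans (Σℕ-≥ (lookup ds) (∈-allFin i)) (ℕ.≤-reflexive (sym (Vec-sum ds))))))) refl

  unique-weakCompositions : ∀ n d → Unique (weakCompositions n d)
  unique-weakCompositions n d = Unique.filter⁺ _ (unique-vectors n (Unique.upTo⁺ (suc d)))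

  tally-map : ∀ {n d} (π : Permutation′ n) (r : Vec (Fin n) d) →
              ∀ i → lookup (tally (Vec.map (π ⟨$⟩ʳ_) r)) (π ⟨$⟩ʳ i) ≡ lookup (tally r) i
  tally-map π r i = trans (Vec.lookup∘tabulate _ (π ⟨$⟩ʳ i)) (trans (trans
    (cong (occ (π ⟨$⟩ʳ i)) (Vec.toList-map _ r))
    (trans (ℕΣ.⅀-map (π ⟨$⟩ʳ_) (toList r) _)
      (ℕΣ.⅀-cong (toList r) λ x → ℕΣ.𝟙-⇔ (π ⟨$⟩ʳ x Fin.≟ π ⟨$⟩ʳ i) (x Fin.≟ i) (perm-injective π) (cong _))))
    (sym (Vec.lookup∘tabulate _ i)))

  tally-map-≡ : ∀ {n d} (π : Permutation′ n) (r r′ : Vec (Fin n) d) →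
    tally (Vec.map (π ⟨$⟩ʳ_) r) ≡ tally (Vec.map (π ⟨$⟩ʳ_) r′) → tally r ≡ tally r′
  tally-map-≡ π r r′ e = lookup-ext λ i →
    trans (sym (tally-map π r i)) (trans (cong (λ v → lookup v (π ⟨$⟩ʳ i)) e) (tally-map π r′ i))
    where
    lookup-ext : ∀ {m} {u v : Vec ℕ m} → (∀ i → lookup u i ≡ lookup v i) → u ≡ v
    lookup-ext {u = u} {v} h = trans (sym (Vec.tabulate∘lookup u)) (trans (Vec.tabulate-cong h) (Vec.tabulate∘lookup v))

  tally-map-cong : ∀ {n d} (π : Permutation′ n) (r r′ : Vec (Fin n) d) →
    tally r ≡ tally r′ → tally (Vec.map (π ⟨$⟩ʳ_) r) ≡ tally (Vec.map (π ⟨$⟩ʳ_) r′)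
  tally-map-cong π r r′ e = tally-map-≡ (Perm.flip π) (Vec.map (π ⟨$⟩ʳ_) r) (Vec.map (π ⟨$⟩ʳ_) r′)
    (trans (cong tally (undo r)) (trans e (cong tally (sym (undo r′)))))
    where
    undo : ∀ {d} (v : Vec (Fin _) d) → Vec.map (π ⟨$⟩ˡ_) (Vec.map (π ⟨$⟩ʳ_) v) ≡ v
    undo v = trans (sym (Vec.map-∘ _ _ v)) (trans (Vec.map-cong (λ _ → inverseˡ π) v) (Vec.map-id v))
open Walks public

-- The trace of a matrix power under differential operators

module TraceFormula {c ℓ₁ ℓ₂} (K : OrderedField c ℓ₁ ℓ₂) where

  open OrderedFields K
  open Tensors K
  open import Relation.Binary.Reasoning.Setoid R.setoid using (begin_; _∎; step-≈-⟩; step-≈-⟨)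
  open import Algebra.Properties.CommutativeSemigroup R.*-commutativeSemigroup using ()
    renaming (x∙yz≈y∙xz to *-leftComm; interchange to *-interchange)

  module _ {n : ℕ} where

    open Lists.Occurrences (_≟ᵃ_ {n}) using () renaming (occ to occᵃ; occ⇒∈ to occᵃ⇒∈)

    arcCount : List (Arc n) → Monomial n
    arcCount []            i′ j′ = 0
    arcCount ((i , j) ∷ A) i′ j′ = isIndet i j i′ j′ ℕ.+ arcCount A i′ j′

    isIndet≡ : ∀ i j i′ j′ → isIndet {n} i j i′ j′ ≡ [ (i , j) ≟ᵃ (i′ , j′) ]ℕ
    isIndet≡ i j i′ j′ = ≡.trans (cong (if_then 1 else 0) (Dec.isYes≗does ((i Fin.≟ i′) ×-dec (j Fin.≟ j′))))
      (ℕΣ.𝟙-⇔ ((i Fin.≟ i′) ×-dec (j Fin.≟ j′)) ((i , j) ≟ᵃ (i′ , j′))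
        (λ { (≡.refl , ≡.refl) → ≡.refl }) (λ { ≡.refl → ≡.refl , ≡.refl }))

    arcCount-occ : ∀ A i j → arcCount A i j ≡ occᵃ (i , j) A
    arcCount-occ []            i j = ≡.refl
    arcCount-occ ((x , y) ∷ A) i j = cong₂ ℕ._+_ (isIndet≡ x y i j) (arcCount-occ A i j)

    arcCount-↭ : ∀ {A B} → A ↭ B → ∀ i j → arcCount A i j ≡ arcCount B i j
    arcCount-↭ {A} {B} p i j = ≡.trans (arcCount-occ A i j) (≡.trans (ℕΣ.⅀-↭ _ p) (≡.sym (arcCount-occ B i j)))

    isIndet-mapArc : (π : Permutation′ n) → ∀ i j x y →
      isIndet (π ⟨$⟩ʳ i) (π ⟨$⟩ʳ j) (π ⟨$⟩ʳ x) (π ⟨$⟩ʳ y) ≡ isIndet i j x y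
    isIndet-mapArc π i j x y = ≡.trans (isIndet≡ _ _ _ _) (≡.trans
      (ℕΣ.𝟙-⇔ (_ ≟ᵃ _) ((i , j) ≟ᵃ (x , y))
        (λ e → cong₂ _,_ (perm-injective π (cong proj₁ e)) (perm-injective π (cong proj₂ e)))
        (cong (mapArc (π ⟨$⟩ʳ_))))
      (≡.sym (isIndet≡ i j x y)))

    -- Monomials are functions, so equal exponents do not make them equal as arguments; a functional
    -- has to respect this agreement explicitly.
    Extensional : (Monomial n → ℕ) → Set
    Extensional h = ∀ {e e′} → (∀ i j → e i j ≡ e′ i j) → h e ≡ h e′

    derive : Arc n → (Monomial n → ℕ) → Monomial n → ℕ
    derive (i , j) h e = e i j ℕ.* h (λ i′ j′ → e i′ j′ ∸ isIndet i j i′ j′)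

    -- The transpose, acting on functionals on monomials, of the product of the ∂/∂a_b, b ∈ B.
    derives : List (Arc n) → (Monomial n → ℕ) → Monomial n → ℕ
    derives []      h = h
    derives (b ∷ B) h = derive b (derives B h)

    derive-ext : ∀ b {h} → Extensional h → Extensional (derive b h)
    derive-ext (i , j) ext eq = cong₂ ℕ._*_ (eq i j) (ext λ i′ j′ → cong (_∸ isIndet i j i′ j′) (eq i′ j′))

    derives-ext : ∀ B {h} → Extensional h → Extensional (derives B h)
    derives-ext []      ext = ext
    derives-ext (b ∷ B) ext = derive-ext b (derives-ext B ext)

    derive-cong : ∀ b {h h′} → h ≗ h′ → derive b h ≗ derive b h′
    derive-cong (i , j) eq e = cong (e i j ℕ.*_) (eq _)

    -- For different arcs, lowering the exponent of one does not change that of the other, so the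
    -- two factors and the two subtractions can be exchanged.
    derive-swap : ∀ a b {h} → Extensional h → derive a (derive b h) ≗ derive b (derive a h)
    derive-swap a@(i , j) b@(x , y) {h} ext e with a ≟ᵃ b
    ... | yes ≡.refl = ≡.refl
    ... | no a≢b = begin′
      e i j ℕ.* ((e x y ∸ isIndet i j x y) ℕ.* h e₁)
        ≡⟨ cong (λ z → e i j ℕ.* ((e x y ∸ z) ℕ.* h e₁)) (zeroInd a b a≢b) ⟩
      e i j ℕ.* (e x y ℕ.* h e₁)
        ≡⟨ cong (λ z → e i j ℕ.* (e x y ℕ.* z)) (ext λ u v → ≡.trans (ℕ.∸-+-assoc (e u v) (isIndet i j u v) (isIndet x y u v))
             (≡.trans (cong (e u v ∸_) (ℕ.+-comm (isIndet i j u v) (isIndet x y u v)))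
               (≡.sym (ℕ.∸-+-assoc (e u v) (isIndet x y u v) (isIndet i j u v))))) ⟩
      e i j ℕ.* (e x y ℕ.* h e₂)
        ≡⟨ ≡.trans (≡.sym (ℕ.*-assoc (e i j) (e x y) _))
             (≡.trans (cong (ℕ._* h e₂) (ℕ.*-comm (e i j) (e x y))) (ℕ.*-assoc (e x y) (e i j) _)) ⟩
      e x y ℕ.* (e i j ℕ.* h e₂)
        ≡⟨ cong (λ z → e x y ℕ.* ((e i j ∸ z) ℕ.* h e₂)) (zeroInd b a (a≢b ∘ ≡.sym)) ⟨
      e x y ℕ.* ((e i j ∸ isIndet x y i j) ℕ.* h e₂) ∎′
      where
      open ≡.≡-Reasoning renaming (begin_ to begin′_; _∎ to _∎′)
      e₁ e₂ : Monomial n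
      e₁ u v = e u v ∸ isIndet i j u v ∸ isIndet x y u v
      e₂ u v = e u v ∸ isIndet x y u v ∸ isIndet i j u v
      zeroInd : ∀ (c d : Arc n) → c ≢ d → isIndet (proj₁ c) (proj₂ c) (proj₁ d) (proj₂ d) ≡ 0
      zeroInd c d c≢d = ≡.trans (isIndet≡ _ _ _ _) (ℕΣ.𝟙-no (c ≟ᵃ d) c≢d)

    derives-inner : ∀ b B {h} → Extensional h → derives B (derive b h) ≗ derives (b ∷ B) h
    derives-inner b []      ext e = ≡.refl
    derives-inner b (a ∷ B) ext e =
      ≡.trans (derive-cong a (derives-inner b B ext) e) (derive-swap a b (derives-ext B ext) e)

    derives-↭ : ∀ {A B h} → Extensional h → A ↭ B → derives A h ≗ derives B h
    derives-↭ ext ↭.refl        e = ≡.refl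
    derives-↭ ext (prep b p)    e = derive-cong b (derives-↭ ext p) e
    derives-↭ {B = _ ∷ _ ∷ B} ext (swap a b p)  e =
      ≡.trans (derive-cong a (derive-cong b (derives-↭ ext p)) e) (derive-swap a b (derives-ext B ext) e)
    derives-↭ ext (↭.trans p q) e = ≡.trans (derives-↭ ext p e) (derives-↭ ext q e)

    derives-++ : ∀ A B {h} → derives A (derives B h) ≗ derives (A ++ B) h
    derives-++ []      B e = ≡.refl
    derives-++ (a ∷ A) B e = derive-cong a (derives-++ A B) e

    zero? : (e : Monomial n) → Dec (∀ i j → e i j ≡ 0)
    zero? e = Fin.all? (λ i → Fin.all? (λ j → e i j ℕ.≟ 0))

    isZero : Monomial n → ℕ
    isZero e = [ zero? e ]ℕ

    isZero-ext : Extensional isZero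
    isZero-ext {e} {e′} eq = ℕΣ.𝟙-⇔ (zero? e) (zero? e′)
      (λ z i j → ≡.trans (≡.sym (eq i j)) (z i j)) (λ z i j → ≡.trans (eq i j) (z i j))

    private
      factor : ∀ {x y} → 1 ℕ.≤ x ℕ.* y → 1 ℕ.≤ x
      factor {suc x} _ = s≤s z≤n
      factor′ : ∀ x {y} → 1 ℕ.≤ x ℕ.* y → 1 ℕ.≤ y
      factor′ x {y} l = factor (ℕ.≤-trans l (ℕ.≤-reflexive (ℕ.*-comm x y)))

    -- A nonzero factor `e i j` shows that the arc still occurs in `A`. Removing it there lowers the
    -- exponents just as the derivative does, and a nonzero constant term at the end means that no
    -- arc is left over.
    derives-positive⇒↭ : ∀ A B {e} → (∀ i j → e i j ≡ arcCount A i j) → 1 ℕ.≤ derives B isZero e → A ↭ B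
    derives-positive⇒↭ []            []            eq le = ↭-refl
    derives-positive⇒↭ ((i , j) ∷ A) []            {e} eq le
      with () ← ≡.trans (≡.sym ([]-≥1⇒ (zero? e) le i j)) (≡.trans (eq i j)
                (cong (ℕ._+ arcCount A i j) (≡.trans (isIndet≡ i j i j) (ℕΣ.𝟙-yes ((i , j) ≟ᵃ (i , j)) ≡.refl))))
    derives-positive⇒↭ A             (b@(i , j) ∷ B) {e} eq le
      with A′ , p ← ∈⇒↭ (occᵃ⇒∈ A (subst (1 ℕ.≤_) (≡.trans (eq i j) (arcCount-occ A i j)) (factor le)))
      = ↭-trans p (prep b (derives-positive⇒↭ A′ B eq′ (factor′ (e i j) le)))
      where
      eq′ : ∀ u v → e u v ∸ isIndet i j u v ≡ arcCount A′ u v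
      eq′ u v = ≡.trans (cong (_∸ isIndet i j u v) (≡.trans (eq u v) (arcCount-↭ p u v)))
                        (ℕ.m+n∸m≡n (isIndet i j u v) _)

    derives-arcCount-positive : ∀ A {e} → (∀ i j → e i j ≡ arcCount A i j) → 1 ℕ.≤ derives A isZero e
    derives-arcCount-positive []            {e} eq = ℕ.≤-reflexive (≡.sym (ℕΣ.𝟙-yes (zero? e) eq))
    derives-arcCount-positive ((i , j) ∷ A) {e} eq = ℕ.*-mono-≤ {1} {e i j} {1}
      (ℕ.≤-trans (ℕ.≤-trans (ℕ.≤-reflexive (≡.sym (≡.trans (isIndet≡ i j i j) (ℕΣ.𝟙-yes ((i , j) ≟ᵃ (i , j)) ≡.refl))))
                            (ℕ.m≤m+n _ _)) (ℕ.≤-reflexive (≡.sym (eq i j))))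
      (derives-arcCount-positive A λ u v → ≡.trans (cong (_∸ isIndet i j u v) (eq u v)) (ℕ.m+n∸m≡n (isIndet i j u v) _))

    derives-mapArc : (π : Permutation′ n) → ∀ B {e e′} → (∀ i j → e′ (π ⟨$⟩ʳ i) (π ⟨$⟩ʳ j) ≡ e i j) →
      derives (map (mapArc (π ⟨$⟩ʳ_)) B) isZero e′ ≡ derives B isZero e
    derives-mapArc π []            {e} {e′} eq = ℕΣ.𝟙-⇔ (zero? e′) (zero? e)
      (λ z i j → ≡.trans (≡.sym (eq i j)) (z _ _))
      (λ z i j → ≡.trans (≡.sym (cong₂ e′ (inverseʳ π) (inverseʳ π))) (≡.trans (eq _ _) (z _ _)))
    derives-mapArc π ((i , j) ∷ B) eq = cong₂ ℕ._*_ (eq i j)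
      (derives-mapArc π B λ x y → cong₂ _∸_ (eq x y) (isIndet-mapArc π i j x y))

    arcCount-mapArc : (π : Permutation′ n) → ∀ A i j →
      arcCount (map (mapArc (π ⟨$⟩ʳ_)) A) (π ⟨$⟩ʳ i) (π ⟨$⟩ʳ j) ≡ arcCount A i j
    arcCount-mapArc π []            i j = ≡.refl
    arcCount-mapArc π ((x , y) ∷ A) i j = cong₂ ℕ._+_ (isIndet-mapArc π x y i j) (arcCount-mapArc π A i j)

    ⅀-walks-mapArc : (π : Permutation′ n) → ∀ N i j (f : List (Arc n) → Carrier) →
      ⅀ (walks N (π ⟨$⟩ʳ i) (π ⟨$⟩ʳ j)) f ≈ ⅀ (walks N i j) (f ∘ map (mapArc (π ⟨$⟩ʳ_)))
    ⅀-walks-mapArc π zero i j f with i Fin.≟ j | π ⟨$⟩ʳ i Fin.≟ π ⟨$⟩ʳ j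
    ... | yes _      | yes _ = R.refl
    ... | no _       | no _  = R.refl
    ... | yes ≡.refl | no ne = contradiction ≡.refl ne
    ... | no ne      | yes e = contradiction (perm-injective π e) ne
    ⅀-walks-mapArc π (suc N) i j f = begin
      ⅀ (walks (suc N) (πʳ i) (πʳ j)) f
        ≈⟨ expand (πʳ i) (πʳ j) f ⟩
      ⅀ (allFin n) (λ l → ⅀ (walks N l (πʳ j)) (λ A → f ((πʳ i , l) ∷ A)))
        ≈⟨ ⅀-permute π _ ⟨
      ⅀ (allFin n) (λ l → ⅀ (walks N (πʳ l) (πʳ j)) (λ A → f ((πʳ i , πʳ l) ∷ A)))
        ≈⟨ ⅀-cong (allFin n) (λ l → ⅀-walks-mapArc π N l j (λ A → f ((πʳ i , πʳ l) ∷ A))) ⟩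
      ⅀ (allFin n) (λ l → ⅀ (walks N l j) (λ A → f (map (mapArc πʳ) ((i , l) ∷ A))))
        ≈⟨ expand i j (f ∘ map (mapArc πʳ)) ⟨
      ⅀ (walks (suc N) i j) (f ∘ map (mapArc πʳ)) ∎
      where
      πʳ = π ⟨$⟩ʳ_
      expand : ∀ i j (f : List (Arc n) → Carrier) →
        ⅀ (walks (suc N) i j) f ≈ ⅀ (allFin n) (λ l → ⅀ (walks N l j) (λ A → f ((i , l) ∷ A)))
      expand i j f = R.trans (⅀-concatMap (λ l → map ((i , l) ∷_) (walks N l j)) (allFin n) f)
        (⅀-cong (allFin n) λ l → R.reflexive (⅀-map ((i , l) ∷_) (walks N l j) f))

    ⅀-closedWalks-mapArc : (π : Permutation′ n) → ∀ N (f : List (Arc n) → Carrier) →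
      ⅀ (closedWalks N) f ≈ ⅀ (closedWalks N) (f ∘ map (mapArc (π ⟨$⟩ʳ_)))
    ⅀-closedWalks-mapArc π N f = R.trans (⅀-concatMap (λ i → walks N i i) (allFin n) f)
      (R.trans (R.sym (⅀-permute π _))
        (R.trans (⅀-cong (allFin n) (λ i → ⅀-walks-mapArc π N i i f))
          (R.sym (⅀-concatMap (λ i → walks N i i) (allFin n) _))))

    -- The constant term of the product of the ∂/∂a_b, b in `B`, applied to the trace of the `N`-th
    -- matrix power.
    ω : ℕ → List (Arc n) → Carrier
    ω N B = ⅀ (closedWalks N) (λ A → fromNat (derives B isZero (arcCount A)))

    ω-↭ : ∀ N {A B} → A ↭ B → ω N A ≈ ω N B
    ω-↭ N p = ⅀-cong (closedWalks {n} N) λ C → R.reflexive (cong fromNat (derives-↭ isZero-ext p (arcCount C)))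

    ω-mapArc : (π : Permutation′ n) → ∀ N B → ω N (map (mapArc (π ⟨$⟩ʳ_)) B) ≈ ω N B
    ω-mapArc π N B = R.trans (⅀-closedWalks-mapArc π N _)
      (⅀-cong (closedWalks N) λ A → R.reflexive (cong fromNat (derives-mapArc π B (arcCount-mapArc π A))))

    ω-pos : ∀ {A B i} → Walk i i A → A ↭ B → 0# < ω (length A) B
    ω-pos {A} {B} w p = ⅀-pos (λ C → fromNat-nonneg (derives B isZero (arcCount C))) (Walk⇒∈closedWalks w)
      (fromNat-pos (subst (1 ℕ.≤_) (derives-↭ isZero-ext p _) (derives-arcCount-positive A (λ _ _ → ≡.refl))))

    -- Each closed walk contributes a natural number, so it can be decided whether some contribution
    -- is nonzero, although the order of the field is not decidable.
    ω-zero⊎Eulerian : ∀ N B → ω N B ≈ 0# ⊎ (0# < ω N B × Eulerian B)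
    ω-zero⊎Eulerian N B = go (closedWalks N) (∈closedWalks⇒Walk N)
      where
      f : List (Arc n) → Carrier
      f A = fromNat (derives B isZero (arcCount A))
      go : ∀ L → (∀ {A} → A ∈ L → ∃ λ i → Walk i i A) → ⅀ L f ≈ 0# ⊎ (0# < ⅀ L f × Eulerian B)
      go []      h = inj₁ R.refl
      go (A ∷ L) h with derives B isZero (arcCount A) in eq
      ... | zero  = Sum.map (λ e → R.trans (R.+-identityˡ _) e)
                            (λ (p , E) → <-respʳ-≈ (R.sym (R.+-identityˡ _)) p , E) (go L (h ∘ there))
      ... | suc m with i , w ← h (here ≡.refl) =
        inj₂ ( pos+nonneg (0<fromNat-suc m) (nonneg-⅀ L (λ C → fromNat-nonneg (derives B isZero (arcCount C))))
             , i , A , w , derives-positive⇒↭ A B (λ _ _ → ≡.refl) (subst (1 ℕ.≤_) (≡.sym eq) (s≤s z≤n)))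

    -- With polynomials paired against functionals on monomials, every operator on `p` becomes its
    -- transpose on `h`, and formal sums of terms never have to be normalised.
    ⟪_,_⟫ : Poly n → (Monomial n → ℕ) → Carrier
    ⟪ p , h ⟫ = ⅀ p (λ (a , e) → a * fromNat (h e))

    ⟪⟫-cong : ∀ p {h h′} → h ≗ h′ → ⟪ p , h ⟫ ≈ ⟪ p , h′ ⟫
    ⟪⟫-cong p eq = ⅀-cong p λ (a , e) → R.*-congˡ (R.reflexive (cong fromNat (eq e)))

    constantTerm-⟪⟫ : ∀ p → constantTerm p ≈ ⟪ p , isZero ⟫
    constantTerm-⟪⟫ p = R.trans (⅀-filter (zero? ∘ proj₂) p proj₁)
      (⅀-cong p λ (a , e) → R.trans (R.*-comm _ a) (R.*-congˡ (R.sym (fromNat-[] (zero? e)))))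

    ⟪scale⟫ : ∀ b p h → ⟪ scale b p , h ⟫ ≈ b * ⟪ p , h ⟫
    ⟪scale⟫ b p h = R.trans (R.reflexive (⅀-map _ p _))
      (R.trans (⅀-cong p λ _ → R.*-assoc b _ _) (R.sym (⅀-*ˡ p b _)))

    ⟪∂⟫ : ∀ i j p h → ⟪ ∂ i j p , h ⟫ ≈ ⟪ p , derive (i , j) h ⟫
    ⟪∂⟫ i j p h = R.trans (R.reflexive (⅀-map _ p _)) (⅀-cong p λ (a , e) →
      R.trans (R.*-congʳ (R.*-comm _ a)) (R.trans (R.*-assoc a _ _) (R.*-congˡ (R.sym (fromNat-* (e i j) _)))))

    ⟪∂ᵥ⟫ : ∀ {r} i (γ : Vec (Fin n) r) p {h} → Extensional h →
            ⟪ ∂ᵥ i γ p , h ⟫ ≈ ⟪ p , derives (rowArcs (i ∷ γ)) h ⟫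
    ⟪∂ᵥ⟫ i []      p ext = R.refl
    ⟪∂ᵥ⟫ i (j ∷ γ) p {h} ext = begin
      ⟪ ∂ i j (∂ᵥ i γ p) , h ⟫                                  ≈⟨ ⟪∂⟫ i j (∂ᵥ i γ p) h ⟩
      ⟪ ∂ᵥ i γ p , derive (i , j) h ⟫                          ≈⟨ ⟪∂ᵥ⟫ i γ p (derive-ext (i , j) ext) ⟩
      ⟪ p , derives (rowArcs (i ∷ γ)) (derive (i , j) h) ⟫      ≈⟨ ⟪⟫-cong p (derives-inner (i , j) (rowArcs (i ∷ γ)) ext) ⟩
      ⟪ p , derives (rowArcs (i ∷ j ∷ γ)) h ⟫ ∎

    ⟪powₘ⟫ : ∀ N i j {h} → Extensional h →
              ⟪ powₘ indet N i j , h ⟫ ≈ ⅀ (walks N i j) (λ A → fromNat (h (arcCount A)))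
    ⟪powₘ⟫ zero    i j ext with i Fin.≟ j
    ... | yes _ = R.+-congʳ (R.*-identityˡ _)
    ... | no _  = R.refl
    ⟪powₘ⟫ (suc N) i j {h} ext = begin
      ⟪ powₘ indet (suc N) i j , h ⟫
        ≈⟨ ⅀-concatMap (λ l → indet i l *ₚ powₘ indet N l j) (allFin n) _ ⟩
      ⅀ (allFin n) (λ l → ⟪ indet i l *ₚ powₘ indet N l j , h ⟫)
        ≈⟨ ⅀-cong (allFin n) (λ l → R.trans (step l) (⟪powₘ⟫ N l j (λ eq → ext λ u v → cong (isIndet i l u v ℕ.+_) (eq u v)))) ⟩
      ⅀ (allFin n) (λ l → ⅀ (walks N l j) (λ A → fromNat (h (arcCount ((i , l) ∷ A)))))
        ≈⟨ ⅀-cong (allFin n) (λ l → R.reflexive (≡.sym (⅀-map ((i , l) ∷_) (walks N l j) _))) ⟩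
      ⅀ (allFin n) (λ l → ⅀ (map ((i , l) ∷_) (walks N l j)) (λ A → fromNat (h (arcCount A))))
        ≈⟨ ⅀-concatMap (λ l → map ((i , l) ∷_) (walks N l j)) (allFin n) _ ⟨
      ⅀ (walks (suc N) i j) (λ A → fromNat (h (arcCount A))) ∎
      where
      step : ∀ l → ⟪ indet i l *ₚ powₘ indet N l j , h ⟫
                 ≈ ⟪ powₘ indet N l j , (λ e → h (λ u v → isIndet i l u v ℕ.+ e u v)) ⟫
      step l = R.trans (⅀-cartesianProductWith (λ (a , e) (b , f) → a * b , λ u v → e u v ℕ.+ f u v) (indet i l) (powₘ indet N l j) _)
        (R.trans (R.+-identityʳ _) (⅀-cong (powₘ indet N l j) λ _ → R.*-congʳ (R.*-identityˡ _)))

    ⟪tr⟫ : ∀ N {h} → Extensional h →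
            ⟪ tr (powₘ indet N) , h ⟫ ≈ ⅀ (closedWalks N) (λ A → fromNat (h (arcCount A)))
    ⟪tr⟫ N ext = R.trans (⅀-concatMap (λ i → powₘ indet N i i) (allFin n) _)
      (R.trans (⅀-cong (allFin n) λ i → ⟪powₘ⟫ N i i ext)
        (R.sym (⅀-concatMap (λ i → walks N i i) (allFin n) _)))

-- The trace as a weighted sum over tuples of rows

-- The uniformity is k + 1.
module ConfigurationSums {c ℓ₁ ℓ₂} (K : OrderedField c ℓ₁ ℓ₂) {n k : ℕ} where

  open OrderedFields K
  open Tensors K
  open TraceFormula K
  open import Relation.Binary.Reasoning.Setoid R.setoid using (begin_; _∎; step-≈-⟩; step-≈-⟨)
  open import Algebra.Properties.CommutativeSemigroup R.*-commutativeSemigroup using ()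
    renaming (x∙yz≈y∙xz to *-leftComm)

  Row : Set
  Row = Vec (Fin n) (suc k)

  Config : ℕ → Set
  Config = Vec Row

  configs : ∀ d → List (Config d)
  configs = vectors (vectors (allFin n) (suc k))

  mapConfig : ∀ {d} → (Fin n → Fin n) → Config d → Config d
  mapConfig f = Vec.map (Vec.map f)

  private
    Γ = vectors (allFin n) k

    rc : ℕ → Carrier
    rc m = recip ((m ℕ.* k) !) {{(m ℕ.* k) ℕ.!≢0}}

    _≟ᵗ_ : (u v : Vec ℕ n) → Dec (u ≡ v)
    _≟ᵗ_ = Vec.≡-dec ℕ._≟_

  multiplicity : ℕ → Vec ℕ n → ℕ
  multiplicity d ds = Σℕ (vectors (allFin n) d) (λ r → [ tally r ≟ᵗ ds ]ℕ)

  -- The denominators of the trace formula, shared equally among all the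
  -- orderings r of the roots that have the same tally.
  rootWeight : ℕ → Vec ℕ n → Carrier
  rootWeight d ds = ∏ (allFin n) (λ i → rc (lookup ds i)) * recip₊ (multiplicity d ds ∸ 1)

  -- Independent of the tensor, whose entries are all collected in `entryProduct`.
  weight : ∀ {d} → Config d → Carrier
  weight {d} s = rootWeight d (tally (Vec.map Vec.head s)) * ω (d ℕ.* k) (arcs s)

  rootWeight-pos : ∀ d ds → 0# < rootWeight d ds
  rootWeight-pos d ds = *-pos (∏-pos (allFin n) (λ i → recip-pos ((lookup ds i ℕ.* k) !) {{(lookup ds i ℕ.* k) ℕ.!≢0}})) (recip₊-pos (multiplicity d ds ∸ 1))

  weight-zero⊎Eulerian : ∀ {d} (s : Config d) → weight s ≈ 0# ⊎ (0# < weight s × Eulerian (arcs s))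
  weight-zero⊎Eulerian {d} s with ω-zero⊎Eulerian (d ℕ.* k) (arcs s)
  ... | inj₁ ω≈0       = inj₁ (R.trans (R.*-congˡ ω≈0) (R.zeroʳ _))
  ... | inj₂ (0<ω , E) = inj₂ (*-pos (rootWeight-pos d _) 0<ω , E)

  weight-nonneg : ∀ {d} (s : Config d) → Nonneg (weight s)
  weight-nonneg s = Sum.map₂ proj₁ (weight-zero⊎Eulerian s)

  length-arcs : ∀ {d} (s : Config d) → length (arcs s) ≡ d ℕ.* k
  length-arcs []            = ≡.refl
  length-arcs ((i ∷ γ) ∷ s) = ≡.trans (List.length-++ (rowArcs (i ∷ γ)))
    (cong₂ ℕ._+_ (≡.trans (List.length-map (i ,_) (toList γ)) (Vec.length-toList γ)) (length-arcs s))

  weight-pos : ∀ {d} (s : Config d) → Eulerian (arcs s) → 0# < weight s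
  weight-pos {d} s (i , A , w , p) = *-pos (rootWeight-pos d _)
    (subst (λ N → 0# < ω N (arcs s)) (≡.trans (↭.↭-length p) (length-arcs s)) (ω-pos w p))

  multiplicity-map : (π : Permutation′ n) → ∀ {d} (r : Vec (Fin n) d) →
    multiplicity d (tally (Vec.map (π ⟨$⟩ʳ_) r)) ≡ multiplicity d (tally r)
  multiplicity-map π {d} r = ≡.trans
    (≡.sym (ℕΣ.⅀-vectors-map (π ⟨$⟩ʳ_) (allFin n) (λ f → ℕΣ.⅀-permute π f) d
      (λ r′ → [ tally r′ ≟ᵗ tally (Vec.map (π ⟨$⟩ʳ_) r) ]ℕ)))
    (ℕΣ.⅀-cong (vectors (allFin n) d) λ r′ →
      ℕΣ.𝟙-⇔ (tally (Vec.map (π ⟨$⟩ʳ_) r′) ≟ᵗ tally (Vec.map (π ⟨$⟩ʳ_) r)) (tally r′ ≟ᵗ tally r)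
        (tally-map-≡ π r′ r) (tally-map-cong π r′ r))

  rootWeight-map : (π : Permutation′ n) → ∀ {d} (r : Vec (Fin n) d) →
    rootWeight d (tally (Vec.map (π ⟨$⟩ʳ_) r)) ≈ rootWeight d (tally r)
  rootWeight-map π {d} r = R.*-cong
    (R.trans (R.sym (∏-↭ _ (map-permute-allFin π)))
      (R.trans (R.reflexive (∏-map (π ⟨$⟩ʳ_) (allFin n) (λ i → rc (lookup (tally (Vec.map (π ⟨$⟩ʳ_) r)) i))))
        (∏-cong (allFin n) λ i → R.reflexive (cong rc (tally-map π r i)))))
    (R.reflexive (cong (λ N → recip₊ (N ∸ 1)) (multiplicity-map π r)))

  -- A permutation of the vertices permutes the tally of the roots, preserves its multiplicity and
  -- carries closed walks to closed walks.
  weight-map : (π : Permutation′ n) → ∀ {d} (s : Config d) → weight (mapConfig (π ⟨$⟩ʳ_) s) ≈ weight s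
  weight-map π {d} s = R.*-cong
    (R.trans (R.reflexive (cong (rootWeight d ∘ tally) heads)) (rootWeight-map π (Vec.map Vec.head s)))
    (R.trans (R.reflexive (cong (ω (d ℕ.* k)) (arcs-map (π ⟨$⟩ʳ_) s))) (ω-mapArc π (d ℕ.* k) (arcs s)))
    where
    heads : Vec.map Vec.head (mapConfig (π ⟨$⟩ʳ_) s) ≡ Vec.map (π ⟨$⟩ʳ_) (Vec.map Vec.head s)
    heads = ≡.trans (≡.sym (Vec.map-∘ _ _ s)) (≡.trans (Vec.map-cong (λ { (i ∷ γ) → ≡.refl }) s) (Vec.map-∘ _ _ s))

  ⅀-configs-map : (π : Permutation′ n) → ∀ {d} (f : Config d → Carrier) →
    ⅀ (configs d) (f ∘ mapConfig (π ⟨$⟩ʳ_)) ≈ ⅀ (configs d) f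
  ⅀-configs-map π {d} = ⅀-vectors-map (Vec.map (π ⟨$⟩ʳ_)) _
    (⅀-vectors-map (π ⟨$⟩ʳ_) (allFin n) (⅀-permute π) (suc k)) d

  module _ (T : Tensor (suc k) n) where

    entryProduct : ∀ {d} → Config d → Carrier
    entryProduct []            = 1#
    entryProduct ((i ∷ γ) ∷ s) = T i γ * entryProduct s

    -- The row operators at the given roots, multiplied out: the arcs of the chosen rows are
    -- collected, and `κ` is what is finally evaluated on them.
    Ω : List (Fin n) → (List (Arc n) → Carrier) → Carrier
    Ω []       κ = κ []
    Ω (i ∷ rs) κ = ⅀ Γ (λ γ → T i γ * Ω rs (λ B → κ (rowArcs (i ∷ γ) ++ B)))

    Ω-cong : ∀ rs {κ κ′} → (∀ B → κ B ≈ κ′ B) → Ω rs κ ≈ Ω rs κ′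
    Ω-cong []       eq = eq []
    Ω-cong (i ∷ rs) eq = ⅀-cong Γ λ γ → R.*-congˡ (Ω-cong rs (λ B → eq _))

    Ω-⅀ : ∀ {x} {X : Set x} rs (xs : List X) (a : X → Carrier) (f : X → List (Arc n) → Carrier) →
      Ω rs (λ B → ⅀ xs (λ x → a x * f x B)) ≈ ⅀ xs (λ x → a x * Ω rs (f x))
    Ω-⅀ []       xs a f = R.refl
    Ω-⅀ (i ∷ rs) xs a f = begin
      ⅀ Γ (λ γ → T i γ * Ω rs (λ B → ⅀ xs (λ x → a x * f x (rowArcs (i ∷ γ) ++ B))))
        ≈⟨ ⅀-cong Γ (λ γ → R.*-congˡ (Ω-⅀ rs xs a (λ x B → f x (rowArcs (i ∷ γ) ++ B)))) ⟩
      ⅀ Γ (λ γ → T i γ * ⅀ xs (λ x → a x * Ω rs (λ B → f x (rowArcs (i ∷ γ) ++ B))))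
        ≈⟨ ⅀-cong Γ (λ γ → ⅀-*ˡ xs (T i γ) _) ⟩
      ⅀ Γ (λ γ → ⅀ xs (λ x → T i γ * (a x * Ω rs (λ B → f x (rowArcs (i ∷ γ) ++ B)))))
        ≈⟨ ⅀-swap Γ xs _ ⟩
      ⅀ xs (λ x → ⅀ Γ (λ γ → T i γ * (a x * Ω rs (λ B → f x (rowArcs (i ∷ γ) ++ B)))))
        ≈⟨ ⅀-cong xs (λ x → ⅀-cong Γ (λ γ → *-leftComm (T i γ) (a x) _)) ⟩
      ⅀ xs (λ x → ⅀ Γ (λ γ → a x * (T i γ * Ω rs (λ B → f x (rowArcs (i ∷ γ) ++ B)))))
        ≈⟨ ⅀-cong xs (λ x → ⅀-*ˡ Γ (a x) _) ⟨
      ⅀ xs (λ x → a x * Ω (i ∷ rs) (f x)) ∎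

    Ω-* : ∀ rs b κ → Ω rs (λ B → b * κ B) ≈ b * Ω rs κ
    Ω-* []       b κ = R.refl
    Ω-* (i ∷ rs) b κ = R.trans
      (⅀-cong Γ λ γ → R.trans (R.*-congˡ (Ω-* rs b _)) (*-leftComm (T i γ) b _)) (R.sym (⅀-*ˡ Γ b _))

    Ω-++ : ∀ xs ys κ → Ω (xs ++ ys) κ ≈ Ω xs (λ B → Ω ys (λ B′ → κ (B ++ B′)))
    Ω-++ []       ys κ = R.refl
    Ω-++ (i ∷ xs) ys κ = ⅀-cong Γ λ γ → R.*-congˡ (R.trans (Ω-++ xs ys _)
      (Ω-cong xs λ B → Ω-cong ys λ B′ → R.reflexive (cong κ (≡.sym (List.++-assoc (rowArcs (i ∷ γ)) B B′)))))

    -- Exchanging two neighbouring roots exchanges two sums, and `κ` does not see the order of the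
    -- arcs.
    Ω-↭ : ∀ {xs ys κ} → (∀ {A B} → A ↭ B → κ A ≈ κ B) → xs ↭ ys → Ω xs κ ≈ Ω ys κ
    Ω-↭ inv ↭.refl        = R.refl
    Ω-↭ inv (prep i p)    = ⅀-cong Γ λ γ → R.*-congˡ (Ω-↭ (inv ∘ ↭.++⁺ˡ (rowArcs (i ∷ γ))) p)
    Ω-↭ {i ∷ j ∷ xs} {_ ∷ _ ∷ ys} {κ} inv (swap i j p) = begin
      ⅀ Γ (λ γ → T i γ * ⅀ Γ (λ δ → T j δ * X xs i j γ δ))
        ≈⟨ ⅀-cong Γ (λ γ → ⅀-*ˡ Γ (T i γ) _) ⟩
      ⅀ Γ (λ γ → ⅀ Γ (λ δ → T i γ * (T j δ * X xs i j γ δ)))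
        ≈⟨ ⅀-swap Γ Γ _ ⟩
      ⅀ Γ (λ δ → ⅀ Γ (λ γ → T i γ * (T j δ * X xs i j γ δ)))
        ≈⟨ ⅀-cong Γ (λ δ → ⅀-cong Γ (λ γ → R.trans (*-leftComm (T i γ) (T j δ) _) (R.*-congˡ (R.*-congˡ (exchange γ δ))))) ⟩
      ⅀ Γ (λ δ → ⅀ Γ (λ γ → T j δ * (T i γ * X ys j i δ γ)))
        ≈⟨ ⅀-cong Γ (λ δ → ⅀-*ˡ Γ (T j δ) _) ⟨
      ⅀ Γ (λ δ → T j δ * ⅀ Γ (λ γ → T i γ * X ys j i δ γ)) ∎
      where
      X : List (Fin n) → Fin n → Fin n → Vec (Fin n) k → Vec (Fin n) k → Carrier
      X zs i j γ δ = Ω zs (λ B → κ (rowArcs (i ∷ γ) ++ (rowArcs (j ∷ δ) ++ B)))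
      exchange : ∀ γ δ → X xs i j γ δ ≈ X ys j i δ γ
      exchange γ δ = R.trans
        (Ω-cong xs λ B → inv (↭.shifts (rowArcs (i ∷ γ)) (rowArcs (j ∷ δ))))
        (Ω-↭ (inv ∘ ↭.++⁺ˡ (rowArcs (j ∷ δ)) ∘ ↭.++⁺ˡ (rowArcs (i ∷ γ))) p)
    Ω-↭ inv (↭.trans p q) = R.trans (Ω-↭ inv p) (Ω-↭ inv q)

    ⟪rowOperator⟫ : ∀ i q {h} → Extensional h →
      ⟪ rowOperator (suc k) T i q , h ⟫ ≈ ⅀ Γ (λ γ → T i γ * ⟪ q , derives (rowArcs (i ∷ γ)) h ⟫)
    ⟪rowOperator⟫ i q {h} ext = R.trans (⅀-concatMap (λ γ → scale (T i γ) (∂ᵥ i γ q)) Γ _)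
      (⅀-cong Γ λ γ → R.trans (⟪scale⟫ (T i γ) (∂ᵥ i γ q) h) (R.*-congˡ (⟪∂ᵥ⟫ i γ q ext)))

    ⟪iterate⟫ : ∀ m i q {h} → Extensional h →
      ⟪ iterate (rowOperator (suc k) T i) q m , h ⟫ ≈ Ω (replicate m i) (λ B → ⟪ q , derives B h ⟫)
    ⟪iterate⟫ zero    i q ext = R.refl
    ⟪iterate⟫ (suc m) i q {h} ext = begin
      ⟪ iterate (rowOperator (suc k) T i) (rowOperator (suc k) T i q) m , h ⟫
        ≈⟨ ⟪iterate⟫ m i (rowOperator (suc k) T i q) ext ⟩
      Ω (replicate m i) (λ B → ⟪ rowOperator (suc k) T i q , derives B h ⟫)
        ≈⟨ Ω-cong (replicate m i) (λ B → ⟪rowOperator⟫ i q (derives-ext B ext)) ⟩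
      Ω (replicate m i) (λ B → ⅀ Γ (λ γ → T i γ * ⟪ q , derives (rowArcs (i ∷ γ)) (derives B h) ⟫))
        ≈⟨ Ω-⅀ (replicate m i) Γ (T i) (λ γ B → ⟪ q , derives (rowArcs (i ∷ γ)) (derives B h) ⟫) ⟩
      ⅀ Γ (λ γ → T i γ * Ω (replicate m i) (λ B → ⟪ q , derives (rowArcs (i ∷ γ)) (derives B h) ⟫))
        ≈⟨ ⅀-cong Γ (λ γ → R.*-congˡ (Ω-cong (replicate m i) λ B → ⟪⟫-cong q (derives-++ (rowArcs (i ∷ γ)) B))) ⟩
      Ω (replicate (suc m) i) (λ B → ⟪ q , derives B h ⟫) ∎

    private
      opStep : Vec ℕ n → Fin n → Poly n → Poly n
      opStep ds i q = scale (rc (lookup ds i)) (iterate (rowOperator (suc k) T i) q (lookup ds i))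

      roots : Vec ℕ n → List (Fin n) → List (Fin n)
      roots ds = concatMap (λ i → replicate (lookup ds i) i)

    ⟪foldr⟫ : ∀ ds p is {h} → Extensional h → ⟪ foldr (opStep ds) p is , h ⟫ ≈
      ∏ is (λ i → rc (lookup ds i)) * Ω (roots ds is) (λ B → ⟪ p , derives B h ⟫)
    ⟪foldr⟫ ds p []       ext = R.sym (R.*-identityˡ _)
    ⟪foldr⟫ ds p (i ∷ is) {h} ext = begin
      ⟪ foldr (opStep ds) p (i ∷ is) , h ⟫
        ≈⟨ ⟪scale⟫ (rc (lookup ds i)) (iterate (rowOperator (suc k) T i) q (lookup ds i)) h ⟩
      rc (lookup ds i) * ⟪ iterate (rowOperator (suc k) T i) q (lookup ds i) , h ⟫
        ≈⟨ R.*-congˡ (⟪iterate⟫ (lookup ds i) i q ext) ⟩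
      rc (lookup ds i) * Ω reps (λ B → ⟪ q , derives B h ⟫)
        ≈⟨ R.*-congˡ (Ω-cong reps λ B → ⟪foldr⟫ ds p is (derives-ext B ext)) ⟩
      rc (lookup ds i) * Ω reps (λ B → P * Ω (roots ds is) (λ B′ → ⟪ p , derives B′ (derives B h) ⟫))
        ≈⟨ R.*-congˡ (Ω-* reps P _) ⟩
      rc (lookup ds i) * (P * Ω reps (λ B → Ω (roots ds is) (λ B′ → ⟪ p , derives B′ (derives B h) ⟫)))
        ≈⟨ R.*-assoc _ P _ ⟨
      rc (lookup ds i) * P * Ω reps (λ B → Ω (roots ds is) (λ B′ → ⟪ p , derives B′ (derives B h) ⟫))
        ≈⟨ R.*-congˡ (Ω-cong reps λ B → Ω-cong (roots ds is) λ B′ → ⟪⟫-cong p λ e →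
             ≡.trans (derives-++ B′ B e) (derives-↭ ext (↭.++-comm B′ B) e)) ⟩
      rc (lookup ds i) * P * Ω reps (λ B → Ω (roots ds is) (λ B′ → ⟪ p , derives (B ++ B′) h ⟫))
        ≈⟨ R.*-congˡ (Ω-++ reps (roots ds is) _) ⟨
      rc (lookup ds i) * P * Ω (reps ++ roots ds is) (λ B → ⟪ p , derives B h ⟫) ∎
      where
      q    = foldr (opStep ds) p is
      P    = ∏ is (λ j → rc (lookup ds j))
      reps = replicate (lookup ds i) i

    constantTerm-operator : ∀ N ds → constantTerm (operator (suc k) T ds (tr (powₘ indet N))) ≈
      ∏ (allFin n) (λ i → rc (lookup ds i)) * Ω (rootsOf ds) (ω N)
    constantTerm-operator N ds = R.trans
      (constantTerm-⟪⟫ (operator (suc k) T ds (tr (powₘ indet N))))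
      (R.trans (⟪foldr⟫ ds (tr (powₘ indet N)) (allFin n) isZero-ext)
        (R.*-congˡ (Ω-cong (rootsOf ds) λ B → ⟪tr⟫ N (derives-ext B isZero-ext))))

    -- The sorted roots are replaced by the average over all orderings with the same tally. In this
    -- way the sum over weak compositions becomes a sum over all tuples of rows, which is symmetric
    -- under permutations of the vertices.
    Ω-spread : ∀ d N ds → Vec.sum ds ≡ d → Ω (rootsOf ds) (ω N) ≈
      recip₊ (multiplicity d ds ∸ 1) * ⅀ (vectors (allFin n) d) (λ r → 𝟙 (tally r ≟ᵗ ds) * Ω (toList r) (ω N))
    Ω-spread d N ds sum≡d = R.sym (begin
      recip₊ (M ∸ 1) * ⅀ rs (λ r → 𝟙 (tally r ≟ᵗ ds) * Ω (toList r) (ω N))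
        ≈⟨ R.*-congˡ (⅀-cong rs same) ⟩
      recip₊ (M ∸ 1) * ⅀ rs (λ r → 𝟙 (tally r ≟ᵗ ds) * Ω (rootsOf ds) (ω N))
        ≈⟨ R.*-congˡ (⅀-*ʳ rs _ _) ⟨
      recip₊ (M ∸ 1) * (⅀ rs (λ r → 𝟙 (tally r ≟ᵗ ds)) * Ω (rootsOf ds) (ω N))
        ≈⟨ R.*-assoc _ _ _ ⟨
      recip₊ (M ∸ 1) * ⅀ rs (λ r → 𝟙 (tally r ≟ᵗ ds)) * Ω (rootsOf ds) (ω N)
        ≈⟨ R.*-congʳ cancel ⟩
      1# * Ω (rootsOf ds) (ω N) ≈⟨ R.*-identityˡ _ ⟩
      Ω (rootsOf ds) (ω N) ∎)
      where
      rs = vectors (allFin n) d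
      M  = multiplicity d ds
      same : ∀ r → 𝟙 (tally r ≟ᵗ ds) * Ω (toList r) (ω N) ≈ 𝟙 (tally r ≟ᵗ ds) * Ω (rootsOf ds) (ω N)
      same r with tally r ≟ᵗ ds
      ... | yes e = R.*-congˡ (R.trans (Ω-↭ (ω-↭ N) (tally⇒↭ r)) (R.reflexive (cong (λ v → Ω (rootsOf v) (ω N)) e)))
      ... | no _       = R.trans (R.zeroˡ _) (R.sym (R.zeroˡ _))
      M≥1 : 1 ℕ.≤ M
      M≥1 with r , e ← tally-surjective ds sum≡d = ℕ.≤-trans
        (ℕ.≤-reflexive (≡.sym (ℕΣ.𝟙-yes (tally r ≟ᵗ ds) e)))
        (Σℕ-≥ (λ r → [ tally r ≟ᵗ ds ]ℕ) (∈-vectors r (λ i → ∈-allFin _)))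
      cancel : recip₊ (M ∸ 1) * ⅀ rs (λ r → 𝟙 (tally r ≟ᵗ ds)) ≈ 1#
      cancel = R.trans (R.*-comm _ _) (R.trans (R.*-congʳ (R.trans
        (⅀-cong rs λ r → R.sym (fromNat-[] (tally r ≟ᵗ ds)))
        (R.trans (R.sym (fromNat-Σ rs (λ r → [ tally r ≟ᵗ ds ]ℕ)))
          (R.reflexive (cong fromNat (≡.sym (ℕ.m+[n∸m]≡n M≥1)))))))
        (recip-inverse (M ∸ 1)))

    ⅀-roots-configs : ∀ d (f : Vec (Fin n) d → Carrier) κ →
      ⅀ (vectors (allFin n) d) (λ r → f r * Ω (toList r) κ) ≈
      ⅀ (configs d) (λ s → f (Vec.map Vec.head s) * (entryProduct s * κ (arcs s)))
    ⅀-roots-configs zero    f κ = R.+-congʳ (R.*-congˡ (R.sym (R.*-identityˡ _)))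
    ⅀-roots-configs (suc d) f κ = begin
      ⅀ (vectors (allFin n) (suc d)) (λ r → f r * Ω (toList r) κ)
        ≈⟨ ⅀-vectors (allFin n) d _ ⟩
      ⅀ (allFin n) (λ i → ⅀ rs (λ r → f (i ∷ r) * ⅀ Γ (λ γ → T i γ * Y i γ r)))
        ≈⟨ ⅀-cong (allFin n) (λ i → step i) ⟩
      ⅀ (allFin n) (λ i → ⅀ Γ (λ γ → ⅀ (configs d) (λ s → g ((i ∷ γ) ∷ s))))
        ≈⟨ ⅀-vectors (allFin n) k _ ⟨
      ⅀ (vectors (allFin n) (suc k)) (λ ρ → ⅀ (configs d) (λ s → g (ρ ∷ s)))
        ≈⟨ ⅀-vectors (vectors (allFin n) (suc k)) d g ⟨
      ⅀ (configs (suc d)) g ∎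
      where
      rs = vectors (allFin n) d
      Y : Fin n → Vec (Fin n) k → Vec (Fin n) d → Carrier
      Y i γ r = Ω (toList r) (λ B → κ (rowArcs (i ∷ γ) ++ B))
      g : Config (suc d) → Carrier
      g s = f (Vec.map Vec.head s) * (entryProduct s * κ (arcs s))
      step : ∀ i → ⅀ rs (λ r → f (i ∷ r) * ⅀ Γ (λ γ → T i γ * Y i γ r)) ≈
                   ⅀ Γ (λ γ → ⅀ (configs d) (λ s → g ((i ∷ γ) ∷ s)))
      step i = begin
        ⅀ rs (λ r → f (i ∷ r) * ⅀ Γ (λ γ → T i γ * Y i γ r))
          ≈⟨ ⅀-cong rs (λ r → R.trans (⅀-*ˡ Γ _ _) (⅀-cong Γ λ γ → *-leftComm _ (T i γ) _)) ⟩
        ⅀ rs (λ r → ⅀ Γ (λ γ → T i γ * (f (i ∷ r) * Y i γ r)))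
          ≈⟨ ⅀-swap rs Γ _ ⟩
        ⅀ Γ (λ γ → ⅀ rs (λ r → T i γ * (f (i ∷ r) * Y i γ r)))
          ≈⟨ ⅀-cong Γ (λ γ → R.trans (R.sym (⅀-*ˡ rs (T i γ) _)) (R.*-congˡ (⅀-roots-configs d (λ r → f (i ∷ r)) _))) ⟩
        ⅀ Γ (λ γ → T i γ * ⅀ (configs d) (λ s → f (i ∷ Vec.map Vec.head s) * (entryProduct s * κ (rowArcs (i ∷ γ) ++ arcs s))))
          ≈⟨ ⅀-cong Γ (λ γ → R.trans (⅀-*ˡ (configs d) (T i γ) _) (⅀-cong (configs d) λ s →
               R.trans (*-leftComm (T i γ) _ _) (R.*-congˡ (R.sym (R.*-assoc (T i γ) _ _))))) ⟩
        ⅀ Γ (λ γ → ⅀ (configs d) (λ s → g ((i ∷ γ) ∷ s))) ∎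

    Tr-configs : ∀ d → Tr (suc k) T (suc d) ≈
      fromNat (k ^ (n ∸ 1)) * ⅀ (configs (suc d)) (λ s → weight s * entryProduct s)
    Tr-configs d′ = R.*-congˡ (begin
      ⅀ wc (λ ds → constantTerm (operator (suc k) T ds (tr (powₘ indet N))))
        ≈⟨ ⅀-cong∈ wc (λ {ds} ds∈ → R.trans (constantTerm-operator N ds)
             (R.*-congˡ (Ω-spread d N ds (proj₂ (∈-filter⁻ (λ ds → Vec.sum ds ℕ.≟ d) {xs = vectors (List.upTo (suc d)) n} ds∈))))) ⟩
      ⅀ wc (λ ds → P ds * (recip₊ (multiplicity d ds ∸ 1) * ⅀ rs (λ r → 𝟙 (tally r ≟ᵗ ds) * Ω (toList r) (ω N))))
        ≈⟨ ⅀-cong wc (λ ds → R.trans (R.sym (R.*-assoc _ _ _)) (⅀-*ˡ rs (rootWeight d ds) _)) ⟩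
      ⅀ wc (λ ds → ⅀ rs (λ r → rootWeight d ds * (𝟙 (tally r ≟ᵗ ds) * Ω (toList r) (ω N))))
        ≈⟨ ⅀-swap wc rs _ ⟩
      ⅀ rs (λ r → ⅀ wc (λ ds → rootWeight d ds * (𝟙 (tally r ≟ᵗ ds) * Ω (toList r) (ω N))))
        ≈⟨ ⅀-cong rs pick ⟩
      ⅀ rs (λ r → rootWeight d (tally r) * Ω (toList r) (ω N))
        ≈⟨ ⅀-roots-configs d (λ r → rootWeight d (tally r)) (ω N) ⟩
      ⅀ (configs d) (λ s → rootWeight d (tally (Vec.map Vec.head s)) * (entryProduct s * ω N (arcs s)))
        ≈⟨ ⅀-cong (configs d) (λ s → R.trans (R.*-congˡ (R.*-comm _ _)) (R.sym (R.*-assoc _ _ _))) ⟩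
      ⅀ (configs d) (λ s → weight s * entryProduct s) ∎)
      where
      d  = suc d′
      N  = d ℕ.* k
      wc = weakCompositions n d
      rs = vectors (allFin n) d
      P : Vec ℕ n → Carrier
      P ds = ∏ (allFin n) (λ i → rc (lookup ds i))
      pick : ∀ r → ⅀ wc (λ ds → rootWeight d ds * (𝟙 (tally r ≟ᵗ ds) * Ω (toList r) (ω N))) ≈
                   rootWeight d (tally r) * Ω (toList r) (ω N)
      pick r = R.trans
        (⅀-single {xs = wc} {tally r} _ (unique-weakCompositions n d) (∈-weakCompositions (tally r) (sum-tally r))
          (λ {ds} _ ne → R.trans (R.*-congˡ (R.trans (R.*-congʳ (𝟙-no (tally r ≟ᵗ ds) (ne ∘ ≡.sym))) (R.zeroˡ _))) (R.zeroʳ _)))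
        (R.*-congˡ (R.trans (R.*-congʳ (𝟙-yes (tally r ≟ᵗ tally r) ≡.refl)) (R.*-identityˡ _)))

-- Forests: a balanced family of rooted edges repeats each edge

module Balance where

  open ≡ using (refl; sym; trans)

  Σℕ-≤-tight : ∀ {a} {A : Set a} (xs : List A) {f g : A → ℕ} → (∀ {x} → x ∈ xs → f x ℕ.≤ g x) →
    Σℕ xs f ≡ Σℕ xs g → ∀ {x} → x ∈ xs → f x ≡ g x
  Σℕ-≤-tight (y ∷ xs) {f} {g} le eq = go
    where
    le′ : Σℕ xs f ℕ.≤ Σℕ xs g
    le′ = Σℕ-mono xs (le ∘ there)
    head≡ : f y ≡ g y
    head≡ = ℕ.≤-antisym (le (here refl)) (ℕ.+-cancelʳ-≤ (Σℕ xs f) (g y) (f y)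
      (ℕ.≤-trans (ℕ.+-monoʳ-≤ (g y) le′) (ℕ.≤-reflexive (sym eq))))
    go : ∀ {x} → x ∈ y ∷ xs → f x ≡ g x
    go (here refl) = head≡
    go (there x∈)  = Σℕ-≤-tight xs (le ∘ there)
      (ℕ.+-cancelˡ-≡ (f y) _ _ (trans eq (cong (ℕ._+ Σℕ xs g) (sym head≡)))) x∈

  Σℕ-≡-at : ∀ {n} (w : Fin n) {f g : Fin n → ℕ} → Σℕ (allFin n) f ≡ Σℕ (allFin n) g →
    (∀ v → v ≢ w → f v ≡ g v) → f w ≡ g w
  Σℕ-≡-at {n} w {f} {g} eq h with ∈⇒↭ (∈-allFin w)
  ... | ys , p = ℕ.+-cancelʳ-≡ (Σℕ ys f) _ _ (begin
    f w ℕ.+ Σℕ ys f    ≡⟨ ℕΣ.⅀-↭ f p ⟨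
    Σℕ (allFin n) f    ≡⟨ eq ⟩
    Σℕ (allFin n) g    ≡⟨ ℕΣ.⅀-↭ g p ⟩
    g w ℕ.+ Σℕ ys g    ≡⟨ cong (g w ℕ.+_) (ℕΣ.⅀-cong∈ ys λ y∈ → h _ λ { refl → w∉ y∈ }) ⟨
    g w ℕ.+ Σℕ ys f ∎)
    where
    open ≡.≡-Reasoning
    w∉ : w ∉ ys
    w∉ = Unique.Unique[x∷xs]⇒x∉xs (unique-↭ p (Unique.allFin⁺ n))

  [_∈_]ₛ : ∀ {n} → Fin n → Subset n → ℕ
  [ v ∈ p ]ₛ = [ v Subset.∈? p ]ℕ

  ∣p∣-Σ : ∀ {n} (p : Subset n) → ∣ p ∣ ≡ Σℕ (allFin n) (λ v → [ v ∈ p ]ₛ)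
  ∣p∣-Σ []            = refl
  ∣p∣-Σ (true ∷ p)  = trans (cong suc (trans (∣p∣-Σ p) (ℕΣ.⅀-cong (allFin _) λ v →
      ℕΣ.𝟙-⇔ (v Subset.∈? p) (suc v Subset.∈? (true ∷ p)) Vec.there Subset.drop-there)))
    (sym (ℕΣ.⅀-allFin-suc (λ v → [ v ∈ true ∷ p ]ₛ)))
  ∣p∣-Σ (false ∷ p) = trans (trans (∣p∣-Σ p) (ℕΣ.⅀-cong (allFin _) λ v →
      ℕΣ.𝟙-⇔ (v Subset.∈? p) (suc v Subset.∈? (false ∷ p)) Vec.there Subset.drop-there))
    (sym (ℕΣ.⅀-allFin-suc (λ v → [ v ∈ false ∷ p ]ₛ)))

  ∈⋃⇒∈ : ∀ {n} {v : Fin n} l → v ∈ₛ ⋃ (map ⁅_⁆ l) → v ∈ l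
  ∈⋃⇒∈ []      v∈ = contradiction v∈ Subset.∉⊥
  ∈⋃⇒∈ (x ∷ l) v∈ with Subset.x∈p∪q⁻ ⁅ x ⁆ _ v∈
  ... | inj₁ v∈x = here (Subset.x∈⁅y⁆⇒x≡y x v∈x)
  ... | inj₂ v∈l = there (∈⋃⇒∈ l v∈l)

  ∈⇒∈⋃ : ∀ {n} {v : Fin n} {l} → v ∈ l → v ∈ₛ ⋃ (map ⁅_⁆ l)
  ∈⇒∈⋃ (here refl) = Subset.x∈p∪q⁺ (inj₁ (Subset.x∈⁅x⁆ _))
  ∈⇒∈⋃ (there v∈)  = Subset.x∈p∪q⁺ (inj₂ (∈⇒∈⋃ v∈))

  Σ-occ : ∀ {n} (l : List (Fin n)) → Σℕ (allFin n) (λ v → occ v l) ≡ length l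
  Σ-occ {n} l = trans (ℕΣ.⅀-swap (allFin n) l _) (trans (ℕΣ.⅀-cong l one) (trans (Σℕ-const l 1) (ℕ.*-identityʳ _)))
    where
    one : ∀ x → Σℕ (allFin n) (λ v → [ x Fin.≟ v ]ℕ) ≡ 1
    one x = trans (ℕΣ.⅀-cong (allFin n) λ i → trans (ℕΣ.𝟙-⇔ (x Fin.≟ i) (i Fin.≟ x) sym sym) (sym (ℕ.*-identityʳ _)))
                  (ℕΣ.⅀-δ x (λ _ → 1))

  -- The indicator is at most the number of occurrences at every vertex, and equal totals force
  -- equality at each of them.
  occ≡[∈⋃] : ∀ {n} (l : List (Fin n)) → ∣ ⋃ (map ⁅_⁆ l) ∣ ≡ length l → ∀ v → occ v l ≡ [ v ∈ ⋃ (map ⁅_⁆ l) ]ₛ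
  occ≡[∈⋃] {n} l eq v = sym (Σℕ-≤-tight (allFin n) (λ {x} _ → le x)
    (trans (sym (∣p∣-Σ (⋃ (map ⁅_⁆ l)))) (trans eq (sym (Σ-occ l)))) (∈-allFin v))
    where
    le : ∀ x → [ x ∈ ⋃ (map ⁅_⁆ l) ]ₛ ℕ.≤ occ x l
    le x with x Subset.∈? ⋃ (map ⁅_⁆ l)
    ... | yes x∈ = ∈⇒occ (∈⋃⇒∈ l x∈)
    ... | no _   = z≤n

  _≟ₛ_ : ∀ {n} (p q : Subset n) → Dec (p ≡ q)
  _≟ₛ_ = Vec.≡-dec Bool._≟_

  module _ {n : ℕ} where
    open Lists.Occurrences (_≟ₛ_ {n}) public using () renaming (occ to occₛ; ∈⇒occ to ∈⇒occₛ)
    open DecMembership (_≟ₛ_ {n}) public using () renaming (_∈?_ to _∈ˡ?_)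

  deg : ∀ {n} → List (Subset n) → Fin n → ℕ
  deg E v = length (filter (v Subset.∈?_) E)

  module _ {n : ℕ} where

    -- An edge is constrained only against those after it in the list, so that edges can be peeled
    -- off from the front. The vertex `w` need not lie in `e`, which admits edges that meet none of
    -- the rest.
    data Forest : List (Subset n) → Set where
      []  : Forest []
      add : ∀ {e es} (w : Fin n) → (∀ {v e′} → v ∈ₛ e → e′ ∈ es → v ∈ₛ e′ → v ≡ w) →
            Forest es → Forest (e ∷ es)

    RootedSet : Set
    RootedSet = Fin n × Subset n

    -- Indegree equals outdegree at `v`, for pairs that stand for rows: a row rooted at r on an edge
    -- of size `K` has K - 1 arcs out of r and one arc into every other vertex of the edge. Adding
    -- the number of rows rooted at `v` to both sides gives this form.
    Balanced : ℕ → List RootedSet → Set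
    Balanced K q = ∀ v → Σℕ q (λ (_ , e) → [ v ∈ e ]ₛ) ≡ K ℕ.* Σℕ q (λ (r , _) → [ r Fin.≟ v ]ℕ)

    private
      at : Subset n → RootedSet → ℕ
      at e (_ , f) = [ f ≟ₛ e ]ℕ

      away : Subset n → RootedSet → ℕ
      away e (_ , f) = [ ¬? (f ≟ₛ e) ]ℕ

      split : ∀ e q (h : RootedSet → ℕ) → Σℕ q h ≡
        Σℕ q (λ x → at e x ℕ.* h x) ℕ.+ Σℕ (filter (λ x → ¬? (proj₂ x ≟ₛ e)) q) h
      split e q h = sym (trans (cong (Σℕ q (λ x → at e x ℕ.* h x) ℕ.+_)
          (ℕΣ.⅀-filter (λ x → ¬? (proj₂ x ≟ₛ e)) q h))
        (trans (sym (ℕΣ.⅀-+ q _ _)) (ℕΣ.⅀-cong q λ x → trans (sym (ℕ.*-distribʳ-+ (h x) (at e x) (away e x)))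
          (trans (cong (ℕ._* h x) (one x)) (ℕ.+-identityʳ (h x))))))
        where
        one : ∀ x → at e x ℕ.+ away e x ≡ 1
        one (_ , f) with f ≟ₛ e
        ... | yes _ = refl
        ... | no _  = refl

    -- Peeling off an edge e that meets the others at most in w: a vertex v ≢ w of e
    -- lies in no other edge, so the balance at v reads c = K a_v with c the number
    -- of members of q on e and a_v the number of those rooted at v; since the a_v
    -- add up to c, the same holds at w.
    module Peel {e es w} (priv : ∀ {v e′} → v ∈ₛ e → e′ ∈ es → v ∈ₛ e′ → v ≡ w)
      (q : List RootedSet) (mem : ∀ {r f} → (r , f) ∈ q → r ∈ₛ f × f ∈ e ∷ es) (bal : Balanced ∣ e ∣ q) where

      open ≡.≡-Reasoning

      c : ℕ
      c = Σℕ q (at e)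

      a : Fin n → ℕ
      a v = Σℕ q (λ x → at e x ℕ.* [ proj₁ x Fin.≟ v ]ℕ)

      only-e : ∀ {v} → v ∈ₛ e → v ≢ w → ∀ {r g} → (r , g) ∈ q → v ∈ₛ g → g ≡ e
      only-e v∈e v≢w x∈ v∈g with proj₂ (mem x∈)
      ... | here g≡e = g≡e
      ... | there g∈ = contradiction (priv v∈e g∈ v∈g) v≢w

      local : ∀ v → v ≢ w → c ℕ.* [ v ∈ e ]ₛ ≡ ∣ e ∣ ℕ.* a v
      local v v≢w with v Subset.∈? e
      ... | yes v∈e = begin
        c ℕ.* 1 ≡⟨ ℕ.*-identityʳ c ⟩
        c       ≡⟨ ℕΣ.⅀-cong∈ q (λ {(r , g)} x∈ → ℕΣ.𝟙-⇔ (g ≟ₛ e) (v Subset.∈? g) (λ { refl → v∈e }) (only-e v∈e v≢w x∈)) ⟩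
        Σℕ q (λ (_ , g) → [ v ∈ g ]ₛ) ≡⟨ bal v ⟩
        ∣ e ∣ ℕ.* Σℕ q (λ (r , _) → [ r Fin.≟ v ]ℕ) ≡⟨ cong (∣ e ∣ ℕ.*_) (ℕΣ.⅀-cong∈ q (λ x∈ → sym (rooted x∈))) ⟩
        ∣ e ∣ ℕ.* a v ∎
        where
        rooted : ∀ {x} → x ∈ q → at e x ℕ.* [ proj₁ x Fin.≟ v ]ℕ ≡ [ proj₁ x Fin.≟ v ]ℕ
        rooted {r , g} x∈ with r Fin.≟ v
        ... | no _     = ℕ.*-zeroʳ (at e (r , g))
        ... | yes refl = trans (ℕ.*-identityʳ _) (ℕΣ.𝟙-yes (g ≟ₛ e) (only-e v∈e v≢w x∈ (proj₁ (mem x∈))))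
      ... | no v∉e = trans (ℕ.*-zeroʳ c) (sym (trans (cong (∣ e ∣ ℕ.*_) (ℕΣ.⅀-0 q none)) (ℕ.*-zeroʳ ∣ e ∣)))
        where
        none : ∀ {x} → x ∈ q → at e x ℕ.* [ proj₁ x Fin.≟ v ]ℕ ≡ 0
        none {r , g} x∈ with g ≟ₛ e | r Fin.≟ v
        ... | yes refl | yes refl = contradiction (proj₁ (mem x∈)) v∉e
        ... | yes _    | no _     = refl
        ... | no _     | _        = refl

      totals : Σℕ (allFin n) (λ v → c ℕ.* [ v ∈ e ]ₛ) ≡ Σℕ (allFin n) (λ v → ∣ e ∣ ℕ.* a v)
      totals = begin
        Σℕ (allFin n) (λ v → c ℕ.* [ v ∈ e ]ₛ) ≡⟨ ℕΣ.⅀-*ˡ (allFin n) c _ ⟨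
        c ℕ.* Σℕ (allFin n) (λ v → [ v ∈ e ]ₛ) ≡⟨ cong (c ℕ.*_) (∣p∣-Σ e) ⟨
        c ℕ.* ∣ e ∣                            ≡⟨ ℕ.*-comm c ∣ e ∣ ⟩
        ∣ e ∣ ℕ.* c                            ≡⟨ cong (∣ e ∣ ℕ.*_) (ℕΣ.⅀-cong q λ x → sym (one x)) ⟩
        ∣ e ∣ ℕ.* Σℕ q (λ x → Σℕ (allFin n) (λ v → at e x ℕ.* [ proj₁ x Fin.≟ v ]ℕ))
          ≡⟨ cong (∣ e ∣ ℕ.*_) (ℕΣ.⅀-swap q (allFin n) _) ⟩
        ∣ e ∣ ℕ.* Σℕ (allFin n) a              ≡⟨ ℕΣ.⅀-*ˡ (allFin n) ∣ e ∣ _ ⟩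
        Σℕ (allFin n) (λ v → ∣ e ∣ ℕ.* a v) ∎
        where
        one : ∀ x → Σℕ (allFin n) (λ v → at e x ℕ.* [ proj₁ x Fin.≟ v ]ℕ) ≡ at e x
        one x@(r , _) = trans (ℕΣ.⅀-cong (allFin n) λ v →
            trans (ℕ.*-comm (at e x) _) (cong (ℕ._* at e x) (ℕΣ.𝟙-⇔ (r Fin.≟ v) (v Fin.≟ r) sym sym)))
          (ℕΣ.⅀-δ r (λ _ → at e x))

      everywhere : ∀ v → c ℕ.* [ v ∈ e ]ₛ ≡ ∣ e ∣ ℕ.* a v
      everywhere v with v Fin.≟ w
      ... | no v≢w   = local v v≢w
      ... | yes refl = Σℕ-≡-at w totals local

      on-e : e ∈ map proj₂ q → ∣ e ∣ ℕ.≤ occₛ e (map proj₂ q)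
      on-e e∈ with (r , _) , x∈ , refl ← ∈-map⁻ proj₂ e∈ =
        subst₂ ℕ._≤_ (ℕ.*-identityʳ ∣ e ∣)
          (trans (sym (everywhere r)) (trans (cong (c ℕ.*_) (ℕΣ.𝟙-yes (r Subset.∈? e) (proj₁ (mem x∈))))
            (trans (ℕ.*-identityʳ c) (sym (ℕΣ.⅀-map proj₂ q _)))))
          (ℕ.*-monoʳ-≤ ∣ e ∣ (ℕ.≤-trans
            (ℕ.≤-reflexive (sym (cong₂ ℕ._*_ (ℕΣ.𝟙-yes (e ≟ₛ e) refl) (ℕΣ.𝟙-yes (r Fin.≟ r) refl))))
            (Σℕ-≥ (λ x → at e x ℕ.* [ proj₁ x Fin.≟ r ]ℕ) x∈)))

      rest : List RootedSet
      rest = filter (λ x → ¬? (proj₂ x ≟ₛ e)) q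

      rest-balanced : Balanced ∣ e ∣ rest
      rest-balanced v = ℕ.+-cancelˡ-≡ (c ℕ.* [ v ∈ e ]ₛ) _ _ (begin
        c ℕ.* [ v ∈ e ]ₛ ℕ.+ Σℕ rest (λ (_ , g) → [ v ∈ g ]ₛ)
          ≡⟨ cong (ℕ._+ Σℕ rest (λ (_ , g) → [ v ∈ g ]ₛ)) (trans (ℕΣ.⅀-*ʳ q (at e) _) (ℕΣ.⅀-cong q same)) ⟩
        Σℕ q (λ x → at e x ℕ.* [ v ∈ proj₂ x ]ₛ) ℕ.+ Σℕ rest (λ (_ , g) → [ v ∈ g ]ₛ)
          ≡⟨ split e q (λ (_ , g) → [ v ∈ g ]ₛ) ⟨
        Σℕ q (λ (_ , g) → [ v ∈ g ]ₛ)                ≡⟨ bal v ⟩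
        ∣ e ∣ ℕ.* Σℕ q (λ (r , _) → [ r Fin.≟ v ]ℕ)
          ≡⟨ cong (∣ e ∣ ℕ.*_) (split e q (λ (r , _) → [ r Fin.≟ v ]ℕ)) ⟩
        ∣ e ∣ ℕ.* (a v ℕ.+ Σℕ rest (λ (r , _) → [ r Fin.≟ v ]ℕ))
          ≡⟨ ℕ.*-distribˡ-+ ∣ e ∣ (a v) _ ⟩
        ∣ e ∣ ℕ.* a v ℕ.+ ∣ e ∣ ℕ.* Σℕ rest (λ (r , _) → [ r Fin.≟ v ]ℕ)
          ≡⟨ cong (ℕ._+ ∣ e ∣ ℕ.* Σℕ rest (λ (r , _) → [ r Fin.≟ v ]ℕ)) (everywhere v) ⟨
        c ℕ.* [ v ∈ e ]ₛ ℕ.+ ∣ e ∣ ℕ.* Σℕ rest (λ (r , _) → [ r Fin.≟ v ]ℕ) ∎)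
        where
        same : ∀ x → at e x ℕ.* [ v ∈ e ]ₛ ≡ at e x ℕ.* [ v ∈ proj₂ x ]ₛ
        same (_ , g) with g ≟ₛ e
        ... | yes refl = refl
        ... | no _     = refl

      rest-mem : ∀ {r f} → (r , f) ∈ rest → r ∈ₛ f × f ∈ es
      rest-mem x∈ with ∈-filter⁻ (λ x → ¬? (proj₂ x ≟ₛ e)) {xs = q} x∈
      ... | x∈q , f≢e with mem x∈q
      ...   | r∈f , here f≡e = contradiction f≡e f≢e
      ...   | r∈f , there f∈ = r∈f , f∈

      rest-∈ : ∀ {f} → f ≢ e → f ∈ map proj₂ q → f ∈ map proj₂ rest
      rest-∈ f≢e f∈ with _ , x∈ , refl ← ∈-map⁻ proj₂ f∈ =
        ∈-map⁺ proj₂ (∈-filter⁺ (λ x → ¬? (proj₂ x ≟ₛ e)) x∈ f≢e)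

      rest-occ : ∀ f → occₛ f (map proj₂ rest) ℕ.≤ occₛ f (map proj₂ q)
      rest-occ f = subst₂ ℕ._≤_ (sym (ℕΣ.⅀-map proj₂ rest _))
        (trans (sym (split e q (at f))) (sym (ℕΣ.⅀-map proj₂ q _)))
        (ℕ.m≤n+m (Σℕ rest (at f)) _)

    -- Either the first edge is `f`, or all its members of `q` can be removed without disturbing the
    -- balance on the remaining forest.
    flow : ∀ {E} K → Forest E → (∀ {e} → e ∈ E → ∣ e ∣ ≡ K) → ∀ q →
      (∀ {r e} → (r , e) ∈ q → r ∈ₛ e × e ∈ E) → Balanced K q →
      ∀ {f} → f ∈ map proj₂ q → K ℕ.≤ occₛ f (map proj₂ q)
    flow K [] unif q mem bal f∈ with _ , x∈ , refl ← ∈-map⁻ proj₂ f∈ with () ← proj₂ (mem x∈)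
    flow {e ∷ es} K (add w priv for) unif q mem bal {f} f∈ with refl ← unif (here refl) | f ≟ₛ e
    ... | yes refl = Peel.on-e {e} {es} {w} priv q mem bal f∈
    ... | no f≢e   = ℕ.≤-trans
      (flow ∣ e ∣ for (unif ∘ there) rest rest-mem rest-balanced (rest-∈ f≢e f∈)) (rest-occ f)
      where open Peel {e} {es} {w} priv q mem bal
open Balance public

-- Images of vertex sets under permutations

module Images where

  open ≡ using (refl; sym; trans)

  subset-ext : ∀ {n} {p q : Subset n} → (∀ v → v ∈ₛ p → v ∈ₛ q) → (∀ v → v ∈ₛ q → v ∈ₛ p) → p ≡ q
  subset-ext f g = Subset.⊆-antisym (f _) (g _)

  ∈-image⁻ : ∀ {m n} (f : Fin m ↔ Fin n) {e : Subset m} {w} → w ∈ₛ image f e → Inverse.from f w ∈ₛ e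
  ∈-image⁻ f {e} {w} w∈ = Vec.lookup⇒[]= _ e
    (trans (sym (Vec.lookup∘tabulate (λ x → lookup e (Inverse.from f x)) w)) (Vec.[]=⇒lookup w∈))

  ∈-image⁺ : ∀ {m n} (f : Fin m ↔ Fin n) {e : Subset m} {w} → Inverse.from f w ∈ₛ e → w ∈ₛ image f e
  ∈-image⁺ f {e} {w} w∈ = Vec.lookup⇒[]= w (image f e)
    (trans (Vec.lookup∘tabulate (λ x → lookup e (Inverse.from f x)) w) (Vec.[]=⇒lookup w∈))

  transpose-left : ∀ {n} (u v : Fin n) → Perm.transpose u v ⟨$⟩ʳ u ≡ v
  transpose-left u v rewrite dec-true (u Fin.≟ u) refl = refl

  module _ {n : ℕ} (π : Permutation′ n) where

    π∈image⁺ : ∀ {e : Subset n} {v} → v ∈ₛ e → π ⟨$⟩ʳ v ∈ₛ image π e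
    π∈image⁺ {e} v∈ = ∈-image⁺ π (subst (_∈ₛ e) (sym (inverseˡ π)) v∈)

    π∈image⁻ : ∀ {e : Subset n} {v} → π ⟨$⟩ʳ v ∈ₛ image π e → v ∈ₛ e
    π∈image⁻ {e} v∈ = subst (_∈ₛ e) (inverseˡ π) (∈-image⁻ π v∈)

    image-ext : ∀ {e f : Subset n} → (∀ v → v ∈ₛ e → π ⟨$⟩ʳ v ∈ₛ f) → (∀ v → π ⟨$⟩ʳ v ∈ₛ f → v ∈ₛ e) → image π e ≡ f
    image-ext {e} {f} to from = subset-ext
      (λ v v∈ → subst (_∈ₛ f) (inverseʳ π) (to _ (∈-image⁻ π v∈)))
      (λ v v∈ → ∈-image⁺ π (from _ (subst (_∈ₛ f) (sym (inverseʳ π)) v∈)))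

    image-injective : ∀ {e f : Subset n} → image π e ≡ image π f → e ≡ f
    image-injective {e} {f} eq = subset-ext
      (λ v v∈ → π∈image⁻ (subst (π ⟨$⟩ʳ v ∈ₛ_) eq (π∈image⁺ v∈)))
      (λ v v∈ → π∈image⁻ (subst (π ⟨$⟩ʳ v ∈ₛ_) (sym eq) (π∈image⁺ v∈)))
open Images public

-- Diagonal rows, spanning rows and the connectedness of their arcs

module Rows {n k : ℕ} where

  open ≡ using (refl; sym; trans)

  diagonal? : (ρ : Vec (Fin n) (suc k)) → Dec (Vec.tail ρ ≡ Vec.replicate k (Vec.head ρ))
  diagonal? ρ = Vec.≡-dec Fin._≟_ (Vec.tail ρ) (Vec.replicate k (Vec.head ρ))

  support : Vec (Fin n) (suc k) → Subset n
  support ρ = ⋃ (map ⁅_⁆ (toList ρ))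

  loops : ∀ {d} → Vec (Vec (Fin n) (suc k)) d → List (Fin n)
  loops []      = []
  loops (ρ ∷ s) = if does (diagonal? ρ) then Vec.head ρ ∷ loops s else loops s

  spanned : ∀ {d} → Vec (Vec (Fin n) (suc k)) d → List (Fin n × Subset n)
  spanned []      = []
  spanned (ρ ∷ s) = if does (diagonal? ρ) then spanned s else (Vec.head ρ , support ρ) ∷ spanned s

  supports : ∀ {d} → Vec (Vec (Fin n) (suc k)) d → List (Subset n)
  supports s = map proj₂ (spanned s)

  length-loops+supports : ∀ {d} (s : Vec (Vec (Fin n) (suc k)) d) → length (loops s) ℕ.+ length (supports s) ≡ d
  length-loops+supports []      = refl
  length-loops+supports (ρ ∷ s) with does (diagonal? ρ)
  ... | true  = cong suc (length-loops+supports s)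
  ... | false = trans (ℕ.+-suc _ _) (cong suc (length-loops+supports s))

  toList-replicate : ∀ {a} {A : Set a} m (x : A) → toList (Vec.replicate m x) ≡ replicate m x
  toList-replicate zero    x = refl
  toList-replicate (suc m) x = cong (x ∷_) (toList-replicate m x)

  head∈support : ∀ (ρ : Vec (Fin n) (suc k)) → Vec.head ρ ∈ₛ support ρ
  head∈support (i ∷ γ) = ∈⇒∈⋃ {l = toList (i ∷ γ)} (here refl)

  spanned-∈ : ∀ {d} (s : Vec (Vec (Fin n) (suc k)) d) {r e} → (r , e) ∈ spanned s → r ∈ₛ e
  spanned-∈ (ρ ∷ s) x∈ with does (diagonal? ρ)
  spanned-∈ (ρ ∷ s) x∈          | true  = spanned-∈ s x∈
  spanned-∈ (ρ ∷ s) (here refl) | false = head∈support ρ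
  spanned-∈ (ρ ∷ s) (there x∈)  | false = spanned-∈ s x∈

  arc-cases : ∀ {d} (s : Vec (Vec (Fin n) (suc k)) d) {i j} → (i , j) ∈ arcs s →
    i ≡ j ⊎ ∃ λ e → e ∈ supports s × i ∈ₛ e × j ∈ₛ e
  arc-cases ((i ∷ γ) ∷ s) a∈ with diagonal? (i ∷ γ) | ∈-++⁻ (rowArcs (i ∷ γ)) a∈
  ... | yes refl | inj₁ a∈ρ with _ , j∈ , refl ← ∈-map⁻ (i ,_) a∈ρ =
    inj₁ (sym (same k (subst (_ ∈_) (toList-replicate k i) j∈)))
    where
    same : ∀ m {j} → j ∈ replicate m i → j ≡ i
    same (suc m) (here refl) = refl
    same (suc m) (there j∈)  = same m j∈
  ... | no _     | inj₁ a∈ρ with _ , j∈ , refl ← ∈-map⁻ (i ,_) a∈ρ =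
    inj₂ (support (i ∷ γ) , here refl , head∈support (i ∷ γ) , ∈⇒∈⋃ {l = toList (i ∷ γ)} (there j∈))
  ... | yes _    | inj₂ a∈s = arc-cases s a∈s
  ... | no _     | inj₂ a∈s = Sum.map₂ (λ (e , e∈ , i∈ , j∈) → e , there e∈ , i∈ , j∈) (arc-cases s a∈s)

  loops-arc : 1 ℕ.≤ k → ∀ {d} (s : Vec (Vec (Fin n) (suc k)) d) {u} → u ∈ loops s → (u , u) ∈ arcs s
  loops-arc 1≤k ((i ∷ γ) ∷ s) u∈ with diagonal? (i ∷ γ)
  loops-arc 1≤k ((i ∷ γ) ∷ s) u∈          | no _     = ∈-++⁺ʳ (rowArcs (i ∷ γ)) (loops-arc 1≤k s u∈)
  loops-arc 1≤k ((i ∷ γ) ∷ s) (there u∈)  | yes _    = ∈-++⁺ʳ (rowArcs (i ∷ γ)) (loops-arc 1≤k s u∈)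
  loops-arc 1≤k ((i ∷ γ) ∷ s) (here refl) | yes refl =
    ∈-++⁺ˡ (∈-map⁺ (i ,_) (subst (i ∈_) (sym (toList-replicate k i)) (∈-replicate 1≤k)))
    where
    ∈-replicate : ∀ {m} → 1 ℕ.≤ m → i ∈ replicate m i
    ∈-replicate {suc m} _ = here refl

  spanned-arc : 1 ℕ.≤ k → ∀ {d} (s : Vec (Vec (Fin n) (suc k)) d) {r e} → (r , e) ∈ spanned s → ∃ λ j → (r , j) ∈ arcs s
  spanned-arc 1≤k (ρ@(i ∷ γ) ∷ s) x∈ with does (diagonal? ρ)
  spanned-arc 1≤k (ρ@(i ∷ γ) ∷ s) x∈          | true  = Product.map₂ (∈-++⁺ʳ (rowArcs ρ)) (spanned-arc 1≤k s x∈)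
  spanned-arc 1≤k (ρ@(i ∷ γ) ∷ s) (there x∈)  | false = Product.map₂ (∈-++⁺ʳ (rowArcs ρ)) (spanned-arc 1≤k s x∈)
  spanned-arc (s≤s _) ((i ∷ j ∷ γ) ∷ s) (here refl) | false = j , here refl

  loops-map : (π : Permutation′ n) → ∀ {d} (s : Vec (Vec (Fin n) (suc k)) d) →
    loops (Vec.map (Vec.map (π ⟨$⟩ʳ_)) s) ≡ map (π ⟨$⟩ʳ_) (loops s)
  supports-map : (π : Permutation′ n) → ∀ {d} (s : Vec (Vec (Fin n) (suc k)) d) →
    supports (Vec.map (Vec.map (π ⟨$⟩ʳ_)) s) ≡ map (image π) (supports s)

  private
    diagonal-map⁺ : ∀ (π : Permutation′ n) (ρ : Vec (Fin n) (suc k)) → Vec.tail ρ ≡ Vec.replicate k (Vec.head ρ) →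
      Vec.tail (Vec.map (π ⟨$⟩ʳ_) ρ) ≡ Vec.replicate k (Vec.head (Vec.map (π ⟨$⟩ʳ_) ρ))
    diagonal-map⁺ π (i ∷ γ) eq = trans (cong (Vec.map (π ⟨$⟩ʳ_)) eq) (Vec.map-replicate _ i k)

    map-undo : ∀ (π : Permutation′ n) {m} (γ : Vec (Fin n) m) → Vec.map (π ⟨$⟩ˡ_) (Vec.map (π ⟨$⟩ʳ_) γ) ≡ γ
    map-undo π γ = trans (sym (Vec.map-∘ _ _ γ)) (trans (Vec.map-cong (λ _ → inverseˡ π) γ) (Vec.map-id γ))

    diagonal-map⁻ : ∀ (π : Permutation′ n) (ρ : Vec (Fin n) (suc k)) →
      Vec.tail (Vec.map (π ⟨$⟩ʳ_) ρ) ≡ Vec.replicate k (Vec.head (Vec.map (π ⟨$⟩ʳ_) ρ)) → Vec.tail ρ ≡ Vec.replicate k (Vec.head ρ)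
    diagonal-map⁻ π ρ eq = subst (λ σ → Vec.tail σ ≡ Vec.replicate k (Vec.head σ)) (map-undo π ρ)
      (diagonal-map⁺ (Perm.flip π) (Vec.map (π ⟨$⟩ʳ_) ρ) eq)

    support-map : ∀ (π : Permutation′ n) (ρ : Vec (Fin n) (suc k)) → support (Vec.map (π ⟨$⟩ʳ_) ρ) ≡ image π (support ρ)
    support-map π ρ = sym (image-ext π
      (λ v v∈ → ∈⇒∈⋃ (subst (π ⟨$⟩ʳ v ∈_) (sym (Vec.toList-map _ ρ)) (∈-map⁺ _ (∈⋃⇒∈ (toList ρ) v∈))))
      (λ v πv∈ → ∈⇒∈⋃ (back (subst (π ⟨$⟩ʳ v ∈_) (Vec.toList-map _ ρ) (∈⋃⇒∈ _ πv∈)))))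
      where
      back : ∀ {v} → π ⟨$⟩ʳ v ∈ map (π ⟨$⟩ʳ_) (toList ρ) → v ∈ toList ρ
      back πv∈ with u , u∈ , eq ← ∈-map⁻ _ πv∈ = subst (_∈ toList ρ) (perm-injective π (sym eq)) u∈

  loops-map π []      = refl
  loops-map π (ρ ∷ s) with diagonal? ρ | diagonal? (Vec.map (π ⟨$⟩ʳ_) ρ)
  ... | yes _ | yes _ = cong₂ _∷_ (head-map ρ) (loops-map π s)
    where
    head-map : ∀ (ρ : Vec (Fin n) (suc k)) → Vec.head (Vec.map (π ⟨$⟩ʳ_) ρ) ≡ π ⟨$⟩ʳ Vec.head ρ
    head-map (i ∷ γ) = refl
  ... | no _  | no _  = loops-map π s
  ... | yes y | no n  = contradiction (diagonal-map⁺ π ρ y) n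
  ... | no n  | yes y = contradiction (diagonal-map⁻ π ρ y) n

  supports-map π []      = refl
  supports-map π (ρ ∷ s) with diagonal? ρ | diagonal? (Vec.map (π ⟨$⟩ʳ_) ρ)
  ... | yes _ | yes _ = supports-map π s
  ... | no _  | no _  = cong₂ _∷_ (support-map π ρ) (supports-map π s)
  ... | yes y | no n  = contradiction (diagonal-map⁺ π ρ y) n
  ... | no n  | yes y = contradiction (diagonal-map⁻ π ρ y) n

  walk-sources-targets : ∀ {i j : Fin n} {A} → Walk i j A → i ∷ map proj₂ A ≡ map proj₁ A ++ j ∷ []
  walk-sources-targets []      = refl
  walk-sources-targets (i ∷ w) = cong (i ∷_) (walk-sources-targets w)

  Eulerian-balance : ∀ {B : List (Arc n)} → Eulerian B → ∀ v → occ v (map proj₁ B) ≡ occ v (map proj₂ B)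
  Eulerian-balance {B} (i , A , w , p) v = trans (sym (ℕΣ.⅀-↭ _ (↭.map⁺ proj₁ p))) (trans
    (ℕ.+-cancelˡ-≡ (occ v (i ∷ [])) _ _ (begin
      occ v (i ∷ []) ℕ.+ occ v (map proj₁ A)  ≡⟨ ℕ.+-comm (occ v (i ∷ [])) _ ⟩
      occ v (map proj₁ A) ℕ.+ occ v (i ∷ [])  ≡⟨ occ-++ v (map proj₁ A) (i ∷ []) ⟨
      occ v (map proj₁ A ++ i ∷ [])           ≡⟨ cong (occ v) (walk-sources-targets w) ⟨
      occ v (i ∷ map proj₂ A)                 ≡⟨ occ-++ v (i ∷ []) (map proj₂ A) ⟩
      occ v (i ∷ []) ℕ.+ occ v (map proj₂ A) ∎))
    (ℕΣ.⅀-↭ _ (↭.map⁺ proj₂ p)))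
    where open ≡.≡-Reasoning

  -- From any arc the walk runs on to its end, which is also its start, and from there it reaches
  -- every arc. So a property that is passed on along arcs holds at all sources once it holds at
  -- one.
  Eulerian-connected : ∀ {B : List (Arc n)} → Eulerian B → (X : Fin n → Set) →
    (∀ {i j} → (i , j) ∈ B → X i → X j) → ∀ {i j i′ j′} → (i , j) ∈ B → (i′ , j′) ∈ B → X i → X i′
  Eulerian-connected {B} (o , A , w , p) X closed a∈ b∈ Xi =
    start w closed′ (end w closed′ (↭.∈-resp-↭ (↭-sym p) a∈) Xi) (↭.∈-resp-↭ (↭-sym p) b∈)
    where
    closed′ : ∀ {i j} → (i , j) ∈ A → X i → X j
    closed′ a∈ = closed (↭.∈-resp-↭ p a∈)
    start : ∀ {x y C} → Walk x y C → (∀ {i j} → (i , j) ∈ C → X i → X j) → X x → ∀ {i j} → (i , j) ∈ C → X i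
    start (x ∷ w) cl Xx (here refl) = Xx
    start (x ∷ w) cl Xx (there b∈)  = start w (cl ∘ there) (cl (here refl) Xx) b∈
    finish : ∀ {x y C} → Walk x y C → (∀ {i j} → (i , j) ∈ C → X i → X j) → X x → X y
    finish []      cl Xx = Xx
    finish (x ∷ w) cl Xx = finish w (cl ∘ there) (cl (here refl) Xx)
    end : ∀ {x y C} → Walk x y C → (∀ {i j} → (i , j) ∈ C → X i → X j) → ∀ {i j} → (i , j) ∈ C → X i → X y
    end (x ∷ w) cl (here refl) Xi = finish w (cl ∘ there) (cl (here refl) Xi)
    end (x ∷ w) cl (there a∈)  Xi = end w (cl ∘ there) a∈ Xi

  private
    sources-row : ∀ {m} v i (γ : Vec (Fin n) m) A → occ v (map proj₁ (rowArcs (i ∷ γ) ++ A)) ≡ m ℕ.* [ i Fin.≟ v ]ℕ ℕ.+ occ v (map proj₁ A)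
    sources-row v i []      A = refl
    sources-row v i (j ∷ γ) A = trans (cong ([ i Fin.≟ v ]ℕ ℕ.+_) (sources-row v i γ A)) (sym (ℕ.+-assoc [ i Fin.≟ v ]ℕ _ _))

    targets-row : ∀ {m} v i (γ : Vec (Fin n) m) A → occ v (map proj₂ (rowArcs (i ∷ γ) ++ A)) ≡ occ v (toList γ) ℕ.+ occ v (map proj₂ A)
    targets-row v i []      A = refl
    targets-row v i (j ∷ γ) A = trans (cong ([ j Fin.≟ v ]ℕ ℕ.+_) (targets-row v i γ A)) (sym (ℕ.+-assoc [ j Fin.≟ v ]ℕ _ _))

    -- Row by row: a diagonal row at `v` has `k` sources and `k` targets there. A spanning row on an
    -- edge e with root i adds [v ∈ γ] + (k + 1) [i = v] on the left and k [i = v] + [v ∈ e] on the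
    -- right, and these agree because the row lists e without repetition.
    rows-balance : ∀ {d} (s : Vec (Vec (Fin n) (suc k)) d) → (∀ {e} → e ∈ supports s → ∣ e ∣ ≡ suc k) → ∀ v →
      occ v (map proj₂ (arcs s)) ℕ.+ suc k ℕ.* Σℕ (spanned s) (λ (r , _) → [ r Fin.≟ v ]ℕ) ≡
      occ v (map proj₁ (arcs s)) ℕ.+ Σℕ (spanned s) (λ (_ , e) → [ v ∈ e ]ₛ)
    rows-balance []            unif v = cong (0 ℕ.+_) (ℕ.*-zeroʳ (suc k))
    rows-balance ((i ∷ γ) ∷ s) unif v with diagonal? (i ∷ γ)
    ... | yes eq = begin
      occ v (map proj₂ (rowArcs (i ∷ γ) ++ arcs s)) ℕ.+ suc k ℕ.* X
        ≡⟨ cong (ℕ._+ suc k ℕ.* X) (targets-row v i γ (arcs s)) ⟩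
      (occ v (toList γ) ℕ.+ occ v (map proj₂ (arcs s))) ℕ.+ suc k ℕ.* X
        ≡⟨ ℕ.+-assoc (occ v (toList γ)) _ _ ⟩
      occ v (toList γ) ℕ.+ (occ v (map proj₂ (arcs s)) ℕ.+ suc k ℕ.* X)
        ≡⟨ cong₂ ℕ._+_ (trans (cong (occ v) (trans (cong toList eq) (toList-replicate k i))) (trans (occ-replicate i v k) (ℕ.*-comm _ k)))
             (rows-balance s unif v) ⟩
      k ℕ.* [ i Fin.≟ v ]ℕ ℕ.+ (occ v (map proj₁ (arcs s)) ℕ.+ Y)
        ≡⟨ ℕ.+-assoc (k ℕ.* [ i Fin.≟ v ]ℕ) _ _ ⟨
      (k ℕ.* [ i Fin.≟ v ]ℕ ℕ.+ occ v (map proj₁ (arcs s))) ℕ.+ Y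
        ≡⟨ cong (ℕ._+ Y) (sources-row v i γ (arcs s)) ⟨
      occ v (map proj₁ (rowArcs (i ∷ γ) ++ arcs s)) ℕ.+ Y ∎
      where
      open ≡.≡-Reasoning
      X = Σℕ (spanned s) (λ (r , _) → [ r Fin.≟ v ]ℕ)
      Y = Σℕ (spanned s) (λ (_ , e) → [ v ∈ e ]ₛ)
    ... | no _ = begin
      occ v (map proj₂ (rowArcs (i ∷ γ) ++ arcs s)) ℕ.+ suc k ℕ.* (δ ℕ.+ X)
        ≡⟨ cong₂ ℕ._+_ (targets-row v i γ (arcs s)) (ℕ.*-distribˡ-+ (suc k) δ X) ⟩
      (t ℕ.+ T₂) ℕ.+ ((δ ℕ.+ k ℕ.* δ) ℕ.+ suc k ℕ.* X)
        ≡⟨ solve 5 (λ t T₂ δ kδ x → (t :+ T₂) :+ ((δ :+ kδ) :+ x) := (kδ :+ (δ :+ t)) :+ (T₂ :+ x)) refl t T₂ δ (k ℕ.* δ) (suc k ℕ.* X) ⟩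
      (k ℕ.* δ ℕ.+ (δ ℕ.+ t)) ℕ.+ (T₂ ℕ.+ suc k ℕ.* X)
        ≡⟨ cong₂ (λ a b → (k ℕ.* δ ℕ.+ a) ℕ.+ b) (occ≡[∈⋃] (toList (i ∷ γ)) (trans (unif (here refl)) (sym (Vec.length-toList (i ∷ γ)))) v)
             (rows-balance s (unif ∘ there) v) ⟩
      (k ℕ.* δ ℕ.+ [ v ∈ support (i ∷ γ) ]ₛ) ℕ.+ (T₁ ℕ.+ Y)
        ≡⟨ solve 4 (λ a b c d → (a :+ b) :+ (c :+ d) := (a :+ c) :+ (b :+ d)) refl (k ℕ.* δ) [ v ∈ support (i ∷ γ) ]ₛ T₁ Y ⟩
      (k ℕ.* δ ℕ.+ T₁) ℕ.+ ([ v ∈ support (i ∷ γ) ]ₛ ℕ.+ Y)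
        ≡⟨ cong (ℕ._+ ([ v ∈ support (i ∷ γ) ]ₛ ℕ.+ Y)) (sources-row v i γ (arcs s)) ⟨
      occ v (map proj₁ (rowArcs (i ∷ γ) ++ arcs s)) ℕ.+ ([ v ∈ support (i ∷ γ) ]ₛ ℕ.+ Y) ∎
      where
      open ≡.≡-Reasoning
      open import Data.Nat.Solver using (module +-*-Solver)
      open +-*-Solver
      X  = Σℕ (spanned s) (λ (r , _) → [ r Fin.≟ v ]ℕ)
      Y  = Σℕ (spanned s) (λ (_ , e) → [ v ∈ e ]ₛ)
      δ  = [ i Fin.≟ v ]ℕ
      t  = occ v (toList γ)
      T₁ = occ v (map proj₁ (arcs s))
      T₂ = occ v (map proj₂ (arcs s))

  -- For a closed walk the two arc counts in `rows-balance` cancel, and what is left is the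
  -- hypothesis of `flow`.
  supports-multiplicity : ∀ {E d} (s : Vec (Vec (Fin n) (suc k)) d) → Forest E → (∀ {e} → e ∈ E → ∣ e ∣ ≡ suc k) →
    Eulerian (arcs s) → (∀ {e} → e ∈ supports s → e ∈ E) → ∀ {f} → f ∈ supports s → suc k ℕ.≤ occₛ f (supports s)
  supports-multiplicity s for unif eul sub = flow (suc k) for unif (spanned s)
    (λ x∈ → spanned-∈ s x∈ , sub (∈-map⁺ proj₂ x∈))
    (λ v → sym (ℕ.+-cancelˡ-≡ (occ v (map proj₂ (arcs s))) _ _
      (trans (rows-balance s (unif ∘ sub) v) (cong (ℕ._+ Σℕ (spanned s) (λ (_ , e) → [ v ∈ e ]ₛ)) (Eulerian-balance eul v)))))

-- Lists of edges with at most two different members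

module Selections {n : ℕ} where

  empty? : (l : List (Subset n)) → Dec (l ≡ [])
  empty? []      = yes ≡.refl
  empty? (_ ∷ _) = no λ ()

  Within : List (Subset n) → List (Subset n) → Set
  Within E l = ∀ {f} → f ∈ l → f ∈ E

  within? : ∀ E l → Dec (Within E l)
  within? E l = Dec.map′ All.lookup All.tabulate (All.all? (_∈ˡ? E) l)

  One : Subset n → List (Subset n) → Set
  One e l = e ∈ l × (∀ {f} → f ∈ l → f ≡ e)

  one? : ∀ e l → Dec (One e l)
  one? e l = (e ∈ˡ? l) ×-dec Dec.map′ All.lookup All.tabulate (All.all? (_≟ₛ e) l)

  Two : Subset n → Subset n → List (Subset n) → Set
  Two e e′ l = e ∈ l × e′ ∈ l × (∀ {f} → f ∈ l → f ≡ e ⊎ f ≡ e′)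

  two? : ∀ e e′ l → Dec (Two e e′ l)
  two? e e′ l = (e ∈ˡ? l) ×-dec (e′ ∈ˡ? l) ×-dec
    Dec.map′ All.lookup All.tabulate (All.all? (λ f → (f ≟ₛ e) ⊎-dec (f ≟ₛ e′)) l)

  occ-total : ∀ {as : List (Subset n)} → Unique as → ∀ l → Σℕ as (λ a → occₛ a l) ℕ.≤ length l
  occ-total {as} u l = ℕ.≤-trans (ℕ.≤-reflexive (ℕΣ.⅀-swap as l _))
    (ℕ.≤-trans (Σℕ-mono l (λ {z} _ → atMost1 u z)) (ℕ.≤-reflexive (≡.trans (Σℕ-const l 1) (ℕ.*-identityʳ _))))
    where
    atMost1 : ∀ {as} → Unique as → ∀ z → Σℕ as (λ a → [ z ≟ₛ a ]ℕ) ℕ.≤ 1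
    atMost1 {[]}     u         z = z≤n
    atMost1 {a ∷ as} (a∉ ∷ u) z with z ≟ₛ a
    ... | no _       = atMost1 u z
    ... | yes ≡.refl = ℕ.≤-reflexive (cong suc (ℕΣ.⅀-0 as (λ {b} b∈ → ℕΣ.𝟙-no (z ≟ₛ b) (All.lookup a∉ b∈))))

  AtMostTwo : List (Subset n) → Set
  AtMostTwo l = ∀ {a b c} → a ∈ l → b ∈ l → c ∈ l → a ≡ b ⊎ a ≡ c ⊎ b ≡ c

  module _ {c ℓ} (R : CommutativeSemiring c ℓ) where

    open CommutativeSemiring R hiding (zero)
    open ListSums R

    -- The cases are disjoint. Induction on `E` adds, for the new edge `e`, those in which `e` is
    -- met alone or together with exactly one later edge.
    𝟙-split : ∀ {E : List (Subset n)} {l} → AtMostTwo l → Unique E →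
      𝟙 (within? E l) ≈ 𝟙 (empty? l) + (⅀ E (λ e → 𝟙 (one? e l)) + ⅀₂ E (λ e e′ → 𝟙 (two? e e′ l)))
    𝟙-split {[]} {l} _ _ = trans (𝟙-⇔ (within? [] l) (empty? l) (to l) λ { ≡.refl → λ () })
      (sym (trans (+-congˡ (+-identityˡ 0#)) (+-identityʳ _)))
      where
      to : ∀ l → Within [] l → l ≡ []
      to []      w = ≡.refl
      to (x ∷ l) w with () ← w (here ≡.refl)
    𝟙-split {e ∷ es} {l} two (e∉ ∷ u) = begin
      𝟙 (within? (e ∷ es) l)
        ≈⟨ new ⟩
      𝟙 (within? es l) + (𝟙 (one? e l) + ⅀ es (λ e′ → 𝟙 (two? e e′ l)))
        ≈⟨ +-congʳ (𝟙-split two u) ⟩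
      (z + (S + P)) + (o + s)
        ≈⟨ +-assoc z _ _ ⟩
      z + ((S + P) + (o + s))
        ≈⟨ +-congˡ (trans (+-comm _ _) (interchange o s S P)) ⟩
      z + ((o + S) + (s + P)) ∎
      where
      open import Relation.Binary.Reasoning.Setoid setoid
      open import Algebra.Properties.CommutativeSemigroup +-commutativeSemigroup using (interchange)
      z = 𝟙 (empty? l)
      o = 𝟙 (one? e l)
      s = ⅀ es (λ e′ → 𝟙 (two? e e′ l))
      S = ⅀ es (λ e → 𝟙 (one? e l))
      P = ⅀₂ es (λ e e′ → 𝟙 (two? e e′ l))
      Goal : Set _
      Goal = 𝟙 (within? (e ∷ es) l) ≈ 𝟙 (within? es l) + (o + s)

      absent : e ∉ l → Goal
      absent e∉l = trans (𝟙-⇔ (within? (e ∷ es) l) (within? es l) drop (λ w f∈ → there (w f∈)))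
        (sym (trans (+-congˡ (trans (+-cong (𝟙-no (one? e l) (e∉l ∘ proj₁))
            (⅀-0 es (λ {e′} _ → 𝟙-no (two? e e′ l) (e∉l ∘ proj₁)))) (+-identityˡ 0#))) (+-identityʳ _)))
        where
        drop : Within (e ∷ es) l → Within es l
        drop w f∈ with w f∈
        ... | here ≡.refl = contradiction f∈ e∉l
        ... | there f∈es  = f∈es

      alone : One e l → Goal
      alone one = trans (trans (𝟙-yes (within? (e ∷ es) l) (λ f∈ → here (proj₂ one f∈))) (sym (+-identityˡ 1#)))
        (+-cong (sym (𝟙-no (within? es l) (λ w → All.lookup e∉ (w (proj₁ one)) ≡.refl)))
          (trans (sym (+-identityʳ 1#)) (+-cong (sym (𝟙-yes (one? e l) one))
            (sym (⅀-0 es (λ {e′} e′∈ → 𝟙-no (two? e e′ l)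
            (λ (_ , e′∈l , _) → All.lookup e∉ e′∈ (≡.sym (proj₂ one e′∈l)))))))))

      joined : e ∈ l → ∀ {f} → f ∈ l → f ≢ e → Goal
      joined e∈l {f} f∈l f≢e =
        trans (other (f ∈ˡ? es)) (sym (trans (+-cong (𝟙-no (within? es l) (λ w → All.lookup e∉ (w e∈l) ≡.refl))
          (trans (+-congʳ (𝟙-no (one? e l) (λ one → f≢e (proj₂ one f∈l)))) (+-identityˡ s))) (+-identityˡ s)))
        where
        dichotomy : ∀ {g} → g ∈ l → g ≡ e ⊎ g ≡ f
        dichotomy g∈ with two g∈ e∈l f∈l
        ... | inj₁ g≡e        = inj₁ g≡e
        ... | inj₂ (inj₁ g≡f) = inj₂ g≡f
        ... | inj₂ (inj₂ e≡f) = contradiction (≡.sym e≡f) f≢e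
        other : Dec (f ∈ es) → 𝟙 (within? (e ∷ es) l) ≈ s
        other (yes f∈es) = trans
          (𝟙-yes (within? (e ∷ es) l) (λ g∈ → [ here , (λ { ≡.refl → there f∈es }) ]′ (dichotomy g∈)))
          (sym (trans (⅀-single _ u f∈es (λ {e′} e′∈ e′≢f → 𝟙-no (two? e e′ l) λ (_ , e′∈l , _) →
                [ (λ e′≡e → All.lookup e∉ e′∈ (≡.sym e′≡e)) , e′≢f ]′ (dichotomy e′∈l)))
            (𝟙-yes (two? e f l) (e∈l , f∈l , dichotomy))))
        other (no f∉es) = trans
          (𝟙-no (within? (e ∷ es) l) (λ w → case w f∈l of λ { (here f≡e) → f≢e f≡e ; (there f∈) → f∉es f∈ }))
          (sym (⅀-0 es (λ {e′} e′∈ → 𝟙-no (two? e e′ l) λ (_ , _ , h) →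
            [ f≢e , (λ { ≡.refl → f∉es e′∈ }) ]′ (h f∈l))))

      present : e ∈ l → Dec (All (_≡ e) l) → Goal
      present e∈l (yes all) = alone (e∈l , All.lookup all)
      present e∈l (no ¬all) with f , f∈l , f≢e ← find (All.¬All⇒Any¬ (_≟ₛ e) l ¬all) = joined e∈l f∈l f≢e

      new : Goal
      new = [ (λ e∈l → present e∈l (All.all? (_≟ₛ e) l)) , absent ]′ (Dec.toSum (e ∈ˡ? l))
open Selections public

-- Sums over closed configurations, split by the edges met

module Expectations {c ℓ₁ ℓ₂} (K : OrderedField c ℓ₁ ℓ₂) {n k : ℕ} (y : OrderedField.Carrier K)
  (0<y : OrderedField._<_ K (OrderedField.0# K) y) where

  open OrderedFields K
  open ConfigurationSums K {n} {k} public
  open Rows {n} {k} public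
  open import Relation.Binary.Reasoning.Setoid R.setoid using (begin_; _∎; step-≈-⟩; step-≈-⟨)
  open import Algebra.Properties.CommutativeSemigroup R.*-commutativeSemigroup using ()
    renaming (x∙yz≈y∙xz to *-leftComm; interchange to *-interchange)

  -- The parameter `y` is the common entry of the rows that span an edge. The diagonal entries stay
  -- outside, since they change with the degrees.
  mass : ∀ {d} → Config d → Carrier
  mass s = weight s * ∏ (supports s) (λ _ → y)

  𝔼 : ∀ d → (Config d → Carrier) → Carrier
  𝔼 d f = ⅀ (configs d) (λ s → mass s * f s)

  -- All other configurations have weight zero, so pointwise statements are needed only where the
  -- arcs form a closed walk.
  𝔼-cong : ∀ {d f g} → (∀ (s : Config d) → Eulerian (arcs s) → f s ≈ g s) → 𝔼 d f ≈ 𝔼 d g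
  𝔼-cong {d} {f} {g} eq = ⅀-cong (configs d) step
    where
    step : ∀ s → mass s * f s ≈ mass s * g s
    step s with weight-zero⊎Eulerian s
    ... | inj₂ (_ , eul) = R.*-congˡ (eq s eul)
    ... | inj₁ w≈0 = R.trans (R.*-congʳ m≈0) (R.trans (R.zeroˡ _) (R.sym (R.trans (R.*-congʳ m≈0) (R.zeroˡ _))))
      where
      m≈0 : mass s ≈ 0#
      m≈0 = R.trans (R.*-congʳ w≈0) (R.zeroˡ _)

  𝔼-0 : ∀ {d f} → (∀ (s : Config d) → Eulerian (arcs s) → f s ≈ 0#) → 𝔼 d f ≈ 0#
  𝔼-0 {d} {f} eq = R.trans (𝔼-cong {g = λ _ → 0#} eq) (⅀-0 (configs d) (λ _ → R.zeroʳ _))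

  𝔼-+ : ∀ {d} (f g : Config d → Carrier) → 𝔼 d (λ s → f s + g s) ≈ 𝔼 d f + 𝔼 d g
  𝔼-+ {d} f g = R.trans (⅀-cong (configs d) (λ s → R.distribˡ _ _ _)) (⅀-+ (configs d) _ _)

  𝔼-*ʳ : ∀ {d} (f : Config d → Carrier) b → 𝔼 d (λ s → f s * b) ≈ 𝔼 d f * b
  𝔼-*ʳ {d} f b = R.trans (⅀-cong (configs d) (λ s → R.sym (R.*-assoc _ _ _))) (R.sym (⅀-*ʳ (configs d) _ b))

  𝔼-⅀ : ∀ {x} {X : Set x} {d} (xs : List X) (f : X → Config d → Carrier) →
    𝔼 d (λ s → ⅀ xs (λ x → f x s)) ≈ ⅀ xs (λ x → 𝔼 d (f x))
  𝔼-⅀ {d = d} xs f = R.trans (⅀-cong (configs d) (λ s → ⅀-*ˡ xs _ _)) (⅀-swap (configs d) xs _)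

  𝔼-⅀₂ : ∀ {x} {X : Set x} {d} (xs : List X) (f : X → X → Config d → Carrier) →
    𝔼 d (λ s → ⅀₂ xs (λ x y → f x y s)) ≈ ⅀₂ xs (λ x y → 𝔼 d (f x y))
  𝔼-⅀₂ {d = d} []       f = 𝔼-0 {d} (λ _ _ → R.refl)
  𝔼-⅀₂ {d = d} (x ∷ xs) f = R.trans (𝔼-+ {d} _ _) (R.+-cong (𝔼-⅀ xs (f x)) (𝔼-⅀₂ xs f))

  mass-map : (π : Permutation′ n) → ∀ {d} (s : Config d) → mass (mapConfig (π ⟨$⟩ʳ_) s) ≈ mass s
  mass-map π s = R.*-cong (weight-map π s) (R.reflexive
    (≡.trans (cong (λ l → ∏ l (λ _ → y)) (supports-map π s)) (∏-map (image π) (supports s) _)))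

  𝔼-map : (π : Permutation′ n) → ∀ {d} (f : Config d → Carrier) → 𝔼 d f ≈ 𝔼 d (f ∘ mapConfig (π ⟨$⟩ʳ_))
  𝔼-map π {d} f = R.trans (R.sym (⅀-configs-map π {d} (λ s → mass s * f s)))
    (⅀-cong (configs d) λ s → R.*-congʳ (mass-map π s))

  mass-nonneg : ∀ {d} (s : Config d) → Nonneg (mass s)
  mass-nonneg s = nonneg-* (weight-nonneg s) (inj₂ (∏-pos (supports s) (λ _ → 0<y)))

  𝔼-pos : ∀ {d} {f : Config d → Carrier} → (∀ s → Nonneg (f s)) →
    (s : Config d) → Eulerian (arcs s) → 0# < f s → 0# < 𝔼 d f
  𝔼-pos {d} {f} nn s eul 0<f = ⅀-pos (λ t → nonneg-* (mass-nonneg t) (nn t))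
    (∈-vectors s (λ i → ∈-vectors (lookup s i) (λ j → ∈-allFin _)))
    (*-pos (*-pos (weight-pos s eul) (∏-pos (supports s) (λ _ → 0<y))) 0<f)

  𝟙*-cong : ∀ {p q} {P : Set p} {Q : Set q} (a : Dec P) (b : Dec Q) {A B : Carrier} →
    (P → Q) → (Q → P) → (P → A ≈ B) → 𝟙 a * A ≈ 𝟙 b * B
  𝟙*-cong (yes p) b f g h = R.*-cong (R.sym (𝟙-yes b (f p))) (h p)
  𝟙*-cong (no ¬p) b f g h = R.trans (R.zeroˡ _) (R.sym (R.trans (R.*-congʳ (𝟙-no b (¬p ∘ g))) (R.zeroˡ _)))

  𝟙*-0 : ∀ {p} {P : Set p} (a : Dec P) {A : Carrier} → ¬ P → 𝟙 a * A ≈ 0#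
  𝟙*-0 a ¬p = R.trans (R.*-congʳ (𝟙-no a ¬p)) (R.zeroˡ _)

  -- The trace up to the factor `k ^ (n ∸ 1)`, with the edge set and the diagonal entries `x` as
  -- independent arguments; this is what allows degrees to be varied while an edge is kept fixed.
  Φ : ∀ d → List (Subset n) → (Fin n → Carrier) → Carrier
  Φ d E x = 𝔼 d (λ s → 𝟙 (within? E (supports s)) * ∏ (loops s) x)

  Φ₀ : ∀ d → (Fin n → Carrier) → Carrier
  Φ₀ d x = 𝔼 d (λ s → 𝟙 (empty? (supports s)) * ∏ (loops s) x)

  Φ₁ : ∀ d → (Fin n → Carrier) → Subset n → Carrier
  Φ₁ d x e = 𝔼 d (λ s → 𝟙 (one? e (supports s)) * ∏ (loops s) x)

  Φ₂ : ∀ d → (Fin n → Carrier) → Subset n → Subset n → Carrier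
  Φ₂ d x e e′ = 𝔼 d (λ s → 𝟙 (two? e e′ (supports s)) * ∏ (loops s) x)

  record Arboreal (E : List (Subset n)) : Set where
    field
      forest   : Forest E
      distinct : Unique E
      sizes    : ∀ {e} → e ∈ E → ∣ e ∣ ≡ suc k

  module _ {E : List (Subset n)} (arb : Arboreal E) where

    open Arboreal arb

    -- Each edge in `as` is the support of at least `suc k` rows, and diagonal and spanning rows
    -- together number `d`.
    supports-count : ∀ {d} (s : Config d) → Eulerian (arcs s) → Within E (supports s) →
      ∀ {as} → Unique as → (∀ {a} → a ∈ as → a ∈ supports s) → length (loops s) ℕ.+ length as ℕ.* suc k ℕ.≤ d
    supports-count s eul w {as} u sub = ℕ.≤-trans (ℕ.+-monoʳ-≤ (length (loops s)) (ℕ.≤-trans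
      (ℕ.≤-reflexive (≡.sym (Σℕ-const as (suc k))))
      (ℕ.≤-trans (Σℕ-mono as (λ a∈ → supports-multiplicity s forest sizes eul w (sub a∈))) (occ-total u (supports s)))))
      (ℕ.≤-reflexive (length-loops+supports s))

    Φ-split : ∀ {d} → d ℕ.< 3 ℕ.* suc k → ∀ x → Φ d E x ≈ Φ₀ d x + (⅀ E (Φ₁ d x) + ⅀₂ E (Φ₂ d x))
    Φ-split {d} d<3K x = begin
      Φ d E x
        ≈⟨ 𝔼-cong {d} pointwise ⟩
      𝔼 d (λ s → 𝟙 (empty? (supports s)) * X s + (⅀ E (λ e → 𝟙 (one? e (supports s)) * X s) + ⅀₂ E (λ e e′ → 𝟙 (two? e e′ (supports s)) * X s)))
        ≈⟨ 𝔼-+ {d} _ _ ⟩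
      Φ₀ d x + 𝔼 d (λ s → ⅀ E (λ e → 𝟙 (one? e (supports s)) * X s) + ⅀₂ E (λ e e′ → 𝟙 (two? e e′ (supports s)) * X s))
        ≈⟨ R.+-congˡ (𝔼-+ {d} _ _) ⟩
      Φ₀ d x + (𝔼 d (λ s → ⅀ E (λ e → 𝟙 (one? e (supports s)) * X s)) + 𝔼 d (λ s → ⅀₂ E (λ e e′ → 𝟙 (two? e e′ (supports s)) * X s)))
        ≈⟨ R.+-congˡ (R.+-cong (𝔼-⅀ {d = d} E _) (𝔼-⅀₂ {d = d} E _)) ⟩
      Φ₀ d x + (⅀ E (Φ₁ d x) + ⅀₂ E (Φ₂ d x)) ∎
      where
      X : Config d → Carrier
      X s = ∏ (loops s) x
      Pointwise : Config d → Set _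
      Pointwise s = 𝟙 (within? E (supports s)) * X s ≈
          𝟙 (empty? (supports s)) * X s + (⅀ E (λ e → 𝟙 (one? e (supports s)) * X s) + ⅀₂ E (λ e e′ → 𝟙 (two? e e′ (supports s)) * X s))

      inside : ∀ s → Eulerian (arcs s) → Within E (supports s) → Pointwise s
      inside s eul w = R.trans (R.*-congʳ (𝟙-split R.commutativeSemiring atMostTwo distinct))
            (R.trans (R.distribʳ _ _ _) (R.+-congˡ (R.trans (R.distribʳ _ _ _)
              (R.+-cong (⅀-*ʳ E _ _) (⅀₂-*ʳ E _ _)))))
        where
        atMostTwo : AtMostTwo (supports s)
        atMostTwo {a} {b} {c} a∈ b∈ c∈ with a ≟ₛ b | a ≟ₛ c | b ≟ₛ c
        ... | yes a≡b | _       | _       = inj₁ a≡b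
        ... | no _    | yes a≡c | _       = inj₂ (inj₁ a≡c)
        ... | no _    | no _    | yes b≡c = inj₂ (inj₂ b≡c)
        ... | no a≢b  | no a≢c  | no b≢c  = contradiction
          (ℕ.≤-trans (ℕ.m≤n+m _ (length (loops s)))
            (supports-count s eul w ((a≢b ∷ a≢c ∷ []) ∷ (b≢c ∷ []) ∷ [] ∷ [])
              λ { (here ≡.refl) → a∈ ; (there (here ≡.refl)) → b∈ ; (there (there (here ≡.refl))) → c∈ }))
          (ℕ.<⇒≱ d<3K)

      outside : ∀ s → ¬ Within E (supports s) → Pointwise s
      outside s ¬w = R.trans (𝟙*-0 (within? E (supports s)) ¬w) (R.sym (R.trans (R.+-cong
              (𝟙*-0 (empty? (supports s)) λ e → ¬w (λ f∈ → contradiction (subst (_ ∈_) e f∈) λ ()))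
              (R.trans (R.+-cong
                (⅀-0 E (λ {e} e∈ → 𝟙*-0 (one? e (supports s)) λ (_ , h) → ¬w (λ f∈ → subst (_∈ E) (≡.sym (h f∈)) e∈)))
                (⅀₂-0 distinct (λ {e} {e′} e∈ e′∈ _ → 𝟙*-0 (two? e e′ (supports s)) λ (_ , _ , h) →
                  ¬w (λ f∈ → [ (λ { ≡.refl → e∈ }) , (λ { ≡.refl → e′∈ }) ]′ (h f∈)))))
                (R.+-identityˡ 0#))) (R.+-identityˡ 0#)))

      pointwise : ∀ s → Eulerian (arcs s) → Pointwise s
      pointwise s eul = [ inside s eul , outside s ]′ (Dec.toSum (within? E (supports s)))

-- The entries of the tensor and the traces of a hypergraph

module HypergraphTraces {c ℓ₁ ℓ₂} (K : OrderedField c ℓ₁ ℓ₂) {n k : ℕ}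
  (α : OrderedField.Carrier K)
  (0<α : OrderedField._<_ K (OrderedField.0# K) α) (α<1 : OrderedField._<_ K α (OrderedField.1# K)) where

  open OrderedFields K
  open Tensors K

  edgeWeight : Carrier
  edgeWeight = (1# - α) * recip (k !) {{k ℕ.!≢0}}

  edgeWeight-pos : 0# < edgeWeight
  edgeWeight-pos = *-pos (0<y-x α<1) (recip-pos (k !) {{k ℕ.!≢0}})

  open Expectations K {n} {k} edgeWeight edgeWeight-pos public
  open import Algebra.Properties.CommutativeSemigroup R.*-commutativeSemigroup using ()
    renaming (x∙yz≈y∙xz to *-leftComm; interchange to *-interchange)

  scaled : (Fin n → ℕ) → Fin n → Carrier
  scaled g v = α * fromNat (g v)

  hypergraph : (E : List (Subset n)) → Unique E → Hypergraph
  hypergraph E u = record { order = n ; edges = E ; unique = u }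

  within-∷ : ∀ (E : List (Subset n)) e l → 𝟙 (within? E (e ∷ l)) ≈ 𝟙 (e ∈ˡ? E) * 𝟙 (within? E l)
  within-∷ E e l = [ yes-case , no-case ]′ (Dec.toSum (e ∈ˡ? E))
    where
    yes-case : e ∈ E → 𝟙 (within? E (e ∷ l)) ≈ 𝟙 (e ∈ˡ? E) * 𝟙 (within? E l)
    yes-case e∈ = R.trans (𝟙-⇔ (within? E (e ∷ l)) (within? E l) (λ w → w ∘ there)
      (λ { w (here ≡.refl) → e∈ ; w (there f∈) → w f∈ }))
      (R.sym (R.trans (R.*-congʳ (𝟙-yes (e ∈ˡ? E) e∈)) (R.*-identityˡ _)))
    no-case : e ∉ E → 𝟙 (within? E (e ∷ l)) ≈ 𝟙 (e ∈ˡ? E) * 𝟙 (within? E l)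
    no-case e∉ = R.trans (𝟙-no (within? E (e ∷ l)) (λ w → e∉ (w (here ≡.refl)))) (R.sym (𝟙*-0 (e ∈ˡ? E) e∉))

  -- Separates the factors that behave differently: a constant for each spanning row, the indicator
  -- that all supports are edges, and the diagonal entries at the loops.
  entryProduct-split : (T : Tensor (suc k) n) (x : Fin n → Carrier) (E : List (Subset n)) →
    (∀ i γ → γ ≡ Vec.replicate k i → T i γ ≈ x i) →
    (∀ i γ → γ ≢ Vec.replicate k i → T i γ ≈ edgeWeight * 𝟙 (support (i ∷ γ) ∈ˡ? E)) →
    ∀ {d} (s : Config d) → entryProduct T s ≈
      ∏ (supports s) (λ _ → edgeWeight) * (𝟙 (within? E (supports s)) * ∏ (loops s) x)
  entryProduct-split T x E diag off [] = R.sym (R.trans (R.*-identityˡ _) (R.trans (R.*-identityʳ _) (𝟙-yes (within? E []) λ ())))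
  entryProduct-split T x E diag off ((i ∷ γ) ∷ s) with diagonal? (i ∷ γ)
  ... | yes d = R.trans (R.*-cong (diag i γ d) (entryProduct-split T x E diag off s))
    (R.trans (*-leftComm (x i) _ _) (R.*-congˡ (*-leftComm (x i) _ _)))
  ... | no ¬d = R.trans (R.*-cong (off i γ ¬d) (entryProduct-split T x E diag off s))
    (R.trans (*-interchange _ _ _ _) (R.*-congˡ
      (R.trans (R.sym (R.*-assoc _ _ _)) (R.*-congʳ (R.sym (within-∷ E (support (i ∷ γ)) (supports s)))))))

  module _ (1≤k : 1 ℕ.≤ k) {E : List (Subset n)} (u : Unique E) (sizes : ∀ {e} → e ∈ E → ∣ e ∣ ≡ suc k) where

    private
      H = hypergraph E u
      T = Aα-tensor α (suc k) H

    -- If the support were an edge, its size would make the row free of repetitions, but `i` occurs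
    -- in it `suc k` times.
    support-diagonal-∉ : ∀ i γ → γ ≡ Vec.replicate k i → support (i ∷ γ) ∉ E
    support-diagonal-∉ i _ ≡.refl e∈ = contradiction 1≤k (ℕ.<⇒≱ (s≤s (ℕ.+-cancelˡ-≤ 1 k 0 (
      ℕ.≤-trans (ℕ.≤-reflexive suc-k≡) ([]-≤1 (i Subset.∈? support ρ))))))
      where
      ρ : Row
      ρ = i ∷ Vec.replicate k i
      suc-k≡ : suc k ≡ [ i ∈ support ρ ]ₛ
      suc-k≡ = ≡.trans (≡.sym (≡.trans
        (cong₂ ℕ._+_ (ℕΣ.𝟙-yes (i Fin.≟ i) ≡.refl) (≡.trans (cong (occ i) (toList-replicate k i)) (occ-replicate i i k)))
        (≡.trans (cong (λ z → 1 ℕ.+ z ℕ.* k) (ℕΣ.𝟙-yes (i Fin.≟ i) ≡.refl)) (cong suc (ℕ.+-identityʳ k)))))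
        (occ≡[∈⋃] (toList ρ) (≡.trans (sizes e∈) (≡.sym (Vec.length-toList ρ))) i)

    entry-diagonal : ∀ i γ → γ ≡ Vec.replicate k i → T i γ ≈ scaled (deg E) i
    entry-diagonal i γ d = R.trans (R.+-cong (R.*-congˡ degree-entry)
        (R.trans (R.*-congˡ adjacency-entry) (R.zeroʳ _))) (R.+-identityʳ _)
      where
      degree-entry : degreeTensor (suc k) H i γ ≈ fromNat (deg E i)
      degree-entry rewrite Dec.isYes≗does (Vec.≡-dec Fin._≟_ γ (Vec.replicate k i))
                         | dec-true (Vec.≡-dec Fin._≟_ γ (Vec.replicate k i)) d = R.refl
      adjacency-entry : adjacencyTensor (suc k) H i γ ≈ 0#
      adjacency-entry rewrite Dec.isYes≗does (support (i ∷ γ) ∈ˡ? E)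
                            | dec-false (support (i ∷ γ) ∈ˡ? E) (support-diagonal-∉ i γ d) = R.refl

    entry-offDiagonal : ∀ i γ → γ ≢ Vec.replicate k i → T i γ ≈ edgeWeight * 𝟙 (support (i ∷ γ) ∈ˡ? E)
    entry-offDiagonal i γ ¬d = R.trans (R.+-cong (R.trans (R.*-congˡ degree-entry) (R.zeroʳ _)) (R.*-congˡ adjacency-entry))
        (R.trans (R.+-identityˡ _) (R.sym (R.*-assoc _ _ _)))
      where
      degree-entry : degreeTensor (suc k) H i γ ≈ 0#
      degree-entry rewrite Dec.isYes≗does (Vec.≡-dec Fin._≟_ γ (Vec.replicate k i))
                         | dec-false (Vec.≡-dec Fin._≟_ γ (Vec.replicate k i)) ¬d = R.refl
      adjacency-entry : adjacencyTensor (suc k) H i γ ≈ recip (k !) {{k ℕ.!≢0}} * 𝟙 (support (i ∷ γ) ∈ˡ? E)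
      adjacency-entry rewrite Dec.isYes≗does (support (i ∷ γ) ∈ˡ? E) with does (support (i ∷ γ) ∈ˡ? E)
      ... | true  = R.sym (R.*-identityʳ _)
      ... | false = R.sym (R.zeroʳ _)

    Tr-Φ : ∀ d → Tr (suc k) T (suc d) ≈ fromNat (k ^ (n ∸ 1)) * Φ (suc d) E (scaled (deg E))
    Tr-Φ d = R.trans (Tr-configs T d) (R.*-congˡ (⅀-cong (configs (suc d)) λ s →
      R.trans (R.*-congˡ (entryProduct-split T (scaled (deg E)) E entry-diagonal entry-offDiagonal s))
        (R.sym (R.*-assoc _ _ _))))

  Φ-precedes : 1 ℕ.≤ k → ∀ {E E′ u u′} → (∀ {e} → e ∈ E → ∣ e ∣ ≡ suc k) → (∀ {e} → e ∈ E′ → ∣ e ∣ ≡ suc k) →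
    ∀ d → suc d ℕ.≤ n ℕ.* k ^ (n ∸ 1) ∸ 1 →
    (∀ t → t ℕ.< d → Φ (suc t) E (scaled (deg E)) ≈ Φ (suc t) E′ (scaled (deg E′))) →
    Φ (suc d) E (scaled (deg E)) < Φ (suc d) E′ (scaled (deg E′)) →
    Precedes (suc k) α (hypergraph E u) (hypergraph E′ u′)
  Φ-precedes 1≤k {E} {E′} {u} {u′} sz sz′ d d≤ eq lt =
    ≡.refl , suc d , s≤s z≤n , d≤ , equal ,
    <-respˡ-≈ (R.sym (Tr-Φ 1≤k u sz d)) (<-respʳ-≈ (R.sym (Tr-Φ 1≤k u′ sz′ d)) (*-monoˡ-< (fromNat-pos (k^ (n ∸ 1))) lt))
    where
    k^ : ∀ j → 1 ℕ.≤ k ^ j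
    k^ zero    = s≤s z≤n
    k^ (suc j) = ℕ.*-mono-≤ 1≤k (k^ j)
    equal : ∀ t → t ℕ.< suc d → Tr (suc k) (Aα-tensor α (suc k) (hypergraph E u)) t
                              ≈ Tr (suc k) (Aα-tensor α (suc k) (hypergraph E′ u′)) t
    -- The zeroth trace depends only on the number of vertices and the uniformity.
    equal zero    _         = R.refl
    equal (suc t) (s≤s t<d) = R.trans (Tr-Φ 1≤k u sz t) (R.trans (R.*-congˡ (eq t t<d)) (R.sym (Tr-Φ 1≤k u′ sz′ t)))

-- Configurations that witness positivity

module Circuits where

  open ≡ using (refl; sym; trans)

  module _ {n : ℕ} where

    _++ʷ_ : ∀ {i j l : Fin n} {A B} → Walk i j A → Walk j l B → Walk i l (A ++ B)
    []      ++ʷ w′ = w′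
    (i ∷ w) ++ʷ w′ = i ∷ (w ++ʷ w′)

    splice : ∀ {i l u j : Fin n} {A} → Walk i l A → (u , j) ∈ A → ∃ λ A′ → Walk i l A′ × A′ ↭ (u , u) ∷ A
    splice {u = u} (_ ∷ w) (here refl) = _ , u ∷ (u ∷ w) , ↭-refl
    splice (i ∷ w) (there a∈) with A′ , w′ , p ← splice w a∈ = _ , i ∷ w′ , ↭-trans (prep _ p) (swap _ _ ↭-refl)

    Eulerian-↭ : ∀ {A B : List (Arc n)} → A ↭ B → Eulerian A → Eulerian B
    Eulerian-↭ p (i , A , w , q) = i , A , w , ↭-trans q p

    -- A loop can be spliced in wherever the walk leaves `u`, and an arc with source `u` still
    -- occurs after each insertion.
    Eulerian-loops : ∀ {u j : Fin n} {B} m → (u , j) ∈ B → Eulerian B → Eulerian (replicate m (u , u) ++ B)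
    Eulerian-loops zero    a∈ eul = eul
    Eulerian-loops (suc m) a∈ eul with i , A , w , p ← Eulerian-loops m a∈ eul
      with A′ , w′ , p′ ← splice w (↭.∈-resp-↭ (↭-sym p) (∈-++⁺ʳ (replicate m _) a∈)) =
      i , A′ , w′ , ↭-trans p′ (prep _ p)

    -- Keeps the root of the row in its place.
    insertSecond : ∀ {m} → Fin n → Vec (Fin n) (suc m) → Vec (Fin n) (suc (suc m))
    insertSecond x (z ∷ r) = z ∷ x ∷ r

    -- One row for each element of the list, rooted there and enumerating the whole list; their arcs
    -- are those of the complete digraph on it.
    rows : ∀ {m} → Vec (Fin n) (suc m) → Vec (Vec (Fin n) (suc m)) (suc m)
    rows (x ∷ [])     = (x ∷ []) ∷ []
    rows (x ∷ y ∷ ys) = (x ∷ y ∷ ys) ∷ Vec.map (insertSecond x) (rows (y ∷ ys))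

    rows-↭ : ∀ {m} (L : Vec (Fin n) (suc m)) i → toList (lookup (rows L) i) ↭ toList L
    rows-↭ (x ∷ [])     zero    = ↭-refl
    rows-↭ (x ∷ y ∷ ys) zero    = ↭-refl
    rows-↭ (x ∷ y ∷ ys) (suc i) = ↭-trans (↭.↭-reflexive (cong toList (Vec.lookup-map i (insertSecond x) (rows (y ∷ ys)))))
      (↭-trans (second (lookup (rows (y ∷ ys)) i)) (prep x (rows-↭ (y ∷ ys) i)))
      where
      second : ∀ {m} (r : Vec (Fin n) (suc m)) → toList (insertSecond x r) ↭ x ∷ toList r
      second (z ∷ r) = swap z x ↭-refl

    heads-rows : ∀ {m} (L : Vec (Fin n) (suc m)) → Vec.map Vec.head (rows L) ≡ L
    heads-rows (x ∷ [])     = refl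
    heads-rows (x ∷ y ∷ ys) = cong (x ∷_) (trans (sym (Vec.map-∘ Vec.head (insertSecond x) (rows (y ∷ ys))))
      (trans (Vec.map-cong (λ { (z ∷ r) → refl }) (rows (y ∷ ys))) (heads-rows (y ∷ ys))))

    arcs-insertSecond : ∀ {m d} x (t : Vec (Vec (Fin n) (suc m)) d) →
      arcs (Vec.map (insertSecond x) t) ↭ map (_, x) (toList (Vec.map Vec.head t)) ++ arcs t
    arcs-insertSecond x []            = ↭-refl
    arcs-insertSecond x ((z ∷ r) ∷ t) = prep _ (↭-trans
      (↭.++⁺ˡ (rowArcs (z ∷ r)) (arcs-insertSecond x t))
      (↭.shifts (rowArcs (z ∷ r)) (map (_, x) (toList (Vec.map Vec.head t)))))

    star : Fin n → List (Fin n) → List (Arc n)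
    star x []       = []
    star x (z ∷ zs) = (x , z) ∷ (z , x) ∷ star x zs

    star-walk : ∀ x zs → Walk x x (star x zs)
    star-walk x []       = []
    star-walk x (z ∷ zs) = x ∷ (z ∷ star-walk x zs)

    star-↭ : ∀ x zs → star x zs ↭ map (x ,_) zs ++ map (_, x) zs
    star-↭ x []       = ↭-refl
    star-↭ x (z ∷ zs) = prep _ (↭-trans (prep _ (star-↭ x zs)) (↭-sym (↭.shift (z , x) (map (x ,_) zs) (map (_, x) zs))))

    -- A circuit of the complete digraph on x, y, ys: out to y, around the
    -- complete digraph on y, ys, back to x, then to each of ys and back.
    circuit : ∀ {m} (x : Fin n) (xs : Vec (Fin n) m) → ∃ λ A → Walk x x A × A ↭ arcs (rows (x ∷ xs))
    circuit x []       = [] , [] , ↭-refl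
    circuit x (y ∷ ys) with A , w , p ← circuit y ys =
      _ , (x ∷ (w ++ʷ (y ∷ []))) ++ʷ star-walk x (toList ys) , prep _ (begin
        (A ++ (y , x) ∷ []) ++ star x ysˡ
          ↭⟨ ↭.++-comm (A ++ (y , x) ∷ []) (star x ysˡ) ⟩
        star x ysˡ ++ (A ++ (y , x) ∷ [])
          ↭⟨ ↭.++⁺ (star-↭ x ysˡ) (↭-trans (↭.++-comm A ((y , x) ∷ [])) (prep _ p)) ⟩
        (map (x ,_) ysˡ ++ map (_, x) ysˡ) ++ (y , x) ∷ arcs (rows (y ∷ ys))
          ≡⟨ List.++-assoc (map (x ,_) ysˡ) (map (_, x) ysˡ) _ ⟩
        map (x ,_) ysˡ ++ map (_, x) ysˡ ++ (y , x) ∷ arcs (rows (y ∷ ys))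
          ↭⟨ ↭.++⁺ˡ (map (x ,_) ysˡ) (↭.shift (y , x) (map (_, x) ysˡ) _) ⟩
        map (x ,_) ysˡ ++ map (_, x) (toList (y ∷ ys)) ++ arcs (rows (y ∷ ys))
          ≡⟨ cong (λ v → map (x ,_) ysˡ ++ map (_, x) (toList v) ++ arcs (rows (y ∷ ys))) (heads-rows (y ∷ ys)) ⟨
        map (x ,_) ysˡ ++ map (_, x) (toList (Vec.map Vec.head (rows (y ∷ ys)))) ++ arcs (rows (y ∷ ys))
          ↭⟨ ↭.++⁺ˡ (map (x ,_) ysˡ) (arcs-insertSecond x (rows (y ∷ ys))) ⟨
        map (x ,_) ysˡ ++ arcs (Vec.map (insertSecond x) (rows (y ∷ ys))) ∎)
      where
      open ↭.PermutationReasoning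
      ysˡ = toList ys

  ∈-replicate⇒≡ : ∀ {a} {A : Set a} m {x y : A} → y ∈ replicate m x → y ≡ x
  ∈-replicate⇒≡ (suc m) (here eq)  = eq
  ∈-replicate⇒≡ (suc m) (there y∈) = ∈-replicate⇒≡ m y∈

  module _ {n k : ℕ} where

    open Rows {n} {k}

    loopRow : Fin n → Vec (Fin n) (suc k)
    loopRow u = Vec.replicate (suc k) u

    arcs-++ : ∀ {d d′} (s : Vec (Vec (Fin n) (suc k)) d) (t : Vec (Vec (Fin n) (suc k)) d′) →
      arcs (s Vec.++ t) ≡ arcs s ++ arcs t
    arcs-++ []      t = refl
    arcs-++ (ρ ∷ s) t = trans (cong (rowArcs ρ ++_) (arcs-++ s t)) (sym (List.++-assoc (rowArcs ρ) (arcs s) (arcs t)))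

    loops-++ : ∀ {d d′} (s : Vec (Vec (Fin n) (suc k)) d) (t : Vec (Vec (Fin n) (suc k)) d′) →
      loops (s Vec.++ t) ≡ loops s ++ loops t
    loops-++ []      t = refl
    loops-++ (ρ ∷ s) t with does (diagonal? ρ)
    ... | true  = cong (Vec.head ρ ∷_) (loops-++ s t)
    ... | false = loops-++ s t

    supports-++ : ∀ {d d′} (s : Vec (Vec (Fin n) (suc k)) d) (t : Vec (Vec (Fin n) (suc k)) d′) →
      supports (s Vec.++ t) ≡ supports s ++ supports t
    supports-++ []      t = refl
    supports-++ (ρ ∷ s) t with does (diagonal? ρ)
    ... | true  = supports-++ s t
    ... | false = cong (support ρ ∷_) (supports-++ s t)

    loops-loopRow : ∀ {d} u (s : Vec (Vec (Fin n) (suc k)) d) → loops (loopRow u ∷ s) ≡ u ∷ loops s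
    loops-loopRow u s rewrite dec-true (diagonal? (loopRow u)) refl = refl

    supports-loopRow : ∀ {d} u (s : Vec (Vec (Fin n) (suc k)) d) → supports (loopRow u ∷ s) ≡ supports s
    supports-loopRow u s rewrite dec-true (diagonal? (loopRow u)) refl = refl

    rowArcs-loopRow : ∀ u → rowArcs (loopRow u) ≡ replicate k (u , u)
    rowArcs-loopRow u = trans (cong (map (u ,_)) (toList-replicate k u)) (List.map-replicate (u ,_) k u)

    root-arc : 1 ℕ.≤ k → ∀ {d} (s : Vec (Vec (Fin n) (suc k)) d) {u} → u ∈ toList (Vec.map Vec.head s) → ∃ λ j → (u , j) ∈ arcs s
    root-arc (s≤s _) ((i ∷ j ∷ γ) ∷ s) (here refl) = j , here refl
    root-arc 1≤k     (ρ ∷ s)           (there u∈)  = Product.map₂ (∈-++⁺ʳ (rowArcs ρ)) (root-arc 1≤k s u∈)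

    private
      ↭⇒nonDiagonal : 1 ℕ.≤ k → ∀ {L ρ : Vec (Fin n) (suc k)} → Unique (toList L) → toList ρ ↭ toList L →
        Vec.tail ρ ≢ Vec.replicate k (Vec.head ρ)
      ↭⇒nonDiagonal (s≤s _) {ρ = i ∷ j ∷ γ} u p eq with unique-↭ (↭-sym p) u
      ... | (i≢j ∷ _) ∷ _ = i≢j (sym (cong Vec.head eq))

      ↭⇒support : ∀ {L ρ : Vec (Fin n) (suc k)} → toList ρ ↭ toList L → support ρ ≡ support L
      ↭⇒support {L} {ρ} p = subset-ext
        (λ v v∈ → ∈⇒∈⋃ (↭.∈-resp-↭ p (∈⋃⇒∈ (toList ρ) v∈)))
        (λ v v∈ → ∈⇒∈⋃ (↭.∈-resp-↭ (↭-sym p) (∈⋃⇒∈ (toList L) v∈)))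

    loops-supports-↭ : 1 ℕ.≤ k → ∀ {L : Vec (Fin n) (suc k)} → Unique (toList L) → ∀ {d} (s : Vec (Vec (Fin n) (suc k)) d) →
      (∀ i → toList (lookup s i) ↭ toList L) → loops s ≡ [] × supports s ≡ replicate d (support L)
    loops-supports-↭ 1≤k u []      h = refl , refl
    loops-supports-↭ 1≤k {L} u (ρ ∷ s) h
      rewrite dec-false (diagonal? ρ) (↭⇒nonDiagonal 1≤k u (h zero)) =
      Product.map₂ (cong₂ _∷_ (↭⇒support {L} {ρ} (h zero))) (loops-supports-↭ 1≤k u s (h ∘ suc))

    loops-supports-rows : 1 ℕ.≤ k → ∀ {L : Vec (Fin n) (suc k)} → Unique (toList L) →
      loops (rows L) ≡ [] × supports (rows L) ≡ replicate (suc k) (support L)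
    loops-supports-rows 1≤k {L} u = loops-supports-↭ 1≤k u (rows L) (rows-↭ L)

    private
      twoLoops : Fin n → Fin n → Vec (Vec (Fin n) (suc k)) 2
      twoLoops u v = loopRow u ∷ loopRow v ∷ []

      loops-twoLoops : ∀ u v → loops (twoLoops u v) ≡ u ∷ v ∷ []
      loops-twoLoops u v = trans (loops-loopRow u (loopRow v ∷ [])) (cong (u ∷_) (loops-loopRow v []))

      supports-twoLoops : ∀ u v → supports (twoLoops u v) ≡ []
      supports-twoLoops u v = trans (supports-loopRow u (loopRow v ∷ [])) (supports-loopRow v [])

      Eulerian-twoLoops : ∀ {d} (s : Vec (Vec (Fin n) (suc k)) d) {u v i j} → (u , i) ∈ arcs s → (v , j) ∈ arcs s →
        Eulerian (arcs s) → Eulerian (arcs (s Vec.++ twoLoops u v))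
      Eulerian-twoLoops s {u} {v} u∈ v∈ eul = Eulerian-↭
        (↭-trans (↭.++⁺ˡ (replicate k (u , u)) (↭.++-comm (replicate k (v , v)) (arcs s)))
        (↭-trans (↭.shifts (replicate k (u , u)) (arcs s)) (↭.↭-reflexive (trans
          (cong₂ (λ a b → arcs s ++ a ++ b) (sym (rowArcs-loopRow u)) (trans (sym (rowArcs-loopRow v)) (sym (List.++-identityʳ _))))
          (sym (arcs-++ s (twoLoops u v)))))))
        (Eulerian-loops k (∈-++⁺ʳ (replicate k (v , v)) u∈) (Eulerian-loops k v∈ eul))

      head-arc : 1 ℕ.≤ k → ∀ (L : Vec (Fin n) (suc k)) {u} → u ∈ toList L → ∃ λ j → (u , j) ∈ arcs (rows L)
      head-arc 1≤k L u∈ = root-arc 1≤k (rows L) (subst (λ l → _ ∈ toList l) (sym (heads-rows L)) u∈)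

    -- The least number of rows that can meet an edge, followed by two loops; its length is the
    -- threshold of the first comparison.
    oneEdgeConfig : Vec (Fin n) (suc k) → Fin n → Fin n → Vec (Vec (Fin n) (suc k)) (suc k ℕ.+ 2)
    oneEdgeConfig L u v = rows L Vec.++ twoLoops u v

    twoEdgeConfig : Vec (Fin n) (suc k) → Vec (Fin n) (suc k) → Fin n → Fin n →
      Vec (Vec (Fin n) (suc k)) ((suc k ℕ.+ suc k) ℕ.+ 2)
    twoEdgeConfig L L′ u v = (rows L Vec.++ rows L′) Vec.++ twoLoops u v

    module _ (1≤k : 1 ℕ.≤ k) where

      oneEdgeConfig-Eulerian : ∀ L {u v} → u ∈ toList L → v ∈ toList L → Eulerian (arcs (oneEdgeConfig L u v))
      oneEdgeConfig-Eulerian L@(x ∷ xs) u∈ v∈ =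
        Eulerian-twoLoops (rows L) (proj₂ (head-arc 1≤k L u∈)) (proj₂ (head-arc 1≤k L v∈)) (x , circuit x xs)

      oneEdgeConfig-loops : ∀ {L} u v → Unique (toList L) → loops (oneEdgeConfig L u v) ≡ u ∷ v ∷ []
      oneEdgeConfig-loops {L} u v uniq = trans (loops-++ (rows L) (twoLoops u v))
        (cong₂ _++_ (proj₁ (loops-supports-rows 1≤k uniq)) (loops-twoLoops u v))

      oneEdgeConfig-supports : ∀ {L} u v → Unique (toList L) → One (support L) (supports (oneEdgeConfig L u v))
      oneEdgeConfig-supports {L} u v uniq = subst (One (support L)) (sym (trans (supports-++ (rows L) (twoLoops u v))
          (trans (cong₂ _++_ (proj₂ (loops-supports-rows 1≤k uniq)) (supports-twoLoops u v)) (List.++-identityʳ _))))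
        (here refl , ∈-replicate⇒≡ (suc k))

      -- Both circuits start at the common vertex `c`, so they can be traversed one after the other.
      twoEdgeConfig-Eulerian : ∀ c (xs ys : Vec (Fin n) k) {u v} → u ∈ toList (c ∷ xs) → v ∈ toList (c ∷ ys) →
        Eulerian (arcs (twoEdgeConfig (c ∷ xs) (c ∷ ys) u v))
      twoEdgeConfig-Eulerian c xs ys {u} {v} u∈ v∈ = Eulerian-twoLoops (rows L Vec.++ rows L′)
          (subst ((u , proj₁ (head-arc 1≤k L u∈)) ∈_) (sym (arcs-++ (rows L) (rows L′))) (∈-++⁺ˡ (proj₂ (head-arc 1≤k L u∈))))
          (subst ((v , proj₁ (head-arc 1≤k L′ v∈)) ∈_) (sym (arcs-++ (rows L) (rows L′))) (∈-++⁺ʳ (arcs (rows L)) (proj₂ (head-arc 1≤k L′ v∈))))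
          both
        where
        L L′ : Vec (Fin n) (suc k)
        L  = c ∷ xs
        L′ = c ∷ ys
        both : Eulerian (arcs (rows L Vec.++ rows L′))
        both with A , w , p ← circuit c xs | A′ , w′ , p′ ← circuit c ys =
          c , A ++ A′ , w ++ʷ w′ , ↭-trans (↭.++⁺ p p′) (↭.↭-reflexive (sym (arcs-++ (rows L) (rows L′))))

      twoEdgeConfig-loops : ∀ {L L′} u v → Unique (toList L) → Unique (toList L′) → loops (twoEdgeConfig L L′ u v) ≡ u ∷ v ∷ []
      twoEdgeConfig-loops {L} {L′} u v uniq uniq′ = trans (loops-++ (rows L Vec.++ rows L′) (twoLoops u v))
        (cong₂ _++_ (trans (loops-++ (rows L) (rows L′))
          (cong₂ _++_ (proj₁ (loops-supports-rows 1≤k uniq)) (proj₁ (loops-supports-rows 1≤k uniq′)))) (loops-twoLoops u v))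

      twoEdgeConfig-supports : ∀ {L L′} u v → Unique (toList L) → Unique (toList L′) →
        Two (support L) (support L′) (supports (twoEdgeConfig L L′ u v))
      twoEdgeConfig-supports {L} {L′} u v uniq uniq′ = subst (Two (support L) (support L′))
        (sym (trans (supports-++ (rows L Vec.++ rows L′) (twoLoops u v))
          (trans (cong₂ _++_ (trans (supports-++ (rows L) (rows L′))
            (cong₂ _++_ (proj₂ (loops-supports-rows 1≤k uniq)) (proj₂ (loops-supports-rows 1≤k uniq′)))) (supports-twoLoops u v))
            (List.++-identityʳ _))))
        ( here refl , ∈-++⁺ʳ (replicate (suc k) (support L)) (here refl)
        , λ f∈ → Sum.map (∈-replicate⇒≡ (suc k)) (∈-replicate⇒≡ (suc k))
            (∈-++⁻ (replicate (suc k) (support L)) f∈))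

    constantConfig : ∀ d → Fin n → Vec (Vec (Fin n) (suc k)) d
    constantConfig d u = Vec.replicate d (loopRow u)

    constantConfig-Eulerian : ∀ d u → Eulerian (arcs (constantConfig d u))
    constantConfig-Eulerian d u = u , _ , go d , ↭-refl
      where
      loopWalk : ∀ m {A} → Walk u u A → Walk u u (replicate m (u , u) ++ A)
      loopWalk zero    w = w
      loopWalk (suc m) w = u ∷ loopWalk m w
      go : ∀ d → Walk u u (arcs (constantConfig d u))
      go zero    = []
      go (suc d) = subst (λ B → Walk u u (B ++ arcs (constantConfig d u))) (sym (rowArcs-loopRow u)) (loopWalk k (go d))

    constantConfig-loops : ∀ d u → loops (constantConfig d u) ≡ replicate d u
    constantConfig-loops zero    u = refl
    constantConfig-loops (suc d) u = trans (loops-loopRow u (constantConfig d u)) (cong (u ∷_) (constantConfig-loops d u))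

    constantConfig-supports : ∀ d u → supports (constantConfig d u) ≡ []
    constantConfig-supports zero    u = refl
    constantConfig-supports (suc d) u = trans (supports-loopRow u (constantConfig d u)) (constantConfig-supports d u)
open Circuits public

-- Contributions of vertices, edges and pairs of edges

module Contributions {c ℓ₁ ℓ₂} (K : OrderedField c ℓ₁ ℓ₂) {n k : ℕ} (y : OrderedField.Carrier K)
  (0<y : OrderedField._<_ K (OrderedField.0# K) y) (1≤k : 1 ℕ.≤ k) where

  open OrderedFields K
  open Expectations K {n} {k} y 0<y
  open import Relation.Binary.Reasoning.Setoid R.setoid using (begin_; _∎; step-≈-⟩; step-≈-⟨)

  private
    support-arc : ∀ {d} (s : Config d) {e} → e ∈ supports s → ∃ λ r → r ∈ₛ e × ∃ λ j → (r , j) ∈ arcs s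
    support-arc s e∈ with (r , _) , x∈ , ≡.refl ← ∈-map⁻ proj₂ e∈ = r , spanned-∈ s x∈ , spanned-arc 1≤k s x∈

    closed-under : ∀ {d} (s : Config d) (X : Fin n → Set) → (∀ {e} → e ∈ supports s → ∀ {i j} → i ∈ₛ e → j ∈ₛ e → X i → X j) →
      ∀ {i j} → (i , j) ∈ arcs s → X i → X j
    closed-under s X h a∈ Xi with arc-cases s a∈
    ... | inj₁ ≡.refl                  = Xi
    ... | inj₂ (e , e∈ , i∈e , j∈e) = h e∈ i∈e j∈e Xi

  -- Without spanning rows all arcs are loops, and a closed walk cannot leave its vertex.
  loops-empty : ∀ {d} (s : Config d) → Eulerian (arcs s) → supports s ≡ [] →
    ∀ {u v} → u ∈ loops s → v ∈ loops s → v ≡ u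
  loops-empty s eul none {u} u∈ v∈ = Eulerian-connected eul (_≡ u)
    (closed-under s (_≡ u) (λ {e} e∈ → contradiction (subst (e ∈_) none e∈) λ ()))
    (loops-arc 1≤k s u∈) (loops-arc 1≤k s v∈) ≡.refl

  -- The edge is closed under all arcs, so the walk stays in it. This is why `Φ₁` sees the diagonal
  -- entries on `e` only.
  loops-one : ∀ {d e} (s : Config d) → Eulerian (arcs s) → One e (supports s) → ∀ {u} → u ∈ loops s → u ∈ₛ e
  loops-one {e = e} s eul (e∈ , only) u∈ with r , r∈e , _ , a∈ ← support-arc s e∈ =
    Eulerian-connected eul (_∈ₛ e) (closed-under s (_∈ₛ e) (λ f∈ _ j∈f _ → subst (_ ∈ₛ_) (only f∈) j∈f))
      a∈ (loops-arc 1≤k s u∈) r∈e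

  loops-two : ∀ {d e e′} (s : Config d) → Eulerian (arcs s) → Two e e′ (supports s) →
    ∀ {u} → u ∈ loops s → u ∈ₛ e ⊎ u ∈ₛ e′
  loops-two {e = e} {e′} s eul (e∈ , _ , only) u∈ with r , r∈e , _ , a∈ ← support-arc s e∈ =
    Eulerian-connected eul X (closed-under s X (λ f∈ _ j∈f _ → in-X (only f∈) j∈f))
      a∈ (loops-arc 1≤k s u∈) (inj₁ r∈e)
    where
    X : Fin n → Set
    X v = v ∈ₛ e ⊎ v ∈ₛ e′
    in-X : ∀ {f j} → f ≡ e ⊎ f ≡ e′ → j ∈ₛ f → X j
    in-X (inj₁ ≡.refl) j∈ = inj₁ j∈
    in-X (inj₂ ≡.refl) j∈ = inj₂ j∈

  -- If the edges were disjoint, `e` would be closed under the arcs, and the walk could not reach a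
  -- root in `e′`.
  two-meet : ∀ {d e e′} (s : Config d) → Eulerian (arcs s) → Two e e′ (supports s) →
    ¬ (∀ v → v ∈ₛ e → v ∉ₛ e′)
  two-meet {e = e} {e′} s eul (e∈ , e′∈ , only) disjoint
    with r , r∈e , _ , a∈ ← support-arc s e∈ | r′ , r′∈e′ , _ , b∈ ← support-arc s e′∈ =
    disjoint r′ (Eulerian-connected eul (_∈ₛ e) (closed-under s (_∈ₛ e) closed) a∈ b∈ r∈e) r′∈e′
    where
    closed : ∀ {f} → f ∈ supports s → ∀ {i j} → i ∈ₛ f → j ∈ₛ f → i ∈ₛ e → j ∈ₛ e
    closed f∈ i∈f j∈f i∈e with only f∈
    ... | inj₁ ≡.refl = j∈f
    ... | inj₂ ≡.refl = contradiction i∈f (disjoint _ i∈e)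

  Φ₁-zero : ∀ {E} → Arboreal E → ∀ {d} → d ℕ.< suc k → ∀ x {e} → e ∈ E → Φ₁ d x e ≈ 0#
  Φ₁-zero {E} arb {d} d<K x {e} e∈E = 𝔼-0 {d} λ s eul → 𝟙*-0 (one? e (supports s)) λ (e∈ , only) →
    ℕ.<⇒≱ d<K (ℕ.≤-trans (ℕ.≤-reflexive (≡.sym (ℕ.+-identityʳ (suc k)))) (ℕ.≤-trans (ℕ.m≤n+m _ (length (loops s)))
      (supports-count arb s eul (λ f∈ → subst (_∈ E) (≡.sym (only f∈)) e∈E) ([] ∷ []) λ { (here ≡.refl) → e∈ })))

  two-within : ∀ {E : List (Subset n)} {e e′ l} → e ∈ E → e′ ∈ E → Two e e′ l → Within E l
  two-within e∈E e′∈E (_ , _ , only) f∈ with only f∈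
  ... | inj₁ ≡.refl = e∈E
  ... | inj₂ ≡.refl = e′∈E

  two-count : ∀ {E} → Arboreal E → ∀ {d} (s : Config d) → Eulerian (arcs s) → ∀ {e e′} → e ∈ E → e′ ∈ E → e ≢ e′ →
    Two e e′ (supports s) → length (loops s) ℕ.+ (suc k ℕ.+ suc k) ℕ.≤ d
  two-count arb s eul e∈E e′∈E e≢e′ two@(e∈ , e′∈ , _) = ℕ.≤-trans
    (ℕ.≤-reflexive (cong (λ z → length (loops s) ℕ.+ (suc k ℕ.+ z)) (≡.sym (ℕ.+-identityʳ (suc k)))))
    (supports-count arb s eul (two-within e∈E e′∈E two) ((e≢e′ ∷ []) ∷ [] ∷ [])
      λ { (here ≡.refl) → e∈ ; (there (here ≡.refl)) → e′∈ })

  one-count : ∀ {E} → Arboreal E → ∀ {d} (s : Config d) → Eulerian (arcs s) → ∀ {e} → e ∈ E →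
    One e (supports s) → length (loops s) ℕ.+ suc k ℕ.≤ d
  one-count {E} arb s eul e∈E (e∈ , only) = ℕ.≤-trans
    (ℕ.≤-reflexive (cong (length (loops s) ℕ.+_) (≡.sym (ℕ.+-identityʳ (suc k)))))
    (supports-count arb s eul (λ f∈ → subst (_∈ E) (≡.sym (only f∈)) e∈E) ([] ∷ []) λ { (here ≡.refl) → e∈ })

  Φ₂-zero : ∀ {E} → Arboreal E → ∀ {d} → d ℕ.< suc k ℕ.+ suc k → ∀ x {e e′} → e ∈ E → e′ ∈ E → e ≢ e′ → Φ₂ d x e e′ ≈ 0#
  Φ₂-zero arb {d} d<2K x {e} {e′} e∈E e′∈E e≢e′ = 𝔼-0 {d} λ s eul → 𝟙*-0 (two? e e′ (supports s)) λ two →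
    ℕ.<⇒≱ d<2K (ℕ.≤-trans (ℕ.m≤n+m _ (length (loops s))) (two-count arb s eul e∈E e′∈E e≢e′ two))

  Φ₂-disjoint : ∀ d x {e e′} → (∀ v → v ∈ₛ e → v ∉ₛ e′) → Φ₂ d x e e′ ≈ 0#
  Φ₂-disjoint d x {e} {e′} disj = 𝔼-0 {d} λ s eul → 𝟙*-0 (two? e e′ (supports s)) λ two → two-meet s eul two disj

  Φ₂-sym : ∀ d x e e′ → Φ₂ d x e e′ ≈ Φ₂ d x e′ e
  Φ₂-sym d x e e′ = 𝔼-cong {d} λ s _ → 𝟙*-cong (two? e e′ (supports s)) (two? e′ e (supports s)) flip flip (λ _ → R.refl)
    where
    flip : ∀ {e e′ : Subset n} {l} → Two e e′ l → Two e′ e l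
    flip (a , b , h) = b , a , Sum.swap ∘ h

  module _ (π : Permutation′ n) where

    private
      ∈-map-image : ∀ {e : Subset n} {l} → image π e ∈ map (image π) l → e ∈ l
      ∈-map-image {l = l} e∈ with f , f∈ , eq ← ∈-map⁻ (image π) e∈ = subst (_∈ l) (image-injective π (≡.sym eq)) f∈

    One-image⁺ : ∀ {e l} → One e l → One (image π e) (map (image π) l)
    One-image⁺ (e∈ , only) = ∈-map⁺ (image π) e∈ , λ f∈ → case ∈-map⁻ (image π) f∈ of λ { (g , g∈ , ≡.refl) → cong (image π) (only g∈) }

    One-image⁻ : ∀ {e l} → One (image π e) (map (image π) l) → One e l
    One-image⁻ (e∈ , only) = ∈-map-image e∈ , λ f∈ → image-injective π (only (∈-map⁺ (image π) f∈))

    Two-image⁺ : ∀ {e e′ l} → Two e e′ l → Two (image π e) (image π e′) (map (image π) l)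
    Two-image⁺ (e∈ , e′∈ , only) = ∈-map⁺ (image π) e∈ , ∈-map⁺ (image π) e′∈ ,
      λ f∈ → case ∈-map⁻ (image π) f∈ of λ { (g , g∈ , ≡.refl) → Sum.map (cong (image π)) (cong (image π)) (only g∈) }

    Two-image⁻ : ∀ {e e′ l} → Two (image π e) (image π e′) (map (image π) l) → Two e e′ l
    Two-image⁻ (e∈ , e′∈ , only) = ∈-map-image e∈ , ∈-map-image e′∈ ,
      λ f∈ → Sum.map (image-injective π) (image-injective π) (only (∈-map⁺ (image π) f∈))

    private
      ∏-loops-map : ∀ {d} (s : Config d) (x′ : Fin n → Carrier) →
        ∏ (loops (mapConfig (π ⟨$⟩ʳ_) s)) x′ ≡ ∏ (loops s) (x′ ∘ (π ⟨$⟩ʳ_))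
      ∏-loops-map s x′ = ≡.trans (cong (λ l → ∏ l x′) (loops-map π s)) (∏-map (π ⟨$⟩ʳ_) (loops s) x′)

    -- Agreement of the entries on `e` is enough, because all loops lie there.
    Φ₁-image : ∀ d {e x x′} → (∀ {v} → v ∈ₛ e → x′ (π ⟨$⟩ʳ v) ≈ x v) → Φ₁ d x e ≈ Φ₁ d x′ (image π e)
    Φ₁-image d {e} {x} {x′} same = R.sym (R.trans (𝔼-map π {d} _) (𝔼-cong {d} λ s eul →
      𝟙*-cong (one? (image π e) (supports (mapConfig (π ⟨$⟩ʳ_) s))) (one? e (supports s))
        (One-image⁻ ∘ subst (One (image π e)) (supports-map π s))
        (subst (One (image π e)) (≡.sym (supports-map π s)) ∘ One-image⁺)
        λ one → R.trans (R.reflexive (∏-loops-map s x′)) (∏-cong∈ (loops s) λ u∈ →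
          same (loops-one s eul (One-image⁻ (subst (One (image π e)) (supports-map π s) one)) u∈))))

    Φ₂-image : ∀ d {e e′ x x′} → (∀ {v} → v ∈ₛ e ⊎ v ∈ₛ e′ → x′ (π ⟨$⟩ʳ v) ≈ x v) →
      Φ₂ d x e e′ ≈ Φ₂ d x′ (image π e) (image π e′)
    Φ₂-image d {e} {e′} {x} {x′} same = R.sym (R.trans (𝔼-map π {d} _) (𝔼-cong {d} λ s eul →
      𝟙*-cong (two? (image π e) (image π e′) (supports (mapConfig (π ⟨$⟩ʳ_) s))) (two? e e′ (supports s))
        (Two-image⁻ ∘ subst (Two (image π e) (image π e′)) (supports-map π s))
        (subst (Two (image π e) (image π e′)) (≡.sym (supports-map π s)) ∘ Two-image⁺)
        λ two → R.trans (R.reflexive (∏-loops-map s x′)) (∏-cong∈ (loops s) λ u∈ →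
          same (loops-two s eul (Two-image⁻ (subst (Two (image π e) (image π e′)) (supports-map π s) two)) u∈))))

  private
    _≟ˡ_ : (a b : List (Fin n)) → Dec (a ≡ b)
    _≟ˡ_ = List.≡-dec Fin._≟_

    constantDec : ∀ {d} (s : Config d) u → Dec (supports s ≡ [] × loops s ≡ replicate d u)
    constantDec {d} s u = empty? (supports s) ×-dec (loops s ≟ˡ replicate d u)

  -- For positive `d`, the coefficient of the `d`-th power of the entry at `u` in `Φ₀`.
  loopCoefficient : ∀ d → Fin n → Carrier
  loopCoefficient d u = 𝔼 d (λ s → 𝟙 (constantDec s u))

  loopCoefficient-pos : ∀ d u → 0# < loopCoefficient d u
  loopCoefficient-pos d u = 𝔼-pos {d} (λ s → 𝟙-nonneg (constantDec s u)) (constantConfig d u) (constantConfig-Eulerian d u)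
    (<-respʳ-≈ (R.sym (𝟙-yes (constantDec (constantConfig d u) u)
      (constantConfig-supports d u , constantConfig-loops d u))) 0<1)

  loopCoefficient-const : ∀ d u v → loopCoefficient d v ≈ loopCoefficient d u
  loopCoefficient-const d u v = R.trans (𝔼-map π {d} _) (𝔼-cong {d} λ s _ →
    𝟙-⇔ (constantDec (mapConfig (π ⟨$⟩ʳ_) s) v) (constantDec s u) (to s) (from s))
    where
    π = Perm.transpose u v
    πu≡v : map (π ⟨$⟩ʳ_) (replicate d u) ≡ replicate d v
    πu≡v = ≡.trans (List.map-replicate (π ⟨$⟩ʳ_) d u) (cong (replicate d) (transpose-left u v))
    to : ∀ s → supports (mapConfig (π ⟨$⟩ʳ_) s) ≡ [] × loops (mapConfig (π ⟨$⟩ʳ_) s) ≡ replicate d v →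
         supports s ≡ [] × loops s ≡ replicate d u
    to s (a , b) = map-empty (≡.trans (≡.sym (supports-map π s)) a) ,
      List.map-injective (perm-injective π) (≡.trans (≡.sym (loops-map π s)) (≡.trans b (≡.sym πu≡v)))
      where
      map-empty : ∀ {l} → map (image π) l ≡ [] → l ≡ []
      map-empty {[]} _ = ≡.refl
    from : ∀ s → supports s ≡ [] × loops s ≡ replicate d u →
         supports (mapConfig (π ⟨$⟩ʳ_) s) ≡ [] × loops (mapConfig (π ⟨$⟩ʳ_) s) ≡ replicate d v
    from s (a , b) = ≡.trans (supports-map π s) (cong (map (image π)) a) ,
      ≡.trans (loops-map π s) (≡.trans (cong (map (π ⟨$⟩ʳ_)) b) πu≡v)

  -- All loops of such a configuration sit at one vertex, which is determined because there is at
  -- least one loop; its coefficient is the same at every vertex, by a transposition.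
  Φ₀-powerSum : ∀ d v x → Φ₀ (suc d) x ≈ loopCoefficient (suc d) v * ⅀ (allFin n) (λ u → ∏ (replicate (suc d) u) x)
  Φ₀-powerSum d v x = begin
    Φ₀ D x
      ≈⟨ 𝔼-cong {D} pointwise ⟩
    𝔼 D (λ s → ⅀ (allFin n) (λ u → 𝟙 (constantDec s u) * X u))
      ≈⟨ 𝔼-⅀ {d = D} (allFin n) _ ⟩
    ⅀ (allFin n) (λ u → 𝔼 D (λ s → 𝟙 (constantDec s u) * X u))
      ≈⟨ ⅀-cong (allFin n) (λ u → R.trans (𝔼-*ʳ {D} _ (X u)) (R.*-congʳ (loopCoefficient-const D v u))) ⟩
    ⅀ (allFin n) (λ u → loopCoefficient D v * X u)
      ≈⟨ ⅀-*ˡ (allFin n) _ _ ⟨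
    loopCoefficient D v * ⅀ (allFin n) X ∎
    where
    D = suc d
    X : Fin n → Carrier
    X u = ∏ (replicate D u) x
    allSame : ∀ {m} (l : List (Fin n)) → length l ≡ suc m → (∀ {a b} → a ∈ l → b ∈ l → b ≡ a) → ∃ λ u → l ≡ replicate (suc m) u
    allSame {m} (a ∷ l) eq h = a , cong (a ∷_) (go m l (ℕ.suc-injective eq) (λ b∈ → h (here ≡.refl) (there b∈)))
      where
      go : ∀ m l → length l ≡ m → (∀ {b} → b ∈ l → b ≡ a) → l ≡ replicate m a
      go zero    []      _  _ = ≡.refl
      go (suc m) (b ∷ l) eq h = cong₂ _∷_ (h (here ≡.refl)) (go m l (ℕ.suc-injective eq) (h ∘ there))
    Pointwise : Config D → Set _
    Pointwise s = 𝟙 (empty? (supports s)) * ∏ (loops s) x ≈ ⅀ (allFin n) (λ u → 𝟙 (constantDec s u) * X u)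
    none : ∀ s → supports s ≢ [] → Pointwise s
    none s ne = R.trans (𝟙*-0 (empty? (supports s)) ne) (R.sym (⅀-0 (allFin n) λ {u} _ → 𝟙*-0 (constantDec s u) (ne ∘ proj₁)))
    some : ∀ s → Eulerian (arcs s) → supports s ≡ [] → Pointwise s
    some s eul e with u , lu ← allSame {d} (loops s)
      (≡.trans (≡.sym (≡.trans (cong (λ l → length (loops s) ℕ.+ length l) e) (ℕ.+-identityʳ _))) (length-loops+supports s))
      (loops-empty s eul e) = R.trans
        (R.*-cong (R.trans (𝟙-yes (empty? (supports s)) e) (R.sym (𝟙-yes (constantDec s u) (e , lu)))) (R.reflexive (cong (λ l → ∏ l x) lu)))
        (R.sym (⅀-single (λ w → 𝟙 (constantDec s w) * X w) (Unique.allFin⁺ n) (∈-allFin u)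
          (λ {w} _ w≢u → 𝟙*-0 (constantDec s w) (λ (_ , lw) → w≢u (List.∷-injectiveˡ (≡.trans (≡.sym lw) lu))))))
    pointwise : ∀ s → Eulerian (arcs s) → Pointwise s
    pointwise s eul = [ some s eul , none s ]′ (Dec.toSum (empty? (supports s)))

  -- The mixed second difference of a product over two loops when the entries are changed by `A` and
  -- by `B`. For fewer loops that difference is zero; longer lists do not occur where it is applied.
  mix : (A B : Fin n → Carrier) → List (Fin n) → Carrier
  mix A B (u ∷ v ∷ []) = A u * B v + B u * A v
  mix A B _            = 0#

  mix-nonneg : ∀ {A B} → (∀ u → Nonneg (A u)) → (∀ u → Nonneg (B u)) → ∀ l → Nonneg (mix A B l)
  mix-nonneg a b []              = inj₁ R.refl
  mix-nonneg a b (_ ∷ [])        = inj₁ R.refl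
  mix-nonneg a b (u ∷ v ∷ [])    = nonneg-+ (nonneg-* (a u) (b v)) (nonneg-* (b u) (a v))
  mix-nonneg a b (_ ∷ _ ∷ _ ∷ _) = inj₁ R.refl

  mix-short : ∀ A B l → length l ℕ.< 2 → mix A B l ≈ 0#
  mix-short A B []          _ = R.refl
  mix-short A B (_ ∷ [])    _ = R.refl
  mix-short A B (_ ∷ _ ∷ l) (s≤s (s≤s ()))

  ∏-mixedDifference : ∀ {A B x x₁ x₂ x₁₂ : Fin n → Carrier} → (∀ v → x₁ v ≈ x v + A v) → (∀ v → x₂ v ≈ x v + B v) →
    (∀ v → x₁₂ v ≈ x v + A v + B v) → ∀ l → length l ℕ.≤ 2 → ∏ l x₁₂ + ∏ l x ≈ (∏ l x₁ + ∏ l x₂) + mix A B l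
  ∏-mixedDifference e₁ e₂ e₁₂ []           _ = R.sym (R.+-identityʳ _)
  ∏-mixedDifference {A} {B} {x} e₁ e₂ e₁₂ (u ∷ [])     _ = R.trans
    (R.+-congʳ (R.*-congʳ (e₁₂ u)))
    (R.trans (solve 3 (λ x a b → (x :+ a :+ b) :* con 1 :+ x :* con 1 := (x :+ a) :* con 1 :+ (x :+ b) :* con 1 :+ con 0) R.refl (x u) (A u) (B u))
      (R.+-congʳ (R.+-cong (R.*-congʳ (R.sym (e₁ u))) (R.*-congʳ (R.sym (e₂ u))))))
    where open import Algebra.Solver.Ring.NaturalCoefficients.Default R.commutativeSemiring
  ∏-mixedDifference {A} {B} {x} e₁ e₂ e₁₂ (u ∷ v ∷ []) _ = R.trans
    (R.+-congʳ (R.*-cong (e₁₂ u) (R.*-congʳ (e₁₂ v))))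
    (R.trans (solve 6 (λ x a b x′ a′ b′ →
        (x :+ a :+ b) :* ((x′ :+ a′ :+ b′) :* con 1) :+ x :* (x′ :* con 1) :=
        (x :+ a) :* ((x′ :+ a′) :* con 1) :+ (x :+ b) :* ((x′ :+ b′) :* con 1) :+ (a :* b′ :+ b :* a′)) R.refl (x u) (A u) (B u) (x v) (A v) (B v))
      (R.+-congʳ (R.+-cong (R.*-cong (R.sym (e₁ u)) (R.*-congʳ (R.sym (e₁ v)))) (R.*-cong (R.sym (e₂ u)) (R.*-congʳ (R.sym (e₂ v)))))))
    where open import Algebra.Solver.Ring.NaturalCoefficients.Default R.commutativeSemiring
  ∏-mixedDifference e₁ e₂ e₁₂ (_ ∷ _ ∷ _ ∷ _) (s≤s (s≤s ()))

  module _ {A B x x₁ x₂ x₁₂ : Fin n → Carrier} (e₁ : ∀ v → x₁ v ≈ x v + A v) (e₂ : ∀ v → x₂ v ≈ x v + B v)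
    (e₁₂ : ∀ v → x₁₂ v ≈ x v + A v + B v) {d : ℕ} {P : List (Subset n) → Set} (P? : ∀ l → Dec (P l))
    (short : ∀ (s : Config d) → Eulerian (arcs s) → P (supports s) → length (loops s) ℕ.≤ 2) where

    private
      V : (Fin n → Carrier) → Carrier
      V z = 𝔼 d (λ s → 𝟙 (P? (supports s)) * ∏ (loops s) z)

    mixedDifference : V x₁₂ + V x ≈ (V x₁ + V x₂) + 𝔼 d (λ s → 𝟙 (P? (supports s)) * mix A B (loops s))
    mixedDifference = R.trans (R.sym (𝔼-+ {d} _ _)) (R.trans
      (𝔼-cong {d} λ s eul → R.trans (R.sym (R.distribˡ _ _ _)) (R.trans
        (𝟙*-cong (P? (supports s)) (P? (supports s)) id id (λ p → ∏-mixedDifference e₁ e₂ e₁₂ (loops s) (short s eul p)))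
        (R.trans (R.distribˡ _ _ _) (R.+-congʳ (R.distribˡ _ _ _)))))
      (R.trans (𝔼-+ {d} _ _) (R.+-congʳ (𝔼-+ {d} _ _))))

  module _ {A B : Fin n → Carrier} (A≥0 : ∀ v → Nonneg (A v)) (B≥0 : ∀ v → Nonneg (B v))
    {u v : Fin n} (0<A : 0# < A u) (0<B : 0# < B v) where

    mix-pos : 0# < mix A B (u ∷ v ∷ [])
    mix-pos = pos+nonneg (*-pos 0<A 0<B) (nonneg-* (B≥0 u) (A≥0 v))

    -- The witness spans the edge once from each of its vertices and has one loop at `u` and one at
    -- `v`.
    mixed₁-pos : ∀ (L : Vec (Fin n) (suc k)) → Unique (toList L) → u ∈ toList L → v ∈ toList L →
      0# < 𝔼 (suc k ℕ.+ 2) (λ s → 𝟙 (one? (support L) (supports s)) * mix A B (loops s))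
    mixed₁-pos L uniq u∈ v∈ = 𝔼-pos {suc k ℕ.+ 2}
      (λ s → nonneg-* (𝟙-nonneg (one? (support L) (supports s))) (mix-nonneg A≥0 B≥0 (loops s)))
      (oneEdgeConfig L u v) (oneEdgeConfig-Eulerian 1≤k L u∈ v∈)
      (*-pos (<-respʳ-≈ (R.sym (𝟙-yes (one? (support L) (supports (oneEdgeConfig L u v))) (oneEdgeConfig-supports 1≤k u v uniq))) 0<1)
        (subst (λ l → 0# < mix A B l) (≡.sym (oneEdgeConfig-loops 1≤k u v uniq)) mix-pos))

    mixed₂-pos : ∀ o (xs ys : Vec (Fin n) k) → Unique (toList (o ∷ xs)) → Unique (toList (o ∷ ys)) →
      u ∈ toList (o ∷ xs) → v ∈ toList (o ∷ ys) →
      0# < 𝔼 ((suc k ℕ.+ suc k) ℕ.+ 2) (λ s → 𝟙 (two? (support (o ∷ xs)) (support (o ∷ ys)) (supports s)) * mix A B (loops s))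
    mixed₂-pos o xs ys uniq uniq′ u∈ v∈ = 𝔼-pos {(suc k ℕ.+ suc k) ℕ.+ 2}
      (λ s → nonneg-* (𝟙-nonneg (two? (support L) (support L′) (supports s))) (mix-nonneg A≥0 B≥0 (loops s)))
      (twoEdgeConfig L L′ u v) (twoEdgeConfig-Eulerian 1≤k o xs ys u∈ v∈)
      (*-pos (<-respʳ-≈ (R.sym (𝟙-yes (two? (support L) (support L′) (supports (twoEdgeConfig L L′ u v))) (twoEdgeConfig-supports 1≤k u v uniq uniq′))) 0<1)
        (subst (λ l → 0# < mix A B l) (≡.sym (twoEdgeConfig-loops 1≤k u v uniq uniq′)) mix-pos))
      where
      L L′ : Vec (Fin n) (suc k)
      L  = o ∷ xs
      L′ = o ∷ ys

-- Matching vertex sets by permutations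

module Extension where

  open ≡ using (refl; sym; trans)

  -- The binomial coefficient C(a, 2).
  tri : ℕ → ℕ
  tri zero    = 0
  tri (suc a) = a ℕ.+ tri a

  transpose-other : ∀ {n} {u v w : Fin n} → w ≢ u → w ≢ v → Perm.transpose u v ⟨$⟩ʳ w ≡ w
  transpose-other {u = u} {v} {w} w≢u w≢v rewrite dec-false (w Fin.≟ u) w≢u | dec-false (w Fin.≟ v) w≢v = refl

  -- The image of the head is corrected by a transposition. Neither of the two vertices it moves is
  -- the image of a vertex in the tail, since both lists are without repetitions.
  extend : ∀ {n} (L L′ : List (Fin n)) → Unique L → Unique L′ → length L ≡ length L′ →
    ∃ λ (π : Permutation′ n) → map (π ⟨$⟩ʳ_) L ≡ L′
  extend []      []       _        _          _  = Perm.id , refl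
  extend (a ∷ L) (b ∷ L′) (a∉ ∷ u) (b∉ ∷ u′) eq with π , refl ← extend L L′ u u′ (ℕ.suc-injective eq) =
    π Perm.∘ₚ σ , cong₂ _∷_ (transpose-left (π ⟨$⟩ʳ a) b) (List.map-cong-local (All.tabulate λ {x} x∈ →
      transpose-other {u = π ⟨$⟩ʳ a} {b} (λ e → All.lookup a∉ x∈ (sym (perm-injective π e)))
        (λ e → All.lookup b∉ (∈-map⁺ (π ⟨$⟩ʳ_) x∈) (sym e))))
    where
    σ = Perm.transpose (π ⟨$⟩ʳ a) b

  ++-split : ∀ {a} {A : Set a} (xs xs′ : List A) {ys ys′} → length xs ≡ length xs′ → xs ++ ys ≡ xs′ ++ ys′ → xs ≡ xs′ × ys ≡ ys′
  ++-split []       []         _  eq = refl , eq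
  ++-split (x ∷ xs) (x′ ∷ xs′) le eq = Product.map₁ (cong₂ _∷_ (List.∷-injectiveˡ eq))
    (++-split xs xs′ (ℕ.suc-injective le) (List.∷-injectiveʳ eq))

  filter-¬filter-↭ : ∀ {a p} {A : Set a} {P : Pred A p} (P? : Decidable P) (xs : List A) → filter P? xs ++ filter (¬? ∘ P?) xs ↭ xs
  filter-¬filter-↭ P? []       = ↭-refl
  filter-¬filter-↭ P? (x ∷ xs) with does (P? x)
  ... | true  = prep x (filter-¬filter-↭ P? xs)
  ... | false = ↭-trans (↭.shift x (filter P? xs) _) (prep x (filter-¬filter-↭ P? xs))

  length-filter : ∀ {a p} {A : Set a} {P : Pred A p} (P? : Decidable P) (xs : List A) → length (filter P? xs) ≡ Σℕ xs (λ x → [ P? x ]ℕ)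
  length-filter P? []       = refl
  length-filter P? (x ∷ xs) with does (P? x)
  ... | true  = cong suc (length-filter P? xs)
  ... | false = length-filter P? xs

  module _ {n : ℕ} where

    elements : Subset n → List (Fin n)
    elements e = filter (Subset._∈? e) (allFin n)

    ∈-elements⁺ : ∀ {e v} → v ∈ₛ e → v ∈ elements e
    ∈-elements⁺ {e} {v} v∈ = ∈-filter⁺ (Subset._∈? e) (∈-allFin v) v∈

    ∈-elements⁻ : ∀ {e v} → v ∈ elements e → v ∈ₛ e
    ∈-elements⁻ {e} v∈ = proj₂ (∈-filter⁻ (Subset._∈? e) {xs = allFin n} v∈)

    unique-elements : ∀ e → Unique (elements e)
    unique-elements e = Unique.filter⁺ (Subset._∈? e) (Unique.allFin⁺ n)

    length-elements : ∀ e → length (elements e) ≡ ∣ e ∣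
    length-elements e = trans (length-filter (Subset._∈? e) (allFin n)) (sym (∣p∣-Σ e))

    Lists : Subset n → List (Fin n) → Set
    Lists e L = Unique L × (∀ {v} → v ∈ₛ e → v ∈ L) × (∀ {v} → v ∈ L → v ∈ₛ e)

    lists-↭ : ∀ {e L} → Lists e L → elements e ↭ L
    lists-↭ (u , to , from) = unique-same⇒↭ u (unique-elements _) (∈-elements⁺ ∘ from) (to ∘ ∈-elements⁻)

    lists-length : ∀ {e L} → Lists e L → length L ≡ ∣ e ∣
    lists-length {e} l = trans (sym (↭.↭-length (lists-↭ l))) (length-elements e)

    lists-elements : ∀ e → Lists e (elements e)
    lists-elements e = unique-elements e , ∈-elements⁺ , ∈-elements⁻

    lists-resp-↭ : ∀ {e L L′} → L ↭ L′ → Lists e L → Lists e L′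
    lists-resp-↭ p (u , to , from) = unique-↭ p u , ↭.∈-resp-↭ p ∘ to , from ∘ ↭.∈-resp-↭ (↭-sym p)

    others : Fin n → Subset n → List (Fin n)
    others w e = filter (λ v → ¬? (v Fin.≟ w)) (elements e)

    ∈-others : ∀ {w e v} → v ∈ others w e → v ∈ₛ e × v ≢ w
    ∈-others {w} {e} v∈ = Product.map₁ ∈-elements⁻ (∈-filter⁻ (λ v → ¬? (v Fin.≟ w)) {xs = elements e} v∈)

    unique-others : ∀ w e → Unique (others w e)
    unique-others w e = Unique.filter⁺ (λ v → ¬? (v Fin.≟ w)) (unique-elements e)

    lists-others : ∀ {w e} → w ∈ₛ e → Lists e (w ∷ others w e)
    lists-others {w} {e} w∈e = (All.tabulate λ v∈ eq → proj₂ (∈-others {w} {e} v∈) (sym eq)) ∷ unique-others w e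
      , (λ {v} v∈ → to v v∈ (v Fin.≟ w)) , λ { (here refl) → w∈e ; (there v∈) → proj₁ (∈-others {w} {e} v∈) }
      where
      to : ∀ v → v ∈ₛ e → Dec (v ≡ w) → v ∈ w ∷ others w e
      to v v∈ (yes refl) = here refl
      to v v∈ (no v≢w)   = there (∈-filter⁺ (λ v → ¬? (v Fin.≟ w)) (∈-elements⁺ v∈) v≢w)

    toVec : ∀ {k} (L : List (Fin n)) → length L ≡ k → ∃ λ (v : Vec (Fin n) k) → toList v ≡ L
    toVec L refl = Vec.fromList L , Vec.toList∘fromList L

    image-lists : ∀ (π : Permutation′ n) {e e′ L L′} → Lists e L → Lists e′ L′ → map (π ⟨$⟩ʳ_) L ≡ L′ → image π e ≡ e′
    image-lists π {L = L} (_ , to , from) (_ , to′ , from′) refl = image-ext π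
      (λ v v∈ → from′ (∈-map⁺ (π ⟨$⟩ʳ_) (to v∈)))
      (λ v πv∈ → case ∈-map⁻ (π ⟨$⟩ʳ_) (to′ πv∈) of λ { (u , u∈ , eq) → subst (_∈ₛ _) (perm-injective π (sym eq)) (from u∈) })

    -- All that the contribution of a single edge remembers of the degrees when these are at most 2.
    record Spread (g : Fin n → ℕ) (e : Subset n) (q : ℕ) : Set where
      field
        {twos ones} : List (Fin n)
        lists       : Lists e (twos ++ ones)
        #twos       : length twos ≡ q
        at-twos     : ∀ {v} → v ∈ twos → g v ≡ 2
        at-ones     : ∀ {v} → v ∈ ones → g v ≡ 1

    spread-match : ∀ {g g′ e e′ q} → ∣ e ∣ ≡ ∣ e′ ∣ → Spread g e q → Spread g′ e′ q →
      ∃ λ (π : Permutation′ n) → image π e ≡ e′ × (∀ {v} → v ∈ₛ e → g′ (π ⟨$⟩ʳ v) ≡ g v)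
    spread-match {g} {g′} size s s′ = π , image-lists π S.lists S′.lists (proj₂ ext) , values ∘ ∈-++⁻ S.twos ∘ proj₁ (proj₂ S.lists)
      where
      module S = Spread s
      module S′ = Spread s′
      ext = extend (S.twos ++ S.ones) (S′.twos ++ S′.ones) (proj₁ S.lists) (proj₁ S′.lists)
        (trans (lists-length S.lists) (trans size (sym (lists-length S′.lists))))
      π = proj₁ ext
      parts = ++-split (map (π ⟨$⟩ʳ_) S.twos) S′.twos (trans (List.length-map (π ⟨$⟩ʳ_) S.twos) (trans S.#twos (sym S′.#twos)))
        (trans (sym (List.map-++ (π ⟨$⟩ʳ_) S.twos S.ones)) (proj₂ ext))
      values : ∀ {v} → v ∈ S.twos ⊎ v ∈ S.ones → g′ (π ⟨$⟩ʳ v) ≡ g v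
      values {v} = [ (λ v∈ → trans (S′.at-twos (subst (π ⟨$⟩ʳ v ∈_) (proj₁ parts) (∈-map⁺ (π ⟨$⟩ʳ_) v∈))) (sym (S.at-twos v∈)))
                   , (λ v∈ → trans (S′.at-ones (subst (π ⟨$⟩ʳ v ∈_) (proj₂ parts) (∈-map⁺ (π ⟨$⟩ʳ_) v∈))) (sym (S.at-ones v∈))) ]′

    -- Two edges with a single common vertex, of degree 2; a and b count the other
    -- vertices of degree 2 of the two edges.
    record Flower (g : Fin n → ℕ) (e₁ e₂ : Subset n) (a b : ℕ) : Set where
      field
        {center}                  : Fin n
        {twos₁ ones₁ twos₂ ones₂} : List (Fin n)
        unique        : Unique (center ∷ (twos₁ ++ ones₁) ++ (twos₂ ++ ones₂))
        lists₁        : Lists e₁ (center ∷ twos₁ ++ ones₁)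
        lists₂        : Lists e₂ (center ∷ twos₂ ++ ones₂)
        #twos₁        : length twos₁ ≡ a
        #twos₂        : length twos₂ ≡ b
        at-center     : g center ≡ 2
        at-twos₁      : ∀ {v} → v ∈ twos₁ → g v ≡ 2
        at-ones₁      : ∀ {v} → v ∈ ones₁ → g v ≡ 1
        at-twos₂      : ∀ {v} → v ∈ twos₂ → g v ≡ 2
        at-ones₂      : ∀ {v} → v ∈ ones₂ → g v ≡ 1

    flower-match : ∀ {g g′ e₁ e₂ e₁′ e₂′ a b} → ∣ e₁ ∣ ≡ ∣ e₁′ ∣ → ∣ e₂ ∣ ≡ ∣ e₂′ ∣ → Flower g e₁ e₂ a b → Flower g′ e₁′ e₂′ a b →
      ∃ λ (π : Permutation′ n) → image π e₁ ≡ e₁′ × image π e₂ ≡ e₂′ × (∀ {v} → v ∈ₛ e₁ ⊎ v ∈ₛ e₂ → g′ (π ⟨$⟩ʳ v) ≡ g v)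
    flower-match {g} {g′} {e₁} {e₂} size₁ size₂ f f′ =
      π , image-lists π F.lists₁ F′.lists₁ (cong₂ _∷_ c≡ (proj₁ halves))
        , image-lists π F.lists₂ F′.lists₂ (cong₂ _∷_ c≡ (proj₂ halves))
        , [ v₁ ∘ proj₁ (proj₂ F.lists₁) , v₂ ∘ proj₁ (proj₂ F.lists₂) ]′
      where
      module F = Flower f
      module F′ = Flower f′
      len₁ : length (F.twos₁ ++ F.ones₁) ≡ length (F′.twos₁ ++ F′.ones₁)
      len₁ = ℕ.suc-injective (trans (lists-length F.lists₁) (trans size₁ (sym (lists-length F′.lists₁))))
      len₂ : length (F.twos₂ ++ F.ones₂) ≡ length (F′.twos₂ ++ F′.ones₂)
      len₂ = ℕ.suc-injective (trans (lists-length F.lists₂) (trans size₂ (sym (lists-length F′.lists₂))))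
      ext = extend (F.center ∷ (F.twos₁ ++ F.ones₁) ++ (F.twos₂ ++ F.ones₂)) (F′.center ∷ (F′.twos₁ ++ F′.ones₁) ++ (F′.twos₂ ++ F′.ones₂))
        F.unique F′.unique (cong suc (trans (List.length-++ (F.twos₁ ++ F.ones₁)) (trans (cong₂ ℕ._+_ len₁ len₂) (sym (List.length-++ (F′.twos₁ ++ F′.ones₁))))))
      π  = proj₁ ext
      πʳ = π ⟨$⟩ʳ_
      m  = map πʳ
      c≡ : πʳ F.center ≡ F′.center
      c≡ = List.∷-injectiveˡ (proj₂ ext)
      halves : m (F.twos₁ ++ F.ones₁) ≡ F′.twos₁ ++ F′.ones₁ × m (F.twos₂ ++ F.ones₂) ≡ F′.twos₂ ++ F′.ones₂
      halves = ++-split (m (F.twos₁ ++ F.ones₁)) (F′.twos₁ ++ F′.ones₁) (trans (List.length-map πʳ (F.twos₁ ++ F.ones₁)) len₁)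
        (trans (sym (List.map-++ πʳ (F.twos₁ ++ F.ones₁) _)) (List.∷-injectiveʳ (proj₂ ext)))
      quarters : ∀ (A B A′ B′ : List (Fin n)) → length A ≡ length A′ → m (A ++ B) ≡ A′ ++ B′ → m A ≡ A′ × m B ≡ B′
      quarters A B A′ B′ le eq = ++-split (m A) A′ (trans (List.length-map πʳ A) le) (trans (sym (List.map-++ πʳ A B)) eq)
      q₁ = quarters F.twos₁ F.ones₁ F′.twos₁ F′.ones₁ (trans F.#twos₁ (sym F′.#twos₁)) (proj₁ halves)
      q₂ = quarters F.twos₂ F.ones₂ F′.twos₂ F′.ones₂ (trans F.#twos₂ (sym F′.#twos₂)) (proj₂ halves)
      move : ∀ {A A′ : List (Fin n)} → m A ≡ A′ → ∀ {v} → v ∈ A → πʳ v ∈ A′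
      move refl v∈ = ∈-map⁺ πʳ v∈
      v₁ : ∀ {v} → v ∈ F.center ∷ F.twos₁ ++ F.ones₁ → g′ (πʳ v) ≡ g v
      v₁ (here refl) = trans (cong g′ c≡) (trans F′.at-center (sym F.at-center))
      v₁ (there v∈)  = [ (λ x → trans (F′.at-twos₁ (move (proj₁ q₁) x)) (sym (F.at-twos₁ x)))
                       , (λ x → trans (F′.at-ones₁ (move (proj₂ q₁) x)) (sym (F.at-ones₁ x))) ]′ (∈-++⁻ F.twos₁ v∈)
      v₂ : ∀ {v} → v ∈ F.center ∷ F.twos₂ ++ F.ones₂ → g′ (πʳ v) ≡ g v
      v₂ (here refl) = trans (cong g′ c≡) (trans F′.at-center (sym F.at-center))
      v₂ (there v∈)  = [ (λ x → trans (F′.at-twos₂ (move (proj₁ q₂) x)) (sym (F.at-twos₂ x)))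
                       , (λ x → trans (F′.at-ones₂ (move (proj₂ q₂) x)) (sym (F.at-ones₂ x))) ]′ (∈-++⁻ F.twos₂ v∈)
open Extension public

-- Edge and pair contributions for degrees at most 2

module DegreeTwo {c ℓ₁ ℓ₂} (K : OrderedField c ℓ₁ ℓ₂) {n k : ℕ}
  (α : OrderedField.Carrier K)
  (0<α : OrderedField._<_ K (OrderedField.0# K) α) (α<1 : OrderedField._<_ K α (OrderedField.1# K))
  (1≤k : 1 ℕ.≤ k) where

  open OrderedFields K
  open HypergraphTraces K {n} {k} α 0<α α<1
  open Contributions K {n} {k} edgeWeight edgeWeight-pos 1≤k
  open import Algebra.Properties.AbelianGroup R.+-abelianGroup using (∙-cancelʳ; xyx⁻¹≈y)
  open import Algebra.Properties.CommutativeSemigroup R.+-commutativeSemigroup using (xy∙z≈xz∙y)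
  open import Algebra.Solver.Ring.NaturalCoefficients.Default R.commutativeSemiring using (solve; _:+_; _:*_; _:=_; con)

  private
    size = suc k

  Φ₁-spread : ∀ d {g g′ e e′ q} → ∣ e ∣ ≡ ∣ e′ ∣ → Spread g e q → Spread g′ e′ q →
    Φ₁ d (scaled g) e ≈ Φ₁ d (scaled g′) e′
  Φ₁-spread d {g} {g′} eq s s′ with π , ≡.refl , h ← spread-match eq s s′ =
    Φ₁-image π d λ v∈ → R.*-congˡ (R.reflexive (cong fromNat (h v∈)))

  Φ₂-flower : ∀ d {g g′ e₁ e₂ e₁′ e₂′ a b} → ∣ e₁ ∣ ≡ ∣ e₁′ ∣ → ∣ e₂ ∣ ≡ ∣ e₂′ ∣ → Flower g e₁ e₂ a b → Flower g′ e₁′ e₂′ a b →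
    Φ₂ d (scaled g) e₁ e₂ ≈ Φ₂ d (scaled g′) e₁′ e₂′
  Φ₂-flower d eq₁ eq₂ f f′ with π , ≡.refl , ≡.refl , h ← flower-match eq₁ eq₂ f f′ =
    Φ₂-image π d λ v∈ → R.*-congˡ (R.reflexive (cong fromNat (h v∈)))

  -- Model degrees: for `Z` without repetitions, 2 on `Z` and 1 elsewhere. Adding `u` to `Z` changes
  -- the diagonal entries by `unit u`.
  twoOn : List (Fin n) → Fin n → ℕ
  twoOn Z v = suc (occ v Z)

  occ-∉ : ∀ {v : Fin n} {Z} → v ∉ Z → occ v Z ≡ 0
  occ-∉ {v} {Z} v∉ = ℕΣ.⅀-0 Z (λ {z} z∈ → ℕΣ.𝟙-no (z Fin.≟ v) λ { ≡.refl → v∉ z∈ })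

  occ-∈ : ∀ {v : Fin n} {Z} → Unique Z → v ∈ Z → occ v Z ≡ 1
  occ-∈ {v} {Z} u v∈ = ≡.trans (ℕΣ.⅀-single (λ z → [ z Fin.≟ v ]ℕ) u v∈ (λ {z} _ z≢v → ℕΣ.𝟙-no (z Fin.≟ v) z≢v)) (ℕΣ.𝟙-yes (v Fin.≟ v) ≡.refl)

  unit : Fin n → Fin n → Carrier
  unit u v = α * 𝟙 (u Fin.≟ v)

  unit-nonneg : ∀ u v → Nonneg (unit u v)
  unit-nonneg u v = nonneg-* (inj₂ 0<α) (𝟙-nonneg (u Fin.≟ v))

  unit-pos : ∀ u → 0# < unit u u
  unit-pos u = *-pos 0<α (<-respʳ-≈ (R.sym (𝟙-yes (u Fin.≟ u) ≡.refl)) 0<1)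

  scaled-∷ : ∀ u Z v → scaled (twoOn (u ∷ Z)) v ≈ scaled (twoOn Z) v + unit u v
  scaled-∷ u Z v = R.trans (R.*-congˡ (R.trans (R.+-congˡ (R.trans (fromNat-+ [ u Fin.≟ v ]ℕ (occ v Z)) (R.+-congʳ (fromNat-[] (u Fin.≟ v)))))
      (R.trans (R.sym (R.+-assoc 1# _ _)) (R.trans (xy∙z≈xz∙y 1# _ _) (R.+-congʳ R.refl)))))
    (R.distribˡ α _ _)

  spread-twoOn : ∀ {e A B} → Lists e (A ++ B) → Spread (twoOn A) e (length A)
  spread-twoOn {A = A} {B} l = record
    { twos = A ; ones = B
    ; lists   = l
    ; #twos   = ≡.refl
    ; at-twos = λ v∈ → cong suc (occ-∈ (unique-++ˡ A (proj₁ l)) v∈)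
    ; at-ones = λ v∈ → cong suc (occ-∉ (unique-++-disjoint A (proj₁ l) v∈))
    }

  flower-twoOn : ∀ {e₁ e₂ o A₁ B₁ A₂ B₂ Z} → Unique (o ∷ (A₁ ++ B₁) ++ (A₂ ++ B₂)) →
    Lists e₁ (o ∷ A₁ ++ B₁) → Lists e₂ (o ∷ A₂ ++ B₂) → Z ↭ o ∷ A₁ ++ A₂ → Flower (twoOn Z) e₁ e₂ (length A₁) (length A₂)
  flower-twoOn {o = o} {A₁} {B₁} {A₂} {B₂} {Z} u l₁ l₂ p = record
    { center = o ; twos₁ = A₁ ; ones₁ = B₁ ; twos₂ = A₂ ; ones₂ = B₂
    ; unique = u ; lists₁ = l₁ ; lists₂ = l₂ ; #twos₁ = ≡.refl ; #twos₂ = ≡.refl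
    ; at-center = cong suc (occ-∈ uZ (↭.∈-resp-↭ (↭-sym p) (here ≡.refl)))
    ; at-twos₁  = λ v∈ → cong suc (occ-∈ uZ (↭.∈-resp-↭ (↭-sym p) (there (∈-++⁺ˡ v∈))))
    ; at-twos₂  = λ v∈ → cong suc (occ-∈ uZ (↭.∈-resp-↭ (↭-sym p) (there (∈-++⁺ʳ A₁ v∈))))
    ; at-ones₁  = λ v∈ → cong suc (occ-∉ (λ v∈Z → off v∈Z (∈-++⁺ˡ v∈)))
    ; at-ones₂  = λ v∈ → cong suc (occ-∉ (λ v∈Z → off v∈Z (∈-++⁺ʳ B₁ v∈)))
    }
    where
    rearrange : o ∷ (A₁ ++ B₁) ++ (A₂ ++ B₂) ↭ (o ∷ A₁ ++ A₂) ++ (B₁ ++ B₂)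
    rearrange = prep o (↭-trans (↭.↭-reflexive (List.++-assoc A₁ B₁ (A₂ ++ B₂)))
      (↭-trans (↭.++⁺ˡ A₁ (↭.shifts B₁ A₂)) (↭.↭-reflexive (≡.sym (List.++-assoc A₁ A₂ (B₁ ++ B₂))))))
    u′ : Unique ((o ∷ A₁ ++ A₂) ++ (B₁ ++ B₂))
    u′ = unique-↭ rearrange u
    uZ : Unique Z
    uZ = unique-↭ (↭-sym p) (unique-++ˡ (o ∷ A₁ ++ A₂) u′)
    off : ∀ {v} → v ∈ Z → v ∉ B₁ ++ B₂
    off v∈Z v∈B = unique-++-disjoint (o ∷ A₁ ++ A₂) u′ v∈B (↭.∈-resp-↭ p v∈Z)

  module SecondDifference (f : ℕ → Carrier) (κ : Carrier) (N : ℕ)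
    (second : ∀ q → suc (suc q) ℕ.≤ N → f (suc (suc q)) + f q ≈ (f (suc q) + f (suc q)) + κ) where

    private
      δ = f 2 - f 1

      f2 : f 1 + δ ≈ f 2
      f2 = R.trans (R.sym (R.+-assoc _ _ _)) (xyx⁻¹≈y (f 1) (f 2))

      first : ∀ a → suc (suc a) ℕ.≤ N → f (suc (suc a)) ≈ f (suc a) + (δ + fromNat a * κ)
      first zero    le = R.trans (R.sym f2) (R.+-congˡ (R.sym (R.trans (R.+-congˡ (R.zeroˡ κ)) (R.+-identityʳ δ))))
      first (suc a) le = ∙-cancelʳ (f (suc a)) _ _ (R.trans (second (suc a) le) (R.trans
        (R.+-congʳ (R.+-congˡ (first a (ℕ.≤-trans (ℕ.n≤1+n _) le))))
        (solve 5 (λ x y d m κ → x :+ (y :+ (d :+ m :* κ)) :+ κ := x :+ (d :+ (con 1 :+ m) :* κ) :+ y) R.refl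
          (f (suc (suc a))) (f (suc a)) δ (fromNat a) κ)))

      closed′ : ∀ a → suc a ℕ.≤ N → f (suc a) ≈ f 1 + (fromNat a * δ + fromNat (tri a) * κ)
      closed′ zero    le = R.sym (R.trans (R.+-congˡ (R.trans (R.+-cong (R.zeroˡ δ) (R.zeroˡ κ)) (R.+-identityˡ 0#))) (R.+-identityʳ _))
      closed′ (suc a) le = R.trans (first a le) (R.trans (R.+-congʳ (closed′ a (ℕ.≤-trans (ℕ.n≤1+n _) le)))
        (R.trans (solve 5 (λ x m d t κ → x :+ (m :* d :+ t :* κ) :+ (d :+ m :* κ) := x :+ ((con 1 :+ m) :* d :+ (m :+ t) :* κ)) R.refl
            (f 1) (fromNat a) δ (fromNat (tri a)) κ)
          (R.+-congˡ (R.+-congˡ (R.*-congʳ (R.sym (fromNat-+ a (tri a))))))))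

    -- Summing twice gives f (1 + a) = f 1 + a (f 2 - f 1) + C(a, 2) κ; the negative terms are moved
    -- to the other side. The count starts at 1 because in a tree with at least two edges every edge
    -- has a neighbour.
    closedForm : ∀ a → suc a ℕ.≤ N → f (suc a) + fromNat a * f 1 ≈ (f 1 + fromNat a * f 2) + fromNat (tri a) * κ
    closedForm a le = R.trans (R.+-congʳ (closed′ a le)) (R.trans
      (solve 4 (λ x m d t → x :+ (m :* d :+ t) :+ m :* x := x :+ m :* (x :+ d) :+ t) R.refl (f 1) (fromNat a) δ (fromNat (tri a) * κ))
      (R.+-congʳ (R.+-congˡ (R.*-congˡ f2))))

  -- The bounds on the number of rows are stated for forests; for the reference edge the forest is
  -- that edge alone.
  arboreal-one : ∀ {e} → ∣ e ∣ ≡ size → Fin n → Arboreal (e ∷ [])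
  arboreal-one eq w = record { forest = add w (λ _ ()) [] ; distinct = [] ∷ [] ; sizes = λ { (here ≡.refl) → eq } }

  arboreal-two : ∀ {e e′} → ∣ e ∣ ≡ size → ∣ e′ ∣ ≡ size → e ≢ e′ → ∀ o → (∀ {v} → v ∈ₛ e → v ∈ₛ e′ → v ≡ o) → Arboreal (e ∷ e′ ∷ [])
  arboreal-two eq eq′ ne o meet = record
    { forest   = add o (λ { v∈ (here ≡.refl) v∈′ → meet v∈ v∈′ }) (add o (λ _ ()) [])
    ; distinct = (ne ∷ []) ∷ [] ∷ []
    ; sizes    = λ { (here ≡.refl) → eq ; (there (here ≡.refl)) → eq′ }
    }

  module OneEdge (u₀ u₁ : Fin n) {k′} (k≡ : k ≡ suc k′) (rest : Vec (Fin n) k′)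
    (uniq : Unique (u₀ ∷ u₁ ∷ toList rest)) (d : ℕ) where

    private
      L : Vec (Fin n) (suc k)
      L = subst (λ m → Vec (Fin n) (suc m)) (≡.sym k≡) (u₀ ∷ u₁ ∷ rest)
      toList-L : toList L ≡ u₀ ∷ u₁ ∷ toList rest
      toList-L = go k≡
        where
        go : ∀ {m} (eq : m ≡ suc k′) → toList (subst (λ m → Vec (Fin n) (suc m)) (≡.sym eq) (u₀ ∷ u₁ ∷ rest)) ≡ u₀ ∷ u₁ ∷ toList rest
        go ≡.refl = ≡.refl
      uniqL : Unique (toList L)
      uniqL = subst Unique (≡.sym toList-L) uniq

    e : Subset n
    e = support L

    listsL : Lists e (u₀ ∷ u₁ ∷ toList rest)
    listsL = uniq , (λ v∈ → subst (_ ∈_) toList-L (∈⋃⇒∈ (toList L) v∈)) , (λ v∈ → ∈⇒∈⋃ (subst (_ ∈_) (≡.sym toList-L) v∈))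

    ∣e∣ : ∣ e ∣ ≡ size
    ∣e∣ = ≡.trans (≡.sym (lists-length listsL)) (≡.trans (cong (λ l → length l) (≡.sym toList-L)) (Vec.length-toList L))

    value : ℕ → Carrier
    value q = Φ₁ d (scaled (twoOn (List.take q (toList L)))) e

    difference : Carrier
    difference = 𝔼 d (λ s → 𝟙 (one? e (supports s)) * mix (unit u₀) (unit u₁) (loops s))

    private
      loops≤ : ∀ (s : Config d) → Eulerian (arcs s) → One e (supports s) → length (loops s) ℕ.+ size ℕ.≤ d
      loops≤ s eul one = one-count (arboreal-one ∣e∣ u₀) s eul (here ≡.refl) one

    value-spread : ∀ {g e′ q} → q ℕ.≤ size → ∣ e′ ∣ ≡ size → Spread g e′ q → Φ₁ d (scaled g) e′ ≈ value q
    value-spread {q = q} q≤ eq s = Φ₁-spread d (≡.trans eq (≡.sym ∣e∣)) s (subst (Spread _ e) len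
        (spread-twoOn {B = List.drop q (toList L)} (subst (Lists e) (≡.trans (≡.sym toList-L) (≡.sym (List.take++drop≡id q (toList L)))) listsL)))
      where
      len : length (List.take q (toList L)) ≡ q
      len = ≡.trans (List.length-take q (toList L)) (ℕ.m≤n⇒m⊓n≡m (ℕ.≤-trans q≤ (ℕ.≤-reflexive (≡.sym (Vec.length-toList L)))))

    -- Take `q` vertices of degree 2 other than `u₀` and `u₁`. Raising the degree of either of these
    -- gives the same value, by symmetry, so the mixed difference at `u₀` and `u₁` is a second
    -- difference in `q`. Its correction term does not involve `q`.
    second : d ℕ.≤ size ℕ.+ 2 → ∀ q → suc (suc q) ℕ.≤ size → value (suc (suc q)) + value q ≈ (value (suc q) + value (suc q)) + difference
    second d≤ q le = R.trans
      (R.+-cong (spread∷ (u₀ ∷ u₁ ∷ A) B (suc (suc q)) le (cong (λ z → suc (suc z)) lenA) ↭-refl′)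
                (spread∷ A (u₀ ∷ u₁ ∷ B) q (ℕ.≤-trans (ℕ.n≤1+n _) (ℕ.≤-trans (ℕ.n≤1+n _) le)) lenA
                  (↭-trans (↭.shift u₀ A (u₁ ∷ B)) (prep u₀ (↭.shift u₁ A B)))))
      (R.trans
        (mixedDifference {x = scaled (twoOn A)} {scaled (twoOn (u₀ ∷ A))} {scaled (twoOn (u₁ ∷ A))} {scaled (twoOn (u₀ ∷ u₁ ∷ A))}
          (scaled-∷ u₀ A) (scaled-∷ u₁ A)
          (λ v → R.trans (scaled-∷ u₀ (u₁ ∷ A) v) (R.trans (R.+-congʳ (scaled-∷ u₁ A v)) (xy∙z≈xz∙y _ _ _)))
          {d} (one? e) (λ s eul one → ℕ.+-cancelʳ-≤ size _ 2 (ℕ.≤-trans (loops≤ s eul one) (ℕ.≤-trans d≤ (ℕ.≤-reflexive (ℕ.+-comm size 2))))))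
        (R.+-congʳ (R.+-cong
          (R.sym (spread∷ (u₀ ∷ A) (u₁ ∷ B) (suc q) (ℕ.≤-trans (ℕ.n≤1+n _) le) (cong suc lenA) (prep u₀ (↭.shift u₁ A B))))
          (R.sym (spread∷ (u₁ ∷ A) (u₀ ∷ B) (suc q) (ℕ.≤-trans (ℕ.n≤1+n _) le) (cong suc lenA)
            (↭-trans (prep u₁ (↭.shift u₀ A B)) (swap u₁ u₀ ↭-refl)))))))
      where
      A B : List (Fin n)
      A = List.take q (toList rest)
      B = List.drop q (toList rest)
      A++B : A ++ B ≡ toList rest
      A++B = List.take++drop≡id q (toList rest)
      ↭-refl′ : u₀ ∷ u₁ ∷ A ++ B ↭ u₀ ∷ u₁ ∷ A ++ B
      ↭-refl′ = ↭-refl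
      lenA : length A ≡ q
      lenA = ≡.trans (List.length-take q (toList rest)) (ℕ.m≤n⇒m⊓n≡m (ℕ.≤-trans
        (ℕ.≤-pred (subst (suc q ℕ.≤_) k≡ (ℕ.≤-pred le))) (ℕ.≤-reflexive (≡.sym (Vec.length-toList rest)))))
      spread∷ : ∀ X Y q′ → q′ ℕ.≤ size → length X ≡ q′ → X ++ Y ↭ u₀ ∷ u₁ ∷ A ++ B → value q′ ≈ Φ₁ d (scaled (twoOn X)) e
      spread∷ X Y q′ q′≤ len p = R.sym (value-spread q′≤ ∣e∣ (subst (Spread (twoOn X) e) len (spread-twoOn {B = Y}
        (lists-resp-↭ (↭-sym p) (subst (λ l → Lists e (u₀ ∷ u₁ ∷ l)) (≡.sym A++B) listsL)))))

    -- The edge takes `size` rows, so fewer than two are left for loops.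
    difference-zero : d ℕ.< size ℕ.+ 2 → difference ≈ 0#
    difference-zero d< = 𝔼-0 {d} λ s eul → R.trans
      (𝟙*-cong (one? e (supports s)) (one? e (supports s)) id id (λ one → mix-short (unit u₀) (unit u₁) (loops s)
        (ℕ.+-cancelʳ-< size _ 2 (ℕ.≤-<-trans (loops≤ s eul one) (ℕ.<-≤-trans d< (ℕ.≤-reflexive (ℕ.+-comm size 2)))))))
      (R.zeroʳ _)

    difference-pos : d ≡ size ℕ.+ 2 → 0# < difference
    difference-pos ≡.refl = mixed₁-pos (unit-nonneg u₀) (unit-nonneg u₁) (unit-pos u₀) (unit-pos u₁) L uniqL
      (subst (u₀ ∈_) (≡.sym toList-L) (here ≡.refl)) (subst (u₁ ∈_) (≡.sym toList-L) (there (here ≡.refl)))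

    closedForm : d ℕ.≤ size ℕ.+ 2 → ∀ a → suc a ℕ.≤ size →
      value (suc a) + fromNat a * value 1 ≈ (value 1 + fromNat a * value 2) + fromNat (tri a) * difference
    closedForm d≤ = SecondDifference.closedForm value difference size (second d≤)

  module TwoEdges (o r₁ r₂ s₁ : Fin n) (X Y : List (Fin n)) (len₁ : length (r₁ ∷ r₂ ∷ X) ≡ k) (len₂ : length (s₁ ∷ Y) ≡ k)
    (uniq : Unique (o ∷ (r₁ ∷ r₂ ∷ X) ++ (s₁ ∷ Y))) (d : ℕ) where

    private
      xs = toVec (r₁ ∷ r₂ ∷ X) len₁
      ys = toVec (s₁ ∷ Y) len₂

      e₁ e₂ : Subset n
      e₁ = support (o ∷ proj₁ xs)
      e₂ = support (o ∷ proj₁ ys)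

      uniq₁ : Unique (o ∷ r₁ ∷ r₂ ∷ X)
      uniq₁ = unique-++ˡ (o ∷ r₁ ∷ r₂ ∷ X) uniq

      uniq₂ : Unique (o ∷ s₁ ∷ Y)
      uniq₂ = unique-++ˡ (o ∷ s₁ ∷ Y) (unique-↭ (prep o (↭.++-comm (r₁ ∷ r₂ ∷ X) (s₁ ∷ Y))) uniq)

      lists : ∀ {L} (v : Vec (Fin n) k) → toList v ≡ L → Unique (o ∷ L) → Lists (support (o ∷ v)) (o ∷ L)
      lists v ≡.refl u = u , ∈⋃⇒∈ (o ∷ toList v) , ∈⇒∈⋃

      l₁ : Lists e₁ (o ∷ r₁ ∷ r₂ ∷ X)
      l₁ = lists (proj₁ xs) (proj₂ xs) uniq₁

      l₂ : Lists e₂ (o ∷ s₁ ∷ Y)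
      l₂ = lists (proj₁ ys) (proj₂ ys) uniq₂

      ∣e₁∣ : ∣ e₁ ∣ ≡ size
      ∣e₁∣ = ≡.trans (≡.sym (lists-length l₁)) (cong suc len₁)

      ∣e₂∣ : ∣ e₂ ∣ ≡ size
      ∣e₂∣ = ≡.trans (≡.sym (lists-length l₂)) (cong suc len₂)

      disjoint : ∀ {v} → v ∈ s₁ ∷ Y → v ∉ o ∷ r₁ ∷ r₂ ∷ X
      disjoint = unique-++-disjoint (o ∷ r₁ ∷ r₂ ∷ X) uniq

      meet : ∀ {v} → v ∈ₛ e₁ → v ∈ₛ e₂ → v ≡ o
      meet v∈₁ v∈₂ with proj₁ (proj₂ l₂) v∈₂
      ... | here v≡o = v≡o
      ... | there v∈ = contradiction (proj₁ (proj₂ l₁) v∈₁) (disjoint v∈)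

      e₁≢e₂ : e₁ ≢ e₂
      e₁≢e₂ eq = disjoint (here ≡.refl) (proj₁ (proj₂ l₁) (subst (s₁ ∈ₛ_) (≡.sym eq) (proj₂ (proj₂ l₂) (there (here ≡.refl)))))

      loops≤ : ∀ (s : Config d) → Eulerian (arcs s) → Two e₁ e₂ (supports s) → length (loops s) ℕ.+ (size ℕ.+ size) ℕ.≤ d
      loops≤ s eul two = two-count (arboreal-two ∣e₁∣ ∣e₂∣ e₁≢e₂ o meet) s eul (here ≡.refl) (there (here ≡.refl)) e₁≢e₂ two

      Z : List (Fin n)
      Z = o ∷ r₂ ∷ []

      V : List (Fin n) → Carrier
      V W = Φ₂ d (scaled (twoOn W)) e₁ e₂

    -- The indices are the numbers of vertices of degree 2, other than o, in the two edges.
    value₁₀ value₂₀ value₁₁ value₂₁ : Carrier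
    value₁₀ = V Z
    value₂₀ = V (r₁ ∷ Z)
    value₁₁ = V (s₁ ∷ Z)
    value₂₁ = V (r₁ ∷ s₁ ∷ Z)

    difference : Carrier
    difference = 𝔼 d (λ s → 𝟙 (two? e₁ e₂ (supports s)) * mix (unit r₁) (unit s₁) (loops s))

    private
      l₁′ : Lists e₁ (o ∷ r₂ ∷ r₁ ∷ X)
      l₁′ = lists-resp-↭ (prep o (swap r₁ r₂ ↭-refl)) l₁
      uniq′ : Unique (o ∷ (r₂ ∷ r₁ ∷ X) ++ (s₁ ∷ Y))
      uniq′ = unique-↭ (prep o (swap r₁ r₂ ↭-refl)) uniq

    module _ {g : Fin n → ℕ} {e e′ : Subset n} (s : ∣ e ∣ ≡ size) (s′ : ∣ e′ ∣ ≡ size) where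

      value₁₀-flower : Flower g e e′ 1 0 → Φ₂ d (scaled g) e e′ ≈ value₁₀
      value₁₀-flower f = Φ₂-flower d (≡.trans s (≡.sym ∣e₁∣)) (≡.trans s′ (≡.sym ∣e₂∣)) f
        (flower-twoOn {A₁ = r₂ ∷ []} {r₁ ∷ X} {[]} {s₁ ∷ Y} uniq′ l₁′ l₂ ↭-refl)

      value₂₀-flower : Flower g e e′ 2 0 → Φ₂ d (scaled g) e e′ ≈ value₂₀
      value₂₀-flower f = Φ₂-flower d (≡.trans s (≡.sym ∣e₁∣)) (≡.trans s′ (≡.sym ∣e₂∣)) f
        (flower-twoOn {A₁ = r₁ ∷ r₂ ∷ []} {X} {[]} {s₁ ∷ Y} uniq l₁ l₂ (swap r₁ o ↭-refl))

      value₁₁-flower : Flower g e e′ 1 1 → Φ₂ d (scaled g) e e′ ≈ value₁₁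
      value₁₁-flower f = Φ₂-flower d (≡.trans s (≡.sym ∣e₁∣)) (≡.trans s′ (≡.sym ∣e₂∣)) f
        (flower-twoOn {A₁ = r₂ ∷ []} {r₁ ∷ X} {s₁ ∷ []} {Y} uniq′ l₁′ l₂ (↭.++-comm (s₁ ∷ []) Z))

      value₂₁-flower : Flower g e e′ 2 1 → Φ₂ d (scaled g) e e′ ≈ value₂₁
      value₂₁-flower f = Φ₂-flower d (≡.trans s (≡.sym ∣e₁∣)) (≡.trans s′ (≡.sym ∣e₂∣)) f
        (flower-twoOn {A₁ = r₁ ∷ r₂ ∷ []} {X} {s₁ ∷ []} {Y} uniq l₁ l₂
          (↭-trans (↭.shift o (r₁ ∷ s₁ ∷ []) (r₂ ∷ [])) (prep o (prep r₁ (swap s₁ r₂ ↭-refl)))))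

    -- The degrees of `r₁` in the first edge and of `s₁` in the second are raised from 1 to 2, while
    -- `o` and `r₂` have degree 2 throughout.
    mixed : d ℕ.≤ (size ℕ.+ size) ℕ.+ 2 → value₂₁ + value₁₀ ≈ (value₂₀ + value₁₁) + difference
    mixed d≤ = mixedDifference (scaled-∷ r₁ Z) (scaled-∷ s₁ Z)
      (λ v → R.trans (scaled-∷ r₁ (s₁ ∷ Z) v) (R.trans (R.+-congʳ (scaled-∷ s₁ Z v)) (xy∙z≈xz∙y _ _ _)))
      {d} (two? e₁ e₂) (λ s eul two → ℕ.+-cancelʳ-≤ (size ℕ.+ size) _ 2
        (ℕ.≤-trans (loops≤ s eul two) (ℕ.≤-trans d≤ (ℕ.≤-reflexive (ℕ.+-comm (size ℕ.+ size) 2)))))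

    difference-zero : d ℕ.< (size ℕ.+ size) ℕ.+ 2 → difference ≈ 0#
    difference-zero d< = 𝔼-0 {d} λ s eul → R.trans
      (𝟙*-cong (two? e₁ e₂ (supports s)) (two? e₁ e₂ (supports s)) id id (λ two → mix-short (unit r₁) (unit s₁) (loops s)
        (ℕ.+-cancelʳ-< (size ℕ.+ size) _ 2 (ℕ.≤-<-trans (loops≤ s eul two) (ℕ.<-≤-trans d< (ℕ.≤-reflexive (ℕ.+-comm (size ℕ.+ size) 2)))))))
      (R.zeroʳ _)

    difference-pos : d ≡ (size ℕ.+ size) ℕ.+ 2 → 0# < difference
    difference-pos ≡.refl = mixed₂-pos (unit-nonneg r₁) (unit-nonneg s₁) (unit-pos r₁) (unit-pos s₁) o (proj₁ xs) (proj₁ ys)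
      (subst (λ l → Unique (o ∷ l)) (≡.sym (proj₂ xs)) uniq₁) (subst (λ l → Unique (o ∷ l)) (≡.sym (proj₂ ys)) uniq₂)
      (subst (λ l → r₁ ∈ o ∷ l) (≡.sym (proj₂ xs)) (there (here ≡.refl)))
      (subst (λ l → s₁ ∈ o ∷ l) (≡.sym (proj₂ ys)) (there (here ≡.refl)))

-- Trees as successive attachments, and the codes of growths

module Trees where

  open ≡ using (refl; sym; trans)

  module _ {n : ℕ} where

    deg-Σ : ∀ (E : List (Subset n)) v → deg E v ≡ Σℕ E (λ e → [ v ∈ e ]ₛ)
    deg-Σ E v = length-filter (v Subset.∈?_) E

    deg-∷ : ∀ (e : Subset n) E v → deg (e ∷ E) v ≡ [ v ∈ e ]ₛ ℕ.+ deg E v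
    deg-∷ e E v = trans (deg-Σ (e ∷ E) v) (cong ([ v ∈ e ]ₛ ℕ.+_) (sym (deg-Σ E v)))

    deg-↭ : ∀ {E F : List (Subset n)} → E ↭ F → ∀ v → deg E v ≡ deg F v
    deg-↭ {E} {F} p v = trans (deg-Σ E v) (trans (ℕΣ.⅀-↭ _ p) (sym (deg-Σ F v)))

    deg≥1 : ∀ {E : List (Subset n)} {e v} → e ∈ E → v ∈ₛ e → 1 ℕ.≤ deg E v
    deg≥1 {E} {e} {v} e∈ v∈ = subst (1 ℕ.≤_) (sym (deg-Σ E v))
      (ℕ.≤-trans (ℕ.≤-reflexive (sym (ℕΣ.𝟙-yes (v Subset.∈? e) v∈))) (Σℕ-≥ (λ f → [ v ∈ f ]ₛ) e∈))

    deg≥1⇒ : ∀ {E : List (Subset n)} {v} → 1 ℕ.≤ deg E v → ∃ λ e → e ∈ E × v ∈ₛ e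
    deg≥1⇒ {E} {v} le with e , e∈ , p ← Σℕ-pos E (λ f → [ v ∈ f ]ₛ) (subst (1 ℕ.≤_) (deg-Σ E v) le) =
      e , e∈ , []-≥1⇒ (v Subset.∈? e) p

    ∣∩∣-Σ : ∀ (e f : Subset n) → ∣ e ∩ f ∣ ≡ Σℕ (allFin n) (λ v → [ v ∈ e ]ₛ ℕ.* [ v ∈ f ]ₛ)
    ∣∩∣-Σ e f = trans (∣p∣-Σ (e ∩ f)) (ℕΣ.⅀-cong (allFin n) λ v → go v)
      where
      go : ∀ v → [ v ∈ e ∩ f ]ₛ ≡ [ v ∈ e ]ₛ ℕ.* [ v ∈ f ]ₛ
      go v = trans (ℕΣ.𝟙-⇔ (v Subset.∈? e ∩ f) ((v Subset.∈? e) ×-dec (v Subset.∈? f)) (Subset.x∈p∩q⁻ e f) Subset.x∈p∩q⁺) (product (v Subset.∈? e) (v Subset.∈? f))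
        where
        product : ∀ {P Q : Set} (a : Dec P) (b : Dec Q) → [ a ×-dec b ]ℕ ≡ [ a ]ℕ ℕ.* [ b ]ℕ
        product (yes _) b = sym (ℕ.+-identityʳ _)
        product (no _)  b = refl

    ∣∩∣-comm : ∀ (e f : Subset n) → ∣ e ∩ f ∣ ≡ ∣ f ∩ e ∣
    ∣∩∣-comm e f = cong ∣_∣ (Subset.∩-comm e f)

    ∣∩∣-self : ∀ (e : Subset n) → ∣ e ∩ e ∣ ≡ ∣ e ∣
    ∣∩∣-self e = cong ∣_∣ (Subset.∩-idem e)

    ∣∩∣-empty : ∀ {e f : Subset n} → (∀ v → v ∈ₛ e → v ∉ₛ f) → ∣ e ∩ f ∣ ≡ 0
    ∣∩∣-empty {e} {f} disj = trans (∣∩∣-Σ e f) (ℕΣ.⅀-0 (allFin n) λ {v} _ → go v)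
      where
      go : ∀ v → [ v ∈ e ]ₛ ℕ.* [ v ∈ f ]ₛ ≡ 0
      go v with v Subset.∈? e | v Subset.∈? f
      ... | yes v∈e | yes v∈f = contradiction v∈f (disj v v∈e)
      ... | yes _   | no _    = refl
      ... | no _    | _       = refl

    ∣∩∣-≥1 : ∀ {e f : Subset n} {v} → v ∈ₛ e → v ∈ₛ f → 1 ℕ.≤ ∣ e ∩ f ∣
    ∣∩∣-≥1 {e} {f} {v} v∈e v∈f = subst (1 ℕ.≤_) (sym (∣∩∣-Σ e f)) (ℕ.≤-trans
      (ℕ.≤-reflexive (sym (cong₂ ℕ._*_ (ℕΣ.𝟙-yes (v Subset.∈? e) v∈e) (ℕΣ.𝟙-yes (v Subset.∈? f) v∈f))))
      (Σℕ-≥ (λ v → [ v ∈ e ]ₛ ℕ.* [ v ∈ f ]ₛ) (∈-allFin v)))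

    ∣∩∣-≥1⇒ : ∀ {e f : Subset n} → 1 ℕ.≤ ∣ e ∩ f ∣ → ∃ λ v → v ∈ₛ e × v ∈ₛ f
    ∣∩∣-≥1⇒ {e} {f} le with v , _ , p ← Σℕ-pos (allFin n) _ (subst (1 ℕ.≤_) (∣∩∣-Σ e f) le) = v , go v p
      where
      go : ∀ v → 1 ℕ.≤ [ v ∈ e ]ₛ ℕ.* [ v ∈ f ]ₛ → v ∈ₛ e × v ∈ₛ f
      go v p with v Subset.∈? e | v Subset.∈? f
      ... | yes v∈e | yes v∈f = v∈e , v∈f
      ... | yes _   | no _    with () ← p
      ... | no _    | _       with () ← p

    ∣∩∣-≡1 : ∀ {e f : Subset n} {w} → w ∈ₛ e → w ∈ₛ f → (∀ {v} → v ∈ₛ e → v ∈ₛ f → v ≡ w) → ∣ e ∩ f ∣ ≡ 1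
    ∣∩∣-≡1 {e} {f} {w} w∈e w∈f only = trans (∣∩∣-Σ e f) (trans
      (ℕΣ.⅀-single (λ v → [ v ∈ e ]ₛ ℕ.* [ v ∈ f ]ₛ) (Unique.allFin⁺ n) (∈-allFin w) (λ {v} _ v≢w → go v v≢w))
      (cong₂ ℕ._*_ (ℕΣ.𝟙-yes (w Subset.∈? e) w∈e) (ℕΣ.𝟙-yes (w Subset.∈? f) w∈f)))
      where
      go : ∀ v → v ≢ w → [ v ∈ e ]ₛ ℕ.* [ v ∈ f ]ₛ ≡ 0
      go v v≢w with v Subset.∈? e | v Subset.∈? f
      ... | yes v∈e | yes v∈f = contradiction (only v∈e v∈f) v≢w
      ... | yes _   | no _    = refl
      ... | no _    | _       = refl

    -- For e ∈ E this is |e| plus the number of incidences of e with the other edges.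
    contacts : List (Subset n) → Subset n → ℕ
    contacts E e = Σℕ E (λ f → ∣ e ∩ f ∣)

    contacts-deg : ∀ E e → contacts E e ≡ Σℕ (allFin n) (λ v → [ v ∈ e ]ₛ ℕ.* deg E v)
    contacts-deg E e = trans (ℕΣ.⅀-cong E (∣∩∣-Σ e)) (trans (ℕΣ.⅀-swap E (allFin n) _)
      (ℕΣ.⅀-cong (allFin n) λ v → trans (sym (ℕΣ.⅀-*ˡ E [ v ∈ e ]ₛ _)) (cong ([ v ∈ e ]ₛ ℕ.*_) (sym (deg-Σ E v)))))

    contacts-↭ : ∀ {E F} e → E ↭ F → contacts E e ≡ contacts F e
    contacts-↭ e = ℕΣ.⅀-↭ (λ f → ∣ e ∩ f ∣)

    data Tree : List (Subset n) → Set where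
      single : ∀ {e w} → w ∈ₛ e → Tree (e ∷ [])
      attach : ∀ {e es f} w → w ∈ₛ e → f ∈ es → w ∈ₛ f →
               (∀ {v g} → v ∈ₛ e → g ∈ es → v ∈ₛ g → v ≡ w) → Tree es → Tree (e ∷ es)

    tree-forest : ∀ {E} → Tree E → Forest E
    tree-forest (single {w = w} _)          = add w (λ _ ()) []
    tree-forest (attach w _ _ _ priv t) = add w priv (tree-forest t)

    tree-meet : ∀ {E} → Tree E → ∀ {e f} → e ∈ E → f ∈ E → e ≢ f → ∀ {u v} → u ∈ₛ e → u ∈ₛ f → v ∈ₛ e → v ∈ₛ f → u ≡ v
    tree-meet (single _) (here refl) (here refl) e≢f = contradiction refl e≢f
    tree-meet (attach w _ _ _ priv t) (here refl) (here refl) e≢f = contradiction refl e≢f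
    tree-meet (attach w _ _ _ priv t) (here refl) (there f∈) _ u∈e u∈f v∈e v∈f = trans (priv u∈e f∈ u∈f) (sym (priv v∈e f∈ v∈f))
    tree-meet (attach w _ _ _ priv t) (there e∈) (here refl) _ u∈e u∈f v∈e v∈f = trans (priv u∈f e∈ u∈e) (sym (priv v∈f e∈ v∈e))
    tree-meet (attach w _ _ _ priv t) (there e∈) (there f∈) e≢f = tree-meet t e∈ f∈ e≢f

    tree-neighbour : ∀ {E} → Tree E → Unique E → 2 ℕ.≤ length E → ∀ {e} → e ∈ E → ∃ λ f → f ∈ E × e ≢ f × ∃ λ v → v ∈ₛ e × v ∈ₛ f
    tree-neighbour (single _) _ (s≤s ())
    tree-neighbour (attach w w∈e f∈ w∈f priv t) (e∉ ∷ u) le (here refl) = _ , there f∈ , All.lookup e∉ f∈ , w , w∈e , w∈f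
    tree-neighbour (attach w w∈e (here refl) w∈f priv (single _)) (e∉ ∷ u) le (there (here refl)) =
      _ , here refl , (λ eq → All.lookup e∉ (here refl) (sym eq)) , w , w∈f , w∈e
    tree-neighbour (attach w w∈e f∈ w∈f priv t@(attach _ _ _ _ _ (single _))) (e∉ ∷ u) le (there e∈)
      with f , f∈ , rest ← tree-neighbour t u (s≤s (s≤s z≤n)) e∈ = f , there f∈ , rest
    tree-neighbour (attach w w∈e f∈ w∈f priv t@(attach _ _ _ _ _ (attach _ _ _ _ _ _))) (e∉ ∷ u) le (there e∈)
      with f , f∈ , rest ← tree-neighbour t u (s≤s (s≤s z≤n)) e∈ = f , there f∈ , rest

    private
      covered : List (Subset n) → ℕ
      covered E = Σℕ (allFin n) (λ v → [ 1 ℕ.≤? deg E v ]ℕ)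

      -- Among the vertices of `e` exactly `w` is covered before.
      covered-attach : ∀ {e es} w → w ∈ₛ e → 1 ℕ.≤ deg es w →
        (∀ {v} → v ∈ₛ e → 1 ℕ.≤ deg es v → v ≡ w) → covered (e ∷ es) ℕ.+ 1 ≡ covered es ℕ.+ ∣ e ∣
      covered-attach {e} {es} w w∈e dw priv = begin
        covered (e ∷ es) ℕ.+ 1
          ≡⟨ cong (covered (e ∷ es) ℕ.+_) (ℕΣ.⅀-δ w (λ _ → 1)) ⟨
        covered (e ∷ es) ℕ.+ Σℕ (allFin n) (λ v → [ v Fin.≟ w ]ℕ ℕ.* 1)
          ≡⟨ ℕΣ.⅀-+ (allFin n) _ _ ⟨
        Σℕ (allFin n) (λ v → [ 1 ℕ.≤? deg (e ∷ es) v ]ℕ ℕ.+ [ v Fin.≟ w ]ℕ ℕ.* 1)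
          ≡⟨ ℕΣ.⅀-cong (allFin n) pointwise ⟩
        Σℕ (allFin n) (λ v → [ 1 ℕ.≤? deg es v ]ℕ ℕ.+ [ v ∈ e ]ₛ)
          ≡⟨ ℕΣ.⅀-+ (allFin n) _ _ ⟩
        covered es ℕ.+ Σℕ (allFin n) (λ v → [ v ∈ e ]ₛ)
          ≡⟨ cong (covered es ℕ.+_) (∣p∣-Σ e) ⟨
        covered es ℕ.+ ∣ e ∣ ∎
        where
        open ≡.≡-Reasoning
        pointwise : ∀ v → [ 1 ℕ.≤? deg (e ∷ es) v ]ℕ ℕ.+ [ v Fin.≟ w ]ℕ ℕ.* 1 ≡ [ 1 ℕ.≤? deg es v ]ℕ ℕ.+ [ v ∈ e ]ₛ
        pointwise v rewrite deg-∷ e es v with v Subset.∈? e | v Fin.≟ w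
        ... | yes v∈e | yes refl = cong (ℕ._+ 1) (sym (ℕΣ.𝟙-yes (1 ℕ.≤? deg es w) dw))
        ... | yes v∈e | no v≢w with deg es v in eq
        ...   | zero  = refl
        ...   | suc _ = contradiction (priv v∈e (subst (1 ℕ.≤_) (sym eq) (s≤s z≤n))) v≢w
        pointwise v | no v∉e | yes refl = contradiction w∈e v∉e
        pointwise v | no v∉e | no _     = refl

      covered-tree : ∀ {E} K → Tree E → (∀ {e} → e ∈ E → ∣ e ∣ ≡ K) → covered E ℕ.+ length E ≡ length E ℕ.* K ℕ.+ 1
      covered-tree K (single {e} _) sizes = cong (ℕ._+ 1) (begin
        covered (e ∷ [])                       ≡⟨ ℕΣ.⅀-cong (allFin n) pointwise ⟩
        Σℕ (allFin n) (λ v → [ v ∈ e ]ₛ)       ≡⟨ ∣p∣-Σ e ⟨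
        ∣ e ∣                                  ≡⟨ sizes (here refl) ⟩
        K                                      ≡⟨ ℕ.+-identityʳ K ⟨
        1 ℕ.* K ∎)
        where
        open ≡.≡-Reasoning
        pointwise : ∀ v → [ 1 ℕ.≤? deg (e ∷ []) v ]ℕ ≡ [ v ∈ e ]ₛ
        pointwise v rewrite deg-∷ e [] v with v Subset.∈? e
        ... | yes _ = refl
        ... | no _  = refl
      covered-tree {e ∷ es} K (attach w w∈e f∈ w∈f priv t) sizes = begin
        covered (e ∷ es) ℕ.+ suc (length es)   ≡⟨ ℕ.+-assoc (covered (e ∷ es)) 1 (length es) ⟨
        (covered (e ∷ es) ℕ.+ 1) ℕ.+ length es
          ≡⟨ cong (ℕ._+ length es) (covered-attach w w∈e (deg≥1 f∈ w∈f) λ v∈e d → case deg≥1⇒ d of λ { (g , g∈ , v∈g) → priv v∈e g∈ v∈g }) ⟩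
        (covered es ℕ.+ ∣ e ∣) ℕ.+ length es   ≡⟨ cong (λ z → (covered es ℕ.+ z) ℕ.+ length es) (sizes (here refl)) ⟩
        (covered es ℕ.+ K) ℕ.+ length es       ≡⟨ cong (ℕ._+ length es) (ℕ.+-comm (covered es) K) ⟩
        (K ℕ.+ covered es) ℕ.+ length es       ≡⟨ ℕ.+-assoc K (covered es) (length es) ⟩
        K ℕ.+ (covered es ℕ.+ length es)       ≡⟨ cong (K ℕ.+_) (covered-tree K t (sizes ∘ there)) ⟩
        K ℕ.+ (length es ℕ.* K ℕ.+ 1)          ≡⟨ ℕ.+-assoc K (length es ℕ.* K) 1 ⟨
        suc (length es) ℕ.* K ℕ.+ 1 ∎
        where open ≡.≡-Reasoning

    tree-order : ∀ {E} K → Tree E → (∀ {e} → e ∈ E → ∣ e ∣ ≡ K) → (∀ v → 1 ℕ.≤ deg E v) → n ℕ.+ length E ≡ length E ℕ.* K ℕ.+ 1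
    tree-order {E} K t sizes cover = trans (cong (ℕ._+ length E) (sym all)) (covered-tree K t sizes)
      where
      all : covered E ≡ n
      all = trans (ℕΣ.⅀-cong (allFin n) λ v → ℕΣ.𝟙-yes (1 ℕ.≤? deg E v) (cover v))
        (trans (Σℕ-const (allFin n) 1) (trans (ℕ.*-identityʳ _) (List.length-tabulate {n = n} id)))

    At : ℕ → Fin n → List (Subset n) → Set
    At p       w []       = ⊥
    At zero    w (e ∷ es) = w ∈ₛ e × (∀ {g} → g ∈ es → w ∉ₛ g)
    At (suc p) w (e ∷ es) = w ∉ₛ e × At p w es

    At⇒∈ : ∀ {p w} es → At p w es → ∃ λ f → f ∈ es × w ∈ₛ f
    At⇒∈ {zero}  (e ∷ es) (w∈ , _) = e , here refl , w∈
    At⇒∈ {suc p} (e ∷ es) (_ , at) with f , f∈ , w∈f ← At⇒∈ es at = f , there f∈ , w∈f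

    -- The code records, for each attached edge, the position of the edge to which it is attached,
    -- counted from the latest one. Since `w` lies in no other edge, all admissible choices of it
    -- are equivalent, and with a given uniformity the code determines the hypergraph.
    data Grow : List (Subset n) → List ℕ → Set where
      single : ∀ {e} → Grow (e ∷ []) []
      attach : ∀ {e es p ps} w → w ∈ₛ e → At p w es →
               (∀ {v g} → v ∈ₛ e → g ∈ es → v ∈ₛ g → v ≡ w) → Grow es ps → Grow (e ∷ es) (p ∷ ps)

    image-cong : ∀ (π σ : Permutation′ n) {e : Subset n} → (∀ {v} → v ∈ₛ e → π ⟨$⟩ʳ v ≡ σ ⟨$⟩ʳ v) → image π e ≡ image σ e
    image-cong π σ {e} h = image-ext π
      (λ v v∈ → subst (_∈ₛ image σ e) (sym (h v∈)) (π∈image⁺ σ v∈))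
      (λ v πv∈ → subst (_∈ₛ e) (perm-injective π (trans (h (∈-image⁻ σ πv∈)) (inverseʳ σ))) (∈-image⁻ σ πv∈))

    image-transpose : ∀ {u w} {e : Subset n} → (u ∈ₛ e → w ∈ₛ e) → (w ∈ₛ e → u ∈ₛ e) → image (Perm.transpose u w) e ≡ e
    image-transpose {u} {w} {e} to from = image-ext (Perm.transpose u w) f g
      where
      f : ∀ v → v ∈ₛ e → Perm.transpose u w ⟨$⟩ʳ v ∈ₛ e
      f v v∈ with v Fin.≟ u
      ... | yes refl = to v∈
      ... | no _ with v Fin.≟ w
      ...   | yes refl = from v∈
      ...   | no _     = v∈
      g : ∀ v → Perm.transpose u w ⟨$⟩ʳ v ∈ₛ e → v ∈ₛ e
      g v πv∈ with v Fin.≟ u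
      ... | yes refl = from πv∈
      ... | no _ with v Fin.≟ w
      ...   | yes refl = to πv∈
      ...   | no _     = πv∈

    image-∘ : ∀ (π σ : Permutation′ n) {e : Subset n} → image (π Perm.∘ₚ σ) e ≡ image σ (image π e)
    image-∘ π σ {e} = image-ext (π Perm.∘ₚ σ) {e} {image σ (image π e)} (λ v v∈ → π∈image⁺ σ {image π e} (π∈image⁺ π {e} v∈)) (λ v v∈ → π∈image⁻ π {e} (π∈image⁻ σ {image π e} v∈))

    private
      At-image : ∀ (π : Permutation′ n) {p w w′} es → At p w es → At p w′ (map (image π) es) →
        ∀ {g} → g ∈ es → (w ∈ₛ g → w′ ∈ₛ image π g) × (w′ ∈ₛ image π g → w ∈ₛ g)
      At-image π {zero}  (e ∷ es) (w∈ , _) (w′∈ , _) (here refl) = (λ _ → w′∈) , (λ _ → w∈)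
      At-image π {zero}  (e ∷ es) (_ , w∉) (_ , w′∉) (there g∈) =
        (λ w∈ → contradiction w∈ (w∉ g∈)) , (λ w′∈ → contradiction w′∈ (w′∉ (∈-map⁺ (image π) g∈)))
      At-image π {suc p} (e ∷ es) (w∉ , _) (w′∉ , _) (here refl) = (λ w∈ → contradiction w∈ w∉) , (λ w′∈ → contradiction w′∈ w′∉)
      At-image π {suc p} (e ∷ es) (_ , at) (_ , at′) (there g∈)  = At-image π es at at′ g∈

    -- The permutation is extended along the growth: first move the image of the
    -- attachment vertex w onto w′ by a transposition (both lie in the image of the
    -- p-th edge only), then match the new vertices.
    grow-iso : ∀ {es fs ps} K → (∀ {e} → e ∈ es → ∣ e ∣ ≡ K) → (∀ {f} → f ∈ fs → ∣ f ∣ ≡ K) →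
      Grow es ps → Grow fs ps → ∃ λ (π : Permutation′ n) → map (image π) es ≡ fs
    grow-iso K se sf (single {e}) (single {f})
      with π , eq ← extend (elements e) (elements f) (unique-elements e) (unique-elements f)
             (trans (length-elements e) (trans (trans (se (here refl)) (sym (sf (here refl)))) (sym (length-elements f))))
      = π , cong (_∷ []) (image-lists π (lists-elements e) (lists-elements f) eq)
    grow-iso K se sf (attach {e} {es} w w∈e at priv g) (attach {f} {fs} w′ w′∈f at′ priv′ g′)
      with π₀ , refl ← grow-iso K (se ∘ there) (sf ∘ there) g g′
      = π , cong₂ _∷_ image-e (List.map-cong-local (All.tabulate image-old))
      where
      τ = Perm.transpose (π₀ ⟨$⟩ʳ w) w′
      π₁ = π₀ Perm.∘ₚ τ

      image-π₁ : ∀ {h} → h ∈ es → image π₁ h ≡ image π₀ h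
      image-π₁ {h} h∈ = trans (image-∘ π₀ τ {h}) (image-transpose
        (λ u → proj₁ (At-image π₀ es at at′ h∈) (π∈image⁻ π₀ u))
        (λ u → π∈image⁺ π₀ (proj₂ (At-image π₀ es at at′ h∈) u)))

      old : List (Fin n)
      old = elements (⋃ es)

      ∈⋃ : ∀ {v} E → v ∈ₛ ⋃ E → ∃ λ h → h ∈ E × v ∈ₛ h
      ∈⋃ []      v∈ = contradiction v∈ Subset.∉⊥
      ∈⋃ (h ∷ E) v∈ with Subset.x∈p∪q⁻ h (⋃ E) v∈
      ... | inj₁ v∈h = h , here refl , v∈h
      ... | inj₂ v∈E with h′ , h′∈ , v∈h′ ← ∈⋃ E v∈E = h′ , there h′∈ , v∈h′

      ∈⋃⁺ : ∀ {v h} {E : List (Subset n)} → h ∈ E → v ∈ₛ h → v ∈ₛ ⋃ E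
      ∈⋃⁺ (here refl) v∈ = Subset.x∈p∪q⁺ (inj₁ v∈)
      ∈⋃⁺ (there h∈)  v∈ = Subset.x∈p∪q⁺ (inj₂ (∈⋃⁺ h∈ v∈))

      le = lists-others w∈e
      lf = lists-others w′∈f

      disjoint : ∀ {v} → v ∈ others w e → v ∉ old
      disjoint v∈ v∈old with h , h∈ , v∈h ← ∈⋃ es (∈-elements⁻ v∈old)
        with refl ← priv (proj₂ (proj₂ le) (there v∈)) h∈ v∈h = Unique.Unique[x∷xs]⇒x∉xs (proj₁ le) v∈

      disjoint′ : ∀ {v} → v ∈ others w′ f → v ∉ map (π₁ ⟨$⟩ʳ_) old
      disjoint′ v∈ v∈old with u , u∈ , refl ← ∈-map⁻ (π₁ ⟨$⟩ʳ_) v∈old | h , h∈ , u∈h ← ∈⋃ es (∈-elements⁻ (proj₁ (proj₂ (∈-map⁻ (π₁ ⟨$⟩ʳ_) v∈old))))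
        = Unique.Unique[x∷xs]⇒x∉xs (proj₁ lf) (subst (_∈ others w′ f)
            (priv′ (proj₂ (proj₂ lf) (there v∈)) (∈-map⁺ (image π₀) h∈) (subst (π₁ ⟨$⟩ʳ _ ∈ₛ_) (image-π₁ h∈) (π∈image⁺ π₁ u∈h))) v∈)

      sizes : length (others w e) ≡ length (others w′ f)
      sizes = ℕ.suc-injective (trans (lists-length le) (trans (se (here refl)) (trans (sym (sf (here refl))) (sym (lists-length lf)))))

      ext = extend (old ++ others w e) (map (π₁ ⟨$⟩ʳ_) old ++ others w′ f)
        (Unique.++⁺ (unique-elements (⋃ es)) (tail (proj₁ le)) (λ (a , b) → disjoint b a))
        (Unique.++⁺ (Unique.map⁺ (perm-injective π₁) (unique-elements (⋃ es))) (tail (proj₁ lf)) (λ (a , b) → disjoint′ b a))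
        (trans (List.length-++ old) (trans (cong₂ ℕ._+_ (sym (List.length-map (π₁ ⟨$⟩ʳ_) old)) sizes) (sym (List.length-++ (map (π₁ ⟨$⟩ʳ_) old)))))
        where
        tail : ∀ {x : Fin n} {xs} → Unique (x ∷ xs) → Unique xs
        tail (_ ∷ u) = u

      π = proj₁ ext

      halves : map (π ⟨$⟩ʳ_) old ≡ map (π₁ ⟨$⟩ʳ_) old × map (π ⟨$⟩ʳ_) (others w e) ≡ others w′ f
      halves = ++-split (map (π ⟨$⟩ʳ_) old) (map (π₁ ⟨$⟩ʳ_) old) (trans (List.length-map _ old) (sym (List.length-map _ old)))
        (trans (sym (List.map-++ (π ⟨$⟩ʳ_) old (others w e))) (proj₂ ext))

      map-≡⇒ : ∀ {l : List (Fin n)} → map (π ⟨$⟩ʳ_) l ≡ map (π₁ ⟨$⟩ʳ_) l → ∀ {v} → v ∈ l → π ⟨$⟩ʳ v ≡ π₁ ⟨$⟩ʳ v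
      map-≡⇒ {_ ∷ l} eq (here refl) = List.∷-injectiveˡ eq
      map-≡⇒ {_ ∷ l} eq (there v∈)  = map-≡⇒ (List.∷-injectiveʳ eq) v∈

      on-old : ∀ {h} → h ∈ es → ∀ {v} → v ∈ₛ h → π ⟨$⟩ʳ v ≡ π₁ ⟨$⟩ʳ v
      on-old h∈ v∈ = map-≡⇒ (proj₁ halves) (∈-elements⁺ (∈⋃⁺ h∈ v∈))

      image-old : ∀ {h} → h ∈ es → image π h ≡ image π₀ h
      image-old h∈ = trans (image-cong π π₁ (on-old h∈)) (image-π₁ h∈)

      w↦w′ : π ⟨$⟩ʳ w ≡ w′
      w↦w′ with h , h∈ , w∈h ← At⇒∈ es at = trans (on-old h∈ w∈h) (transpose-left (π₀ ⟨$⟩ʳ w) w′)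

      image-e : image π e ≡ f
      image-e = image-lists π le lf (cong₂ _∷_ w↦w′ (proj₂ halves))
open Trees public

-- From connected hypergraphs without cycles to trees

module Building (H : Hypergraph) where

  open ≡ using (refl; sym; trans)

  private
    V = Fin (order H)
    Edge = Subset (order H)

  infix 4 _∈ᵥ_
  _∈ᵥ_ : V → List Edge → Set
  v ∈ᵥ es = ∃ λ f → f ∈ es × v ∈ₛ f

  _∈ᵥ?_ : ∀ v es → Dec (v ∈ᵥ es)
  v ∈ᵥ? es = Dec.map′ find (λ (f , f∈ , v∈) → lose f∈ v∈) (Any.any? (v Subset.∈?_) es)

  -- The list of vertices omits the end point of the path.
  data Path (es : List Edge) : V → V → List V → List Edge → Set where
    stop : ∀ {v} → Path es v v [] []
    step : ∀ {u v x e vs gs} → u ∈ₛ e → x ∈ₛ e → e ∈ es → Path es x v vs gs → Path es u v (u ∷ vs) (e ∷ gs)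

  path-edges : ∀ {es u v vs gs} → Path es u v vs gs → ∀ {g} → g ∈ gs → g ∈ es
  path-edges (step _ _ e∈ p) (here refl) = e∈
  path-edges (step _ _ e∈ p) (there g∈)  = path-edges p g∈

  path-vertices : ∀ {es u v vs gs} → Path es u v vs gs → ∀ {w} → w ∈ vs → w ∈ᵥ es
  path-vertices (step u∈ _ e∈ p) (here refl) = _ , e∈ , u∈
  path-vertices (step _ _ _ p)   (there w∈)  = path-vertices p w∈

  path-weaken : ∀ {es fs u v vs gs} → (∀ {g} → g ∈ es → g ∈ fs) → Path es u v vs gs → Path fs u v vs gs
  path-weaken sub stop             = stop
  path-weaken sub (step u∈ x∈ e∈ p) = step u∈ x∈ (sub e∈) (path-weaken sub p)

  path-snoc : ∀ {es u w v e vs gs} → Path es u w vs gs → w ∈ₛ e → v ∈ₛ e → e ∈ es → Path es u v (vs ++ w ∷ []) (gs ++ e ∷ [])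
  path-snoc stop               w∈ v∈ e∈ = step w∈ v∈ e∈ stop
  path-snoc (step u∈ x∈ f∈ p) w∈ v∈ e∈ = step u∈ x∈ f∈ (path-snoc p w∈ v∈ e∈)

  vertexAt : ∀ {es u v vs gs} → Path es u v vs gs → Fin (suc (length gs)) → V
  vertexAt {v = v} stop _ = v
  vertexAt {u = u} (step _ _ _ p) zero    = u
  vertexAt         (step _ _ _ p) (suc i) = vertexAt p i

  vertexAt-zero : ∀ {es u v vs gs} (p : Path es u v vs gs) → vertexAt p zero ≡ u
  vertexAt-zero stop           = refl
  vertexAt-zero (step _ _ _ p) = refl

  vertexAt-last : ∀ {es u v vs gs} (p : Path es u v vs gs) → vertexAt p (Fin.fromℕ (length gs)) ≡ v
  vertexAt-last stop           = refl
  vertexAt-last (step _ _ _ p) = vertexAt-last p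

  vertexAt-source : ∀ {es u v vs gs} (p : Path es u v vs gs) i → vertexAt p (Fin.inject₁ i) ∈ₛ List.lookup gs i
  vertexAt-source (step u∈ _ _ p) zero    = u∈
  vertexAt-source (step _ _ _ p)  (suc i) = vertexAt-source p i

  vertexAt-target : ∀ {es u v vs gs} (p : Path es u v vs gs) i → vertexAt p (suc i) ∈ₛ List.lookup gs i
  vertexAt-target (step _ x∈ _ p) zero    = subst (_∈ₛ _) (sym (vertexAt-zero p)) x∈
  vertexAt-target (step _ _ _ p)  (suc i) = vertexAt-target p i

  vertexAt-∈ : ∀ {es u v vs gs} (p : Path es u v vs gs) i → vertexAt p (Fin.inject₁ i) ∈ vs
  vertexAt-∈ (step _ _ _ p) zero    = here refl
  vertexAt-∈ (step _ _ _ p) (suc i) = there (vertexAt-∈ p i)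

  vertexAt-injective : ∀ {es u v vs gs} (p : Path es u v vs gs) → Unique vs → ∀ {i j} →
    vertexAt p (Fin.inject₁ i) ≡ vertexAt p (Fin.inject₁ j) → i ≡ j
  vertexAt-injective (step _ _ _ p) (u∉ ∷ uq) {zero}  {zero}  eq = refl
  vertexAt-injective (step _ _ _ p) (u∉ ∷ uq) {zero}  {suc j} eq = contradiction eq (All.lookup u∉ (vertexAt-∈ p j))
  vertexAt-injective (step _ _ _ p) (u∉ ∷ uq) {suc i} {zero}  eq = contradiction (sym eq) (All.lookup u∉ (vertexAt-∈ p i))
  vertexAt-injective (step _ _ _ p) (u∉ ∷ uq) {suc i} {suc j} eq = cong suc (vertexAt-injective p uq eq)

  lookup-injective : ∀ {gs : List Edge} → Unique gs → ∀ {i j} → List.lookup gs i ≡ List.lookup gs j → i ≡ j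
  lookup-injective (g∉ ∷ u) {zero}  {zero}  eq = refl
  lookup-injective (g∉ ∷ u) {zero}  {suc j} eq = contradiction eq (All.lookup g∉ (∈-lookup j))
  lookup-injective (g∉ ∷ u) {suc i} {zero}  eq = contradiction (sym eq) (All.lookup g∉ (∈-lookup i))
  lookup-injective (g∉ ∷ u) {suc i} {suc j} eq = cong suc (lookup-injective u eq)

  closedPath⇒Cycle : ∀ {v vs gs} → Path (edges H) v v vs gs → Unique vs → Unique gs → 2 ℕ.≤ length gs → Cycle H
  closedPath⇒Cycle {v} {vs} {gs} p uv ug 2≤ = record
    { len = length gs ; 2≤len = 2≤ ; vertex = vertexAt p ; edge = List.lookup gs
    ; isEdge = λ i → path-edges p (∈-lookup i)
    ; source∈ = vertexAt-source p ; target∈ = vertexAt-target p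
    ; closed = trans (vertexAt-last p) (sym (vertexAt-zero p))
    ; vertex-dist = vertexAt-injective p uv
    ; edge-dist = lookup-injective ug }

  Simple : List Edge → V → V → Set
  Simple es u v = ∃₂ λ vs gs → Path es u v vs gs × Unique vs × v ∉ vs × Unique gs

  -- The invariant by which a second common vertex of a new edge with the old ones turns into a
  -- cycle.
  Linked : List Edge → Set
  Linked es = ∀ {u v} → u ∈ᵥ es → v ∈ᵥ es → Simple es u v

  single-step : ∀ {es e u v} → e ∈ es → u ∈ₛ e → v ∈ₛ e → Simple es u v
  single-step {e = e} {u} {v} e∈ u∈ v∈ with u Fin.≟ v
  ... | yes refl = [] , [] , stop , [] , (λ ()) , []
  ... | no u≢v   = u ∷ [] , e ∷ [] , step u∈ v∈ e∈ stop , [] ∷ [] , (λ { (here v≡u) → u≢v (sym v≡u) }) , [] ∷ []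

  -- A path to a vertex that occurs only in `e` passes through `w` and takes `e` as its last edge,
  -- which is new to the path; dually at the start.
  linked-attach : ∀ {e es w} → e ∉ es → w ∈ₛ e → w ∈ᵥ es → Linked es → Linked (e ∷ es)
  linked-attach {e} {es} {w} e∉ w∈e w∈es link {u} {v} = go (u ∈ᵥ? es) (v ∈ᵥ? es)
    where
    in-e : ∀ {x} → ¬ (x ∈ᵥ es) → x ∈ᵥ e ∷ es → x ∈ₛ e
    in-e x∉ (f , here refl , x∈) = x∈
    in-e x∉ (f , there f∈ , x∈)  = contradiction (f , f∈ , x∈) x∉
    go : Dec (u ∈ᵥ es) → Dec (v ∈ᵥ es) → u ∈ᵥ e ∷ es → v ∈ᵥ e ∷ es → Simple (e ∷ es) u v
    go (yes u∈) (yes v∈) _ _ with vs , gs , p , rest ← link u∈ v∈ = vs , gs , path-weaken there p , rest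
    go (no u∉) (yes v∈) u∈′ _ with vs , gs , p , uv , v∉ , ug ← link w∈es v∈ =
      u ∷ vs , e ∷ gs , step (in-e u∉ u∈′) w∈e (here refl) (path-weaken there p)
      , All.tabulate (λ x∈ eq → u∉ (subst (_∈ᵥ es) (sym eq) (path-vertices p x∈))) ∷ uv
      , (λ { (here v≡u) → u∉ (subst (_∈ᵥ es) v≡u v∈) ; (there v∈vs) → v∉ v∈vs })
      , All.tabulate (λ g∈ eq → e∉ (subst (_∈ es) (sym eq) (path-edges p g∈))) ∷ ug
    go (yes u∈) (no v∉) _ v∈′ with vs , gs , p , uv , w∉ , ug ← link u∈ w∈es =
      vs ++ w ∷ [] , gs ++ e ∷ [] , path-snoc (path-weaken there p) w∈e (in-e v∉ v∈′) (here refl)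
      , Unique.++⁺ uv ([] ∷ []) (λ { (x∈ , here refl) → w∉ x∈ })
      , (λ v∈vs → [ (λ x∈ → v∉ (path-vertices p x∈)) , (λ { (here refl) → v∉ w∈es }) ]′ (∈-++⁻ vs v∈vs))
      , Unique.++⁺ ug ([] ∷ []) (λ { (x∈ , here refl) → e∉ (path-edges p x∈) })
    go (no u∉) (no v∉) u∈′ v∈′ = single-step (here refl) (in-e u∉ u∈′) (in-e v∉ v∈′)

  module _ {k m} (hyp : IsHypertree (suc k) m H) where

    open IsHypertree hyp

    sizes : ∀ {e} → e ∈ edges H → ∣ e ∣ ≡ suc k
    sizes = All.lookup uniform

    inhabited : ∀ {e} → e ∈ edges H → ∃ λ v → v ∈ₛ e
    inhabited {e} e∈ with elements e in eq
    ... | v ∷ _ = v , ∈-elements⁻ (subst (v ∈_) (sym eq) (here refl))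
    ... | [] with () ← trans (cong (λ l → length l) (sym eq)) (trans (length-elements e) (sizes e∈))

    record Part (es rs : List Edge) : Set where
      field
        tree   : Tree es
        linked : Linked es
        parts  : es ++ rs ↭ edges H

      old : ∀ {g} → g ∈ es → g ∈ edges H
      old g∈ = ↭.∈-resp-↭ parts (∈-++⁺ˡ g∈)

      new : ∀ {g} → g ∈ rs → g ∈ edges H
      new g∈ = ↭.∈-resp-↭ parts (∈-++⁺ʳ es g∈)

      separate : ∀ {g} → g ∈ rs → g ∉ es
      separate g∈rs g∈es with ys , p ← ∈⇒↭ g∈rs | zs , q ← ∈⇒↭ g∈es =
        Unique.Unique[x∷xs]⇒x∉xs (unique-↭ (↭-trans (↭-sym parts) (↭.++⁺ q p)) (unique H)) (∈-++⁺ʳ zs (here refl))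

    start : ∀ {e} → e ∈ edges H → ∃ λ rs → Part (e ∷ []) rs
    start e∈ with rs , p ← ∈⇒↭ e∈ = rs , record
      { tree   = single (proj₂ (inhabited e∈))
      ; linked = λ { (_ , here refl , u∈) (_ , here refl , v∈) → single-step (here refl) u∈ v∈ }
      ; parts  = ↭-sym p }

    extendPart : ∀ {es rs} → Part es rs → ∀ {e w} → e ∈ rs → w ∈ₛ e → w ∈ᵥ es → ∃ λ rs′ → Part (e ∷ es) rs′ × rs ↭ e ∷ rs′
    extendPart {es} {rs} part {e} {w} e∈ w∈e w∈es@(f , f∈ , w∈f) with rs′ , p ← ∈⇒↭ e∈ = rs′ , record
      { tree   = attach w w∈e f∈ w∈f priv tree
      ; linked = linked-attach (separate e∈) w∈e w∈es linked
      ; parts  = ↭-trans (↭-sym (↭.shift e es rs′)) (↭-trans (↭.++⁺ˡ es (↭-sym p)) parts) } , p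
      where
      open Part part
      -- If `e` met the old edges in a second vertex `v`, a simple path of old edges from `v` back
      -- to `w` would close up with `e` to a cycle.
      priv : ∀ {v g} → v ∈ₛ e → g ∈ es → v ∈ₛ g → v ≡ w
      priv {v} {g} v∈e g∈ v∈g with v Fin.≟ w
      ... | yes v≡w = v≡w
      ... | no v≢w with linked (g , g∈ , v∈g) w∈es
      ...   | vs , gs , p , uv , w∉ , ug = contradiction (closedPath⇒Cycle
        (step w∈e v∈e (new e∈) (path-weaken old p))
        (All.tabulate (λ x∈ eq → w∉ (subst (_∈ vs) (sym eq) x∈)) ∷ uv)
        (All.tabulate (λ x∈ eq → separate e∈ (subst (_∈ es) (sym eq) (path-edges p x∈))) ∷ ug)
        (s≤s (nonempty p))) acyclic
        where
        nonempty : ∀ {vs gs} → Path es v w vs gs → 1 ℕ.≤ length gs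
        nonempty stop           = contradiction refl v≢w
        nonempty (step _ _ _ _) = s≤s z≤n

    root : ∀ {es} → Tree es → ∃ λ u → u ∈ᵥ es
    root (single w∈)           = _ , _ , here refl , w∈
    root (attach w w∈ _ _ _ _) = w , _ , here refl , w∈

    -- Follow a walk from a covered vertex to a vertex of `e`. The first edge on it outside `es` is
    -- entered at a covered vertex; if there is none, `e` itself touches the part.
    findNext : ∀ {es rs} → Part es rs → ∀ {e} → e ∈ rs → ∃₂ λ g w → g ∈ rs × w ∈ₛ g × w ∈ᵥ es
    findNext {es} {rs} part {e} e∈ with u , u∈es ← root (Part.tree part) | x , x∈ ← inhabited (Part.new part e∈) =
      [ (λ x∈es → e , x , e∈ , x∈ , x∈es) , id ]′ (go (connected u x) u∈es)
      where
      open Part part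
      go : ∀ {a b} → Star (Adjacent H) a b → a ∈ᵥ es → b ∈ᵥ es ⊎ ∃₂ λ g w → g ∈ rs × w ∈ₛ g × w ∈ᵥ es
      go ε a∈ = inj₁ a∈
      go ((g , g∈ , a∈g , c∈g) ◅ star) a∈ with ∈-++⁻ es (↭.∈-resp-↭ (↭-sym parts) g∈)
      ... | inj₁ g∈es = go star (g , g∈es , c∈g)
      ... | inj₂ g∈rs = inj₂ (g , _ , g∈rs , a∈g , a∈)

    -- The given part remains a suffix, so that a growth prescribed at the beginning is kept.
    complete : ∀ {es rs} → Part es rs → ∃ λ ns → Part (ns ++ es) []
    complete {es} {rs} part = go (length rs) part refl
      where
      go : ∀ l {es rs} → Part es rs → length rs ≡ l → ∃ λ ns → Part (ns ++ es) []
      go zero    {rs = []}    part eq = [] , part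
      go (suc l) {es} {r ∷ rs} part eq with g , w , g∈ , w∈g , w∈es ← findNext part (here refl)
        with rs′ , part′ , p ← extendPart part g∈ w∈g w∈es
        with ns , full ← go l part′ (ℕ.suc-injective (trans (sym (↭.↭-length p)) eq)) =
        ns ++ g ∷ [] , subst (λ z → Part z []) (sym (List.++-assoc ns (g ∷ []) es)) full

    Part-full : ∀ {es} → Part es [] → es ↭ edges H
    Part-full {es} part = subst (_↭ edges H) (List.++-identityʳ es) (Part.parts part)

    covers : ∀ {e} → e ∈ edges H → ∀ v → 1 ℕ.≤ deg (edges H) v
    covers e∈ v with u , u∈ ← inhabited e∈ with connected v u
    ... | ε                       = deg≥1 e∈ u∈
    ... | (g , g∈ , v∈g , _) ◅ _ = deg≥1 g∈ v∈g

-- Trees are connected and acyclic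

module _ where

  open ≡ using (refl; sym; trans)

  tree-connected : ∀ {H es} → (∀ {g} → g ∈ es → g ∈ edges H) → Tree es →
    ∀ {u v} → (∃ λ f → f ∈ es × u ∈ₛ f) → (∃ λ f → f ∈ es × v ∈ₛ f) → Star (Adjacent H) u v
  tree-connected {H} sub (single _) (_ , here refl , u∈) (_ , here refl , v∈) = (_ , sub (here refl) , u∈ , v∈) ◅ ε
  tree-connected {H} sub (attach w w∈e f∈ w∈f _ t) (_ , here refl , u∈) (_ , here refl , v∈) = (_ , sub (here refl) , u∈ , v∈) ◅ ε
  tree-connected {H} sub (attach w w∈e f∈ w∈f _ t) (_ , here refl , u∈) (_ , there g∈ , v∈) =
    (_ , sub (here refl) , u∈ , w∈e) ◅ tree-connected {H} (sub ∘ there) t (_ , f∈ , w∈f) (_ , g∈ , v∈)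
  tree-connected {H} sub (attach w w∈e f∈ w∈f _ t) (_ , there g∈ , u∈) (_ , here refl , v∈) =
    tree-connected {H} (sub ∘ there) t (_ , g∈ , u∈) (_ , f∈ , w∈f) ◅◅ ((_ , sub (here refl) , w∈e , v∈) ◅ ε)
  tree-connected {H} sub (attach w w∈e f∈ w∈f _ t) (_ , there g∈ , u∈) (_ , there h∈ , v∈) =
    tree-connected {H} (sub ∘ there) t (_ , g∈ , u∈) (_ , h∈ , v∈)

  next : ∀ {l} → Fin (suc l) → Fin (suc l)
  next i with Top.view i
  ... | Top.‵fromℕ     = zero
  ... | Top.‵inject₁ j = suc j

  prev : ∀ {l} (i : Fin (suc l)) → ∃ λ j → next j ≡ i
  prev {l} zero = Fin.fromℕ l , eq
    where
    eq : next (Fin.fromℕ l) ≡ zero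
    eq rewrite Top.view-fromℕ l = refl
  prev {suc l} (suc i) = Fin.inject₁ i , eq
    where
    eq : next (Fin.inject₁ i) ≡ suc i
    eq rewrite Top.view-inject₁ i = refl

  next≢ : ∀ {l} (i : Fin (suc (suc l))) → next i ≢ i
  next≢ i eq with Top.view i
  ... | Top.‵fromℕ     with () ← eq
  ... | Top.‵inject₁ j = ℕ.1+n≢n (trans (cong toℕ eq) (Fin.toℕ-inject₁ j))

  module _ {H : Hypergraph} where

    private
      -- The latest edge `e` cannot lie on the cycle: its two vertices there belong also to the
      -- preceding and the following edge, which are in `es`, so both would be `w`. Otherwise the
      -- cycle lies in the smaller tree.
      impossible : ∀ {E} → Tree E → ∀ {l} (vertex : Fin (suc (suc (suc l))) → Fin (order H)) (edge : Fin (suc (suc l)) → Subset (order H)) →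
        (∀ i → vertex (Fin.inject₁ i) ∈ₛ edge i) → (∀ i → vertex (suc i) ∈ₛ edge i) → vertex (Fin.fromℕ (suc (suc l))) ≡ vertex zero →
        (∀ {i j} → vertex (Fin.inject₁ i) ≡ vertex (Fin.inject₁ j) → i ≡ j) → (∀ {i j} → edge i ≡ edge j → i ≡ j) → ¬ (∀ i → edge i ∈ E)
      impossible (single _) vertex edge source target closed vd ed all with all zero | all (suc zero)
      ... | here p | here q with () ← ed {zero} {suc zero} (trans p (sym q))
      impossible {e ∷ es} (attach w _ _ _ priv t) {l} vertex edge source target closed vd ed all = case Fin.any? (λ i → edge i ≟ₛ e) of λ where
          (no none)       → impossible t vertex edge source target closed vd ed (λ i → [ (λ p → contradiction (i , p) none) , id ]′ (cases (all i)))
          (yes (i , refl)) → hit i refl (prev i)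
        where
        cases : ∀ {g} → g ∈ e ∷ es → g ≡ e ⊎ g ∈ es
        cases (here p)   = inj₁ p
        cases (there g∈) = inj₂ g∈
        turn : ∀ i → vertex (suc i) ≡ vertex (Fin.inject₁ (next i))
        turn i with Top.view i
        ... | Top.‵fromℕ     = closed
        ... | Top.‵inject₁ j = refl
        elsewhere : ∀ {i j} → edge i ≡ e → j ≢ i → edge j ∈ es
        elsewhere {i} {j} p j≢i = [ (λ q → contradiction (ed (trans q (sym p))) j≢i) , id ]′ (cases (all j))
        hit : ∀ i → edge i ≡ e → ¬ (∃ λ j → next j ≡ i)
        hit i p (j , refl) = next≢ (next j) (vd (trans (sym (turn (next j))) (trans target-w (sym source-w))))
          where
          source-w : vertex (Fin.inject₁ (next j)) ≡ w
          source-w = priv (subst (_ ∈ₛ_) p (source (next j))) (elsewhere p (λ eq → next≢ j (sym eq)))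
            (subst (_∈ₛ edge j) (turn j) (target j))
          target-w : vertex (suc (next j)) ≡ w
          target-w = priv (subst (_ ∈ₛ_) p (target (next j))) (elsewhere p (next≢ (next j)))
            (subst (_∈ₛ edge (next (next j))) (sym (turn (next j))) (source (next (next j))))

    tree-acyclic : Tree (edges H) → ¬ Cycle H
    tree-acyclic t cyc = go t (Cycle.len cyc) (Cycle.2≤len cyc) (Cycle.vertex cyc) (Cycle.edge cyc) (Cycle.source∈ cyc) (Cycle.target∈ cyc)
        (Cycle.closed cyc) (Cycle.vertex-dist cyc) (Cycle.edge-dist cyc) (Cycle.isEdge cyc)
      where
      go : ∀ {E} → Tree E → ∀ len → 2 ℕ.≤ len → (vertex : Fin (suc len) → Fin (order H)) (edge : Fin len → Subset (order H)) →
        (∀ i → vertex (Fin.inject₁ i) ∈ₛ edge i) → (∀ i → vertex (suc i) ∈ₛ edge i) → vertex (Fin.fromℕ len) ≡ vertex zero →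
        (∀ {i j} → vertex (Fin.inject₁ i) ≡ vertex (Fin.inject₁ j) → i ≡ j) → (∀ {i j} → edge i ≡ edge j → i ≡ j) → ¬ (∀ i → edge i ∈ E)
      go t (suc (suc l)) (s≤s (s≤s _)) = impossible t

    tree-hypertree : ∀ {k} → Tree (edges H) → (∀ {e} → e ∈ edges H → ∣ e ∣ ≡ k) → (∀ v → ∃ λ f → f ∈ edges H × v ∈ₛ f) →
      IsHypertree k (length (edges H)) H
    tree-hypertree t sizes cover = record
      { uniform   = All.tabulate sizes
      ; size      = refl
      ; connected = λ u v → tree-connected {H} id t (cover u) (cover v)
      ; acyclic   = tree-acyclic t }

-- Double counting of contacts

module Counting where

  open ≡ using (refl; sym; trans)
  open ℕΣ using () renaming (⅀₂ to Σ₂)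
  open import Data.Nat.Solver using (module +-*-Solver)
  open +-*-Solver using (solve; _:+_; _:*_; _:=_; con)

  Σℕ-sub : ∀ {a} {A : Set a} {as xs : List A} (f : A → ℕ) → Unique as → (∀ {x} → x ∈ as → x ∈ xs) → Σℕ as f ℕ.≤ Σℕ xs f
  Σℕ-sub {as = as} {xs} f u sub with zs , p ← unique-⊆⇒↭ u sub = ℕ.≤-trans (ℕ.m≤m+n (Σℕ as f) (Σℕ zs f))
    (ℕ.≤-reflexive (sym (trans (ℕΣ.⅀-↭ f p) (ℕΣ.⅀-++ as zs f))))

  Σℕ-two : ∀ {a} {A : Set a} (xs : List A) (f : A → ℕ) → Unique xs → (∀ {x} → x ∈ xs → f x ℕ.≤ 1) → 2 ℕ.≤ Σℕ xs f →
    ∃₂ λ x y → x ∈ xs × y ∈ xs × x ≢ y × 1 ℕ.≤ f x × 1 ℕ.≤ f y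
  Σℕ-two (x ∷ xs) f (x∉ ∷ u) le 2≤ with f x in eq | le (here refl)
  ... | zero | _ with a , b , a∈ , b∈ , rest ← Σℕ-two xs f u (le ∘ there) 2≤ = a , b , there a∈ , there b∈ , rest
  ... | suc zero | _ with b , b∈ , p ← Σℕ-pos xs f (ℕ.≤-pred 2≤) =
    x , b , here refl , there b∈ , All.lookup x∉ b∈ , ℕ.≤-reflexive (sym eq) , p
  ... | suc (suc _) | s≤s ()

  Σ₂-double : ∀ {a} {A : Set a} (xs : List A) (h : A → A → ℕ) →
    Σ₂ xs (λ x y → h x y ℕ.+ h y x) ℕ.+ Σℕ xs (λ x → h x x) ≡ Σℕ xs (λ x → Σℕ xs (h x))
  Σ₂-double []       h = refl
  Σ₂-double (x ∷ xs) h = begin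
    (Σℕ xs (λ y → h x y ℕ.+ h y x) ℕ.+ Σ₂ xs (λ x y → h x y ℕ.+ h y x)) ℕ.+ (h x x ℕ.+ Σℕ xs (λ x → h x x))
      ≡⟨ cong (λ z → (z ℕ.+ Σ₂ xs (λ x y → h x y ℕ.+ h y x)) ℕ.+ (h x x ℕ.+ Σℕ xs (λ x → h x x))) (ℕΣ.⅀-+ xs _ _) ⟩
    ((A ℕ.+ B) ℕ.+ Σ₂ xs (λ x y → h x y ℕ.+ h y x)) ℕ.+ (h x x ℕ.+ Σℕ xs (λ x → h x x))
      ≡⟨ solve 5 (λ a b s d t → ((a :+ b) :+ s) :+ (d :+ t) := (d :+ a) :+ (b :+ (s :+ t))) refl A B _ (h x x) _ ⟩
    (h x x ℕ.+ A) ℕ.+ (B ℕ.+ (Σ₂ xs (λ x y → h x y ℕ.+ h y x) ℕ.+ Σℕ xs (λ x → h x x)))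
      ≡⟨ cong (λ z → (h x x ℕ.+ A) ℕ.+ (B ℕ.+ z)) (Σ₂-double xs h) ⟩
    (h x x ℕ.+ A) ℕ.+ (B ℕ.+ Σℕ xs (λ y → Σℕ xs (h y)))
      ≡⟨ cong ((h x x ℕ.+ A) ℕ.+_) (ℕΣ.⅀-+ xs _ _) ⟨
    (h x x ℕ.+ A) ℕ.+ Σℕ xs (λ y → h y x ℕ.+ Σℕ xs (h y)) ∎
    where
    open ≡.≡-Reasoning
    A = Σℕ xs (h x)
    B = Σℕ xs (λ y → h y x)

  tri-≤1 : ∀ a → tri a ℕ.≤ 1 → a ℕ.≤ 2
  tri-≤1 0 _ = z≤n
  tri-≤1 1 _ = s≤s z≤n
  tri-≤1 2 _ = s≤s (s≤s z≤n)
  tri-≤1 (suc (suc (suc a))) (s≤s ())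

  tri-≤0 : ∀ a → tri a ℕ.≤ 0 → a ℕ.≤ 1
  tri-≤0 0 _ = z≤n
  tri-≤0 1 _ = s≤s z≤n

  tri-∸ : ∀ b x → x ℕ.≤ b ℕ.+ 1 → tri (x ∸ b) ≡ 0
  tri-∸ b x le with x ∸ b | ℕ.m≤n+o⇒m∸n≤o x b le
  ... | 0           | _ = refl
  ... | 1           | _ = refl
  ... | suc (suc _) | s≤s ()

  record Arrangement {n} (k : ℕ) (E : List (Subset n)) : Set where
    field
      tree   : Tree E
      distinct : Unique E
      sizes  : ∀ {e} → e ∈ E → ∣ e ∣ ≡ suc k
      cover  : ∀ v → 1 ℕ.≤ deg E v

  module _ {n k : ℕ} {E : List (Subset n)} (arr : Arrangement k E) where

    open Arrangement arr

    private
      m K : ℕ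
      m = length E
      K = suc k

    order-length : n ℕ.+ m ≡ m ℕ.* K ℕ.+ 1
    order-length = tree-order K tree sizes cover

    Σ-deg : Σℕ (allFin n) (deg E) ≡ m ℕ.* K
    Σ-deg = trans (ℕΣ.⅀-cong (allFin n) (deg-Σ E)) (trans (ℕΣ.⅀-swap (allFin n) E _)
      (trans (ℕΣ.⅀-cong∈ E (λ {e} e∈ → trans (sym (∣p∣-Σ e)) (sizes e∈))) (Σℕ-const E K)))

    inter≤1 : ∀ {e f} → e ∈ E → f ∈ E → e ≢ f → ∣ e ∩ f ∣ ≡ 0 ⊎ ∃ λ c → c ∈ₛ e × c ∈ₛ f × (∀ {v} → v ∈ₛ e → v ∈ₛ f → v ≡ c)
    inter≤1 {e} {f} e∈ f∈ e≢f with ∣ e ∩ f ∣ in eq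
    ... | zero  = inj₁ refl
    ... | suc _ with c , c∈e , c∈f ← ∣∩∣-≥1⇒ {e = e} {f} (subst (1 ℕ.≤_) (sym eq) (s≤s z≤n)) =
      inj₂ (c , c∈e , c∈f , λ v∈e v∈f → tree-meet tree e∈ f∈ e≢f v∈e v∈f c∈e c∈f)

    -- The number a_e. In a tree with at least two edges every edge has at least `suc K` contacts,
    -- so nothing is truncated; if the degrees are at most 2, it is the number of neighbours minus
    -- 1.
    excess : Subset n → ℕ
    excess e = contacts E e ∸ suc K

    defect : ℕ
    defect = Σℕ E (tri ∘ excess)

    module _ (2≤m : 2 ℕ.≤ m) where

      contacts-excess : ∀ {e} → e ∈ E → contacts E e ≡ suc K ℕ.+ excess e
      contacts-excess {e} e∈ = sym (ℕ.m+[n∸m]≡n lower)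
        where
        lower : suc K ℕ.≤ contacts E e
        lower with f , f∈ , e≢f , v , v∈e , v∈f ← tree-neighbour tree distinct 2≤m e∈ = ℕ.≤-trans
          (ℕ.≤-trans (ℕ.≤-reflexive (ℕ.+-comm 1 K)) (ℕ.+-mono-≤ (ℕ.≤-reflexive (sym (trans (∣∩∣-self e) (sizes e∈))))
            (ℕ.≤-trans (∣∩∣-≥1 {e = e} {f} v∈e v∈f) (ℕ.m≤m+n _ 0))))
          (Σℕ-sub (λ g → ∣ e ∩ g ∣) ((e≢f ∷ []) ∷ [] ∷ []) λ { (here refl) → e∈ ; (there (here refl)) → f∈ })

      -- The value at e is counted once for each edge that meets e, which is `suc (excess e)` times.
      -- The diagonal terms, where e meets itself in `K` vertices, are added to both sides so that
      -- `Σ₂-double` applies.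
      Σ₂-inter : ∀ (φ : Subset n → ℕ) → Σ₂ E (λ e f → ∣ e ∩ f ∣ ℕ.* (φ e ℕ.+ φ f)) ≡ Σℕ E (λ e → φ e ℕ.* suc (excess e))
      Σ₂-inter φ = ℕ.+-cancelʳ-≡ (Σℕ E (λ e → φ e ℕ.* K)) _ _ (begin
        Σ₂ E (λ e f → ∣ e ∩ f ∣ ℕ.* (φ e ℕ.+ φ f)) ℕ.+ Σℕ E (λ e → φ e ℕ.* K)
          ≡⟨ cong₂ ℕ._+_ (ℕΣ.⅀₂-cong∈ distinct (λ {e} {f} _ _ _ → trans (ℕ.*-distribˡ-+ ∣ e ∩ f ∣ (φ e) (φ f))
               (cong₂ ℕ._+_ (ℕ.*-comm ∣ e ∩ f ∣ (φ e)) (trans (ℕ.*-comm ∣ e ∩ f ∣ (φ f)) (cong (φ f ℕ.*_) (∣∩∣-comm e f))))))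
             (ℕΣ.⅀-cong∈ E (λ {e} e∈ → cong (φ e ℕ.*_) (sym (trans (∣∩∣-self e) (sizes e∈))))) ⟩
        Σ₂ E (λ e f → φ e ℕ.* ∣ e ∩ f ∣ ℕ.+ φ f ℕ.* ∣ f ∩ e ∣) ℕ.+ Σℕ E (λ e → φ e ℕ.* ∣ e ∩ e ∣)
          ≡⟨ Σ₂-double E (λ e f → φ e ℕ.* ∣ e ∩ f ∣) ⟩
        Σℕ E (λ e → Σℕ E (λ f → φ e ℕ.* ∣ e ∩ f ∣))
          ≡⟨ ℕΣ.⅀-cong∈ E (λ {e} e∈ → trans (sym (ℕΣ.⅀-*ˡ E (φ e) _)) (trans (cong (φ e ℕ.*_) (contacts-excess e∈))
               (solve 3 (λ p K a → p :* (con 1 :+ K :+ a) := p :* (con 1 :+ a) :+ p :* K) refl (φ e) K (excess e)))) ⟩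
        Σℕ E (λ e → φ e ℕ.* suc (excess e) ℕ.+ φ e ℕ.* K)
          ≡⟨ ℕΣ.⅀-+ E _ _ ⟩
        Σℕ E (λ e → φ e ℕ.* suc (excess e)) ℕ.+ Σℕ E (λ e → φ e ℕ.* K) ∎)
        where open ≡.≡-Reasoning

      module _ (deg≤2 : ∀ v → deg E v ℕ.≤ 2) where

        private
          deg-two : ∀ v → deg E v ≡ 1 ℕ.+ [ deg E v ℕ.≟ 2 ]ℕ
          deg-two v with deg E v | cover v | deg≤2 v
          ... | 1 | _ | _ = refl
          ... | 2 | _ | _ = refl
          ... | suc (suc (suc _)) | _ | s≤s (s≤s ())

        -- The contacts of `e` are the sum of the degrees on `e`, which is `K` plus the number of
        -- its vertices of degree 2.
        spread : ∀ {e} → e ∈ E → Spread (deg E) e (suc (excess e))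
        spread {e} e∈ = record
          { twos    = filter (λ v → deg E v ℕ.≟ 2) (elements e)
          ; ones    = filter (λ v → ¬? (deg E v ℕ.≟ 2)) (elements e)
          ; lists   = lists-resp-↭ (↭-sym (filter-¬filter-↭ (λ v → deg E v ℕ.≟ 2) (elements e))) (lists-elements e)
          ; #twos   = ℕ.+-cancelˡ-≡ K _ _ (trans (sym count) (trans (contacts-excess e∈) (sym (ℕ.+-suc K (excess e)))))
          ; at-twos = λ v∈ → proj₂ (∈-filter⁻ (λ v → deg E v ℕ.≟ 2) {xs = elements e} v∈)
          ; at-ones = λ {v} v∈ → trans (deg-two v) (cong suc (ℕΣ.𝟙-no (deg E v ℕ.≟ 2)
              (proj₂ (∈-filter⁻ (λ v → ¬? (deg E v ℕ.≟ 2)) {xs = elements e} v∈))))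
          }
          where
          open ≡.≡-Reasoning
          count : contacts E e ≡ K ℕ.+ length (filter (λ v → deg E v ℕ.≟ 2) (elements e))
          count = begin
            contacts E e
              ≡⟨ contacts-deg E e ⟩
            Σℕ (allFin n) (λ v → [ v ∈ e ]ₛ ℕ.* deg E v)
              ≡⟨ ℕΣ.⅀-cong (allFin n) (λ v → trans (cong ([ v ∈ e ]ₛ ℕ.*_) (deg-two v)) (trans (ℕ.*-distribˡ-+ [ v ∈ e ]ₛ 1 _)
                   (cong (ℕ._+ [ v ∈ e ]ₛ ℕ.* [ deg E v ℕ.≟ 2 ]ℕ) (ℕ.*-identityʳ _)))) ⟩
            Σℕ (allFin n) (λ v → [ v ∈ e ]ₛ ℕ.+ [ v ∈ e ]ₛ ℕ.* [ deg E v ℕ.≟ 2 ]ℕ)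
              ≡⟨ ℕΣ.⅀-+ (allFin n) _ _ ⟩
            Σℕ (allFin n) (λ v → [ v ∈ e ]ₛ) ℕ.+ Σℕ (allFin n) (λ v → [ v ∈ e ]ₛ ℕ.* [ deg E v ℕ.≟ 2 ]ℕ)
              ≡⟨ cong₂ ℕ._+_ (trans (sym (∣p∣-Σ e)) (sizes e∈)) (sym (trans (length-filter (λ v → deg E v ℕ.≟ 2) (elements e))
                   (ℕΣ.⅀-filter (Subset._∈? e) (allFin n) _))) ⟩
            K ℕ.+ length (filter (λ v → deg E v ℕ.≟ 2) (elements e)) ∎

        excess-bound : ∀ {e} → e ∈ E → suc (excess e) ℕ.≤ K
        excess-bound {e} e∈ = subst (ℕ._≤ K) S.#twos (ℕ.≤-trans (ℕ.m≤m+n (length S.twos) (length S.ones))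
          (ℕ.≤-reflexive (trans (sym (List.length-++ S.twos)) (trans (lists-length S.lists) (sizes e∈)))))
          where module S = Spread (spread e∈)

        -- The contacts of all edges add up to the sum of the squares of the degrees, and x² + 2 =
        -- 3x for x = 1, 2. The sum of the degrees and the number of vertices are known from `Σ-deg`
        -- and `order-length`.
        Σ-excess : Σℕ E excess ℕ.+ 2 ≡ m
        Σ-excess = ℕ.+-cancelˡ-≡ (3 ℕ.* (m ℕ.* K) ℕ.+ m) _ _ (begin
          (3 ℕ.* (m ℕ.* K) ℕ.+ m) ℕ.+ (X ℕ.+ 2)
            ≡⟨ solve 3 (λ mK m X → (con 3 :* mK :+ m) :+ (X :+ con 2) := (m :+ mK :+ X) :+ con 2 :* (mK :+ con 1)) refl (m ℕ.* K) m X ⟩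
          (m ℕ.+ m ℕ.* K ℕ.+ X) ℕ.+ 2 ℕ.* (m ℕ.* K ℕ.+ 1)
            ≡⟨ cong₂ (λ a b → a ℕ.+ 2 ℕ.* b) total (sym order-length) ⟩
          Σℕ E (contacts E) ℕ.+ 2 ℕ.* (n ℕ.+ m)
            ≡⟨ solve 3 (λ c n m → c :+ con 2 :* (n :+ m) := (c :+ con 2 :* n) :+ con 2 :* m) refl (Σℕ E (contacts E)) n m ⟩
          (Σℕ E (contacts E) ℕ.+ 2 ℕ.* n) ℕ.+ 2 ℕ.* m
            ≡⟨ cong (ℕ._+ 2 ℕ.* m) squares ⟩
          3 ℕ.* (m ℕ.* K) ℕ.+ 2 ℕ.* m
            ≡⟨ solve 2 (λ a m → a :+ con 2 :* m := (a :+ m) :+ m) refl (3 ℕ.* (m ℕ.* K)) m ⟩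
          (3 ℕ.* (m ℕ.* K) ℕ.+ m) ℕ.+ m ∎)
          where
          open ≡.≡-Reasoning
          X = Σℕ E excess
          total : m ℕ.+ m ℕ.* K ℕ.+ X ≡ Σℕ E (contacts E)
          total = sym (trans (ℕΣ.⅀-cong∈ E contacts-excess) (trans (ℕΣ.⅀-+ E (λ _ → suc K) excess)
            (cong (ℕ._+ X) (trans (Σℕ-const E (suc K)) (ℕ.*-suc m K)))))
          square : ∀ v → deg E v ℕ.* deg E v ℕ.+ 2 ≡ 3 ℕ.* deg E v
          square v with deg E v | cover v | deg≤2 v
          ... | 1 | _ | _ = refl
          ... | 2 | _ | _ = refl
          ... | suc (suc (suc _)) | _ | s≤s (s≤s ())
          squares : Σℕ E (contacts E) ℕ.+ 2 ℕ.* n ≡ 3 ℕ.* (m ℕ.* K)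
          squares = begin
            Σℕ E (contacts E) ℕ.+ 2 ℕ.* n
              ≡⟨ cong₂ ℕ._+_ (trans (ℕΣ.⅀-cong E (contacts-deg E)) (trans (ℕΣ.⅀-swap E (allFin n) _)
                   (ℕΣ.⅀-cong (allFin n) λ v → trans (sym (ℕΣ.⅀-*ʳ E _ (deg E v))) (cong (ℕ._* deg E v) (sym (deg-Σ E v))))))
                 (trans (ℕ.*-comm 2 n) (sym (trans (Σℕ-const (allFin n) 2) (cong (ℕ._* 2) (List.length-tabulate {n = n} id))))) ⟩
            Σℕ (allFin n) (λ v → deg E v ℕ.* deg E v) ℕ.+ Σℕ (allFin n) (λ _ → 2)
              ≡⟨ ℕΣ.⅀-+ (allFin n) _ _ ⟨
            Σℕ (allFin n) (λ v → deg E v ℕ.* deg E v ℕ.+ 2)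
              ≡⟨ ℕΣ.⅀-cong (allFin n) square ⟩
            Σℕ (allFin n) (λ v → 3 ℕ.* deg E v)
              ≡⟨ ℕΣ.⅀-*ˡ (allFin n) 3 _ ⟨
            3 ℕ.* Σℕ (allFin n) (deg E)
              ≡⟨ cong (3 ℕ.*_) Σ-deg ⟩
            3 ℕ.* (m ℕ.* K) ∎

        Σ₂-pairs : Σ₂ E (λ e f → ∣ e ∩ f ∣) ℕ.+ 1 ≡ m
        Σ₂-pairs = ℕ.*-cancelˡ-≡ _ _ 2 (begin
          2 ℕ.* (P ℕ.+ 1)
            ≡⟨ solve 1 (λ P → con 2 :* (P :+ con 1) := P :* con 2 :+ con 2) refl P ⟩
          P ℕ.* 2 ℕ.+ 2
            ≡⟨ cong (ℕ._+ 2) (trans (ℕΣ.⅀₂-*ʳ E (λ e f → ∣ e ∩ f ∣) 2) (trans (Σ₂-inter (λ _ → 1)) (ℕΣ.⅀-cong E (λ e → ℕ.*-identityˡ _)))) ⟩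
          Σℕ E (λ e → suc (excess e)) ℕ.+ 2
            ≡⟨ cong (ℕ._+ 2) (trans (ℕΣ.⅀-+ E (λ _ → 1) excess) (cong (ℕ._+ Σℕ E excess) (trans (Σℕ-const E 1) (ℕ.*-identityʳ m)))) ⟩
          (m ℕ.+ Σℕ E excess) ℕ.+ 2
            ≡⟨ ℕ.+-assoc m (Σℕ E excess) 2 ⟩
          m ℕ.+ (Σℕ E excess ℕ.+ 2)
            ≡⟨ cong (m ℕ.+_) Σ-excess ⟩
          m ℕ.+ m
            ≡⟨ cong (m ℕ.+_) (ℕ.+-identityʳ m) ⟨
          2 ℕ.* m ∎)
          where
          open ≡.≡-Reasoning
          P = Σ₂ E (λ e f → ∣ e ∩ f ∣)

        -- The center is one of the `suc (excess e)` vertices of degree 2 in `e`, and likewise in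
        -- `f`; this is why the counts are the excesses themselves.
        flower : ∀ {e f c} → e ∈ E → f ∈ E → e ≢ f → c ∈ₛ e → c ∈ₛ f → Flower (deg E) e f (excess e) (excess f)
        flower {e} {f} {c} e∈ f∈ e≢f c∈e c∈f = record
          { center = c ; twos₁ = twos e ; ones₁ = ones e ; twos₂ = twos f ; ones₂ = ones f
          ; unique = unique-↭ (prep c (↭-sym (↭.++⁺ (filter-¬filter-↭ (λ v → deg E v ℕ.≟ 2) (others c e)) (filter-¬filter-↭ (λ v → deg E v ℕ.≟ 2) (others c f)))))
              (All.++⁺ (All.tabulate λ v∈ eq → proj₂ (∈-others {w = c} {e} v∈) (sym eq)) (All.tabulate λ v∈ eq → proj₂ (∈-others {w = c} {f} v∈) (sym eq))
               ∷ Unique.++⁺ (unique-others c e) (unique-others c f) λ (a , b) → proj₂ (∈-others {w = c} {e} a) (tree-meet tree e∈ f∈ e≢f (proj₁ (∈-others {w = c} {e} a)) (proj₁ (∈-others {w = c} {f} b)) c∈e c∈f))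
          ; lists₁ = lists-resp-↭ (prep c (↭-sym (filter-¬filter-↭ (λ v → deg E v ℕ.≟ 2) (others c e)))) (lists-others c∈e)
          ; lists₂ = lists-resp-↭ (prep c (↭-sym (filter-¬filter-↭ (λ v → deg E v ℕ.≟ 2) (others c f)))) (lists-others c∈f)
          ; #twos₁ = count e∈ c∈e ; #twos₂ = count f∈ c∈f
          ; at-center = center-two
          ; at-twos₁ = at-two {e} ; at-twos₂ = at-two {f} ; at-ones₁ = at-one {e} ; at-ones₂ = at-one {f}
          }
          where
          twos ones : Subset n → List (Fin n)
          twos g = filter (λ v → deg E v ℕ.≟ 2) (others c g)
          ones g = filter (λ v → ¬? (deg E v ℕ.≟ 2)) (others c g)
          at-two : ∀ {g v} → v ∈ twos g → deg E v ≡ 2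
          at-two {g} v∈ = proj₂ (∈-filter⁻ (λ v → deg E v ℕ.≟ 2) {xs = others c g} v∈)
          at-one : ∀ {g v} → v ∈ ones g → deg E v ≡ 1
          at-one {g} {v} v∈ = trans (deg-two v) (cong suc (ℕΣ.𝟙-no (deg E v ℕ.≟ 2) (proj₂ (∈-filter⁻ (λ v → ¬? (deg E v ℕ.≟ 2)) {xs = others c g} v∈))))
          center-two : deg E c ≡ 2
          center-two = ℕ.≤-antisym (deg≤2 c) (ℕ.≤-trans (ℕ.≤-reflexive (sym (cong₂ ℕ._+_ (ℕΣ.𝟙-yes (c Subset.∈? e) c∈e)
              (trans (ℕ.+-identityʳ _) (ℕΣ.𝟙-yes (c Subset.∈? f) c∈f)))))
            (ℕ.≤-trans (Σℕ-sub (λ g → [ c ∈ g ]ₛ) ((e≢f ∷ []) ∷ [] ∷ []) λ { (here refl) → e∈ ; (there (here refl)) → f∈ })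
              (ℕ.≤-reflexive (sym (deg-Σ E c)))))
          count : ∀ {g} → g ∈ E → c ∈ₛ g → length (twos g) ≡ excess g
          count {g} g∈ c∈ = ℕ.suc-injective (begin
            suc (length (twos g))
              ≡⟨ cong suc (length-filter (λ v → deg E v ℕ.≟ 2) (others c g)) ⟩
            suc (Σℕ (others c g) (λ v → [ deg E v ℕ.≟ 2 ]ℕ))
              ≡⟨ cong (ℕ._+ Σℕ (others c g) (λ v → [ deg E v ℕ.≟ 2 ]ℕ)) (sym (ℕΣ.𝟙-yes (deg E c ℕ.≟ 2) center-two)) ⟩
            Σℕ (c ∷ others c g) (λ v → [ deg E v ℕ.≟ 2 ]ℕ)
              ≡⟨ ℕΣ.⅀-↭ _ (lists-↭ (lists-others c∈)) ⟨
            Σℕ (elements g) (λ v → [ deg E v ℕ.≟ 2 ]ℕ)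
              ≡⟨ ℕΣ.⅀-↭ _ (lists-↭ S.lists) ⟩
            Σℕ (S.twos ++ S.ones) (λ v → [ deg E v ℕ.≟ 2 ]ℕ)
              ≡⟨ ℕΣ.⅀-++ S.twos S.ones _ ⟩
            Σℕ S.twos (λ v → [ deg E v ℕ.≟ 2 ]ℕ) ℕ.+ Σℕ S.ones (λ v → [ deg E v ℕ.≟ 2 ]ℕ)
              ≡⟨ cong₂ ℕ._+_ (ℕΣ.⅀-cong∈ S.twos (λ {v} v∈ → ℕΣ.𝟙-yes (deg E v ℕ.≟ 2) (S.at-twos v∈)))
                   (ℕΣ.⅀-0 S.ones (λ {v} v∈ → ℕΣ.𝟙-no (deg E v ℕ.≟ 2) (λ eq → case trans (sym (S.at-ones v∈)) eq of λ ()))) ⟩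
            Σℕ S.twos (λ _ → 1) ℕ.+ 0
              ≡⟨ trans (ℕ.+-identityʳ _) (trans (Σℕ-const S.twos 1) (trans (ℕ.*-identityʳ _) S.#twos)) ⟩
            suc (excess g) ∎)
            where
            open ≡.≡-Reasoning
            module S = Spread (spread g∈)
open Counting public

-- Trees of defect 1: the hub and its leaves

module Shapes where

  open ≡ using (refl; sym; trans)
  open ℕΣ using () renaming (⅀₂ to Σ₂)

  ∈-pair : ∀ {a} {A : Set a} (xs : List A) → length xs ≡ 2 → ∀ {x y z} → x ∈ xs → y ∈ xs → x ≢ y → z ∈ xs → z ≡ x ⊎ z ≡ y
  ∈-pair (a ∷ b ∷ []) _ (here refl) (here refl) ne _ = contradiction refl ne
  ∈-pair (a ∷ b ∷ []) _ (here refl) (there (here refl)) ne (here refl) = inj₁ refl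
  ∈-pair (a ∷ b ∷ []) _ (here refl) (there (here refl)) ne (there (here refl)) = inj₂ refl
  ∈-pair (a ∷ b ∷ []) _ (there (here refl)) (here refl) ne (here refl) = inj₂ refl
  ∈-pair (a ∷ b ∷ []) _ (there (here refl)) (here refl) ne (there (here refl)) = inj₁ refl
  ∈-pair (a ∷ b ∷ []) _ (there (here refl)) (there (here refl)) ne _ = contradiction refl ne

  module _ {n : ℕ} where

    contacts-three : ∀ {K} {E : List (Subset n)} {e f g} → ∣ e ∣ ≡ K → e ∈ E → f ∈ E → g ∈ E → e ≢ f → e ≢ g → f ≢ g →
      1 ℕ.≤ ∣ e ∩ f ∣ → 1 ℕ.≤ ∣ e ∩ g ∣ → suc (suc K) ℕ.≤ contacts E e
    contacts-three {K} {E} {e} {f} {g} ∣e∣ e∈ f∈ g∈ e≢f e≢g f≢g ef eg = ℕ.≤-trans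
      (ℕ.≤-trans (ℕ.≤-reflexive (ℕ.+-comm 2 K)) (ℕ.+-mono-≤ (ℕ.≤-reflexive (sym (trans (∣∩∣-self e) ∣e∣)))
        (ℕ.+-mono-≤ ef (ℕ.≤-trans eg (ℕ.m≤m+n _ 0)))))
      (Σℕ-sub (λ h → ∣ e ∩ h ∣) ((e≢f ∷ e≢g ∷ []) ∷ (f≢g ∷ []) ∷ [] ∷ [])
        λ { (here refl) → e∈ ; (there (here refl)) → f∈ ; (there (there (here refl))) → g∈ })

    contacts-∷ : ∀ E (e g : Subset n) → contacts E g ℕ.≤ contacts (e ∷ E) g
    contacts-∷ E e g = ℕ.m≤n+m (contacts E g) ∣ g ∩ e ∣

    -- Otherwise the two edges would form a component of their own. In the induction an edge that
    -- meets the latest one has another neighbour among the older edges, and with three edges in all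
    -- the latest one touches one of the two.
    tree-adjacent : ∀ {K} {E : List (Subset n)} → Tree E → Unique E → 3 ℕ.≤ length E → (∀ {e} → e ∈ E → ∣ e ∣ ≡ K) →
      ∀ {e f} → e ∈ E → f ∈ E → e ≢ f → 1 ℕ.≤ ∣ e ∩ f ∣ → suc (suc K) ℕ.≤ contacts E e ⊎ suc (suc K) ℕ.≤ contacts E f
    tree-adjacent (single _) _ (s≤s ()) sizes e∈ f∈ e≢f ef
    tree-adjacent {K} {g ∷ es} (attach w w∈g h∈ w∈h priv t) (g∉ ∷ u) (s≤s 2≤) sizes = go
      where
      headCase : ∀ {f} → f ∈ es → 1 ℕ.≤ ∣ f ∩ g ∣ → suc (suc K) ℕ.≤ contacts (g ∷ es) f
      headCase {f} f∈ fg with h , h∈ , f≢h , v , v∈f , v∈h ← tree-neighbour t u 2≤ f∈ =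
        contacts-three (sizes (there f∈)) (there f∈) (here refl) (there h∈) (λ eq → All.lookup g∉ f∈ (sym eq)) f≢h
          (All.lookup g∉ h∈) fg (∣∩∣-≥1 {e = f} {h} v∈f v∈h)
      third : ∀ {e f} → e ∈ es → f ∈ es → e ≢ f → 1 ℕ.≤ ∣ e ∩ f ∣ → length es ≡ 2 →
        suc (suc K) ℕ.≤ contacts (g ∷ es) e ⊎ suc (suc K) ℕ.≤ contacts (g ∷ es) f
      third {e} {f} e∈ f∈ e≢f ef len with ∈-pair es len e∈ f∈ e≢f h∈
      ... | inj₁ refl = inj₁ (contacts-three (sizes (there e∈)) (there e∈) (there f∈) (here refl) e≢f (λ eq → All.lookup g∉ e∈ (sym eq))
              (λ eq → All.lookup g∉ f∈ (sym eq)) ef (∣∩∣-≥1 {e = e} {g} w∈h w∈g))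
      ... | inj₂ refl = inj₂ (contacts-three (sizes (there f∈)) (there f∈) (there e∈) (here refl) (e≢f ∘ sym) (λ eq → All.lookup g∉ f∈ (sym eq))
              (λ eq → All.lookup g∉ e∈ (sym eq)) (subst (1 ℕ.≤_) (∣∩∣-comm e f) ef) (∣∩∣-≥1 {e = f} {g} w∈h w∈g))
      go : ∀ {e f} → e ∈ g ∷ es → f ∈ g ∷ es → e ≢ f → 1 ℕ.≤ ∣ e ∩ f ∣ → suc (suc K) ℕ.≤ contacts (g ∷ es) e ⊎ suc (suc K) ℕ.≤ contacts (g ∷ es) f
      go (here refl) (here refl) e≢f ef = contradiction refl e≢f
      go {f = f} (here refl) (there f∈)  e≢f ef = inj₂ (headCase f∈ (subst (1 ℕ.≤_) (∣∩∣-comm g f) ef))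
      go (there e∈)  (here refl) e≢f ef = inj₁ (headCase e∈ ef)
      go {e} {f} (there e∈) (there f∈) e≢f ef with ℕ.m≤n⇒m<n∨m≡n 2≤
      ... | inj₂ 2≡ = third e∈ f∈ e≢f ef (sym 2≡)
      ... | inj₁ 3≤ = Sum.map (λ le → ℕ.≤-trans le (contacts-∷ es g e)) (λ le → ℕ.≤-trans le (contacts-∷ es g f))
              (tree-adjacent t u 3≤ (sizes ∘ there) e∈ f∈ e≢f ef)

  module OneDefect {n k : ℕ} {E : List (Subset n)} (arr : Arrangement k E) (3≤m : 3 ℕ.≤ length E)
    (deg≤2 : ∀ v → deg E v ℕ.≤ 2) (defect≡1 : defect arr ≡ 1) where

    open Arrangement arr

    private
      2≤m : 2 ℕ.≤ length E
      2≤m = ℕ.≤-trans (ℕ.n≤1+n 2) 3≤m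
      a = excess arr

    -- As the excesses are at most 2, `peak` is the indicator of excess 2; both are natural numbers
    -- so that they can be summed over edges and pairs.
    leaf peak : Subset n → ℕ
    leaf e = [ a e ℕ.≟ 0 ]ℕ
    peak e = tri (a e)

    a≤2 : ∀ {e} → e ∈ E → a e ℕ.≤ 2
    a≤2 {e} e∈ = tri-≤1 (a e) (ℕ.≤-trans (Σℕ-≥ (tri ∘ a) e∈) (ℕ.≤-reflexive defect≡1))

    abstract
      center : ∃ λ e → e ∈ E × a e ≡ 2
      center with e , e∈ , p ← Σℕ-pos E (tri ∘ a) (ℕ.≤-reflexive (sym defect≡1)) = e , e∈ , two (a e) (a≤2 e∈) p
        where
        two : ∀ x → x ℕ.≤ 2 → 1 ℕ.≤ tri x → x ≡ 2
        two 2 _ _ = refl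
        two (suc (suc (suc x))) (s≤s (s≤s ())) _

    hub : Subset n
    hub = proj₁ center

    hub∈ : hub ∈ E
    hub∈ = proj₁ (proj₂ center)

    a-hub : a hub ≡ 2
    a-hub = proj₂ (proj₂ center)

    a≤1 : ∀ {e} → e ∈ E → e ≢ hub → a e ℕ.≤ 1
    a≤1 {e} e∈ e≢ = tri-≤0 (a e) (ℕ.+-cancelʳ-≤ 1 (tri (a e)) 0 (ℕ.≤-trans
      (ℕ.≤-reflexive (cong (tri (a e) ℕ.+_) (trans (sym (cong tri a-hub)) (sym (ℕ.+-identityʳ _)))))
      (ℕ.≤-trans (Σℕ-sub (tri ∘ a) ((e≢ ∷ []) ∷ [] ∷ []) λ { (here refl) → e∈ ; (there (here refl)) → hub∈ }) (ℕ.≤-reflexive defect≡1))))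

    peak-hub : peak hub ≡ 1
    peak-hub = cong tri a-hub

    peak-other : ∀ {e} → e ∈ E → e ≢ hub → peak e ≡ 0
    peak-other {e} e∈ e≢ = zero′ (a e) (a≤1 e∈ e≢)
      where
      zero′ : ∀ x → x ℕ.≤ 1 → tri x ≡ 0
      zero′ 0 _ = refl
      zero′ 1 _ = refl
      zero′ (suc (suc x)) (s≤s ())

    -- For x at most 2, x + [x = 0] = 1 + C(x, 2). Summed over the edges this compares with the sum
    -- of the excesses, which is two less than the number of edges.
    Σ-leaf : Σℕ E leaf ≡ 3
    Σ-leaf = ℕ.+-cancelˡ-≡ (Σℕ E a ℕ.+ 2) _ _ (begin
      (Σℕ E a ℕ.+ 2) ℕ.+ Σℕ E leaf  ≡⟨ trans (ℕ.+-assoc (Σℕ E a) 2 _) (trans (cong (Σℕ E a ℕ.+_) (ℕ.+-comm 2 _)) (sym (ℕ.+-assoc (Σℕ E a) _ 2))) ⟩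
      (Σℕ E a ℕ.+ Σℕ E leaf) ℕ.+ 2  ≡⟨ cong (ℕ._+ 2) (trans (sym (ℕΣ.⅀-+ E a leaf)) (trans (ℕΣ.⅀-cong∈ E (λ {e} e∈ → balance (a e) (a≤2 e∈))) (ℕΣ.⅀-+ E (λ _ → 1) peak))) ⟩
      (Σℕ E (λ _ → 1) ℕ.+ defect arr) ℕ.+ 2 ≡⟨ cong₂ (λ x y → (x ℕ.+ y) ℕ.+ 2) (trans (Σℕ-const E 1) (ℕ.*-identityʳ _)) defect≡1 ⟩
      (length E ℕ.+ 1) ℕ.+ 2        ≡⟨ ℕ.+-assoc (length E) 1 2 ⟩
      length E ℕ.+ 3                ≡⟨ cong (ℕ._+ 3) (Σ-excess arr 2≤m deg≤2) ⟨
      (Σℕ E a ℕ.+ 2) ℕ.+ 3 ∎)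
      where
      open ≡.≡-Reasoning
      balance : ∀ x → x ℕ.≤ 2 → x ℕ.+ [ x ℕ.≟ 0 ]ℕ ≡ 1 ℕ.+ tri x
      balance 0 _ = refl
      balance 1 _ = refl
      balance 2 _ = refl
      balance (suc (suc (suc x))) (s≤s (s≤s ()))

    Σ₂-leaf : Σ₂ E (λ e f → ∣ e ∩ f ∣ ℕ.* (leaf e ℕ.+ leaf f)) ≡ 3
    Σ₂-leaf = trans (Σ₂-inter arr 2≤m leaf) (trans (ℕΣ.⅀-cong E (λ e → one (a e))) Σ-leaf)
      where
      one : ∀ x → [ x ℕ.≟ 0 ]ℕ ℕ.* suc x ≡ [ x ℕ.≟ 0 ]ℕ
      one zero    = refl
      one (suc x) = refl

    Σ₂-peak : Σ₂ E (λ e f → ∣ e ∩ f ∣ ℕ.* (peak e ℕ.+ peak f)) ≡ 3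
    Σ₂-peak = trans (Σ₂-inter arr 2≤m peak) (trans
      (ℕΣ.⅀-single (λ e → peak e ℕ.* suc (a e)) distinct hub∈ (λ {e} e∈ e≢ → cong (ℕ._* suc (a e)) (peak-other e∈ e≢)))
      (cong₂ (λ x y → x ℕ.* suc y) peak-hub a-hub))

    leafContact : Subset n → ℕ
    leafContact e = leaf e ℕ.* ∣ e ∩ hub ∣

    hubLeaves : ℕ
    hubLeaves = Σℕ E leafContact

    -- Since `peak` vanishes off the hub, only pairs of a leaf and the hub are left.
    Σ₂-hubLeaves : Σ₂ E (λ e f → ∣ e ∩ f ∣ ℕ.* (leaf e ℕ.* peak f ℕ.+ leaf f ℕ.* peak e)) ≡ hubLeaves
    Σ₂-hubLeaves = begin
      Σ₂ E (λ e f → ∣ e ∩ f ∣ ℕ.* (leaf e ℕ.* peak f ℕ.+ leaf f ℕ.* peak e))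
        ≡⟨ ℕΣ.⅀₂-cong∈ distinct (λ {e} {f} _ _ _ → trans (ℕ.*-distribˡ-+ ∣ e ∩ f ∣ _ _) (cong (λ z → ∣ e ∩ f ∣ ℕ.* (leaf e ℕ.* peak f) ℕ.+ z ℕ.* (leaf f ℕ.* peak e)) (∣∩∣-comm e f))) ⟩
      Σ₂ E (λ e f → h e f ℕ.+ h f e)
        ≡⟨ trans (cong (Σ₂ E (λ e f → h e f ℕ.+ h f e) ℕ.+_) (ℕΣ.⅀-0 E (λ {e} _ → trans (cong (∣ e ∩ e ∣ ℕ.*_) (diag (a e))) (ℕ.*-zeroʳ ∣ e ∩ e ∣)))) (ℕ.+-identityʳ _) ⟨
      Σ₂ E (λ e f → h e f ℕ.+ h f e) ℕ.+ Σℕ E (λ e → h e e)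
        ≡⟨ Σ₂-double E h ⟩
      Σℕ E (λ e → Σℕ E (h e))
        ≡⟨ ℕΣ.⅀-cong E (λ e → trans (ℕΣ.⅀-single (h e) distinct hub∈ (λ {f} f∈ f≢ →
             trans (cong (λ z → ∣ e ∩ f ∣ ℕ.* (leaf e ℕ.* z)) (peak-other f∈ f≢)) (trans (cong (∣ e ∩ f ∣ ℕ.*_) (ℕ.*-zeroʳ (leaf e))) (ℕ.*-zeroʳ ∣ e ∩ f ∣))))
             (trans (cong (λ z → ∣ e ∩ hub ∣ ℕ.* (leaf e ℕ.* z)) peak-hub) (trans (cong (∣ e ∩ hub ∣ ℕ.*_) (ℕ.*-identityʳ (leaf e))) (ℕ.*-comm ∣ e ∩ hub ∣ (leaf e))))) ⟩
      hubLeaves ∎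
      where
      open ≡.≡-Reasoning
      h : Subset n → Subset n → ℕ
      h e f = ∣ e ∩ f ∣ ℕ.* (leaf e ℕ.* peak f)
      diag : ∀ x → [ x ℕ.≟ 0 ]ℕ ℕ.* tri x ≡ 0
      diag zero    = refl
      diag (suc x) = refl

    leafContact≤1 : ∀ {e} → e ∈ E → leafContact e ℕ.≤ 1
    leafContact≤1 {e} e∈ = gate (a e ℕ.≟ 0) (λ a≡0 → small (inter≤1 arr e∈ hub∈ λ e≡h → case trans (sym a≡0) (trans (cong a e≡h) a-hub) of λ ()))
      where
      gate : ∀ {P : Set} (d : Dec P) {x} → (P → x ℕ.≤ 1) → [ d ]ℕ ℕ.* x ℕ.≤ 1
      gate (yes p) h = ℕ.≤-trans (ℕ.≤-reflexive (ℕ.+-identityʳ _)) (h p)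
      gate (no _)  h = z≤n
      small : ∣ e ∩ hub ∣ ≡ 0 ⊎ (∃ λ c → c ∈ₛ e × c ∈ₛ hub × (∀ {v} → v ∈ₛ e → v ∈ₛ hub → v ≡ c)) → ∣ e ∩ hub ∣ ℕ.≤ 1
      small (inj₁ z)                        = subst (ℕ._≤ 1) (sym z) z≤n
      small (inj₂ (c , c∈e , c∈h , only)) = ℕ.≤-reflexive (∣∩∣-≡1 {e = e} {hub} c∈e c∈h only)

    leafContact⇒ : ∀ {e} → 1 ℕ.≤ leafContact e → a e ≡ 0 × 1 ℕ.≤ ∣ e ∩ hub ∣
    leafContact⇒ {e} = gate (a e ℕ.≟ 0)
      where
      gate : ∀ {P : Set} (d : Dec P) {x} → 1 ℕ.≤ [ d ]ℕ ℕ.* x → P × 1 ℕ.≤ x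
      gate (yes p) le = p , ℕ.≤-trans le (ℕ.≤-reflexive (ℕ.+-identityʳ _))

    twoHubLeaves⇒ : 2 ℕ.≤ hubLeaves → ∃₂ λ x y → x ∈ E × y ∈ E × x ≢ y × (a x ≡ 0 × 1 ℕ.≤ ∣ x ∩ hub ∣) × (a y ≡ 0 × 1 ℕ.≤ ∣ y ∩ hub ∣)
    twoHubLeaves⇒ 2≤ with x , y , x∈ , y∈ , x≢y , p , q ← Σℕ-two E leafContact distinct leafContact≤1 2≤ =
      x , y , x∈ , y∈ , x≢y , leafContact⇒ {x} p , leafContact⇒ {y} q

    ⇒twoHubLeaves : ∀ {x y} → x ∈ E → y ∈ E → x ≢ y → a x ≡ 0 × 1 ℕ.≤ ∣ x ∩ hub ∣ → a y ≡ 0 × 1 ℕ.≤ ∣ y ∩ hub ∣ → 2 ℕ.≤ hubLeaves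
    ⇒twoHubLeaves {x} {y} x∈ y∈ x≢y p q = ℕ.≤-trans (ℕ.+-mono-≤ (contact {x} p) (ℕ.≤-trans (contact {y} q) (ℕ.m≤m+n _ 0)))
      (Σℕ-sub leafContact ((x≢y ∷ []) ∷ [] ∷ []) λ { (here refl) → x∈ ; (there (here refl)) → y∈ })
      where
      contact : ∀ {z} → a z ≡ 0 × 1 ℕ.≤ ∣ z ∩ hub ∣ → 1 ℕ.≤ leafContact z
      contact {z} (a≡0 , le) = ℕ.*-mono-≤ {1} {leaf z} {1} (ℕ.≤-reflexive (sym (ℕΣ.𝟙-yes (a z ℕ.≟ 0) a≡0))) le

    leaves-apart : ∀ {e f} → e ∈ E → f ∈ E → e ≢ f → 1 ℕ.≤ ∣ e ∩ f ∣ → a e ≡ 0 → a f ≢ 0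
    leaves-apart {e} {f} e∈ f∈ e≢f ef a≡0 b≡0 = [ small e∈ a≡0 , small f∈ b≡0 ]′ (tree-adjacent tree distinct 3≤m sizes e∈ f∈ e≢f ef)
      where
      small : ∀ {g} → g ∈ E → a g ≡ 0 → ¬ (suc (suc (suc k)) ℕ.≤ contacts E g)
      small g∈ z le = ℕ.<-irrefl (sym (trans (contacts-excess arr 2≤m g∈) (trans (cong (suc (suc k) ℕ.+_) z) (ℕ.+-identityʳ _)))) le
open Shapes public

-- Recognising the hyperpath and the fork by their growth

module Classification where

  open ≡ using (refl; sym; trans)

  module Growth {n : ℕ} (K : ℕ) (cap : Subset n → ℕ) where

    -- All edges but the first already have all their contacts, and the first lacks at most one.
    Saturating : List (Subset n) → Set
    Saturating []       = ⊥
    Saturating (h ∷ tl) = (∀ {g} → g ∈ tl → cap g ℕ.≤ contacts (h ∷ tl) g) × cap h ℕ.≤ suc (contacts (h ∷ tl) h)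

    -- Meeting `e` would give `g` one contact more than `cap` allows.
    exceeds : ∀ {e es g w} → cap g ℕ.≤ contacts es g → contacts (e ∷ es) g ℕ.≤ cap g → w ∈ₛ e → w ∉ₛ g
    exceeds {e} {es} {g} full le w∈e w∈g = ℕ.<-irrefl refl (ℕ.≤-trans (ℕ.+-mono-≤ (∣∩∣-≥1 {e = g} {e} w∈g w∈e) full) le)

    -- The attachment vertex avoids all edges that have their contacts, so it lies in the head only.
    -- This contact completes the head, and the new edge, which has at most two contacts besides
    -- itself, then lacks at most one.
    grow-step : ∀ {e} es {ps} → Tree (e ∷ es) → ∣ e ∣ ≡ K → (∀ {g} → g ∈ es → contacts (e ∷ es) g ℕ.≤ cap g) →
      cap e ℕ.≤ suc (suc K) → Grow es ps → Saturating es → Grow (e ∷ es) (0 ∷ ps) × Saturating (e ∷ es)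
    grow-step {e} (h ∷ tl) (attach w w∈e f∈ w∈f priv t) ∣e∣ bound cap-e g (full , almost) =
      attach w w∈e (w∈h f∈ w∈f , off) priv g , tail , top
      where
      off : ∀ {g} → g ∈ tl → w ∉ₛ g
      off {g} g∈ = exceeds {e} {h ∷ tl} {g} (full g∈) (bound (there g∈)) w∈e
      w∈h : ∀ {f} → f ∈ h ∷ tl → w ∈ₛ f → w ∈ₛ h
      w∈h (here refl) w∈ = w∈
      w∈h (there f∈)  w∈ = contradiction w∈ (off f∈)
      touch : ∀ {f} → f ∈ h ∷ tl → w ∈ₛ f → 1 ℕ.≤ ∣ e ∩ h ∣
      touch f∈ w∈f = ∣∩∣-≥1 {e = e} {h} w∈e (w∈h f∈ w∈f)
      tail : ∀ {g} → g ∈ h ∷ tl → cap g ℕ.≤ contacts (e ∷ h ∷ tl) g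
      tail (here refl) = ℕ.≤-trans almost (ℕ.+-monoˡ-≤ (contacts (h ∷ tl) h) (subst (1 ℕ.≤_) (∣∩∣-comm e h) (touch f∈ w∈f)))
      tail {g} (there g∈) = ℕ.≤-trans (full g∈) (contacts-∷ (h ∷ tl) e g)
      top : cap e ℕ.≤ suc (contacts (e ∷ h ∷ tl) e)
      top = ℕ.≤-trans cap-e (s≤s (ℕ.≤-trans (ℕ.≤-reflexive (ℕ.+-comm 1 K))
        (ℕ.+-mono-≤ (ℕ.≤-reflexive (sym (trans (∣∩∣-self e) ∣e∣))) (ℕ.≤-trans (touch f∈ w∈f) (ℕ.m≤m+n ∣ e ∩ h ∣ _)))))

    grow-on : ∀ ns {es ps} → Tree (ns ++ es) → (∀ {g} → g ∈ ns → ∣ g ∣ ≡ K) →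
      (∀ {g} → g ∈ ns ++ es → contacts (ns ++ es) g ℕ.≤ cap g) → (∀ {g} → g ∈ ns → cap g ℕ.≤ suc (suc K)) →
      Grow es ps → Saturating es → Grow (ns ++ es) (replicate (length ns) 0 ++ ps) × Saturating (ns ++ es)
    grow-on []       t sizes bound caps g sat = g , sat
    grow-on (e ∷ ns) {es} t sizes bound caps g sat =
      grow-step (ns ++ es) t (sizes (here refl)) (bound ∘ there) (caps (here refl)) (proj₁ IH) (proj₂ IH)
      where
      nonempty : ∀ ns {es} → Saturating es → ns ++ es ≢ []
      nonempty []      {_ ∷ _} sat ()
      nonempty (_ ∷ _) sat ()
      rest′ : ∀ {L} → L ≢ [] → Tree (e ∷ L) → Tree L
      rest′ ne (attach _ _ _ _ _ t) = t
      rest′ ne (single _)           = contradiction refl ne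
      rest : Tree (e ∷ ns ++ es) → Tree (ns ++ es)
      rest = rest′ (nonempty ns sat)
      IH = grow-on ns (rest t) (sizes ∘ there) (λ {g} g∈ → ℕ.≤-trans (contacts-∷ (ns ++ es) e g) (bound (there g∈))) (caps ∘ there) g sat

  module OfHypertree (H : Hypergraph) {k m} (hyp : IsHypertree (suc k) m H) where

    open Building H

    private
      K : ℕ
      K = suc k
      E = edges H
      cap : Subset (order H) → ℕ
      cap = contacts E
    open Growth K cap

    arrangement : ∀ {es} → es ↭ E → Tree es → ∀ {e} → e ∈ E → Arrangement k es
    arrangement p t e∈ = record
      { tree     = t
      ; distinct = unique-↭ (↭-sym p) (unique H)
      ; sizes    = sizes hyp ∘ ↭.∈-resp-↭ p
      ; cover    = λ v → subst (1 ℕ.≤_) (sym (deg-↭ p v)) (covers hyp e∈ v) }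

    private
      finish : ∀ {ns ps} es₀ → Part hyp (ns ++ es₀) [] → (∀ {g} → g ∈ ns → cap g ℕ.≤ suc (suc K)) → Grow es₀ ps → Saturating es₀ →
        ∃ λ fs → fs ↭ E × Grow fs (replicate (m ∸ length es₀) 0 ++ ps)
      finish {ns} {ps} es₀ part small g sat = ns ++ es₀ , q , subst (λ l → Grow (ns ++ es₀) (replicate l 0 ++ ps)) len
        (proj₁ (grow-on ns (Part.tree part) (λ h∈ → sizes hyp (↭.∈-resp-↭ q (∈-++⁺ˡ h∈))) (λ {h} _ → ℕ.≤-reflexive (contacts-↭ h q)) small g sat))
        where
        q : ns ++ es₀ ↭ E
        q = Part-full hyp part
        len : length ns ≡ m ∸ length es₀
        len = sym (trans (cong (_∸ length es₀) (trans (sym (IsHypertree.size hyp)) (trans (sym (↭.↭-length q)) (List.length-++ ns))))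
          (ℕ.m+n∸n≡m (length ns) (length es₀)))

      self : ∀ {e} → e ∈ E → ∣ e ∩ e ∣ ≡ K
      self {e} e∈ = trans (∣∩∣-self e) (sizes hyp e∈)

    -- A leaf alone lacks at most one contact; from there every step of the growth is forced.
    pathGrowth : ∀ {e} → e ∈ E → cap e ℕ.≤ suc K → (∀ {g} → g ∈ E → cap g ℕ.≤ suc (suc K)) →
      ∃ λ fs → fs ↭ E × Grow fs (replicate (m ∸ 1) 0)
    pathGrowth {e} e∈ capₑ caps = go (start hyp e∈)
      where
      close : (∃ λ ns → Part hyp (ns ++ e ∷ []) []) → ∃ λ fs → fs ↭ E × Grow fs (replicate (m ∸ 1) 0)
      close (ns , full) = subst (λ ps → ∃ λ fs → fs ↭ E × Grow fs ps) (List.++-identityʳ _)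
        (finish (e ∷ []) full (λ h∈ → caps (↭.∈-resp-↭ (Part-full hyp full) (∈-++⁺ˡ h∈))) (single {e = e})
          ((λ ()) , ℕ.≤-trans capₑ (s≤s (ℕ.≤-reflexive (trans (sym (self e∈)) (sym (ℕ.+-identityʳ _)))))))
      go : (∃ λ rs → Part hyp (e ∷ []) rs) → ∃ λ fs → fs ↭ E × Grow fs (replicate (m ∸ 1) 0)
      go (_ , part) = close (complete hyp part)

    -- Grow from one leaf x at the hub through the hub to a second leaf y; the next
    -- edge can only be attached to the hub, and from then on each edge is attached
    -- to the previous one.
    module ForkGrowth {x y hub} (x∈ : x ∈ E) (y∈ : y ∈ E) (hub∈ : hub ∈ E) (x≢y : x ≢ y) (x≢hub : x ≢ hub) (y≢hub : y ≢ hub)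
      {u v} (u∈x : u ∈ₛ x) (u∈h : u ∈ₛ hub) (v∈y : v ∈ₛ y) (v∈h : v ∈ₛ hub) (capx : cap x ≡ suc K) (capy : cap y ≡ suc K)
      (cap-hub : cap hub ≡ suc K ℕ.+ 2) (caps : ∀ {g} → g ∈ E → g ≢ hub → cap g ℕ.≤ suc (suc K)) (4≤m : 4 ℕ.≤ m) where

      private
        -- The code is to be read from the right: the hub is attached to `x`, then `y` to the hub,
        -- then an edge at position 1, which is the hub behind `y`, and afterwards each edge to the
        -- latest one.
        Growth-fork : Set
        Growth-fork = ∃ λ fs → fs ↭ E × Grow fs (replicate (m ∸ 4) 0 ++ 1 ∷ 0 ∷ 0 ∷ [])
        L₂ L₃ : List (Subset (order H))
        L₂ = hub ∷ x ∷ []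
        L₃ = y ∷ L₂
        hx : 1 ℕ.≤ ∣ x ∩ hub ∣
        hx = ∣∩∣-≥1 {e = x} {hub} u∈x u∈h
        hy : 1 ℕ.≤ ∣ y ∩ hub ∣
        hy = ∣∩∣-≥1 {e = y} {hub} v∈y v∈h
        fullx : cap x ℕ.≤ contacts L₂ x
        fullx = ℕ.≤-trans (ℕ.≤-reflexive capx) (ℕ.+-mono-≤ hx (ℕ.≤-trans (ℕ.≤-reflexive (sym (self x∈))) (ℕ.m≤m+n _ 0)))
        fully : cap y ℕ.≤ contacts L₃ y
        fully = ℕ.≤-trans (ℕ.≤-reflexive (trans capy (ℕ.+-comm 1 K)))
          (ℕ.+-mono-≤ (ℕ.≤-reflexive (sym (self y∈))) (ℕ.≤-trans hy (ℕ.m≤m+n _ _)))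
        fullx₃ : cap x ℕ.≤ contacts L₃ x
        fullx₃ = ℕ.≤-trans fullx (contacts-∷ L₂ y x)

        at-hub₂ : ∀ {w f} → w ∉ₛ x → f ∈ L₂ → w ∈ₛ f → w ∈ₛ hub
        at-hub₂ offx (here refl)         w∈ = w∈
        at-hub₂ offx (there (here refl)) w∈ = contradiction w∈ offx

        at-hub₃ : ∀ {w f} → w ∉ₛ y → w ∉ₛ x → f ∈ L₃ → w ∈ₛ f → w ∈ₛ hub
        at-hub₃ offy offx (here refl) w∈ = contradiction w∈ offy
        at-hub₃ offy offx (there f∈)  w∈ = at-hub₂ offx f∈ w∈

        grow₂ : Tree L₂ → Grow L₂ (0 ∷ [])
        grow₂ (attach w w∈ (here refl) w∈x priv _) = attach w w∈ (w∈x , λ ()) priv single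

        grow₃ : Tree L₃ → contacts L₃ x ℕ.≤ cap x → Grow L₃ (0 ∷ 0 ∷ [])
        grow₃ (attach w w∈ f∈ w∈f priv t) bound = attach w w∈ (at-hub₂ offx f∈ w∈f , λ { (here refl) → offx }) priv (grow₂ t)
          where
          offx : w ∉ₛ x
          offx = exceeds {y} {L₂} {x} fullx bound w∈

        module Last {g ns} (g∈ : g ∈ E) (full : Part hyp (ns ++ g ∷ L₃) []) (g≢hub : g ≢ hub) where

          L₄ : List (Subset (order H))
          L₄ = g ∷ L₃
          q : ns ++ L₄ ↭ E
          q = Part-full hyp full
          bounded : ∀ ms {L} h → ns ++ L₄ ≡ ms ++ L → contacts L h ℕ.≤ cap h
          bounded ms {L} h eq = ℕ.≤-trans (ℕ.m≤n+m (contacts L h) (contacts ms h)) (ℕ.≤-reflexive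
            (trans (sym (ℕΣ.⅀-++ ms L (λ f → ∣ h ∩ f ∣))) (trans (cong (λ l → contacts l h) (sym eq)) (contacts-↭ h q))))
          hub-fresh : ∀ {h} → h ∈ ns → h ≢ hub
          hub-fresh h∈ refl = unique-++-disjoint ns (unique-↭ (↭-sym q) (unique H)) (there (there (here refl))) h∈

          full-hub : 1 ℕ.≤ ∣ hub ∩ g ∣ → cap hub ℕ.≤ contacts L₄ hub
          full-hub hg = ℕ.≤-trans (ℕ.≤-reflexive (trans cap-hub (cong suc (ℕ.+-suc K 1))))
            (ℕ.+-mono-≤ hg (ℕ.+-mono-≤ (subst (1 ℕ.≤_) (∣∩∣-comm y hub) hy)
              (ℕ.+-mono-≤ (ℕ.≤-reflexive (sym (self hub∈))) (ℕ.≤-trans (subst (1 ℕ.≤_) (∣∩∣-comm x hub) hx) (ℕ.m≤m+n _ 0)))))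

          saturating : 1 ℕ.≤ ∣ g ∩ hub ∣ → Saturating L₄
          saturating gh = saturated
                        , ℕ.≤-trans (caps g∈ g≢hub) (s≤s (ℕ.≤-trans (ℕ.≤-reflexive (ℕ.+-comm 1 K)) (ℕ.+-mono-≤ (ℕ.≤-reflexive (sym (self g∈)))
                            (ℕ.≤-trans gh (ℕ.≤-trans (ℕ.m≤m+n ∣ g ∩ hub ∣ _) (ℕ.m≤n+m _ ∣ g ∩ y ∣))))))
            where
            saturated : ∀ {h} → h ∈ L₃ → cap h ℕ.≤ contacts L₄ h
            saturated (here refl)                 = ℕ.≤-trans fully (contacts-∷ L₃ g y)
            saturated (there (here refl))         = full-hub (subst (1 ℕ.≤_) (∣∩∣-comm g hub) gh)
            saturated (there (there (here refl))) = ℕ.≤-trans fullx₃ (contacts-∷ L₃ g x)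

          wrapUp : Tree L₄ → Growth-fork
          wrapUp (attach w w∈ f∈ w∈f priv t) = finish L₄ full (λ h∈ → caps (↭.∈-resp-↭ q (∈-++⁺ˡ h∈)) (hub-fresh h∈))
              (attach w w∈ (offy , w∈hub , λ { (here refl) → offx }) priv (grow₃ t (bounded (ns ++ g ∷ []) x (sym (List.++-assoc ns (g ∷ []) L₃)))))
              (saturating (∣∩∣-≥1 {e = g} {hub} w∈ w∈hub))
            where
            offx : w ∉ₛ x
            offx = exceeds {g} {L₃} {x} fullx₃ (bounded ns x refl) w∈
            offy : w ∉ₛ y
            offy = exceeds {g} {L₃} {y} fully (bounded ns y refl) w∈
            w∈hub : w ∈ₛ hub
            w∈hub = at-hub₃ offy offx f∈ w∈f

        pick : ∀ {e f : Subset (order H)} {rs} → e ∈ f ∷ rs → e ≢ f → e ∈ rs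
        pick (here e≡f) e≢f = contradiction e≡f e≢f
        pick (there e∈) e≢f = e∈

        step₄ : ∀ {rs} → Part hyp L₃ rs → (∃₂ λ g w → g ∈ rs × w ∈ₛ g × w ∈ᵥ L₃) → Growth-fork
        step₄ part₃ (g , w , g∈ , w∈g , w∈ᵥ) with _ , part₄ , _ ← extendPart hyp part₃ g∈ w∈g w∈ᵥ with _ , full ← complete hyp part₄ =
          Last.wrapUp (Part.new part₃ g∈) full (λ { refl → Part.separate part₃ g∈ (there (here refl)) }) (Part.tree part₄)

        step₃ : ∀ {rs} → Part hyp L₃ rs → Growth-fork
        step₃ {[]}    part₃ = contradiction 4≤m (ℕ.<⇒≱ (s≤s (ℕ.≤-reflexive (trans (sym (IsHypertree.size hyp)) (sym (↭.↭-length (Part.parts part₃)))))))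
        step₃ {_ ∷ _} part₃ = step₄ part₃ (findNext hyp part₃ (here refl))

        rest : ∀ {e f rs} → Part hyp (f ∷ []) rs → e ∈ E → e ≢ f → e ∈ rs
        rest part e∈ = pick (↭.∈-resp-↭ (↭-sym (Part.parts part)) e∈)

      forkGrowth : Growth-fork
      forkGrowth with _ , part₁ ← start hyp x∈
        with _ , part₂ , q₂ ← extendPart hyp part₁ {hub} {u} (rest part₁ hub∈ (x≢hub ∘ sym)) u∈h (x , here refl , u∈x)
        with _ , part₃ , _ ← extendPart hyp part₂ {y} {v} (pick (↭.∈-resp-↭ q₂ (rest part₁ y∈ (x≢y ∘ sym))) y≢hub) v∈y (hub , here refl , v∈h)
        = step₃ part₃

    module _ {es} (arr : Arrangement k es) (p : es ↭ E) (2≤ : 2 ℕ.≤ length es) (deg≤2 : ∀ v → deg es v ℕ.≤ 2) where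

      private
        from : ∀ {e} → e ∈ E → e ∈ es
        from = ↭.∈-resp-↭ (↭-sym p)

      cap-excess : ∀ {e} → e ∈ E → cap e ≡ suc K ℕ.+ excess arr e
      cap-excess {e} e∈ = trans (sym (contacts-↭ e p)) (contacts-excess arr 2≤ (from e∈))

      cap-zero : ∀ {e} → e ∈ E → excess arr e ≡ 0 → cap e ≡ suc K
      cap-zero e∈ z = trans (cap-excess e∈) (trans (cong (suc K ℕ.+_) z) (ℕ.+-identityʳ _))

      cap-one : ∀ {e} → e ∈ E → excess arr e ℕ.≤ 1 → cap e ℕ.≤ suc (suc K)
      cap-one e∈ le = ℕ.≤-trans (ℕ.≤-reflexive (cap-excess e∈)) (ℕ.≤-trans (ℕ.+-monoʳ-≤ (suc K) le) (ℕ.≤-reflexive (ℕ.+-comm (suc K) 1)))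

      -- The excesses add up to two less than the number of edges, so they cannot all be positive.
      someLeaf : ∃ λ e → e ∈ es × excess arr e ≡ 0
      someLeaf = [ find , (λ none → contradiction (many none) (ℕ.<⇒≱ few)) ]′ (Dec.toSum (Any.any? (λ e → excess arr e ℕ.≟ 0) es))
        where
        few : Σℕ es (excess arr) ℕ.< length es
        few = ℕ.≤-trans (ℕ.m<m+n _ {2} (s≤s z≤n)) (ℕ.≤-reflexive (Σ-excess arr 2≤ deg≤2))
        many : ¬ Any (λ e → excess arr e ≡ 0) es → length es ℕ.≤ Σℕ es (excess arr)
        many none = ℕ.≤-trans (ℕ.≤-reflexive (trans (sym (ℕ.*-identityʳ _)) (sym (Σℕ-const es 1))))
          (Σℕ-mono es {λ _ → 1} {excess arr} (λ {e} e∈ → ℕ.n≢0⇒n>0 (λ z → none (lose e∈ z))))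

      pathShape : defect arr ≡ 0 → ∃ λ fs → fs ↭ E × Grow fs (replicate (m ∸ 1) 0)
      pathShape defect≡0 = go someLeaf
        where
        go : (∃ λ e → e ∈ es × excess arr e ≡ 0) → ∃ λ fs → fs ↭ E × Grow fs (replicate (m ∸ 1) 0)
        go (e , e∈ , z) = pathGrowth (↭.∈-resp-↭ p e∈) (ℕ.≤-reflexive (cap-zero (↭.∈-resp-↭ p e∈) z)) λ {g} g∈ →
          cap-one g∈ (tri-≤0 (excess arr g) (ℕ.≤-trans (Σℕ-≥ (tri ∘ excess arr) (from g∈)) (ℕ.≤-reflexive defect≡0)))

    module _ {es} (arr : Arrangement k es) (p : es ↭ E) (4≤m : 4 ℕ.≤ m) (3≤ : 3 ℕ.≤ length es) (deg≤2 : ∀ v → deg es v ℕ.≤ 2)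
      (defect≡1 : defect arr ≡ 1) where

      private
        2≤ : 2 ℕ.≤ length es
        2≤ = ℕ.≤-trans (ℕ.n≤1+n 2) 3≤
      open OneDefect arr 3≤ deg≤2 defect≡1

      forkShape : 2 ℕ.≤ hubLeaves → ∃ λ fs → fs ↭ E × Grow fs (replicate (m ∸ 4) 0 ++ 1 ∷ 0 ∷ 0 ∷ [])
      forkShape two = go (twoHubLeaves⇒ two)
        where
        toE : ∀ {e} → e ∈ es → e ∈ E
        toE = ↭.∈-resp-↭ p
        ≢hub : ∀ {e} → excess arr e ≡ 0 → e ≢ hub
        ≢hub z e≡ = case trans (sym z) (trans (cong (excess arr) e≡) a-hub) of λ ()
        go : (∃₂ λ x y → x ∈ es × y ∈ es × x ≢ y × (excess arr x ≡ 0 × 1 ℕ.≤ ∣ x ∩ hub ∣) × (excess arr y ≡ 0 × 1 ℕ.≤ ∣ y ∩ hub ∣)) →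
          ∃ λ fs → fs ↭ E × Grow fs (replicate (m ∸ 4) 0 ++ 1 ∷ 0 ∷ 0 ∷ [])
        go (x , y , x∈ , y∈ , x≢y , (ax , xh) , (ay , yh)) = meet (∣∩∣-≥1⇒ {e = x} {hub} xh) (∣∩∣-≥1⇒ {e = y} {hub} yh)
          where
          meet : (∃ λ u → u ∈ₛ x × u ∈ₛ hub) → (∃ λ v → v ∈ₛ y × v ∈ₛ hub) → ∃ λ fs → fs ↭ E × Grow fs (replicate (m ∸ 4) 0 ++ 1 ∷ 0 ∷ 0 ∷ [])
          meet (_ , u∈x , u∈h) (_ , v∈y , v∈h) = ForkGrowth.forkGrowth (toE x∈) (toE y∈) (toE hub∈) x≢y (≢hub ax) (≢hub ay) u∈x u∈h v∈y v∈h
            (cap-zero arr p 2≤ deg≤2 (toE x∈) ax) (cap-zero arr p 2≤ deg≤2 (toE y∈) ay)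
            (trans (cap-excess arr p 2≤ deg≤2 (toE hub∈)) (cong (suc K ℕ.+_) a-hub))
            (λ g∈ g≢ → cap-one arr p 2≤ deg≤2 g∈ (a≤1 (↭.∈-resp-↭ (↭-sym p) g∈) g≢)) 4≤m
open Classification public

-- Chains of edges and the hyperpath

module Examples where

  open ≡ using (refl; sym; trans)

  module _ {n : ℕ} where

    data Chain : List (Subset n) → Set where
      single : ∀ {e w} → w ∈ₛ e → Chain (e ∷ [])
      link   : ∀ {e f es} w → w ∈ₛ e → w ∈ₛ f → (∀ {v} → v ∈ₛ e → v ∈ₛ f → v ≡ w) →
               (∀ {v g} → v ∈ₛ e → g ∈ es → v ∉ₛ g) → Chain (f ∷ es) → Chain (e ∷ f ∷ es)

    chain-tree : ∀ {es} → Chain es → Tree es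
    chain-tree (single w∈) = single w∈
    chain-tree (link w w∈e w∈f meet far c) = attach w w∈e (here refl) w∈f
      (λ { v∈e (here refl) v∈g → meet v∈e v∈g ; v∈e (there g∈) v∈g → contradiction v∈g (far v∈e g∈) }) (chain-tree c)

    -- The vertex `W i` is the one that edge `i` shares with its predecessor; for `zero` it is any
    -- vertex of the edge.
    chain-tabulate : ∀ {j} (e : Fin (suc j) → Subset n) (W : Fin (suc j) → Fin n) →
      (∀ i → W i ∈ₛ e i) → (∀ i → W (suc i) ∈ₛ e (Fin.inject₁ i)) →
      (∀ {i i′ v} → toℕ i ℕ.< toℕ i′ → v ∈ₛ e i → v ∈ₛ e i′ → toℕ i′ ≡ suc (toℕ i) × v ≡ W i′) → Chain (List.tabulate e)
    chain-tabulate {zero}  e W own prev far = single (own zero)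
    chain-tabulate {suc j} e W own prev far = link (W (suc zero)) (prev zero) (own (suc zero))
      (λ v∈ v∈′ → proj₂ (far (s≤s z≤n) v∈ v∈′))
      (λ v∈ g∈ v∈g → case ∈-tabulate⁻ g∈ of λ { (i , refl) → case proj₁ (far {zero} {suc (suc i)} (s≤s z≤n) v∈ v∈g) of λ () })
      (chain-tabulate (e ∘ suc) (W ∘ suc) (own ∘ suc) (prev ∘ suc)
        (λ lt v∈ v∈′ → Product.map₁ ℕ.suc-injective (far (s≤s lt) v∈ v∈′)))

    private
      deg-zero : ∀ {es : List (Subset n)} {v} → (∀ {g} → g ∈ es → v ∉ₛ g) → deg es v ≡ 0
      deg-zero {es} {v} h = trans (deg-Σ es v) (ℕΣ.⅀-0 es λ {g} g∈ → ℕΣ.𝟙-no (v Subset.∈? g) (h g∈))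

    chain-deg≤2 : ∀ {es} → Chain es → ∀ v → deg es v ℕ.≤ 2
    chain-deg≤2 (single {e} _) v = ℕ.≤-trans (ℕ.≤-reflexive (deg-∷ e [] v)) (ℕ.≤-trans (ℕ.+-monoˡ-≤ 0 ([]-≤1 (v Subset.∈? e))) (s≤s z≤n))
    chain-deg≤2 (link {e} {f} {es} w _ _ _ far c) v rewrite deg-∷ e (f ∷ es) v with v Subset.∈? e
    ... | no _    = chain-deg≤2 c v
    ... | yes v∈e = s≤s (ℕ.≤-trans (ℕ.≤-reflexive (deg-∷ f es v))
      (ℕ.≤-trans (ℕ.+-mono-≤ ([]-≤1 (v Subset.∈? f)) (ℕ.≤-reflexive (deg-zero (far v∈e)))) ℕ.≤-refl))

    chain-contacts-head : ∀ {e f es K} → Chain (e ∷ f ∷ es) → ∣ e ∣ ≡ K → contacts (e ∷ f ∷ es) e ≡ suc K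
    chain-contacts-head {e} {f} {es} {K} (link w w∈e w∈f meet far c) ∣e∣ = trans (cong₂ ℕ._+_ (trans (∣∩∣-self e) ∣e∣)
      (cong₂ ℕ._+_ (∣∩∣-≡1 {e = e} {f} w∈e w∈f meet) (ℕΣ.⅀-0 es (λ {g} g∈ → ∣∩∣-empty {e = e} {g} (λ v v∈ → far v∈ g∈))))) (ℕ.+-comm K 1)

    chain-contacts-second : ∀ {e f es} → Chain (e ∷ f ∷ es) → contacts (e ∷ f ∷ es) f ≡ suc (contacts (f ∷ es) f)
    chain-contacts-second {e} {f} {es} (link w w∈e w∈f meet far c) =
      cong (ℕ._+ contacts (f ∷ es) f) (∣∩∣-≡1 {e = f} {e} w∈f w∈e (λ a b → meet b a))

    chain-contacts-≤ : ∀ {es K} → Chain es → (∀ {e} → e ∈ es → ∣ e ∣ ≡ K) → ∀ {e} → e ∈ es → contacts es e ℕ.≤ suc (suc K)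
    chain-contacts-≤ {K = K} (single {e} _) sizes (here refl) = ℕ.≤-trans (ℕ.≤-reflexive (trans (ℕ.+-identityʳ _) (trans (∣∩∣-self e) (sizes (here refl)))))
      (ℕ.≤-trans (ℕ.n≤1+n K) (ℕ.n≤1+n (suc K)))
    chain-contacts-≤ {K = K} c@(link _ _ _ _ _ _) sizes (here refl) = ℕ.≤-trans (ℕ.≤-reflexive (chain-contacts-head c (sizes (here refl)))) (ℕ.n≤1+n _)
    chain-contacts-≤ {K = K} c@(link {f = f} {es} _ _ _ _ _ c′) sizes (there (here refl)) = ℕ.≤-trans (ℕ.≤-reflexive (chain-contacts-second c)) (s≤s (top c′ (sizes ∘ there)))
      where
      top : ∀ {f es} → Chain (f ∷ es) → (∀ {e} → e ∈ f ∷ es → ∣ e ∣ ≡ K) → contacts (f ∷ es) f ℕ.≤ suc K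
      top {f} (single _) sz = ℕ.≤-trans (ℕ.≤-reflexive (trans (ℕ.+-identityʳ _) (trans (∣∩∣-self f) (sz (here refl))))) (ℕ.n≤1+n K)
      top c@(link _ _ _ _ _ _) sz = ℕ.≤-reflexive (chain-contacts-head c (sz (here refl)))
    chain-contacts-≤ {K = K} (link {e} {f} {es} _ _ _ _ far c′) sizes {g} (there (there g∈)) = ℕ.≤-trans
      (ℕ.≤-reflexive (cong (ℕ._+ contacts (f ∷ es) g) (trans (∣∩∣-comm g e) (∣∩∣-empty {e = e} {g} (λ v v∈ → far v∈ g∈)))))
      (chain-contacts-≤ c′ (sizes ∘ there) (there g∈))

  ∈-lookup⁺ : ∀ {n} {p : Subset n} {v} → lookup p v ≡ true → v ∈ₛ p
  ∈-lookup⁺ {p = p} {v} = Vec.lookup⇒[]= v p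

  ∈-lookup⁻ : ∀ {n} {p : Subset n} {v} → v ∈ₛ p → lookup p v ≡ true
  ∈-lookup⁻ = Vec.[]=⇒lookup

  module _ {a b : ℕ} where

    ↑ˡ∈⁺ : ∀ {p : Subset a} {q : Subset b} {v} → v ∈ₛ p → v Fin.↑ˡ b ∈ₛ p Vec.++ q
    ↑ˡ∈⁺ {p} {q} {v} v∈ = ∈-lookup⁺ (trans (Vec.lookup-++ˡ p q v) (∈-lookup⁻ v∈))

    ↑ˡ∈⁻ : ∀ {p : Subset a} {q : Subset b} {v} → v Fin.↑ˡ b ∈ₛ p Vec.++ q → v ∈ₛ p
    ↑ˡ∈⁻ {p} {q} {v} v∈ = ∈-lookup⁺ (trans (sym (Vec.lookup-++ˡ p q v)) (∈-lookup⁻ v∈))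

    ↑ʳ∈⁺ : ∀ {p : Subset a} {q : Subset b} {x} → x ∈ₛ q → a Fin.↑ʳ x ∈ₛ p Vec.++ q
    ↑ʳ∈⁺ {p} {q} {x} x∈ = ∈-lookup⁺ (trans (Vec.lookup-++ʳ p q x) (∈-lookup⁻ x∈))

    ↑ʳ∈⁻ : ∀ {p : Subset a} {q : Subset b} {x} → a Fin.↑ʳ x ∈ₛ p Vec.++ q → x ∈ₛ q
    ↑ʳ∈⁻ {p} {q} {x} x∈ = ∈-lookup⁺ (trans (sym (Vec.lookup-++ʳ p q x)) (∈-lookup⁻ x∈))

    data Side : Fin (a ℕ.+ b) → Set where
      left  : ∀ v → Side (v Fin.↑ˡ b)
      right : ∀ x → Side (a Fin.↑ʳ x)

    side : ∀ w → Side w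
    side w with Fin.splitAt a w | Fin.join-splitAt a b w
    ... | inj₁ v | refl = left v
    ... | inj₂ x | refl = right x

  module HyperPath (l c : ℕ) where

    -- Equal by computation to the hyperedges of `hyperpath l (suc (suc c))`.
    pathEdge : Fin l → Subset (suc l ℕ.+ l ℕ.* c)
    pathEdge i = (⁅ Fin.inject₁ i ⁆ ∪ ⁅ suc i ⁆) Vec.++ Vec.tabulate (λ x → ⌊ Fin.quotient c x Fin.≟ i ⌋)

    ∈block⁺ : ∀ {i x} → Fin.quotient {l} c x ≡ i → x ∈ₛ Vec.tabulate (λ x → ⌊ Fin.quotient c x Fin.≟ i ⌋)
    ∈block⁺ {i} {x} eq = ∈-lookup⁺ (trans (Vec.lookup∘tabulate _ x) (trans (Dec.isYes≗does (Fin.quotient {l} c x Fin.≟ i)) (dec-true (Fin.quotient {l} c x Fin.≟ i) eq)))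

    ∈block⁻ : ∀ {i x} → x ∈ₛ Vec.tabulate (λ x → ⌊ Fin.quotient {l} c x Fin.≟ i ⌋) → Fin.quotient {l} c x ≡ i
    ∈block⁻ {i} {x} x∈ with Fin.quotient {l} c x Fin.≟ i | trans (sym (Dec.isYes≗does (Fin.quotient {l} c x Fin.≟ i))) (trans (sym (Vec.lookup∘tabulate (λ x → ⌊ Fin.quotient {l} c x Fin.≟ i ⌋) x)) (∈-lookup⁻ x∈))
    ... | yes eq | _ = eq

    ∈ends : ∀ {i : Fin l} {v} → v ∈ₛ ⁅ Fin.inject₁ i ⁆ ∪ ⁅ suc i ⁆ → v ≡ Fin.inject₁ i ⊎ v ≡ suc i
    ∈ends {i} v∈ = Sum.map (Subset.x∈⁅y⁆⇒x≡y (Fin.inject₁ i)) (Subset.x∈⁅y⁆⇒x≡y (suc i)) (Subset.x∈p∪q⁻ _ _ v∈)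

    private
      ends block : Fin l → Subset _
      ends i  = ⁅ Fin.inject₁ i ⁆ ∪ ⁅ suc i ⁆
      block i = Vec.tabulate (λ x → ⌊ Fin.quotient {l} c x Fin.≟ i ⌋)

    on-path : ∀ i {u} → u Fin.↑ˡ (l ℕ.* c) ∈ₛ pathEdge i → u ≡ Fin.inject₁ i ⊎ u ≡ suc i
    on-path i u∈ = ∈ends {i} (↑ˡ∈⁻ {p = ends i} {block i} u∈)

    inserted : ∀ i {x} → suc l Fin.↑ʳ x ∈ₛ pathEdge i → Fin.quotient {l} c x ≡ i
    inserted i x∈ = ∈block⁻ {i} (↑ʳ∈⁻ {p = ends i} {block i} x∈)

    inserted⁺ : ∀ i {x} → Fin.quotient {l} c x ≡ i → suc l Fin.↑ʳ x ∈ₛ pathEdge i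
    inserted⁺ i eq = ↑ʳ∈⁺ {p = ends i} {block i} (∈block⁺ {i} eq)

    source∈ : ∀ i → Fin.inject₁ i Fin.↑ˡ (l ℕ.* c) ∈ₛ pathEdge i
    source∈ i = ↑ˡ∈⁺ {p = ends i} {block i} (Subset.x∈p∪q⁺ (inj₁ (Subset.x∈⁅x⁆ (Fin.inject₁ i))))

    target∈ : ∀ i → suc i Fin.↑ˡ (l ℕ.* c) ∈ₛ pathEdge i
    target∈ i = ↑ˡ∈⁺ {p = ends i} {block i} (Subset.x∈p∪q⁺ (inj₂ (Subset.x∈⁅x⁆ (suc i))))

    pathEdge-meet : ∀ {i i′ v} → toℕ i ℕ.< toℕ i′ → v ∈ₛ pathEdge i → v ∈ₛ pathEdge i′ →
      toℕ i′ ≡ suc (toℕ i) × v ≡ Fin.inject₁ i′ Fin.↑ˡ (l ℕ.* c)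
    pathEdge-meet {i} {i′} {v} lt v∈ v∈′ with side {suc l} {l ℕ.* c} v
    ... | right x = contradiction (cong toℕ (trans (sym (inserted i v∈)) (inserted i′ v∈′))) (ℕ.<⇒≢ lt)
    ... | left u with on-path i v∈ | on-path i′ v∈′
    ...   | inj₁ refl | inj₁ e = contradiction (cong toℕ (Fin.inject₁-injective e)) (ℕ.<⇒≢ lt)
    ...   | inj₁ refl | inj₂ e = contradiction (ℕ.≤-trans (ℕ.n≤1+n _) (ℕ.≤-reflexive (trans (sym (cong toℕ e)) (Fin.toℕ-inject₁ i)))) (ℕ.<⇒≱ lt)
    ...   | inj₂ refl | inj₂ e = contradiction (ℕ.suc-injective (cong toℕ e)) (ℕ.<⇒≢ lt)
    ...   | inj₂ refl | inj₁ e = trans (sym (Fin.toℕ-inject₁ i′)) (sym (cong toℕ e)) , cong (Fin._↑ˡ (l ℕ.* c)) e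

    pathEdge-lists : ∀ i → Lists (pathEdge i) ((Fin.inject₁ i Fin.↑ˡ (l ℕ.* c)) ∷ (suc i Fin.↑ˡ (l ℕ.* c)) ∷ map (λ y → suc l Fin.↑ʳ Fin.combine i y) (allFin c))
    pathEdge-lists i =
        ((λ e → i≢ (Fin.↑ˡ-injective (l ℕ.* c) _ _ e)) ∷ All.tabulate (apart _)) ∷ All.tabulate (apart _) ∷ Unique.map⁺ inj (Unique.allFin⁺ c)
      , to , λ { (here refl) → source∈ i ; (there (here refl)) → target∈ i ; (there (there v∈)) → from v∈ }
      where
      blockˡ : List (Fin (suc l ℕ.+ l ℕ.* c))
      blockˡ = map (λ y → suc l Fin.↑ʳ Fin.combine i y) (allFin c)
      i≢ : Fin.inject₁ i ≢ suc i
      i≢ e = ℕ.1+n≢n (sym (trans (sym (Fin.toℕ-inject₁ i)) (cong toℕ e)))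
      sides : ∀ (u : Fin (suc l)) (x : Fin (l ℕ.* c)) → u Fin.↑ˡ (l ℕ.* c) ≢ suc l Fin.↑ʳ x
      sides u x e with () ← trans (sym (Fin.splitAt-↑ˡ (suc l) u (l ℕ.* c))) (trans (cong (Fin.splitAt (suc l)) e) (Fin.splitAt-↑ʳ (suc l) (l ℕ.* c) x))
      apart : ∀ (u : Fin (suc l)) {x} → x ∈ blockˡ → u Fin.↑ˡ (l ℕ.* c) ≢ x
      apart u x∈ with y , _ , refl ← ∈-map⁻ _ x∈ = sides u _
      inj : ∀ {y y′} → suc l Fin.↑ʳ Fin.combine i y ≡ suc l Fin.↑ʳ Fin.combine i y′ → y ≡ y′
      inj {y} {y′} e = Fin.combine-injectiveʳ i y i y′ (Fin.↑ʳ-injective (suc l) _ _ e)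
      from : ∀ {v} → v ∈ blockˡ → v ∈ₛ pathEdge i
      from v∈ with y , _ , refl ← ∈-map⁻ _ v∈ = inserted⁺ i (cong proj₁ (Fin.remQuot-combine {l} i y))
      to : ∀ {v} → v ∈ₛ pathEdge i → v ∈ (Fin.inject₁ i Fin.↑ˡ (l ℕ.* c)) ∷ (suc i Fin.↑ˡ (l ℕ.* c)) ∷ blockˡ
      to {v} v∈ with side {suc l} {l ℕ.* c} v
      ... | left u with on-path i v∈
      ...   | inj₁ refl = here refl
      ...   | inj₂ refl = there (here refl)
      to {v} v∈ | right x with refl ← inserted i v∈ = there (there (subst (λ z → suc l Fin.↑ʳ z ∈ blockˡ) (Fin.combine-remQuot {l} c x)
        (∈-map⁺ (λ y → suc l Fin.↑ʳ Fin.combine i y) (∈-allFin (Fin.remainder {l} c x)))))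

    pathEdge-size : ∀ i → ∣ pathEdge i ∣ ≡ suc (suc c)
    pathEdge-size i = trans (sym (lists-length (pathEdge-lists i)))
      (cong (λ z → suc (suc z)) (trans (List.length-map _ (allFin c)) (List.length-tabulate {n = c} id)))

    pathEdge-sizes : ∀ {e} → e ∈ List.tabulate pathEdge → ∣ e ∣ ≡ suc (suc c)
    pathEdge-sizes e∈ with i , refl ← ∈-tabulate⁻ e∈ = pathEdge-size i

  path-chain : ∀ l c → Chain (List.tabulate (HyperPath.pathEdge (suc l) c))
  path-chain l c = chain-tabulate {j = l} pathEdge (λ i → Fin.inject₁ i Fin.↑ˡ (suc l ℕ.* c)) source∈ (λ i → target∈ (Fin.inject₁ i)) pathEdge-meet
    where open HyperPath (suc l) c

  path-cover : ∀ l c v → ∃ λ f → f ∈ List.tabulate (HyperPath.pathEdge (suc l) c) × v ∈ₛ f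
  path-cover l c v with side {suc (suc l)} {suc l ℕ.* c} v
  ... | left zero    = pathEdge zero , ∈-tabulate⁺ {f = pathEdge} zero , source∈ zero
    where open HyperPath (suc l) c
  ... | left (suc i) = pathEdge i , ∈-tabulate⁺ {f = pathEdge} i , target∈ i
    where open HyperPath (suc l) c
  ... | right x      = pathEdge (Fin.quotient {suc l} c x) , ∈-tabulate⁺ {f = pathEdge} (Fin.quotient {suc l} c x) , inserted⁺ (Fin.quotient {suc l} c x) refl
    where open HyperPath (suc l) c

  path-unique : ∀ l c → Unique (List.tabulate (HyperPath.pathEdge l c))
  path-unique l c = unique (hyperpath l (suc (suc c)))

  path-arrangement : ∀ l c → Arrangement (suc c) (List.tabulate (HyperPath.pathEdge (suc l) c))
  path-arrangement l c = record
    { tree = chain-tree (path-chain l c) ; distinct = path-unique (suc l) c ; sizes = HyperPath.pathEdge-sizes (suc l) c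
    ; cover = λ v → let _ , f∈ , v∈ = path-cover l c v in deg≥1 f∈ v∈ }

  path-deg≤2 : ∀ l c v → deg (List.tabulate (HyperPath.pathEdge (suc l) c)) v ℕ.≤ 2
  path-deg≤2 l c = chain-deg≤2 (path-chain l c)

  path-defect : ∀ l c → defect (path-arrangement l c) ≡ 0
  path-defect l c = ℕΣ.⅀-0 (List.tabulate (HyperPath.pathEdge (suc l) c)) λ {e} e∈ → tri-∸ (suc (suc (suc c))) (contacts (List.tabulate (HyperPath.pathEdge (suc l) c)) e)
      (ℕ.≤-trans (chain-contacts-≤ (path-chain l c) (HyperPath.pathEdge-sizes (suc l) c) e∈) (ℕ.≤-reflexive (ℕ.+-comm 1 (suc (suc (suc c))))))
open Examples public

-- A chain with a pendant edge at its second edge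

module Pendants where

  open ≡ using (refl; sym; trans)

  ∣++∣ : ∀ {a b} (p : Subset a) (q : Subset b) → ∣ p Vec.++ q ∣ ≡ ∣ p ∣ ℕ.+ ∣ q ∣
  ∣++∣ []          q = refl
  ∣++∣ (true ∷ p)  q = cong suc (∣++∣ p q)
  ∣++∣ (false ∷ p) q = ∣++∣ p q

  ∩-++ : ∀ {a b} (p p′ : Subset a) (q q′ : Subset b) → (p Vec.++ q) ∩ (p′ Vec.++ q′) ≡ (p ∩ p′) Vec.++ (q ∩ q′)
  ∩-++ []      []        q q′ = refl
  ∩-++ (x ∷ p) (x′ ∷ p′) q q′ = cong (_ ∷_) (∩-++ p p′ q q′)

  module _ {N j : ℕ} where

    lift : Subset N → Subset (N ℕ.+ suc j)
    lift e = e Vec.++ Subset.⊥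

    pendant : Fin N → Subset (N ℕ.+ suc j)
    pendant v = ⁅ v ⁆ Vec.++ Subset.⊤

    ∣lift∣ : ∀ e → ∣ lift e ∣ ≡ ∣ e ∣
    ∣lift∣ e = trans (∣++∣ e Subset.⊥) (trans (cong (∣ e ∣ ℕ.+_) (Subset.∣⊥∣≡0 (suc j))) (ℕ.+-identityʳ _))

    ∣pendant∣ : ∀ v → ∣ pendant v ∣ ≡ suc (suc j)
    ∣pendant∣ v = trans (∣++∣ ⁅ v ⁆ Subset.⊤) (cong₂ ℕ._+_ (Subset.∣⁅x⁆∣≡1 v) (Subset.∣⊤∣≡n (suc j)))

    lift∈⁺ : ∀ {e u} → u ∈ₛ e → u Fin.↑ˡ suc j ∈ₛ lift e
    lift∈⁺ {e} = ↑ˡ∈⁺ {p = e} {Subset.⊥}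

    lift∈⁻ : ∀ {e u} → u Fin.↑ˡ suc j ∈ₛ lift e → u ∈ₛ e
    lift∈⁻ {e} = ↑ˡ∈⁻ {p = e} {Subset.⊥}

    lift∌ : ∀ {e x} → N Fin.↑ʳ x ∉ₛ lift e
    lift∌ {e} x∈ = Subset.∉⊥ (↑ʳ∈⁻ {p = e} {Subset.⊥} x∈)

    pendant∈ : ∀ {v u} → u Fin.↑ˡ suc j ∈ₛ pendant v → u ≡ v
    pendant∈ {v} u∈ = Subset.x∈⁅y⁆⇒x≡y v (↑ˡ∈⁻ {p = ⁅ v ⁆} {Subset.⊤} u∈)

    pendant∋ : ∀ v → v Fin.↑ˡ suc j ∈ₛ pendant v
    pendant∋ v = ↑ˡ∈⁺ {p = ⁅ v ⁆} {Subset.⊤} (Subset.x∈⁅x⁆ v)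

    ∣lift∩lift∣ : ∀ e f → ∣ lift e ∩ lift f ∣ ≡ ∣ e ∩ f ∣
    ∣lift∩lift∣ e f = trans (cong ∣_∣ (trans (∩-++ e f Subset.⊥ Subset.⊥) (cong ((e ∩ f) Vec.++_) (Subset.∩-idem {suc j} Subset.⊥)))) (∣lift∣ (e ∩ f))

    contacts-lift : ∀ E e → contacts (map lift E) (lift e) ≡ contacts E e
    contacts-lift E e = trans (ℕΣ.⅀-map lift E (λ f → ∣ lift e ∩ f ∣)) (ℕΣ.⅀-cong E (∣lift∩lift∣ e))

    deg-lift : ∀ E u → deg (map lift E) (u Fin.↑ˡ suc j) ≡ deg E u
    deg-lift E u = trans (deg-Σ (map lift E) _) (trans (ℕΣ.⅀-map lift E (λ f → [ u Fin.↑ˡ suc j ∈ f ]ₛ))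
      (trans (ℕΣ.⅀-cong E (λ e → ℕΣ.𝟙-⇔ (u Fin.↑ˡ suc j Subset.∈? lift e) (u Subset.∈? e) (lift∈⁻ {e}) lift∈⁺)) (sym (deg-Σ E u))))

    deg-new : ∀ E x → deg (map lift E) (N Fin.↑ʳ x) ≡ 0
    deg-new E x = trans (deg-Σ (map lift E) _) (ℕΣ.⅀-0 (map lift E) λ {f} f∈ → ℕΣ.𝟙-no (N Fin.↑ʳ x Subset.∈? f)
      λ x∈ → case ∈-map⁻ lift f∈ of λ { (e , _ , refl) → lift∌ {e} x∈ })

    private
      lift-only : ∀ {e g : Subset N} {w v} → (∀ {u} → u ∈ₛ e → u ∈ₛ g → u ≡ w) → v ∈ₛ lift e → v ∈ₛ lift g → v ≡ w Fin.↑ˡ suc j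
      lift-only {e} {g} {w} {v} h v∈e v∈g with side {N} {suc j} v
      ... | left u  = cong (Fin._↑ˡ suc j) (h (lift∈⁻ {e} v∈e) (lift∈⁻ {g} v∈g))
      ... | right x = contradiction v∈e (lift∌ {e})

    tree-lift : ∀ {E} → Tree E → Tree (map lift E)
    tree-lift (single w∈) = single (lift∈⁺ w∈)
    tree-lift (attach {e} {es} w w∈e f∈ w∈f priv t) = attach (w Fin.↑ˡ suc j) (lift∈⁺ w∈e) (∈-map⁺ lift f∈) (lift∈⁺ w∈f)
      (λ v∈e g∈ v∈g → case ∈-map⁻ lift g∈ of λ { (g , g∈′ , refl) → lift-only {e} {g} (λ u∈e u∈g → priv u∈e g∈′ u∈g) v∈e v∈g })
      (tree-lift t)

    ∣pendant∩lift∣-yes : ∀ {v e} → v ∈ₛ e → ∣ pendant v ∩ lift e ∣ ≡ 1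
    ∣pendant∩lift∣-yes {v} {e} v∈ = ∣∩∣-≡1 {e = pendant v} {lift e} (pendant∋ v) (lift∈⁺ v∈) only
      where
      only : ∀ {w} → w ∈ₛ pendant v → w ∈ₛ lift e → w ≡ v Fin.↑ˡ suc j
      only {w} w∈p w∈e with side {N} {suc j} w
      ... | left u  = cong (Fin._↑ˡ suc j) (pendant∈ w∈p)
      ... | right x = contradiction w∈e (lift∌ {e})

    ∣pendant∩lift∣-no : ∀ {v e} → v ∉ₛ e → ∣ pendant v ∩ lift e ∣ ≡ 0
    ∣pendant∩lift∣-no {v} {e} v∉ = ∣∩∣-empty {e = pendant v} {lift e} none
      where
      none : ∀ w → w ∈ₛ pendant v → w ∉ₛ lift e
      none w w∈p w∈e with side {N} {suc j} w
      ... | left u  = v∉ (subst (_∈ₛ e) (pendant∈ w∈p) (lift∈⁻ {e} w∈e))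
      ... | right x = lift∌ {e} w∈e

    module Fork {e₀ e₁ e₂ : Subset N} {es} (chain : Chain (e₀ ∷ e₁ ∷ e₂ ∷ es))
      (distinct : Unique (e₀ ∷ e₁ ∷ e₂ ∷ es)) (sizes : ∀ {e} → e ∈ e₀ ∷ e₁ ∷ e₂ ∷ es → ∣ e ∣ ≡ suc (suc j))
      (cover : ∀ u → ∃ λ f → f ∈ e₀ ∷ e₁ ∷ e₂ ∷ es × u ∈ₛ f)
      {v : Fin N} (v∈e₁ : v ∈ₛ e₁) (v∉e₀ : v ∉ₛ e₀) (v∉ : ∀ {g} → g ∈ e₂ ∷ es → v ∉ₛ g)
      (uniqueF : Unique (pendant v ∷ map lift (e₀ ∷ e₁ ∷ e₂ ∷ es))) where

      private
        L : List (Subset N)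
        L = e₀ ∷ e₁ ∷ e₂ ∷ es
        K : ℕ
        K = suc (suc j)
        e₁∈ : e₁ ∈ L
        e₁∈ = there (here refl)

      fork : List (Subset (N ℕ.+ suc j))
      fork = pendant v ∷ map lift L

      fork-tree : Tree fork
      fork-tree = attach (v Fin.↑ˡ suc j) (pendant∋ v) (∈-map⁺ lift e₁∈) (lift∈⁺ v∈e₁) priv (tree-lift (chain-tree chain))
        where
        priv : ∀ {w g} → w ∈ₛ pendant v → g ∈ map lift L → w ∈ₛ g → w ≡ v Fin.↑ˡ suc j
        priv {w} w∈p g∈ w∈g with g , _ , refl ← ∈-map⁻ lift g∈ with side {N} {suc j} w
        ... | left u  = cong (Fin._↑ˡ suc j) (pendant∈ w∈p)
        ... | right x = contradiction w∈g (lift∌ {g})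

      fork-sizes : ∀ {e} → e ∈ fork → ∣ e ∣ ≡ K
      fork-sizes (here refl) = ∣pendant∣ v
      fork-sizes (there e∈) with e , e∈′ , refl ← ∈-map⁻ lift e∈ = trans (∣lift∣ e) (sizes e∈′)

      fork-cover : ∀ w → ∃ λ f → f ∈ fork × w ∈ₛ f
      fork-cover w with side {N} {suc j} w
      ... | left u with f , f∈ , u∈ ← cover u = lift f , there (∈-map⁺ lift f∈) , lift∈⁺ u∈
      ... | right x = pendant v , here refl , ↑ʳ∈⁺ {p = ⁅ v ⁆} {Subset.⊤} Subset.∈⊤

      fork-arrangement : Arrangement (suc j) fork
      fork-arrangement = record { tree = fork-tree ; distinct = uniqueF ; sizes = fork-sizes
        ; cover = λ w → let f , f∈ , w∈ = fork-cover w in deg≥1 f∈ w∈ }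

      fork-deg≤2 : ∀ w → deg fork w ℕ.≤ 2
      fork-deg≤2 w with side {N} {suc j} w
      ... | right x = ℕ.≤-trans (ℕ.≤-reflexive (trans (deg-∷ (pendant v) (map lift L) (N Fin.↑ʳ x)) (cong ([ N Fin.↑ʳ x ∈ pendant v ]ₛ ℕ.+_) (deg-new L x))))
        (ℕ.≤-trans (ℕ.+-monoˡ-≤ 0 ([]-≤1 (N Fin.↑ʳ x Subset.∈? pendant v))) (s≤s z≤n))
      ... | left u = ℕ.≤-trans (ℕ.≤-reflexive (trans (deg-∷ (pendant v) (map lift L) (u Fin.↑ˡ suc j)) (cong ([ u Fin.↑ˡ suc j ∈ pendant v ]ₛ ℕ.+_) (deg-lift L u)))) (bound (u Fin.≟ v))
        where
        deg-v : deg L v ≡ 1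
        deg-v = trans (deg-Σ L v) (trans (ℕΣ.⅀-single (λ g → [ v ∈ g ]ₛ) distinct e₁∈ elsewhere) (ℕΣ.𝟙-yes (v Subset.∈? e₁) v∈e₁))
          where
          elsewhere : ∀ {g} → g ∈ L → g ≢ e₁ → [ v ∈ g ]ₛ ≡ 0
          elsewhere {g} (here refl)         _   = ℕΣ.𝟙-no (v Subset.∈? g) v∉e₀
          elsewhere {g} (there (here refl)) g≢  = contradiction refl g≢
          elsewhere {g} (there (there g∈))  _   = ℕΣ.𝟙-no (v Subset.∈? g) (v∉ g∈)
        bound : Dec (u ≡ v) → [ u Fin.↑ˡ suc j ∈ pendant v ]ₛ ℕ.+ deg L u ℕ.≤ 2
        bound (yes refl) = ℕ.+-mono-≤ ([]-≤1 (u Fin.↑ˡ suc j Subset.∈? pendant u)) (ℕ.≤-reflexive deg-v)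
        bound (no u≢v)   = ℕ.+-mono-≤ (ℕ.≤-reflexive (ℕΣ.𝟙-no (u Fin.↑ˡ suc j Subset.∈? pendant v) (u≢v ∘ pendant∈))) (chain-deg≤2 chain u)

      private
        contacts-fork : ∀ e → contacts fork (lift e) ≡ ∣ pendant v ∩ lift e ∣ ℕ.+ contacts L e
        contacts-fork e = cong₂ ℕ._+_ (∣∩∣-comm (lift e) (pendant v)) (contacts-lift L e)

        contacts-pendant : contacts fork (pendant v) ≡ suc K
        contacts-pendant = trans (cong₂ ℕ._+_ (trans (∣∩∣-self (pendant v)) (∣pendant∣ v))
          (cong₂ ℕ._+_ (∣pendant∩lift∣-no v∉e₀) (cong₂ ℕ._+_ (∣pendant∩lift∣-yes v∈e₁)
            (trans (ℕΣ.⅀-map lift (e₂ ∷ es) (λ f → ∣ pendant v ∩ f ∣)) (ℕΣ.⅀-0 (e₂ ∷ es) (λ g∈ → ∣pendant∩lift∣-no (v∉ g∈))))))) (ℕ.+-comm K 1)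

        contacts₀ : contacts fork (lift e₀) ≡ suc K
        contacts₀ = trans (contacts-fork e₀) (cong₂ ℕ._+_ (∣pendant∩lift∣-no v∉e₀) (chain-contacts-head chain (sizes (here refl))))

        contacts₁ : contacts fork (lift e₁) ≡ suc (suc (suc K))
        contacts₁ = trans (contacts-fork e₁) (cong₂ ℕ._+_ (∣pendant∩lift∣-yes v∈e₁) (trans (chain-contacts-second chain) (cong suc (tail chain))))
          where
          tail : Chain L → contacts (e₁ ∷ e₂ ∷ es) e₁ ≡ suc K
          tail (link _ _ _ _ _ c) = chain-contacts-head c (sizes e₁∈)

      excess-pendant : excess fork-arrangement (pendant v) ≡ 0
      excess-pendant = trans (cong (_∸ suc K) contacts-pendant) (ℕ.n∸n≡0 (suc K))

      excess₀ : excess fork-arrangement (lift e₀) ≡ 0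
      excess₀ = trans (cong (_∸ suc K) contacts₀) (ℕ.n∸n≡0 (suc K))

      excess₁ : excess fork-arrangement (lift e₁) ≡ 2
      excess₁ = trans (cong (_∸ suc K) contacts₁) (ℕ.m+n∸n≡m 2 (suc K))

      -- The pendant edge adds a contact to `e₁` only, which already has two neighbours. The other
      -- edges keep excess at most 1, where `tri` vanishes.
      fork-defect : defect fork-arrangement ≡ 1
      fork-defect = cong₂ ℕ._+_ (cong tri excess-pendant) (cong₂ ℕ._+_ (cong tri excess₀) (cong₂ ℕ._+_ (cong tri excess₁)
        (trans (ℕΣ.⅀-map lift (e₂ ∷ es) (tri ∘ excess fork-arrangement)) (ℕΣ.⅀-0 (e₂ ∷ es) rest))))
        where
        rest : ∀ {g} → g ∈ e₂ ∷ es → tri (excess fork-arrangement (lift g)) ≡ 0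
        rest {g} g∈ = tri-∸ (suc K) (contacts fork (lift g)) (ℕ.≤-trans (ℕ.≤-reflexive (trans (contacts-fork g) (cong (ℕ._+ contacts L g) (∣pendant∩lift∣-no (v∉ g∈)))))
          (ℕ.≤-trans (chain-contacts-≤ chain sizes (there (there g∈))) (ℕ.≤-reflexive (ℕ.+-comm 1 (suc K)))))

      module _ (3≤m : 3 ℕ.≤ length fork) where

        open OneDefect fork-arrangement 3≤m fork-deg≤2 fork-defect

        private
          -- The hub is found by a search, and every edge other than the hub has excess at most 1.
          hub≡ : hub ≡ lift e₁
          hub≡ = Dec.decidable-stable (hub ≟ₛ lift e₁) λ ne →
            contradiction (subst (ℕ._≤ 1) excess₁ (a≤1 (there (∈-map⁺ lift e₁∈)) (ne ∘ sym))) λ { (s≤s ()) }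

        -- Two leaves at the hub are the pendant edge and the first edge of the chain; for the
        -- latter the pendant edge has to be at the second edge.
        fork-hubLeaves : 2 ℕ.≤ hubLeaves
        fork-hubLeaves = ⇒twoHubLeaves {pendant v} {lift e₀} (here refl) (there (here refl)) ne
          (excess-pendant , subst (λ h → 1 ℕ.≤ ∣ pendant v ∩ h ∣) (sym hub≡) (ℕ.≤-reflexive (sym (∣pendant∩lift∣-yes v∈e₁))))
          (excess₀ , subst (λ h → 1 ℕ.≤ ∣ lift e₀ ∩ h ∣) (sym hub≡) (ℕ.≤-reflexive (sym (trans (∣lift∩lift∣ e₀ e₁) (meet chain)))))
          where
          ne : pendant v ≢ lift e₀
          ne eq = v∉e₀ (lift∈⁻ {e₀} (subst (v Fin.↑ˡ suc j ∈ₛ_) eq (pendant∋ v)))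
          meet : Chain L → ∣ e₀ ∩ e₁ ∣ ≡ 1
          meet (link w w∈e w∈f only _ _) = ∣∩∣-≡1 {e = e₀} {e₁} w∈e w∈f only
open Pendants public

-- The parts of a trace in terms of reference values

module Comparison {c ℓ₁ ℓ₂} (𝕂 : OrderedField c ℓ₁ ℓ₂) {n k : ℕ}
  (α : OrderedField.Carrier 𝕂)
  (0<α : OrderedField._<_ 𝕂 (OrderedField.0# 𝕂) α) (α<1 : OrderedField._<_ 𝕂 α (OrderedField.1# 𝕂))
  (2≤k : 2 ℕ.≤ k) where

  open OrderedFields 𝕂
  open ℕΣ using () renaming (⅀₂ to Σ₂)

  private
    1≤k : 1 ℕ.≤ k
    1≤k = ℕ.≤-trans (ℕ.n≤1+n 1) 2≤k
    K : ℕ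
    K = suc k

  open HypergraphTraces 𝕂 {n} {k} α 0<α α<1
  open Contributions 𝕂 {n} {k} edgeWeight edgeWeight-pos 1≤k
  open DegreeTwo 𝕂 {n} {k} α 0<α α<1 1≤k
  open import Algebra.Solver.Ring.NaturalCoefficients.Default R.commutativeSemiring using (Polynomial; solve; _:+_; _:*_; _:=_; con)
  open import Relation.Binary.Reasoning.Setoid R.setoid using (begin_; _∎; step-≈-⟩; step-≈-⟨)

  private
    -- `fromNat 1` computes to `1# + 0#`, and the solver has to see the constant in this form.
    one′ : ∀ {m} → Polynomial m
    one′ = con 1 :+ con 0

    -- The identities are the possible cases of `Relation`, with the excesses of the two edges as
    -- subscripts: p, q, r, s are `value₁₁`, `value₁₀`, `value₂₁`, `difference`, and t is `value₂₀`.
    -- The present one is for disjoint edges.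
    identity₀ : ∀ p q r s → 0# + (fromNat 0 * p + (fromNat 0 * p + fromNat 0 * s)) ≈ fromNat 0 * p + (fromNat 0 * q + fromNat 0 * r)
    identity₀ = solve 4 (λ p q r s → con 0 :+ (con 0 :* p :+ (con 0 :* p :+ con 0 :* s)) := con 0 :* p :+ (con 0 :* q :+ con 0 :* r)) R.refl

    identity₁₀ : ∀ p q r s → q + (fromNat 1 * p + (fromNat 0 * p + fromNat 0 * s)) ≈ fromNat 1 * p + (fromNat 1 * q + fromNat 0 * r)
    identity₁₀ = solve 4 (λ p q r s → q :+ (one′ :* p :+ (con 0 :* p :+ con 0 :* s)) := one′ :* p :+ (one′ :* q :+ con 0 :* r)) R.refl

    identity₁₁ : ∀ p q r s → p + (fromNat 0 * p + (fromNat 0 * p + fromNat 0 * s)) ≈ fromNat 1 * p + (fromNat 0 * q + fromNat 0 * r)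
    identity₁₁ = solve 4 (λ p q r s → p :+ (con 0 :* p :+ (con 0 :* p :+ con 0 :* s)) := one′ :* p :+ (con 0 :* q :+ con 0 :* r)) R.refl

    identity₂₁ : ∀ p q r s → r + (fromNat 0 * p + (fromNat 1 * p + fromNat 0 * s)) ≈ fromNat 1 * p + (fromNat 0 * q + fromNat 1 * r)
    identity₂₁ = solve 4 (λ p q r s → r :+ (con 0 :* p :+ (one′ :* p :+ con 0 :* s)) := one′ :* p :+ (con 0 :* q :+ one′ :* r)) R.refl

    identity₂₀ : ∀ t p s → t + (fromNat 1 * p + (fromNat 1 * p + fromNat 1 * s)) ≈ p + ((t + p) + s)
    identity₂₀ = solve 3 (λ t p s → t :+ (one′ :* p :+ (one′ :* p :+ one′ :* s)) := p :+ ((t :+ p) :+ s)) R.refl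

    identity₂₀′ : ∀ p q r → p + (r + q) ≈ fromNat 1 * p + (fromNat 1 * q + fromNat 1 * r)
    identity₂₀′ = solve 3 (λ p q r → p :+ (r :+ q) := one′ :* p :+ (one′ :* q :+ one′ :* r)) R.refl

    table₀ : ∀ x y z → x + (fromNat 1 * y + fromNat 0 * y) ≈ y + (fromNat 1 * x + fromNat 0 * z)
    table₀ = solve 3 (λ x y z → x :+ (one′ :* y :+ con 0 :* y) := y :+ (one′ :* x :+ con 0 :* z)) R.refl

    table₁ : ∀ x y z → y + (fromNat 0 * y + fromNat 0 * y) ≈ y + (fromNat 0 * x + fromNat 0 * z)
    table₁ = solve 3 (λ x y z → y :+ (con 0 :* y :+ con 0 :* y) := y :+ (con 0 :* x :+ con 0 :* z)) R.refl

    table₂ : ∀ x y z → z + (fromNat 0 * y + fromNat 1 * y) ≈ y + (fromNat 0 * x + fromNat 1 * z)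
    table₂ = solve 3 (λ x y z → z :+ (con 0 :* y :+ one′ :* y) := y :+ (con 0 :* x :+ one′ :* z)) R.refl

    square : ∀ a x → (a * x) * ((a * x) * 1#) ≈ (a * a) * (x * x)
    square = solve 2 (λ a x → (a :* x) :* ((a :* x) :* con 1) := (a :* a) :* (x :* x)) R.refl

  Ψ : ℕ → List (Subset n) → Carrier
  Ψ d E = Φ d E (scaled (deg E))

  Ψ-↭ : ∀ d {E F} → E ↭ F → Ψ d E ≈ Ψ d F
  Ψ-↭ d {E} {F} p = 𝔼-cong {d} λ s _ → 𝟙*-cong (within? E (supports s)) (within? F (supports s))
    (λ w → ↭.∈-resp-↭ p ∘ w) (λ w → ↭.∈-resp-↭ (↭-sym p) ∘ w)
    (λ _ → ∏-cong (loops s) λ v → R.*-congˡ (R.reflexive (cong fromNat (deg-↭ p v))))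

  arboreal : ∀ {E} → Arrangement k E → Arboreal E
  arboreal arr = record { forest = tree-forest tree ; distinct = distinct ; sizes = sizes }
    where open Arrangement arr

  vertexSum : ℕ → (Fin n → ℕ) → Carrier
  vertexSum d g = ⅀ (allFin n) (λ u → ∏ (replicate d u) (scaled g))

  module _ {E : List (Subset n)} (arr : Arrangement k E) where

    open Arrangement arr

    Ψ-split : ∀ {d} → d ℕ.< 3 ℕ.* K → ∀ v → 1 ℕ.≤ d → Ψ d E ≈ loopCoefficient d v * vertexSum d (deg E) +
      (⅀ E (Φ₁ d (scaled (deg E))) + ⅀₂ E (Φ₂ d (scaled (deg E))))
    Ψ-split {suc d} lt v _ = R.trans (Φ-split (arboreal arr) lt (scaled (deg E))) (R.+-congʳ (Φ₀-powerSum d v (scaled (deg E))))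

    Ψ-loops : ∀ {d} → d ℕ.< K → ∀ v → 1 ℕ.≤ d → Ψ d E ≈ loopCoefficient d v * vertexSum d (deg E)
    Ψ-loops {d} lt v 1≤d = R.trans (Ψ-split (ℕ.<-≤-trans lt (ℕ.m≤m+n K _)) v 1≤d)
      (R.trans (R.+-congˡ (R.trans (R.+-cong (⅀-0 E (λ e∈ → Φ₁-zero (arboreal arr) lt _ e∈))
        (⅀₂-0 distinct (λ e∈ f∈ e≢f → Φ₂-zero (arboreal arr) (ℕ.<-≤-trans lt (ℕ.m≤m+n K K)) _ e∈ f∈ e≢f))) (R.+-identityˡ 0#)))
        (R.+-identityʳ _))

    vertexSum-1 : vertexSum 1 (deg E) ≈ α * fromNat (length E ℕ.* K)
    vertexSum-1 = R.trans (⅀-cong (allFin n) (λ u → R.*-identityʳ _)) (R.trans (R.sym (⅀-*ˡ (allFin n) α _))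
      (R.*-congˡ (R.trans (R.sym (fromNat-Σ (allFin n) (deg E))) (R.reflexive (cong fromNat (Σ-deg arr))))))

    vertexSum-2 : vertexSum 2 (deg E) ≈ (α * α) * fromNat (Σℕ (allFin n) (λ u → deg E u ℕ.* deg E u))
    vertexSum-2 = R.trans (⅀-cong (allFin n) (λ u → R.trans
        (square α (fromNat (deg E u)))
        (R.*-congˡ (R.sym (fromNat-* (deg E u) (deg E u))))))
      (R.trans (R.sym (⅀-*ˡ (allFin n) (α * α) _)) (R.*-congˡ (R.sym (fromNat-Σ (allFin n) (λ u → deg E u ℕ.* deg E u)))))

  -- If some degree of E′ exceeds 2, the sums of the squares of the degrees decide.
  module LargeDegree {E E′ : List (Subset n)} (arr : Arrangement k E) (arr′ : Arrangement k E′) (len : length E ≡ length E′)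
    (deg≤2 : ∀ v → deg E v ℕ.≤ 2) {v} (3≤deg : 3 ℕ.≤ deg E′ v) where

    private
      squares : List (Subset n) → ℕ
      squares F = Σℕ (allFin n) (λ u → deg F u ℕ.* deg F u)

      defect-sum : ∀ {F} → Arrangement k F → Σℕ (allFin n) (λ u → 3 ℕ.* deg F u) ≡ 3 ℕ.* (length F ℕ.* K)
      defect-sum a = ≡.trans (≡.sym (ℕΣ.⅀-*ˡ (allFin n) 3 _)) (cong (3 ℕ.*_) (Σ-deg a))

      upper : ∀ u → deg E u ℕ.* deg E u ℕ.+ 2 ≡ 3 ℕ.* deg E u
      upper u with deg E u | Arrangement.cover arr u | deg≤2 u
      ... | 1 | _ | _ = ≡.refl
      ... | 2 | _ | _ = ≡.refl
      ... | suc (suc (suc _)) | _ | s≤s (s≤s ())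

      product : ∀ x → 3 ℕ.≤ x → 3 ℕ.* x ℕ.< x ℕ.* x ℕ.+ 2
      product x 3≤ = ℕ.≤-<-trans (ℕ.*-monoˡ-≤ x 3≤) (ℕ.m<m+n (x ℕ.* x) (s≤s z≤n))

      lower : ∀ x → 1 ℕ.≤ x → 3 ℕ.* x ℕ.≤ x ℕ.* x ℕ.+ 2
      lower 1 _ = ℕ.≤-refl
      lower 2 _ = ℕ.≤-refl
      lower (suc (suc (suc x))) _ = ℕ.<⇒≤ (product (suc (suc (suc x))) (s≤s (s≤s (s≤s z≤n))))

      Σ-< : ∀ {w} (xs : List (Fin n)) (f g : Fin n → ℕ) → (∀ u → f u ℕ.≤ g u) → w ∈ xs → f w ℕ.< g w → Σℕ xs f ℕ.< Σℕ xs g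
      Σ-< (x ∷ xs) f g le (here ≡.refl) lt = ℕ.+-mono-<-≤ lt (Σℕ-mono xs (λ {u} _ → le u))
      Σ-< (x ∷ xs) f g le (there w∈)    lt = ℕ.+-mono-≤-< (le x) (Σ-< xs f g le w∈ lt)

      split-2 : ∀ F → Σℕ (allFin n) (λ u → deg F u ℕ.* deg F u ℕ.+ 2) ≡ squares F ℕ.+ Σℕ (allFin n) (λ _ → 2)
      split-2 F = ℕΣ.⅀-+ (allFin n) _ _

      -- For x ≥ 1 one has 3x ≤ x² + 2, with equality at 1 and 2 and strictly from 3 on, and the
      -- sums of 3 deg are the same for both trees.
      squares-< : squares E ℕ.< squares E′
      squares-< = ℕ.+-cancelʳ-< (Σℕ (allFin n) (λ _ → 2)) (squares E) (squares E′) (subst₂ ℕ._<_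
        (≡.trans (defect-sum arr′) (≡.trans (cong (λ m → 3 ℕ.* (m ℕ.* K)) (≡.sym len)) (≡.trans (≡.sym (defect-sum arr))
          (≡.trans (ℕΣ.⅀-cong (allFin n) (λ u → ≡.sym (upper u))) (split-2 E)))))
        (split-2 E′)
        (Σ-< (allFin n) _ _ (λ u → lower (deg E′ u) (Arrangement.cover arr′ u)) (∈-allFin v) (product (deg E′ v) 3≤deg)))

    equal : Ψ 1 E ≈ Ψ 1 E′
    equal = R.trans (Ψ-loops arr (s≤s 1≤k) v (s≤s z≤n)) (R.trans (R.*-congˡ (R.trans (vertexSum-1 arr)
      (R.trans (R.*-congˡ (R.reflexive (cong (λ m → fromNat (m ℕ.* K)) len))) (R.sym (vertexSum-1 arr′))))) (R.sym (Ψ-loops arr′ (s≤s 1≤k) v (s≤s z≤n))))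

    less : Ψ 2 E < Ψ 2 E′
    less = <-respˡ-≈ (R.sym (R.trans (Ψ-loops arr (s≤s 2≤k) v (s≤s z≤n)) (R.*-congˡ (vertexSum-2 arr))))
      (<-respʳ-≈ (R.sym (R.trans (Ψ-loops arr′ (s≤s 2≤k) v (s≤s z≤n)) (R.*-congˡ (vertexSum-2 arr′))))
        (*-monoˡ-< (loopCoefficient-pos 2 v) (*-monoˡ-< (*-pos 0<α 0<α) (fromNat-< squares-<))))

  power : ℕ → Carrier → Carrier
  power zero    y = 1#
  power (suc d) y = y * power d y

  ∏-power : ∀ d (u : Fin n) (x : Fin n → Carrier) → ∏ (replicate d u) x ≈ power d (x u)
  ∏-power zero    u x = R.refl
  ∏-power (suc d) u x = R.*-congˡ (∏-power d u x)

  ⅀-const-fromNat : ∀ {a} {A : Set a} (xs : List A) (h : A → ℕ) y → ⅀ xs (λ x → fromNat (h x) * y) ≈ fromNat (Σℕ xs h) * y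
  ⅀-const-fromNat xs h y = R.trans (R.sym (⅀-*ʳ xs _ y)) (R.*-congʳ (R.sym (fromNat-Σ xs h)))

  fromNat-Σ₂ : ∀ {a} {A : Set a} (xs : List A) (h : A → A → ℕ) → fromNat (Σ₂ xs h) ≈ ⅀₂ xs (λ x y → fromNat (h x y))
  fromNat-Σ₂ []       h = R.refl
  fromNat-Σ₂ (x ∷ xs) h = R.trans (fromNat-+ (Σℕ xs (h x)) _) (R.+-cong (fromNat-Σ xs (h x)) (fromNat-Σ₂ xs h))

  ⅀₂-const-fromNat : ∀ {a} {A : Set a} (xs : List A) (h : A → A → ℕ) y → ⅀₂ xs (λ x z → fromNat (h x z) * y) ≈ fromNat (Σ₂ xs h) * y
  ⅀₂-const-fromNat xs h y = R.trans (R.sym (⅀₂-*ʳ xs _ y)) (R.*-congʳ (R.sym (fromNat-Σ₂ xs h)))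

  ⅀-const : ∀ {a} {A : Set a} (xs : List A) y → ⅀ xs (λ _ → y) ≈ fromNat (length xs) * y
  ⅀-const []       y = R.sym (R.zeroˡ y)
  ⅀-const (x ∷ xs) y = R.trans (R.+-congˡ (⅀-const xs y)) (R.trans (R.+-congʳ (R.sym (R.*-identityˡ y))) (R.sym (R.distribʳ y 1# _)))

  -- The pointwise relation is linear in `z`, so after summation only the totals of the integer
  -- coefficients matter.
  ⅀₂-relation : ∀ {a} {A : Set a} {xs : List A} → Unique xs → (z : A → A → Carrier) (f g h i : A → A → ℕ) (p q r s : Carrier) →
    ∀ {F G H I} → Σ₂ xs f ≡ F → Σ₂ xs g ≡ G → Σ₂ xs h ≡ H → Σ₂ xs i ≡ I →
    (∀ {x y} → x ∈ xs → y ∈ xs → x ≢ y → z x y + (fromNat (g x y) * p + (fromNat (h x y) * p + fromNat (i x y) * s)) ≈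
      fromNat (f x y) * p + (fromNat (g x y) * q + fromNat (h x y) * r)) →
    ⅀₂ xs z + (fromNat G * p + (fromNat H * p + fromNat I * s)) ≈ fromNat F * p + (fromNat G * q + fromNat H * r)
  ⅀₂-relation {xs = xs} uniq z f g h i p q r s ≡.refl ≡.refl ≡.refl ≡.refl pointwise = begin
    ⅀₂ xs z + (fromNat (Σ₂ xs g) * p + (fromNat (Σ₂ xs h) * p + fromNat (Σ₂ xs i) * s))
      ≈⟨ R.+-congˡ (R.+-cong (⅀₂-const-fromNat xs g p) (R.+-cong (⅀₂-const-fromNat xs h p) (⅀₂-const-fromNat xs i s))) ⟨
    ⅀₂ xs z + (⅀₂ xs (λ x y → fromNat (g x y) * p) + (⅀₂ xs (λ x y → fromNat (h x y) * p) + ⅀₂ xs (λ x y → fromNat (i x y) * s)))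
      ≈⟨ R.trans (⅀₂-+ xs _ _) (R.+-congˡ (R.trans (⅀₂-+ xs _ _) (R.+-congˡ (⅀₂-+ xs _ _)))) ⟨
    ⅀₂ xs (λ x y → z x y + (fromNat (g x y) * p + (fromNat (h x y) * p + fromNat (i x y) * s)))
      ≈⟨ ⅀₂-cong∈ uniq pointwise ⟩
    ⅀₂ xs (λ x y → fromNat (f x y) * p + (fromNat (g x y) * q + fromNat (h x y) * r))
      ≈⟨ R.trans (⅀₂-+ xs _ _) (R.+-cong (⅀₂-const-fromNat xs f p)
        (R.trans (⅀₂-+ xs _ _) (R.+-cong (⅀₂-const-fromNat xs g q) (⅀₂-const-fromNat xs h r)))) ⟩
    fromNat (Σ₂ xs f) * p + (fromNat (Σ₂ xs g) * q + fromNat (Σ₂ xs h) * r) ∎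

  module MaxDegreeTwo {E : List (Subset n)} (arr : Arrangement k E) (2≤m : 2 ℕ.≤ length E) (deg≤2 : ∀ v → deg E v ℕ.≤ 2) where

    open Arrangement arr

    private
      m : ℕ
      m = length E
      a : Subset n → ℕ
      a = excess arr
      A : ℕ
      A = Σℕ E a

    -- Each vertex contributes one of two values, so the sum is determined by the number of vertices
    -- of degree 2, and `#degree-two` fixes that number.
    vertexSum-two : ∀ d → vertexSum d (deg E) + fromNat (Σℕ (allFin n) (λ u → [ deg E u ℕ.≟ 2 ]ℕ)) * power d (α * fromNat 1) ≈
      ⅀ (allFin n) (λ _ → power d (α * fromNat 1)) + fromNat (Σℕ (allFin n) (λ u → [ deg E u ℕ.≟ 2 ]ℕ)) * power d (α * fromNat 2)
    vertexSum-two d = R.trans (R.+-congˡ (R.sym (⅀-const-fromNat (allFin n) _ _))) (R.trans (R.sym (⅀-+ (allFin n) _ _))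
      (R.trans (⅀-cong (allFin n) pointwise) (R.trans (⅀-+ (allFin n) _ _) (R.+-congˡ (⅀-const-fromNat (allFin n) _ _)))))
      where
      table : ∀ x → 1 ℕ.≤ x → x ℕ.≤ 2 → power d (α * fromNat x) + fromNat [ x ℕ.≟ 2 ]ℕ * power d (α * fromNat 1) ≈
        power d (α * fromNat 1) + fromNat [ x ℕ.≟ 2 ]ℕ * power d (α * fromNat 2)
      table 1 _ _ = R.+-congˡ (R.trans (R.zeroˡ _) (R.sym (R.zeroˡ _)))
      table 2 _ _ = R.trans (R.+-comm _ _) (R.+-cong (R.trans (R.*-congʳ fromNat-1) (R.*-identityˡ _))
        (R.sym (R.trans (R.*-congʳ fromNat-1) (R.*-identityˡ _))))
      table (suc (suc (suc x))) _ (s≤s (s≤s ()))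
      pointwise : ∀ u → ∏ (replicate d u) (scaled (deg E)) + fromNat [ deg E u ℕ.≟ 2 ]ℕ * power d (α * fromNat 1) ≈
        power d (α * fromNat 1) + fromNat [ deg E u ℕ.≟ 2 ]ℕ * power d (α * fromNat 2)
      pointwise u = R.trans (R.+-congʳ (∏-power d u (scaled (deg E)))) (table (deg E u) (cover u) (deg≤2 u))

    #degree-two : n ℕ.+ Σℕ (allFin n) (λ u → [ deg E u ℕ.≟ 2 ]ℕ) ≡ m ℕ.* K
    #degree-two = ≡.trans (cong (ℕ._+ Σℕ (allFin n) (λ u → [ deg E u ℕ.≟ 2 ]ℕ)) (≡.sym (≡.trans (Σℕ-const (allFin n) 1) (≡.trans (ℕ.*-identityʳ _) (List.length-tabulate {n = n} id)))))
      (≡.trans (≡.sym (ℕΣ.⅀-+ (allFin n) _ _)) (≡.trans (ℕΣ.⅀-cong (allFin n) (λ u → pointwise u (cover u) (deg≤2 u))) (Σ-deg arr)))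
      where
      pointwise : ∀ u → 1 ℕ.≤ deg E u → deg E u ℕ.≤ 2 → 1 ℕ.+ [ deg E u ℕ.≟ 2 ]ℕ ≡ deg E u
      pointwise u p q with deg E u | p | q
      ... | 1 | _ | _ = ≡.refl
      ... | 2 | _ | _ = ≡.refl
      ... | suc (suc (suc _)) | _ | s≤s (s≤s ())

    module _ (u₀ u₁ : Fin n) {k′} (k≡ : k ≡ suc k′) (rest : Vec (Fin n) k′) (uniq : Unique (u₀ ∷ u₁ ∷ toList rest)) (d : ℕ) where

      open OneEdge u₀ u₁ k≡ rest uniq d

      Φ₁-value : ∀ {e} → e ∈ E → Φ₁ d (scaled (deg E)) e ≈ value (suc (a e))
      Φ₁-value e∈ = value-spread (excess-bound arr 2≤m deg≤2 e∈) (sizes e∈) (spread arr 2≤m deg≤2 e∈)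

      -- For a given reference and `d`, everything except `defect arr` is determined by the number
      -- of edges, since `A` is two less than `m`.
      ⅀Φ₁-closed : d ℕ.≤ K ℕ.+ 2 → ⅀ E (Φ₁ d (scaled (deg E))) + fromNat A * value 1 ≈
        (fromNat m * value 1 + fromNat A * value 2) + fromNat (defect arr) * difference
      ⅀Φ₁-closed d≤ = begin
        ⅀ E (Φ₁ d (scaled (deg E))) + fromNat A * value 1
          ≈⟨ R.+-cong (⅀-cong∈ E Φ₁-value) (R.sym (⅀-const-fromNat E a (value 1))) ⟩
        ⅀ E (λ e → value (suc (a e))) + ⅀ E (λ e → fromNat (a e) * value 1)
          ≈⟨ ⅀-+ E _ _ ⟨
        ⅀ E (λ e → value (suc (a e)) + fromNat (a e) * value 1)
          ≈⟨ ⅀-cong∈ E (λ {e} e∈ → closedForm d≤ (a e) (excess-bound arr 2≤m deg≤2 e∈)) ⟩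
        ⅀ E (λ e → (value 1 + fromNat (a e) * value 2) + fromNat (tri (a e)) * difference)
          ≈⟨ R.trans (⅀-+ E _ _) (R.+-cong (⅀-+ E _ _) (⅀-const-fromNat E (tri ∘ a) difference)) ⟩
        (⅀ E (λ _ → value 1) + ⅀ E (λ e → fromNat (a e) * value 2)) + fromNat (defect arr) * difference
          ≈⟨ R.+-congʳ (R.+-cong (⅀-const E (value 1)) (⅀-const-fromNat E a (value 2))) ⟩
        (fromNat m * value 1 + fromNat A * value 2) + fromNat (defect arr) * difference ∎

      module _ (3≤m : 3 ℕ.≤ m) (defect≡1 : defect arr ≡ 1) where

        open OneDefect arr 3≤m deg≤2 defect≡1

        -- Valid for every `d`, because it uses no second difference: three edges have excess 0, one
        -- has 2 and the others have 1.
        ⅀Φ₁-oneDefect : ⅀ E (Φ₁ d (scaled (deg E))) + (fromNat 3 * value 2 + fromNat 1 * value 2) ≈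
          fromNat m * value 2 + (fromNat 3 * value 1 + fromNat 1 * value 3)
        ⅀Φ₁-oneDefect = begin
          ⅀ E (Φ₁ d (scaled (deg E))) + (fromNat 3 * value 2 + fromNat 1 * value 2)
            ≈⟨ R.+-cong (⅀-cong∈ E Φ₁-value) (R.+-cong (leaves (value 2)) (peaks (value 2))) ⟩
          ⅀ E (λ e → value (suc (a e))) + (⅀ E (λ e → fromNat (leaf e) * value 2) + ⅀ E (λ e → fromNat (peak e) * value 2))
            ≈⟨ R.trans (⅀-+ E _ _) (R.+-congˡ (⅀-+ E _ _)) ⟨
          ⅀ E (λ e → value (suc (a e)) + (fromNat (leaf e) * value 2 + fromNat (peak e) * value 2))
            ≈⟨ ⅀-cong∈ E (λ {e} e∈ → table (a e) (a≤2 e∈)) ⟩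
          ⅀ E (λ e → value 2 + (fromNat (leaf e) * value 1 + fromNat (peak e) * value 3))
            ≈⟨ R.trans (⅀-+ E _ _) (R.+-congˡ (⅀-+ E _ _)) ⟩
          ⅀ E (λ _ → value 2) + (⅀ E (λ e → fromNat (leaf e) * value 1) + ⅀ E (λ e → fromNat (peak e) * value 3))
            ≈⟨ R.+-cong (⅀-const E (value 2)) (R.+-cong (R.sym (leaves (value 1))) (R.sym (peaks (value 3)))) ⟩
          fromNat m * value 2 + (fromNat 3 * value 1 + fromNat 1 * value 3) ∎
          where
          leaves : ∀ y → fromNat 3 * y ≈ ⅀ E (λ e → fromNat (leaf e) * y)
          leaves y = R.sym (R.trans (⅀-const-fromNat E leaf y) (R.*-congʳ (R.reflexive (cong fromNat Σ-leaf))))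
          peaks : ∀ y → fromNat 1 * y ≈ ⅀ E (λ e → fromNat (peak e) * y)
          peaks y = R.sym (R.trans (⅀-const-fromNat E peak y) (R.*-congʳ (R.reflexive (cong fromNat defect≡1))))
          table : ∀ x → x ℕ.≤ 2 → value (suc x) + (fromNat [ x ℕ.≟ 0 ]ℕ * value 2 + fromNat (tri x) * value 2) ≈
            value 2 + (fromNat [ x ℕ.≟ 0 ]ℕ * value 1 + fromNat (tri x) * value 3)
          table 0 _ = table₀ (value 1) (value 2) (value 3)
          table 1 _ = table₁ (value 1) (value 2) (value 3)
          table 2 _ = table₂ (value 1) (value 2) (value 3)
          table (suc (suc (suc x))) (s≤s (s≤s ()))

    module _ (3≤m : 3 ℕ.≤ m) (defect≡1 : defect arr ≡ 1)
      (o r₁ r₂ s₁ : Fin n) (X Y : List (Fin n)) (len₁ : length (r₁ ∷ r₂ ∷ X) ≡ k) (len₂ : length (s₁ ∷ Y) ≡ k)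
      (uniq : Unique (o ∷ (r₁ ∷ r₂ ∷ X) ++ (s₁ ∷ Y))) (d : ℕ) (d≤ : d ℕ.≤ (K ℕ.+ K) ℕ.+ 2) where

      open OneDefect arr 3≤m deg≤2 defect≡1
      open TwoEdges o r₁ r₂ s₁ X Y len₁ len₂ uniq d

      private
        Relation′ : Carrier → ℕ → ℕ → ℕ → ℕ → Set _
        Relation′ z I s t u = z + (fromNat (I ℕ.* s) * value₁₁ + (fromNat (I ℕ.* t) * value₁₁ + fromNat (I ℕ.* u) * difference)) ≈
          fromNat I * value₁₁ + (fromNat (I ℕ.* s) * value₁₀ + fromNat (I ℕ.* t) * value₂₁)

        -- The linear relation satisfied by the contribution z of two edges with I
        -- common vertices and excesses a and b.
        Relation : Carrier → ℕ → ℕ → ℕ → Set _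
        Relation z I a b = Relation′ z I ([ a ℕ.≟ 0 ]ℕ ℕ.+ [ b ℕ.≟ 0 ]ℕ) (tri a ℕ.+ tri b) ([ a ℕ.≟ 0 ]ℕ ℕ.* tri b ℕ.+ [ b ℕ.≟ 0 ]ℕ ℕ.* tri a)

        relation₀ : ∀ {z} a b → z ≈ 0# → Relation z 0 a b
        relation₀ a b z≈0 = R.trans (R.+-congʳ z≈0) (identity₀ value₁₁ value₁₀ value₂₁ difference)

        relation₁₀ : ∀ {z} → z ≈ value₁₀ → Relation z 1 1 0
        relation₁₀ eq = R.trans (R.+-congʳ eq) (identity₁₀ value₁₁ value₁₀ value₂₁ difference)

        relation₁₁ : ∀ {z} → z ≈ value₁₁ → Relation z 1 1 1
        relation₁₁ eq = R.trans (R.+-congʳ eq) (identity₁₁ value₁₁ value₁₀ value₂₁ difference)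

        relation₂₁ : ∀ {z} → z ≈ value₂₁ → Relation z 1 2 1
        relation₂₁ eq = R.trans (R.+-congʳ eq) (identity₂₁ value₁₁ value₁₀ value₂₁ difference)

        -- The only case that needs `mixed`: the value of a leaf at the hub is expressed by the
        -- other three at the cost of one `difference`.
        relation₂₀ : ∀ {z} → z ≈ value₂₀ → Relation z 1 2 0
        relation₂₀ eq = R.trans (R.+-congʳ eq) (R.trans (identity₂₀ value₂₀ value₁₁ difference)
          (R.trans (R.+-congˡ (R.sym (mixed d≤))) (identity₂₀′ value₁₁ value₁₀ value₂₁)))

        relation-sym : ∀ {z} I a b → Relation z I a b → Relation z I b a
        relation-sym {z} I a b = subst₂ (λ s (t , u) → Relation′ z I s t u) (ℕ.+-comm [ a ℕ.≟ 0 ]ℕ [ b ℕ.≟ 0 ]ℕ)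
          (cong₂ _,_ (ℕ.+-comm (tri a) (tri b)) (ℕ.+-comm ([ a ℕ.≟ 0 ]ℕ ℕ.* tri b) ([ b ℕ.≟ 0 ]ℕ ℕ.* tri a)))

        z : Subset n → Subset n → Carrier
        z = Φ₂ d (scaled (deg E))

        -- Two leaves are not adjacent and there is only one hub, which excludes 0, 0 and 2, 2.
        -- Pairs whose order is opposite to the reference are turned round by `Φ₂-sym`.
        adjacent : ∀ {e f} → e ∈ E → f ∈ E → ∀ x y → x ℕ.≤ 2 → y ℕ.≤ 2 → (x ≡ 0 → y ≢ 0) → (x ≡ 2 → y ≢ 2) →
          Flower (deg E) e f x y → Flower (deg E) f e y x → Relation (z e f) 1 x y
        adjacent e∈ f∈ 0 0 _ _ ne _ _ _ = contradiction ≡.refl (ne ≡.refl)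
        adjacent {e} {f} e∈ f∈ 0 1 _ _ _ _ _ fl = relation-sym 1 1 0 (relation₁₀ (R.trans (Φ₂-sym d _ e f) (value₁₀-flower (sizes f∈) (sizes e∈) fl)))
        adjacent {e} {f} e∈ f∈ 0 2 _ _ _ _ _ fl = relation-sym 1 2 0 (relation₂₀ (R.trans (Φ₂-sym d _ e f) (value₂₀-flower (sizes f∈) (sizes e∈) fl)))
        adjacent e∈ f∈ 1 0 _ _ _ _ fl _ = relation₁₀ (value₁₀-flower (sizes e∈) (sizes f∈) fl)
        adjacent e∈ f∈ 1 1 _ _ _ _ fl _ = relation₁₁ (value₁₁-flower (sizes e∈) (sizes f∈) fl)
        adjacent {e} {f} e∈ f∈ 1 2 _ _ _ _ _ fl = relation-sym 1 2 1 (relation₂₁ (R.trans (Φ₂-sym d _ e f) (value₂₁-flower (sizes f∈) (sizes e∈) fl)))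
        adjacent e∈ f∈ 2 0 _ _ _ _ fl _ = relation₂₀ (value₂₀-flower (sizes e∈) (sizes f∈) fl)
        adjacent e∈ f∈ 2 1 _ _ _ _ fl _ = relation₂₁ (value₂₁-flower (sizes e∈) (sizes f∈) fl)
        adjacent e∈ f∈ 2 2 _ _ _ ne _ _ = contradiction ≡.refl (ne ≡.refl)
        adjacent e∈ f∈ (suc (suc (suc x))) y (s≤s (s≤s ())) _ _ _ _ _
        adjacent e∈ f∈ x (suc (suc (suc y))) _ (s≤s (s≤s ())) _ _ _ _

        pair : ∀ {e f} → e ∈ E → f ∈ E → e ≢ f → Relation (z e f) ∣ e ∩ f ∣ (a e) (a f)
        pair {e} {f} e∈ f∈ e≢f = by (inter≤1 arr e∈ f∈ e≢f)
          where
          by : (∣ e ∩ f ∣ ≡ 0 ⊎ ∃ λ c → c ∈ₛ e × c ∈ₛ f × (∀ {v} → v ∈ₛ e → v ∈ₛ f → v ≡ c)) → Relation (z e f) ∣ e ∩ f ∣ (a e) (a f)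
          by (inj₁ eq) = subst (λ I → Relation (z e f) I (a e) (a f)) (≡.sym eq) (relation₀ (a e) (a f)
            (Φ₂-disjoint d _ λ v v∈e v∈f → case ℕ.≤-trans (∣∩∣-≥1 {e = e} {f} v∈e v∈f) (ℕ.≤-reflexive eq) of λ ()))
          by (inj₂ (c , c∈e , c∈f , only)) = subst (λ I → Relation (z e f) I (a e) (a f)) (≡.sym one≡)
            (adjacent e∈ f∈ (a e) (a f) (a≤2 e∈) (a≤2 f∈)
              (leaves-apart e∈ f∈ e≢f (ℕ.≤-reflexive (≡.sym one≡))) peaks-apart
              (flower arr 2≤m deg≤2 e∈ f∈ e≢f c∈e c∈f) (flower arr 2≤m deg≤2 f∈ e∈ (e≢f ∘ ≡.sym) c∈f c∈e))
            where
            one≡ : ∣ e ∩ f ∣ ≡ 1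
            one≡ = ∣∩∣-≡1 {e = e} {f} c∈e c∈f only
            is-hub : ∀ {g} → g ∈ E → a g ≡ 2 → g ≡ hub
            is-hub {g} g∈ eq with g ≟ₛ hub
            ... | yes g≡ = g≡
            ... | no g≢  = contradiction (subst (ℕ._≤ 1) eq (a≤1 g∈ g≢)) λ { (s≤s ()) }
            peaks-apart : a e ≡ 2 → a f ≢ 2
            peaks-apart p q = e≢f (≡.trans (is-hub e∈ p) (≡.sym (is-hub f∈ q)))

      -- Solved for the pair sum: for a given reference and `d`, a quantity depending only on `m`,
      -- minus `hubLeaves` times `difference`.
      ⅀₂Φ₂-oneDefect : ⅀₂ E (Φ₂ d (scaled (deg E))) + (fromNat 3 * value₁₁ + (fromNat 3 * value₁₁ + fromNat hubLeaves * difference)) ≈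
        fromNat (m ∸ 1) * value₁₁ + (fromNat 3 * value₁₀ + fromNat 3 * value₂₁)
      ⅀₂Φ₂-oneDefect = ⅀₂-relation distinct z (λ e f → ∣ e ∩ f ∣) (λ e f → ∣ e ∩ f ∣ ℕ.* (leaf e ℕ.+ leaf f))
        (λ e f → ∣ e ∩ f ∣ ℕ.* (peak e ℕ.+ peak f)) (λ e f → ∣ e ∩ f ∣ ℕ.* (leaf e ℕ.* peak f ℕ.+ leaf f ℕ.* peak e))
        value₁₁ value₁₀ value₂₁ difference pairs Σ₂-leaf Σ₂-peak Σ₂-hubLeaves pair
        where
        pairs : Σ₂ E (λ e f → ∣ e ∩ f ∣) ≡ m ∸ 1
        pairs = ≡.sym (≡.trans (cong (_∸ 1) (≡.sym (Σ₂-pairs arr 2≤m deg≤2))) (ℕ.m+n∸n≡m _ 1))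

-- Comparing two trees of maximum degree at most 2

module Ordering {c ℓ₁ ℓ₂} (𝕂 : OrderedField c ℓ₁ ℓ₂) {n k : ℕ}
  (α : OrderedField.Carrier 𝕂)
  (0<α : OrderedField._<_ 𝕂 (OrderedField.0# 𝕂) α) (α<1 : OrderedField._<_ 𝕂 α (OrderedField.1# 𝕂))
  (2≤k : 2 ℕ.≤ k) where

  open OrderedFields 𝕂
  open Comparison 𝕂 {n} {k} α 0<α α<1 2≤k

  private
    1≤k : 1 ℕ.≤ k
    1≤k = ℕ.≤-trans (ℕ.n≤1+n 1) 2≤k
    K : ℕ
    K = suc k

  open HypergraphTraces 𝕂 {n} {k} α 0<α α<1
  open Contributions 𝕂 {n} {k} edgeWeight edgeWeight-pos 1≤k
  open DegreeTwo 𝕂 {n} {k} α 0<α α<1 1≤k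
  open import Algebra.Properties.AbelianGroup R.+-abelianGroup using (∙-cancelʳ)
  open import Algebra.Solver.Ring.NaturalCoefficients.Default R.commutativeSemiring using (solve; _:+_; _:=_)

  private
    swap-right : ∀ x g u → (x + g) + u ≈ (x + u) + g
    swap-right = solve 3 (λ x g u → x :+ g :+ u := x :+ u :+ g) R.refl

    gather : ∀ s g p q → (s + g) + (p + q) ≈ s + ((p + g) + q)
    gather = solve 4 (λ s g p q → s :+ g :+ (p :+ q) := s :+ ((p :+ g) :+ q)) R.refl

    gap-≈ : ∀ {X X′ u D N N′ κ} → X + u ≈ D + fromNat N * κ → X′ + u ≈ D + fromNat N′ * κ → κ ≈ 0# → X ≈ X′
    gap-≈ {X} {X′} {u} p q κ≈0 = ∙-cancelʳ u X X′ (R.trans p (R.trans (R.+-congˡ (R.trans (R.*-congˡ κ≈0)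
      (R.trans (R.zeroʳ _) (R.sym (R.trans (R.*-congˡ κ≈0) (R.zeroʳ _)))))) (R.sym q)))

    gap-< : ∀ {X X′ u D N N′ κ} → X + u ≈ D + fromNat N * κ → X′ + u ≈ D + fromNat N′ * κ → 0# < κ → N ℕ.< N′ → X < X′
    gap-< {X} {X′} {u} {D} {N} {N′} {κ} p q 0<κ N<N′ = <-fromDifference eq (*-pos (fromNat-pos (ℕ.m<n⇒0<n∸m N<N′)) 0<κ)
      where
      eq : X + fromNat (N′ ∸ N) * κ ≈ X′
      eq = ∙-cancelʳ u _ X′ (R.trans (swap-right X _ u)
        (R.trans (R.+-congʳ p) (R.trans (R.+-assoc D _ _) (R.trans (R.+-congˡ (R.trans (R.sym (R.distribʳ κ _ _))
          (R.*-congʳ (R.trans (R.sym (fromNat-+ N (N′ ∸ N))) (R.reflexive (cong fromNat (ℕ.m+[n∸m]≡n (ℕ.<⇒≤ N<N′)))))))) (R.sym q)))))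

  -- Both trees are evaluated at one and the same reference, so that its unknown values cancel.
  record EdgeReference : Set where
    field
      u₀ u₁ : Fin n
      {k′}  : ℕ
      k≡    : k ≡ suc k′
      rest  : Vec (Fin n) k′
      uniq  : Unique (u₀ ∷ u₁ ∷ toList rest)

  edgeReference : ∀ {e} → ∣ e ∣ ≡ K → EdgeReference
  edgeReference {e} size = go (elements e) (unique-elements e) (≡.trans (length-elements e) size)
    where
    go : ∀ l → Unique l → length l ≡ K → EdgeReference
    go (u₀ ∷ [])       _ eq with () ← ℕ.≤-trans 2≤k (ℕ.≤-reflexive (≡.sym (ℕ.suc-injective eq)))
    go (u₀ ∷ u₁ ∷ l)   u eq = record { u₀ = u₀ ; u₁ = u₁ ; k≡ = ≡.sym (ℕ.suc-injective eq) ; rest = Vec.fromList l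
      ; uniq = subst (λ z → Unique (u₀ ∷ u₁ ∷ z)) (≡.sym (Vec.toList∘fromList l)) u }

  record PairReference : Set where
    field
      o r₁ r₂ s₁ : Fin n
      X Y        : List (Fin n)
      length₁    : length (r₁ ∷ r₂ ∷ X) ≡ k
      length₂    : length (s₁ ∷ Y) ≡ k
      apart      : Unique (o ∷ (r₁ ∷ r₂ ∷ X) ++ (s₁ ∷ Y))

  pairReference : ∀ {o} P Q → Unique (o ∷ P ++ Q) → length P ≡ k → length Q ≡ k → PairReference
  pairReference []           Q        u p q with () ← ℕ.≤-trans 1≤k (ℕ.≤-reflexive (≡.sym p))
  pairReference (_ ∷ [])     Q        u p q with s≤s () ← ℕ.≤-trans 2≤k (ℕ.≤-reflexive (≡.sym p))
  pairReference (r ∷ r′ ∷ P) []       u p q with () ← ℕ.≤-trans 1≤k (ℕ.≤-reflexive (≡.sym q))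
  pairReference (r ∷ r′ ∷ P) (s ∷ Q)  u p q = record { r₁ = r ; r₂ = r′ ; s₁ = s ; X = P ; Y = Q ; length₁ = p ; length₂ = q ; apart = u }

  module _ {E E′ : List (Subset n)} (arr : Arrangement k E) (arr′ : Arrangement k E′) (len : length E ≡ length E′)
    (2≤m : 2 ℕ.≤ length E) (deg≤2 : ∀ v → deg E v ℕ.≤ 2) (deg≤2′ : ∀ v → deg E′ v ℕ.≤ 2) where

    private
      2≤m′ : 2 ℕ.≤ length E′
      2≤m′ = subst (2 ℕ.≤_) len 2≤m
      module M  = MaxDegreeTwo arr 2≤m deg≤2
      module M′ = MaxDegreeTwo arr′ 2≤m′ deg≤2′

    vertexSums : ∀ d → vertexSum d (deg E) ≈ vertexSum d (deg E′)
    vertexSums d = ∙-cancelʳ (fromNat Z′ * power d (α * fromNat 1)) _ _ (R.trans (R.+-congˡ (at Z≡))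
      (R.trans (M.vertexSum-two d) (R.trans (R.+-congˡ (R.sym (at Z≡))) (R.sym (M′.vertexSum-two d)))))
      where
      Z Z′ : ℕ
      Z  = Σℕ (allFin n) (λ u → [ deg E u ℕ.≟ 2 ]ℕ)
      Z′ = Σℕ (allFin n) (λ u → [ deg E′ u ℕ.≟ 2 ]ℕ)
      Z≡ : Z′ ≡ Z
      Z≡ = ℕ.+-cancelˡ-≡ n _ _ (≡.trans M′.#degree-two (≡.trans (cong (ℕ._* K) (≡.sym len)) (≡.sym M.#degree-two)))
      at : ∀ {a b} → a ≡ b → ∀ {y} → fromNat a * y ≈ fromNat b * y
      at e = R.*-congʳ (R.reflexive (cong fromNat e))

    excesses : Σℕ E (excess arr) ≡ Σℕ E′ (excess arr′)
    excesses = ℕ.+-cancelʳ-≡ 2 _ _ (≡.trans (Σ-excess arr 2≤m deg≤2) (≡.trans len (≡.sym (Σ-excess arr′ 2≤m′ deg≤2′))))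

    module _ (ref : EdgeReference) where

      open EdgeReference ref

      private
        v = u₀

      open OneEdge u₀ u₁ k≡ rest uniq

      private
        closed′ : ∀ {d} → d ℕ.≤ K ℕ.+ 2 → ⅀ E′ (Φ₁ d (scaled (deg E′))) + fromNat (Σℕ E (excess arr)) * value d 1 ≈
          (fromNat (length E) * value d 1 + fromNat (Σℕ E (excess arr)) * value d 2) + fromNat (defect arr′) * difference d
        closed′ {d} le = subst₂ (λ m A → ⅀ E′ (Φ₁ d (scaled (deg E′))) + fromNat A * value d 1 ≈
          (fromNat m * value d 1 + fromNat A * value d 2) + fromNat (defect arr′) * difference d)
          (≡.sym len) (≡.sym excesses) (M′.⅀Φ₁-closed u₀ u₁ k≡ rest uniq d le)

        -- Two edges do not fit into `K ℕ.+ 2` rows; this is where the uniformity `K` has to be at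
        -- least 3.
        K+2<K+K : K ℕ.+ 2 ℕ.< K ℕ.+ K
        K+2<K+K = ℕ.+-monoʳ-< K (s≤s 2≤k)

        noPairs : ∀ {F} → Arrangement k F → ∀ {d} → d ℕ.≤ K ℕ.+ 2 → ⅀₂ F (Φ₂ d (scaled (deg F))) ≈ 0#
        noPairs a le = ⅀₂-0 (Arrangement.distinct a) (λ e∈ f∈ e≢f → Φ₂-zero (arboreal a) (ℕ.≤-<-trans le K+2<K+K) _ e∈ f∈ e≢f)

        K+K≤3K : K ℕ.+ K ℕ.≤ 3 ℕ.* K
        K+K≤3K = ℕ.+-monoʳ-≤ K (ℕ.m≤m+n K _)

        split : ∀ {F} → (a : Arrangement k F) → ∀ {d} → 1 ℕ.≤ d → d ℕ.≤ K ℕ.+ 2 →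
          Ψ d F ≈ loopCoefficient d v * vertexSum d (deg F) + ⅀ F (Φ₁ d (scaled (deg F)))
        split a 1≤d le = R.trans (Ψ-split a (ℕ.<-≤-trans (ℕ.≤-<-trans le K+2<K+K) K+K≤3K) v 1≤d)
          (R.+-congˡ (R.trans (R.+-congˡ (noPairs a le)) (R.+-identityʳ _)))

      defect-equal : ∀ {d} → 1 ℕ.≤ d → d ℕ.< K ℕ.+ 2 → Ψ d E ≈ Ψ d E′
      defect-equal {d} 1≤d d< = R.trans (split arr 1≤d (ℕ.<⇒≤ d<)) (R.trans (R.+-cong (R.*-congˡ (vertexSums d))
        (gap-≈ {N = defect arr} {defect arr′} (M.⅀Φ₁-closed u₀ u₁ k≡ rest uniq d (ℕ.<⇒≤ d<)) (closed′ (ℕ.<⇒≤ d<)) (difference-zero d d<))) (R.sym (split arr′ 1≤d (ℕ.<⇒≤ d<))))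

      defect-less : defect arr ℕ.< defect arr′ → Ψ (K ℕ.+ 2) E < Ψ (K ℕ.+ 2) E′
      defect-less lt = <-respˡ-≈ (R.sym (split arr (s≤s z≤n) ℕ.≤-refl)) (<-respʳ-≈ (R.sym (split arr′ (s≤s z≤n) ℕ.≤-refl))
        (<-respˡ-≈ (R.trans (R.+-comm _ _) (R.+-congʳ (R.*-congˡ (R.sym (vertexSums (K ℕ.+ 2))))))
          (<-respʳ-≈ (R.+-comm _ _) (+-monoˡ-< _ (gap-< {N = defect arr} {defect arr′} (M.⅀Φ₁-closed u₀ u₁ k≡ rest uniq _ ℕ.≤-refl) (closed′ ℕ.≤-refl) (difference-pos _ ≡.refl) lt)))))

      module _ (3≤m : 3 ℕ.≤ length E) (3≤m′ : 3 ℕ.≤ length E′) (defect≡1 : defect arr ≡ 1) (defect≡1′ : defect arr′ ≡ 1) where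

        private
          module D  = OneDefect arr 3≤m deg≤2 defect≡1
          module D′ = OneDefect arr′ 3≤m′ deg≤2′ defect≡1′

          edgeSums : ∀ d → ⅀ E (Φ₁ d (scaled (deg E))) ≈ ⅀ E′ (Φ₁ d (scaled (deg E′)))
          edgeSums d = ∙-cancelʳ _ _ _ (R.trans (M.⅀Φ₁-oneDefect u₀ u₁ k≡ rest uniq d 3≤m defect≡1) (R.trans
            (R.+-congʳ (R.*-congʳ (R.reflexive (cong fromNat len)))) (R.sym (M′.⅀Φ₁-oneDefect u₀ u₁ k≡ rest uniq d 3≤m′ defect≡1′))))

        -- The hub with one of its neighbours. The first edge has to offer two vertices besides the
        -- common one, which it does since `k` is at least 2.
        hubReference : PairReference
        hubReference with f , f∈ , e≢f , c , c∈e , c∈f ← tree-neighbour (Arrangement.tree arr) (Arrangement.distinct arr) 2≤m D.hub∈ =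
          pairReference (Fl.twos₁ f∈ e≢f c∈e c∈f ++ Fl.ones₁ f∈ e≢f c∈e c∈f) (Fl.twos₂ f∈ e≢f c∈e c∈f ++ Fl.ones₂ f∈ e≢f c∈e c∈f) (Fl.unique f∈ e≢f c∈e c∈f)
            (ℕ.suc-injective (≡.trans (lists-length (Fl.lists₁ f∈ e≢f c∈e c∈f)) (Arrangement.sizes arr D.hub∈)))
            (ℕ.suc-injective (≡.trans (lists-length (Fl.lists₂ f∈ e≢f c∈e c∈f)) (Arrangement.sizes arr f∈)))
          where
          module Fl {f c} (f∈ : f ∈ E) (e≢f : D.hub ≢ f) (c∈e : c ∈ₛ D.hub) (c∈f : c ∈ₛ f) = Flower (flower arr 2≤m deg≤2 D.hub∈ f∈ e≢f c∈e c∈f)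

        module _ (pref : PairReference) where

          private
            module P = PairReference pref
            open TwoEdges P.o P.r₁ P.r₂ P.s₁ P.X P.Y P.length₁ P.length₂ P.apart using (value₁₁)
              renaming (difference to pairDifference; difference-zero to pairDifference-zero; difference-pos to pairDifference-pos)

            top : ℕ
            top = (K ℕ.+ K) ℕ.+ 2

            common : ℕ → Carrier
            common d = fromNat 3 * value₁₁ d + fromNat 3 * value₁₁ d

            -- Each pair sum is increased by its own number of hub leaves times the difference, and
            -- the results agree; so the tree with more hub leaves has the smaller pair sum when the
            -- difference is positive.
            relation : ∀ {d} → d ℕ.≤ top → ⅀₂ E (Φ₂ d (scaled (deg E))) + (fromNat D.hubLeaves * pairDifference d + common d) ≈
              ⅀₂ E′ (Φ₂ d (scaled (deg E′))) + (fromNat D′.hubLeaves * pairDifference d + common d)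
            relation {d} le = R.trans (R.+-congˡ (shuffle D.hubLeaves)) (R.trans
              (M.⅀₂Φ₂-oneDefect 3≤m defect≡1 P.o P.r₁ P.r₂ P.s₁ P.X P.Y P.length₁ P.length₂ P.apart d le)
              (R.trans (R.+-congʳ (R.*-congʳ (R.reflexive (cong (λ m → fromNat (m ∸ 1)) len))))
                (R.trans (R.sym (M′.⅀₂Φ₂-oneDefect 3≤m′ defect≡1′ P.o P.r₁ P.r₂ P.s₁ P.X P.Y P.length₁ P.length₂ P.apart d le))
                  (R.+-congˡ (R.sym (shuffle D′.hubLeaves))))))
              where
              shuffle : ∀ N → fromNat N * pairDifference d + common d ≈ fromNat 3 * value₁₁ d + (fromNat 3 * value₁₁ d + fromNat N * pairDifference d)
              shuffle N = R.trans (R.+-comm _ _) (R.+-assoc _ _ _)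

            -- Three edges do not fit into `top` rows, again because `K` is at least 3.
            top<3K : top ℕ.< 3 ℕ.* K
            top<3K = subst (top ℕ.<_) (≡.trans (ℕ.+-assoc K K K) (cong (λ z → K ℕ.+ (K ℕ.+ z)) (≡.sym (ℕ.+-identityʳ K)))) (ℕ.+-monoʳ-< (K ℕ.+ K) (s≤s 2≤k))

            pairs-≈ : ∀ {d} → d ℕ.< top → ⅀₂ E (Φ₂ d (scaled (deg E))) ≈ ⅀₂ E′ (Φ₂ d (scaled (deg E′)))
            pairs-≈ {d} d< = ∙-cancelʳ _ _ _ (R.trans (relation (ℕ.<⇒≤ d<)) (R.+-congˡ (R.+-congʳ
              (R.trans (vanish D′.hubLeaves) (R.sym (vanish D.hubLeaves))))))
              where
              vanish : ∀ N → fromNat N * pairDifference d ≈ 0#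
              vanish N = R.trans (R.*-congˡ (pairDifference-zero d d<)) (R.zeroʳ _)

            pairs-< : D′.hubLeaves ℕ.< D.hubLeaves → ⅀₂ E (Φ₂ top (scaled (deg E))) < ⅀₂ E′ (Φ₂ top (scaled (deg E′)))
            pairs-< lt = <-fromDifference
              (∙-cancelʳ (fromNat D′.hubLeaves * pairDifference top + common top) _ _ (R.trans
                (gather _ _ _ (common top))
                (R.trans (R.+-congˡ (R.+-congʳ (R.trans (R.sym (R.distribʳ (pairDifference top) _ _)) (R.*-congʳ
                  (R.trans (R.sym (fromNat-+ D′.hubLeaves (D.hubLeaves ∸ D′.hubLeaves))) (R.reflexive (cong fromNat (ℕ.m+[n∸m]≡n (ℕ.<⇒≤ lt)))))))))
                  (relation ℕ.≤-refl))))
              (*-pos (fromNat-pos (ℕ.m<n⇒0<n∸m lt)) (pairDifference-pos top ≡.refl))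

          hubLeaves-equal : ∀ {d} → 1 ℕ.≤ d → d ℕ.< top → Ψ d E ≈ Ψ d E′
          hubLeaves-equal {d} 1≤d d< = R.trans (Ψ-split arr (ℕ.<-trans d< top<3K) v 1≤d) (R.trans
            (R.+-cong (R.*-congˡ (vertexSums d)) (R.+-cong (edgeSums d) (pairs-≈ d<))) (R.sym (Ψ-split arr′ (ℕ.<-trans d< top<3K) v 1≤d)))

          hubLeaves-less : D′.hubLeaves ℕ.< D.hubLeaves → Ψ top E < Ψ top E′
          hubLeaves-less lt = <-respˡ-≈ (R.sym (R.trans (Ψ-split arr top<3K v (s≤s z≤n)) (R.+-cong (R.*-congˡ (vertexSums top)) (R.+-congʳ (edgeSums top)))))
            (<-respʳ-≈ (R.sym (Ψ-split arr′ top<3K v (s≤s z≤n))) (add-left (add-left (pairs-< lt))))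
            where
            add-left : ∀ {w x y} → x < y → w + x < w + y
            add-left {w} lt = <-respˡ-≈ (R.+-comm _ w) (<-respʳ-≈ (R.+-comm _ w) (+-monoˡ-< w lt))

-- From hypertrees to the order on hypergraphs

module Hypertrees where

  open ≡ using (refl; sym; trans)

  record Sorted (k m : ℕ) (H : Hypergraph) : Set where
    field
      {list}      : List (Subset (order H))
      perm        : list ↭ edges H
      arrangement : Arrangement k list
      len         : length list ≡ m

  sorted : ∀ {k m H} → 1 ℕ.≤ m → IsHypertree (suc k) m H → Sorted k m H
  sorted {k} {m} {H} 1≤m hyp = go (edges H) refl
    where
    open Building H
    go : ∀ E → E ≡ edges H → Sorted k m H
    go []      eq with () ← ℕ.≤-trans 1≤m (ℕ.≤-reflexive (trans (sym (IsHypertree.size hyp)) (cong length (sym eq))))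
    go (e ∷ _) eq with e∈ ← subst (e ∈_) eq (here refl) with rs , part ← start hyp e∈ with ns , full ← complete hyp part = record
      { perm        = Part-full hyp full
      ; arrangement = OfHypertree.arrangement H hyp (Part-full hyp full) (Part.tree full) e∈
      ; len         = trans (↭.↭-length (Part-full hyp full)) (IsHypertree.size hyp) }

  sorted-order : ∀ {k m H} (s : Sorted k m H) → order H ℕ.+ m ≡ m ℕ.* suc k ℕ.+ 1
  sorted-order record { arrangement = arr ; len = refl } = order-length arr

  same-order : ∀ {k m H G} → Sorted k m H → Sorted k m G → order H ≡ order G
  same-order {m = m} s s′ = ℕ.+-cancelʳ-≡ m _ _ (trans (sorted-order s) (sym (sorted-order s′)))

  grow-≅ : ∀ {k ps} H G → order H ≡ order G → (∀ {e} → e ∈ edges H → ∣ e ∣ ≡ k) → (∀ {e} → e ∈ edges G → ∣ e ∣ ≡ k) →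
    (∃ λ fs → fs ↭ edges H × Grow fs ps) → (∃ λ fs → fs ↭ edges G × Grow fs ps) → H ≅ G
  grow-≅ {k} record { order = n ; edges = E } record { edges = E′ } refl sizes sizes′ (fs , p , g) (fs′ , p′ , g′)
    with π , refl ← grow-iso k (sizes ∘ ↭.∈-resp-↭ p) (sizes′ ∘ ↭.∈-resp-↭ p′) g g′ =
    π , λ e → mk⇔ (λ e∈ → ↭.∈-resp-↭ p′ (∈-map⁺ (image π) (↭.∈-resp-↭ (↭-sym p) e∈)))
      (λ πe∈ → case ∈-map⁻ (image π) (↭.∈-resp-↭ (↭-sym p′) πe∈) of λ { (f , f∈ , eq) →
        ↭.∈-resp-↭ p (subst (_∈ fs) (image-injective π (sym eq)) f∈) })

  ∣image∩image∣ : ∀ {n} (π : Permutation′ n) e f → ∣ image π e ∩ image π f ∣ ≡ ∣ e ∩ f ∣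
  ∣image∩image∣ {n} π e f = trans (∣∩∣-Σ (image π e) (image π f)) (trans (sym (ℕΣ.⅀-permute π _))
    (trans (ℕΣ.⅀-cong (allFin n) λ v → cong₂ ℕ._*_ (same e v) (same f v)) (sym (∣∩∣-Σ e f))))
    where
    same : ∀ g v → [ π ⟨$⟩ʳ v ∈ image π g ]ₛ ≡ [ v ∈ g ]ₛ
    same g v = ℕΣ.𝟙-⇔ (π ⟨$⟩ʳ v Subset.∈? image π g) (v Subset.∈? g) (π∈image⁻ π) (π∈image⁺ π)

  -- An isomorphism preserves the sizes of intersections; the largest number of contacts is the
  -- invariant that separates the fork from the hyperpath.
  ≅-contacts : ∀ H G → order H ≡ order G → H ≅ G → ∀ {b} → (∀ {e} → e ∈ edges G → contacts (edges G) e ℕ.≤ b) →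
    ∀ {e} → e ∈ edges H → contacts (edges H) e ℕ.≤ b
  ≅-contacts record { edges = E ; unique = u } record { edges = E′ ; unique = u′ } refl (π , iff) bound {e} e∈ = ℕ.≤-trans (ℕ.≤-reflexive (begin
    contacts E e                                ≡⟨ ℕΣ.⅀-cong E (λ f → sym (∣image∩image∣ π e f)) ⟩
    Σℕ E (λ f → ∣ image π e ∩ image π f ∣)      ≡⟨ ℕΣ.⅀-map (image π) E _ ⟨
    contacts (map (image π) E) (image π e)      ≡⟨ contacts-↭ (image π e) (unique-same⇒↭ u′ (Unique.map⁺ (image-injective π) u) from to) ⟩
    contacts E′ (image π e) ∎)) (bound (Equivalence.to (iff e) e∈))
    where
    open ≡.≡-Reasoning
    to : ∀ {f} → f ∈ map (image π) E → f ∈ E′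
    to f∈ with g , g∈ , refl ← ∈-map⁻ (image π) f∈ = Equivalence.to (iff g) g∈
    from : ∀ {f} → f ∈ E′ → f ∈ map (image π) E
    from {f} f∈ = subst (_∈ map (image π) E) back (∈-map⁺ (image π) (Equivalence.from (iff (image (Perm.flip π) f)) (subst (_∈ E′) (sym back) f∈)))
      where
      back : image π (image (Perm.flip π) f) ≡ f
      back = image-ext π (λ v v∈ → subst (_∈ₛ f) refl (∈-image⁻ (Perm.flip π) v∈)) (λ v πv∈ → ∈-image⁺ (Perm.flip π) πv∈)

  -- The deciding index must be smaller than the number of eigenvalues. Here n = mk + 1 is at least
  -- 8 and k ^ (n - 1) is at least k, and 8k already exceeds what is needed, as 2k + 5 ≤ 8k.
  enough-traces : ∀ {n k m D} → n ℕ.+ m ≡ m ℕ.* suc k ℕ.+ 1 → 4 ℕ.≤ m → 2 ℕ.≤ k → D ℕ.≤ (suc k ℕ.+ suc k) ℕ.+ 2 → D ℕ.≤ n ℕ.* k ^ (n ∸ 1) ∸ 1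
  enough-traces {n} {k} {m} {D} eq 4≤m 2≤k D≤ = ℕ.≤-trans D≤ (ℕ.≤-trans (ℕ.≤-reflexive (sym (ℕ.m+n∸n≡m _ 1))) (ℕ.∸-monoˡ-≤ 1 (ℕ.≤-trans small
    (ℕ.*-mono-≤ {8} {n} {k} n≥8k+1′ powers))))
    where
    open import Data.Nat.Solver using (module +-*-Solver)
    open +-*-Solver using (solve; _:+_; _:*_; _:=_; con)
    n≡ : n ≡ m ℕ.* k ℕ.+ 1
    n≡ = ℕ.+-cancelʳ-≡ m _ _ (trans eq (solve 2 (λ m k → m :* (con 1 :+ k) :+ con 1 := m :* k :+ con 1 :+ m) refl m k))
    mk≥8 : 8 ℕ.≤ m ℕ.* k
    mk≥8 = ℕ.*-mono-≤ 4≤m 2≤k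
    n≥8k+1′ : 8 ℕ.≤ n
    n≥8k+1′ = ℕ.≤-trans mk≥8 (ℕ.≤-trans (ℕ.m≤m+n _ 1) (ℕ.≤-reflexive (sym n≡)))
    1≤k : 1 ℕ.≤ k
    1≤k = ℕ.≤-trans (ℕ.n≤1+n 1) 2≤k
    pow : ∀ x → 1 ℕ.≤ k ^ x
    pow zero    = s≤s z≤n
    pow (suc x) = ℕ.*-mono-≤ 1≤k (pow x)
    powers : k ℕ.≤ k ^ (n ∸ 1)
    powers rewrite n≡ | ℕ.m+n∸n≡m (m ℕ.* k) 1 with m ℕ.* k | mk≥8
    ... | suc x | _ = ℕ.≤-trans (ℕ.≤-reflexive (sym (ℕ.*-identityʳ k))) (ℕ.*-monoʳ-≤ k (pow x))
    small : (suc k ℕ.+ suc k) ℕ.+ 2 ℕ.+ 1 ℕ.≤ 8 ℕ.* k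
    small = ℕ.≤-trans (ℕ.≤-reflexive (solve 1 (λ k → (con 1 :+ k :+ (con 1 :+ k)) :+ con 2 :+ con 1 := con 2 :* k :+ con 5) refl k))
      (ℕ.≤-trans (ℕ.+-monoʳ-≤ (2 ℕ.* k) {5} {6 ℕ.* k} (ℕ.≤-trans (ℕ.n≤1+n 5) (ℕ.*-monoʳ-≤ 6 1≤k)))
        (ℕ.≤-reflexive (solve 1 (λ k → con 2 :* k :+ con 6 :* k := con 8 :* k) refl k)))

  module Precedence {c ℓ₁ ℓ₂} (𝕂 : OrderedField c ℓ₁ ℓ₂) (α : OrderedField.Carrier 𝕂)
    (0<α : OrderedField._<_ 𝕂 (OrderedField.0# 𝕂) α) (α<1 : OrderedField._<_ 𝕂 α (OrderedField.1# 𝕂))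
    {k m : ℕ} (2≤k : 2 ℕ.≤ k) (4≤m : 4 ℕ.≤ m) where

    open OrderedFields 𝕂 using (module R; <-respˡ-≈; <-respʳ-≈)
    open OrderedField 𝕂 using (_<_; _≈_)
    open Tensors 𝕂

    private
      1≤k : 1 ℕ.≤ k
      1≤k = ℕ.≤-trans (ℕ.n≤1+n 1) 2≤k
      2≤m : 2 ℕ.≤ m
      2≤m = ℕ.≤-trans (s≤s (s≤s z≤n)) 4≤m
      3≤m : 3 ℕ.≤ m
      3≤m = ℕ.≤-trans (ℕ.n≤1+n 3) 4≤m

    Small : ∀ {H} → Sorted k m H → Set
    Small s = ∀ v → deg (Sorted.list s) v ℕ.≤ 2

    Large : ∀ {H} → Sorted k m H → Set
    Large s = ∃ λ v → 3 ℕ.≤ deg (Sorted.list s) v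

    small⊎large : ∀ {H} (s : Sorted k m H) → Small s ⊎ Large s
    small⊎large s with Fin.any? (λ v → 3 ℕ.≤? deg (Sorted.list s) v)
    ... | yes l = inj₂ l
    ... | no ¬l = inj₁ (λ v → ℕ.≤-pred (ℕ.≰⇒> (λ le → ¬l (v , le))))

    private
      module Transfer {n : ℕ} where
        open Comparison 𝕂 {n} {k} α 0<α α<1 2≤k public
        open Ordering 𝕂 {n} {k} α 0<α α<1 2≤k public
        open HypergraphTraces 𝕂 {n} {k} α 0<α α<1 public

      -- The comparisons concern the edges in an order of construction; `Ψ-↭` carries them over to
      -- the edge list of the hypergraph.
      transfer : ∀ {n E E′} (u : Unique E) (u′ : Unique E′) {es es′ : List (Subset n)} → es ↭ E → es′ ↭ E′ →
        Arrangement k es → Arrangement k es′ → length es ≡ m → ∀ d → suc d ℕ.≤ (suc k ℕ.+ suc k) ℕ.+ 2 →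
        (∀ t → t ℕ.< d → Transfer.Ψ (suc t) es ≈ Transfer.Ψ (suc t) es′) → Transfer.Ψ (suc d) es < Transfer.Ψ (suc d) es′ →
        Precedes (suc k) α (record { order = n ; edges = E ; unique = u }) (record { order = n ; edges = E′ ; unique = u′ })
      transfer {n} u u′ p p′ arr arr′ refl d d≤ eq lt = Transfer.Φ-precedes {n} 1≤k {u = u} {u′}
        (Arrangement.sizes arr ∘ ↭.∈-resp-↭ (↭-sym p)) (Arrangement.sizes arr′ ∘ ↭.∈-resp-↭ (↭-sym p′)) d
        (enough-traces (order-length arr) 4≤m 2≤k d≤)
        (λ t t<d → R.trans (R.sym (Transfer.Ψ-↭ (suc t) p)) (R.trans (eq t t<d) (Transfer.Ψ-↭ (suc t) p′)))
        (<-respˡ-≈ (Transfer.Ψ-↭ (suc d) p) (<-respʳ-≈ (Transfer.Ψ-↭ (suc d) p′) lt))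

    large-precedes : ∀ {H G} → order H ≡ order G → (s : Sorted k m H) (t : Sorted k m G) → Small s → Large t → Precedes (suc k) α H G
    large-precedes {H} {G} refl record { perm = p ; arrangement = arr ; len = l } record { perm = p′ ; arrangement = arr′ ; len = l′ } small (v , 3≤) =
      -- The argument 1 stands for the second trace: `transfer` takes the deciding index diminished
      -- by 1, here and in the two cases below.
      transfer (unique H) (unique G) p p′ arr arr′ l 1 (ℕ.m≤n+m 2 (suc k ℕ.+ suc k)) (λ { zero _ → L.equal ; (suc _) (s≤s ()) }) L.less
      where
      module L = Transfer.LargeDegree arr arr′ (trans l (sym l′)) small 3≤

    defect-precedes : ∀ {H G} → order H ≡ order G → (s : Sorted k m H) (t : Sorted k m G) → Small s → Small t →
      defect (Sorted.arrangement s) ℕ.< defect (Sorted.arrangement t) → Precedes (suc k) α H G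
    defect-precedes {H} {G} refl record { list = es ; perm = p ; arrangement = arr ; len = refl } record { perm = p′ ; arrangement = arr′ ; len = l′ } small small′ lt =
      transfer (unique H) (unique G) p p′ arr arr′ refl (k ℕ.+ 2) (ℕ.+-monoˡ-≤ 2 (ℕ.m≤m+n (suc k) (suc k)))
        (λ t t<d → Transfer.defect-equal arr arr′ (sym l′) 2≤m small small′ ref (s≤s z≤n) (s≤s t<d))
        (Transfer.defect-less arr arr′ (sym l′) 2≤m small small′ ref lt)
      where
      e₀ = List.lookup es (Fin.fromℕ< 2≤m)
      ref = Transfer.edgeReference {e = e₀} (Arrangement.sizes arr (∈-lookup {xs = es} (Fin.fromℕ< 2≤m)))

    leaves-precedes : ∀ {H G} → order H ≡ order G → (s : Sorted k m H) (t : Sorted k m G) → (small : Small s) (small′ : Small t) →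
      (3≤ : 3 ℕ.≤ length (Sorted.list s)) (3≤′ : 3 ℕ.≤ length (Sorted.list t)) →
      (eq : defect (Sorted.arrangement s) ≡ 1) (eq′ : defect (Sorted.arrangement t) ≡ 1) →
      OneDefect.hubLeaves (Sorted.arrangement t) 3≤′ small′ eq′ ℕ.< OneDefect.hubLeaves (Sorted.arrangement s) 3≤ small eq → Precedes (suc k) α H G
    leaves-precedes {H} {G} refl record { list = es ; perm = p ; arrangement = arr ; len = refl } record { perm = p′ ; arrangement = arr′ ; len = l′ } small small′ 3≤ 3≤′ eq eq′ lt =
      transfer (unique H) (unique G) p p′ arr arr′ refl ((k ℕ.+ suc k) ℕ.+ 2) ℕ.≤-refl
        (λ t t<d → Transfer.hubLeaves-equal arr arr′ (sym l′) 2≤m small small′ ref 3≤ 3≤′ eq eq′ pref (s≤s z≤n) (s≤s t<d))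
        (Transfer.hubLeaves-less arr arr′ (sym l′) 2≤m small small′ ref 3≤ 3≤′ eq eq′ pref lt)
      where
      e₀ = List.lookup es (Fin.fromℕ< 2≤m)
      ref = Transfer.edgeReference {e = e₀} (Arrangement.sizes arr (∈-lookup {xs = es} (Fin.fromℕ< 2≤m)))
      pref = Transfer.hubReference arr arr′ (sym l′) 2≤m small small′ ref 3≤ 3≤′ eq eq′

    zero-first : ∀ {H G} → order H ≡ order G → (s : Sorted k m H) (t : Sorted k m G) → Small s → defect (Sorted.arrangement s) ≡ 0 →
      (Small t → defect (Sorted.arrangement t) ≢ 0) → Precedes (suc k) α H G
    zero-first same s t small zero≡ nonzero = [ (λ small′ → defect-precedes same s t small small′
      (subst (ℕ._< defect (Sorted.arrangement t)) (sym zero≡) (ℕ.n≢0⇒n>0 (nonzero small′)))) , large-precedes same s t small ]′ (small⊎large t)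

    -- A degree of at least 3 in the other tree is decided by the second trace, a defect of at least
    -- 2 by the trace at K + 2, and defect 1 with fewer than two hub leaves by the trace at 2K + 2,
    -- where K = `suc k`.
    one-second : ∀ {H G} → order H ≡ order G → (s : Sorted k m H) (t : Sorted k m G) (small : Small s) (3≤ : 3 ℕ.≤ length (Sorted.list s))
      (3≤′ : 3 ℕ.≤ length (Sorted.list t)) (eq : defect (Sorted.arrangement s) ≡ 1) →
      2 ℕ.≤ OneDefect.hubLeaves (Sorted.arrangement s) 3≤ small eq → (Small t → defect (Sorted.arrangement t) ≢ 0) →
      (∀ small′ eq′ → ¬ (2 ℕ.≤ OneDefect.hubLeaves (Sorted.arrangement t) 3≤′ small′ eq′)) → Precedes (suc k) α H G
    one-second {H} {G} same s t small 3≤ 3≤′ eq two nonzero few = [ small-case , large-precedes same s t small ]′ (small⊎large t)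
      where
      small-case : Small t → Precedes (suc k) α H G
      small-case small′ = [ (λ 1< → defect-precedes same s t small small′ (subst (ℕ._< defect (Sorted.arrangement t)) (sym eq) 1<))
                          , (λ 1≡ → leaves-precedes same s t small small′ 3≤ 3≤′ eq (sym 1≡) (ℕ.<-≤-trans (ℕ.≰⇒> (few small′ (sym 1≡))) two))
                          ]′ (ℕ.m≤n⇒m<n∨m≡n (ℕ.n≢0⇒n>0 (nonzero small′)))
open Hypertrees public

-- The hyperpath and `F` as the first two hypertrees

module PathAndFork (m₀ k₀ : ℕ) where

  open ≡ using (refl; sym; trans)

  private
    -- There are `m₀` + 4 edges of size `k₀` + 3. Each edge of a hyperpath has `c` inserted
    -- vertices, and `suc l` is the number of edges of the hyperpath to which `F` attaches its
    -- pendant edge.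
    c K l : ℕ
    c = suc k₀
    K = suc (suc c)
    l = suc (suc m₀)
    path-m = hyperpath (suc (suc l)) K
    path-l = List.tabulate (HyperPath.pathEdge (suc l) c)
    open HyperPath (suc l) c using (pathEdge; inserted; inserted⁺)

    spot : Fin (suc l ℕ.* c)
    spot = Fin.combine {suc l} {c} (suc zero) zero

    branch : Fin (order (hyperpath (suc l) K))
    branch = insertedVertex (suc l) K (suc zero) zero

    block-of-branch : Fin.quotient {suc l} c spot ≡ suc zero
    block-of-branch = cong proj₁ (Fin.remQuot-combine {suc l} {c} (suc zero) zero)

    off : ∀ {g} → g ∈ List.tabulate (λ (i : Fin (suc m₀)) → pathEdge (suc (suc i))) → branch ∉ₛ g
    off g∈ b∈ with i , refl ← ∈-tabulate⁻ {f = λ (i : Fin (suc m₀)) → pathEdge (suc (suc i))} g∈ with () ← trans (sym block-of-branch) (inserted (suc (suc i)) {spot} b∈)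

    fork-F = F (suc (suc l)) K (s≤s (s≤s (s≤s z≤n))) (s≤s (s≤s (s≤s z≤n)))

    open Fork (path-chain l c) (path-unique (suc l) c) (HyperPath.pathEdge-sizes (suc l) c) (path-cover l c) {branch}
      (inserted⁺ (suc zero) {spot} block-of-branch) (λ b∈ → case trans (sym block-of-branch) (inserted zero {spot} b∈) of λ ()) off (unique fork-F)

    length-tabulate : ∀ {a} {A : Set a} {n} (f : Fin n → A) → length (List.tabulate f) ≡ n
    length-tabulate f = List.length-tabulate f

  path-hypertree : IsHypertree K (suc (suc l)) path-m
  path-hypertree = subst (λ z → IsHypertree K z path-m) (length-tabulate (HyperPath.pathEdge (suc (suc l)) c))
    (tree-hypertree (chain-tree (path-chain (suc l) c)) (HyperPath.pathEdge-sizes (suc (suc l)) c) (path-cover (suc l) c))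

  path-sorted : Sorted (suc c) (suc (suc l)) path-m
  path-sorted = record { perm = ↭-refl ; arrangement = path-arrangement (suc l) c ; len = length-tabulate (HyperPath.pathEdge (suc (suc l)) c) }

  fork-length : length (edges fork-F) ≡ suc (suc l)
  fork-length = cong suc (trans (List.length-map lift path-l) (length-tabulate pathEdge))

  fork-hypertree : IsHypertree K (suc (suc l)) fork-F
  fork-hypertree = subst (λ z → IsHypertree K z fork-F) fork-length (tree-hypertree fork-tree fork-sizes fork-cover)

  fork-sorted : Sorted (suc c) (suc (suc l)) fork-F
  fork-sorted = record { perm = ↭-refl ; arrangement = fork-arrangement ; len = fork-length }

  fork-small : ∀ v → deg (edges fork-F) v ℕ.≤ 2
  fork-small = fork-deg≤2

  fork-one : defect (Sorted.arrangement fork-sorted) ≡ 1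
  fork-one = fork-defect

  fork-two : ∀ 3≤ → 2 ℕ.≤ OneDefect.hubLeaves (Sorted.arrangement fork-sorted) 3≤ fork-small fork-one
  fork-two = fork-hubLeaves

  -- The hub has `K` + 3 contacts, an edge of the hyperpath at most `K` + 2.
  fork≇path : ¬ (fork-F ≅ path-m)
  fork≇path iso = ℕ.<-irrefl refl (subst (ℕ._≤ suc (suc K)) three (≅-contacts fork-F path-m (same-order fork-sorted path-sorted) iso
      (chain-contacts-≤ (path-chain (suc l) c) (HyperPath.pathEdge-sizes (suc (suc l)) c)) hub∈))
    where
    3≤ : 3 ℕ.≤ length (edges fork-F)
    3≤ = subst (3 ℕ.≤_) (sym fork-length) (s≤s (s≤s (s≤s z≤n)))
    open OneDefect (Sorted.arrangement fork-sorted) 3≤ fork-small fork-one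
    three : contacts (edges fork-F) hub ≡ suc (suc (suc K))
    three = trans (contacts-excess (Sorted.arrangement fork-sorted) (ℕ.≤-trans (ℕ.n≤1+n 2) 3≤) hub∈)
      (trans (cong (suc K ℕ.+_) a-hub) (ℕ.+-comm (suc K) 2))

theorem6p3 : ∀ {c ℓ₁ ℓ₂} (ℝ : RealNumbers c ℓ₁ ℓ₂) →
    let open RealNumbers ℝ
        open Tensors orderedField
    in
    (m k : ℕ) (4≤m : 4 ≤ m) (3≤k : 3 ≤ k)
    (α : Carrier) → 0# < α → α < 1# →
    IsSecond (Precedes k α) (IsHypertree k m) (F m k (<⇒≤ 4≤m) 3≤k)
theorem6p3 ℝ (suc (suc (suc (suc m₀)))) (suc (suc (suc k₀))) 4≤m@(s≤s (s≤s (s≤s (s≤s z≤n)))) 3≤k@(s≤s (s≤s (s≤s z≤n))) α 0<α α<1 =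
  -- The first hypertree is the hyperpath with `m` edges, while `F` is built on the one with
  -- `m ∸ 1`.
  path , (path-hypertree , path-first) , ((fork-hypertree , fork≇path) , λ H (hyp , H≇path) H≇fork → fork-second H hyp H≇path H≇fork)
  where
  open PathAndFork m₀ k₀
  m K : ℕ
  m = suc (suc (suc (suc m₀)))
  K = suc (suc (suc k₀))
  path = hyperpath m K
  fork = F m K (<⇒≤ 4≤m) 3≤k
  open Precedence (RealNumbers.orderedField ℝ) α 0<α α<1 {suc (suc k₀)} {m} (s≤s (s≤s z≤n)) 4≤m
  open Tensors (RealNumbers.orderedField ℝ) using (Precedes)

  2≤length : ∀ {H} (s : Sorted (suc (suc k₀)) m H) → 2 ≤ length (Sorted.list s)
  2≤length s = subst (2 ≤_) (≡.sym (Sorted.len s)) (s≤s (s≤s z≤n))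

  3≤length : ∀ {H} (s : Sorted (suc (suc k₀)) m H) → 3 ≤ length (Sorted.list s)
  3≤length s = subst (3 ≤_) (≡.sym (Sorted.len s)) (s≤s (s≤s (s≤s z≤n)))

  path-small : Small path-sorted
  path-small = path-deg≤2 (suc (suc (suc m₀))) (suc k₀)

  path-zero : defect (Sorted.arrangement path-sorted) ≡ 0
  path-zero = path-defect (suc (suc (suc m₀))) (suc k₀)

  Path-shape Fork-shape : Hypergraph → Set
  Path-shape H = ∃ λ fs → fs ↭ edges H × Grow fs (replicate (m ∸ 1) 0)
  Fork-shape H = ∃ λ fs → fs ↭ edges H × Grow fs (replicate (m ∸ 4) 0 ++ 1 ∷ 0 ∷ 0 ∷ [])

  path-shape : ∀ {H} → IsHypertree K m H → (s : Sorted (suc (suc k₀)) m H) → Small s → defect (Sorted.arrangement s) ≡ 0 → Path-shape H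
  path-shape {H} hyp s small eq = OfHypertree.pathShape H hyp (Sorted.arrangement s) (Sorted.perm s) (2≤length s) small eq

  fork-shape : ∀ {H} → IsHypertree K m H → (s : Sorted (suc (suc k₀)) m H) (small : Small s) (eq : defect (Sorted.arrangement s) ≡ 1) →
    2 ≤ OneDefect.hubLeaves (Sorted.arrangement s) (3≤length s) small eq → Fork-shape H
  fork-shape {H} hyp s small eq two = OfHypertree.forkShape H hyp (Sorted.arrangement s) (Sorted.perm s) 4≤m (3≤length s) small eq two

  sizes : ∀ {H} → IsHypertree K m H → ∀ {e} → e ∈ edges H → ∣ e ∣ ≡ K
  sizes hyp = All.lookup (IsHypertree.uniform hyp)

  -- The hyperpath satisfies the same hypotheses, so its growth is obtained from the same lemma as
  -- that of `H` and has the same code.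
  is-path : ∀ {H} → IsHypertree K m H → (s : Sorted (suc (suc k₀)) m H) → Small s → defect (Sorted.arrangement s) ≡ 0 → H ≅ path
  is-path {H} hyp s small eq = grow-≅ H path (same-order s path-sorted) (sizes hyp) (sizes path-hypertree)
    (path-shape hyp s small eq) (path-shape path-hypertree path-sorted path-small path-zero)

  is-fork : ∀ {H} → IsHypertree K m H → (s : Sorted (suc (suc k₀)) m H) (small : Small s) (eq : defect (Sorted.arrangement s) ≡ 1) →
    2 ≤ OneDefect.hubLeaves (Sorted.arrangement s) (3≤length s) small eq → H ≅ fork
  is-fork {H} hyp s small eq two = grow-≅ H fork (same-order s fork-sorted) (sizes hyp) (sizes fork-hypertree)
    (fork-shape hyp s small eq two) (fork-shape fork-hypertree fork-sorted fork-small fork-one (fork-two (3≤length fork-sorted)))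

  path-first : ∀ H → IsHypertree K m H → ¬ (H ≅ path) → Precedes K α path H
  path-first H hyp H≇path = zero-first (same-order path-sorted s) path-sorted s path-small path-zero (λ small → H≇path ∘ is-path hyp s small)
    where
    s = sorted (s≤s z≤n) hyp

  fork-second : ∀ H → IsHypertree K m H → ¬ (H ≅ path) → ¬ (H ≅ fork) → Precedes K α fork H
  fork-second H hyp H≇path H≇fork = one-second (same-order fork-sorted s) fork-sorted s fork-small (3≤length fork-sorted) (3≤length s) fork-one
    (fork-two (3≤length fork-sorted)) (λ small → H≇path ∘ is-path hyp s small) (λ small eq → H≇fork ∘ is-fork hyp s small eq)
    where
    s = sorted (s≤s z≤n) hyp
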